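{- Let $m\ge 3$ be odd and $q=2^m$. On the set of codewords of the quaternary Delsarte-Goethals code $\mathcal{DG}$ of length $q$, define the following ten relations, where $w_L$ denotes Lee weight and $\mathcal{K}\subseteq\mathcal{DG}$ is the quaternary Kerdock code: $(x,y)\in S_0$ if $w_L(x-y)=0$; $(x,y)\in S_1$ if $w_L(x-y)=q-\sqrt{2q}$; $(x,y)\in S'_{21}$ if $w_L(x-y)=q-\sqrt{q/2}$ and $x-y\in\mathcal{K}$; $(x,y)\in S'_{22}$ if $w_L(x-y)=q-\sqrt{q/2}$ and $x-y\notin\mathcal{K}$; $(x,y)\in S_3$ if $w_L(x-y)=q$ and $x-y\in\mathcal{K}$; $(x,y)\in S_4$ if $w_L(x-y)=q$ and $x-y\notin\mathcal{K}$; $(x,y)\in S'_{51}$ if $w_L(x-y)=q+\sqrt{q/2}$ and $x-y\notin\mathcal{K}$; $(x,y)\in S'_{52}$ if $w_L(x-y)=q+\sqrt{q/2}$ and $x-y\in\mathcal{K}$; $(x,y)\in S_6$ if $w_L(x-y)=q+\sqrt{2q}$; $(x,y)\in S_7$ if $w_L(x-y)=2q$. Then these relations define a $9$-class abelian (translation) association scheme $\mathfrak{B}$ on $\mathcal{DG}$.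
   Context: Let $R=GR(4,m)$ be the Galois ring of characteristic $4$ with $4^m$ elements, $\beta$ a unit of order $2^m-1$, $\mathcal{T}=\{0,1,\beta,\ldots,\beta^{2^m-2}\}$ the Teichmüller set, and $\mathrm{T}:R\to\mathbb{Z}_4$ the trace. For $u\in\mathbb{Z}_4,a\in R,b\in\mathcal{T}$ let $\mathbf{c}(u,a,b)\in\mathbb{Z}_4^q$ be indexed by $x\in\mathcal{T}$ with entries $u+\mathrm{T}(ax+2bx^3)$. Then $\mathcal{DG}=\{\mathbf{c}(u,a,b)\}$ and the Kerdock code is $\mathcal{K}=\{\mathbf{c}(u,a,0)\}$. The nonzero Lee weights of $\mathcal{DG}$ are $q\pm\sqrt{2q}$, $q\pm\sqrt{q/2}$, $q$, $2q$. -}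

module Defs where

open import Level using (Level; _⊔_)
open import Algebra.Bundles using (AbelianGroup; CommutativeRing; Semiring)
import Algebra.Construct.Pointwise as Pointwise
import Algebra.Definitions.RawSemiring as RawSemiringDefs
import Algebra.Properties.AbelianGroup as AbelianGroupProperties
import Algebra.Properties.Ring as RingProperties
import Algebra.Properties.Semiring.Exp as Exp
import Algebra.Solver.Ring.NaturalCoefficients.Default as Solver
open import Data.Fin.Base as Fin using (Fin; toℕ; punchOut; remQuot; combine)
open import Data.Fin.Patterns
open import Data.Fin.Properties as Fin
  using (all?; any?; injective⇒≤; punchOut-injective; combine-remQuot; toℕ<n; toℕ-injective)
open import Data.Nat.Base as ℕ using (ℕ; zero; suc; _∸_; _⊓_; _<_)
open import Data.Nat.Divisibility using (_∣_; _∣?_; ∣-refl)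
open import Data.Nat.DivMod using (_mod_; _/_)
open import Data.Nat.GeneralisedArithmetic using (iterate)
import Data.Nat.Properties as ℕ
open import Data.Product.Base using (Σ; ∃; ∃₂; _×_; _,_; proj₁; proj₂)
open import Data.Sum.Base using (_⊎_; inj₁; inj₂)
open import Data.Vec.Functional using (foldr)
open import Function.Base using (_∘_; _on_)
open import Function.Bundles using (Inverse; _⇔_; Equivalence)
open import Function.Definitions using (Injective)
open import Relation.Binary.Bundles using (Setoid)
open import Relation.Binary.Core using (Rel)
open import Relation.Binary.Definitions using (Symmetric; _Respects_; _Respects₂_; tri<; tri≈; tri>)
import Relation.Binary.Construct.On as On
import Relation.Binary.Reasoning.Setoid as SetoidReasoning
open import Relation.Binary.PropositionalEquality as ≡ using (_≡_; _≢_; refl)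
open import Relation.Nullary using (¬_; Dec; yes; no; contradiction)
open import Relation.Nullary.Decidable using (from-yes; from-no; map′)
open import Relation.Unary using (Pred)

private variable
  a c ℓ p r : Level

Subsetoid : (X : Setoid a ℓ) → Pred (Setoid.Carrier X) p → Setoid (a ⊔ p) ℓ
Subsetoid X P = On.setoid {B = Σ (Setoid.Carrier X) P} X proj₁

HasSize : Setoid a ℓ → ℕ → Set (a ⊔ ℓ)
HasSize X n = Inverse X (≡.setoid (Fin n))

-- The symmetric form of the axioms; commutativity of the intersection
-- numbers is a consequence.
record IsAssociationScheme (X : Setoid a ℓ) (d : ℕ)
    (S : Fin (suc d) → Rel (Setoid.Carrier X) r) : Set (a ⊔ ℓ ⊔ r) where
  open Setoid X
  field
    finite       : ∃ λ n → HasSize X n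
    respects     : ∀ i → S i Respects₂ _≈_
    diagonal     : ∀ x y → S 0F x y ⇔ x ≈ y
    covering     : ∀ x y → ∃ λ i → S i x y
    disjoint     : ∀ {i j x y} → S i x y → S j x y → i ≡ j
    inhabited    : ∀ i → ∃₂ λ x y → S i x y
    symmetric    : ∀ i → Symmetric (S i)
    intersection : ∀ i j k → ∃ λ n → ∀ x y → S k x y →
                   HasSize (Subsetoid X (λ z → S i x z × S j z y)) n

-- An abelian (translation) scheme on a subgroup C of G.  That C is a
-- subgroup is part of the assertion.
record IsTranslationScheme (G : AbelianGroup a ℓ) (C : Pred (AbelianGroup.Carrier G) p)
    (d : ℕ) (S : Fin (suc d) → Rel (AbelianGroup.Carrier G) r) : Set (a ⊔ ℓ ⊔ p ⊔ r) where
  open AbelianGroup G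
  field
    C-respects  : C Respects _≈_
    ε∈C         : C ε
    ∙-closed    : ∀ {x y} → C x → C y → C (x ∙ y)
    ⁻¹-closed   : ∀ {x} → C x → C (x ⁻¹)
    scheme      : IsAssociationScheme (Subsetoid setoid C) d (λ i → S i on proj₁)
    translation : ∀ i {x y z} → C x → C y → C z → S i x y → S i (x ∙ z) (y ∙ z)

infixl 6 _+₄_

_+₄_ : Fin 4 → Fin 4 → Fin 4
i +₄ j = (toℕ i ℕ.+ toℕ j) mod 4

-₄_ : Fin 4 → Fin 4
-₄ i = (4 ∸ toℕ i) mod 4

ℤ₄ : AbelianGroup _ _
ℤ₄ = record
  { Carrier = Fin 4
  ; _≈_     = _≡_
  ; _∙_     = _+₄_
  ; ε       = 0F
  ; _⁻¹     = -₄_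
  ; isAbelianGroup = record
    { isGroup = record
      { isMonoid = record
        { isSemigroup = record
          { isMagma = record
            { isEquivalence = ≡.isEquivalence
            ; ∙-cong        = ≡.cong₂ _+₄_
            }
          ; assoc = from-yes (all? λ i → all? λ j → all? λ k →
                      ((i +₄ j) +₄ k) Fin.≟ (i +₄ (j +₄ k)))
          }
        ; identity = from-yes (all? λ i → (0F +₄ i) Fin.≟ i)
                   , from-yes (all? λ i → (i +₄ 0F) Fin.≟ i)
        }
      ; inverse = from-yes (all? λ i → ((-₄ i) +₄ i) Fin.≟ 0F)
                , from-yes (all? λ i → (i +₄ (-₄ i)) Fin.≟ 0F)
      ; ⁻¹-cong = ≡.cong -₄_
      }
    ; comm = from-yes (all? λ i → all? λ j → (i +₄ j) Fin.≟ (j +₄ i))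
    }
  }

Words : ℕ → AbelianGroup _ _
Words n = Pointwise.abelianGroup (Fin n) ℤ₄

lee : Fin 4 → ℕ
lee i = toℕ i ⊓ (4 ∸ toℕ i)

leeWeight : ∀ {n} → (Fin n → Fin 4) → ℕ
leeWeight v = foldr ℕ._+_ 0 (lee ∘ v)

module _ (R : CommutativeRing c ℓ) where
  open CommutativeRing R using (Carrier; _≈_; _≉_; _*_; _+_; 0#; 1#; setoid; semiring)
  open RawSemiringDefs (Semiring.rawSemiring semiring)
    using (_^_) renaming (_×_ to _·_; _∣_ to _∣ᴿ_)

  ZeroDivisor : Pred Carrier _
  ZeroDivisor x = x ≉ 0# × ∃ λ y → y ≉ 0# × x * y ≈ 0#

  -- A Galois ring is a finite commutative ring whose zero divisors,
  -- together with 0, form the ideal generated by a prime number p (here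
  -- p = 2).  It is determined up to isomorphism by its characteristic
  -- and its cardinality.
  record IsGR4 (m : ℕ) : Set (c ⊔ ℓ) where
    field
      cardinality    : HasSize setoid (4 ℕ.^ m)
      characteristic : ∀ n → n · 1# ≈ 0# ⇔ 4 ∣ n
      zeroDivisors   : ∀ x → (x ≈ 0# ⊎ ZeroDivisor x) ⇔ (1# + 1#) ∣ᴿ x

  HasOrder : Carrier → ℕ → Set ℓ
  HasOrder x n = x ^ n ≈ 1# × (∀ k → 0 < k → k < n → ¬ x ^ k ≈ 1#)

private
  injective⇒surjective : ∀ {n} (f : Fin n → Fin n) → Injective _≡_ _≡_ f →
                         ∀ y → ∃ λ x → f x ≡ y
  injective⇒surjective {suc n} f inj y with any? (λ x → f x Fin.≟ y)
  ... | yes hit = hit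
  ... | no miss = contradiction (injective⇒≤ {f = g} g-inj) (ℕ.<⇒≱ ℕ.≤-refl)
    where
    y≢f : ∀ x → y ≢ f x
    y≢f x eq = miss (x , ≡.sym eq)

    g : Fin (suc n) → Fin n
    g x = punchOut (y≢f x)

    g-inj : Injective _≡_ _≡_ g
    g-inj {x} {x′} eq = inj (punchOut-injective (y≢f x) (y≢f x′) eq)

  1+2^m∸1≡2^m : ∀ m → suc (2 ℕ.^ m ∸ 1) ≡ 2 ℕ.^ m
  1+2^m∸1≡2^m m = ℕ.m+[n∸m]≡n (ℕ.m^n>0 2 m)

  2k≢1+2l : ∀ k l → k ℕ.+ k ≢ suc (l ℕ.+ l)
  2k≢1+2l (suc k) zero    eq with () ← ≡.trans (≡.sym (ℕ.+-suc k k)) (ℕ.suc-injective eq)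
  2k≢1+2l (suc k) (suc l) eq = 2k≢1+2l k l (ℕ.suc-injective
    (≡.trans (≡.sym (ℕ.+-suc k k)) (≡.trans (ℕ.suc-injective eq) (≡.cong suc (ℕ.+-suc l l)))))

  2k≢2^m∸1 : ∀ m k → 0 < k → k ℕ.+ k ≢ 2 ℕ.^ m ∸ 1
  2k≢2^m∸1 zero    (suc k) _ ()
  2k≢2^m∸1 (suc m) k       _ eq = 2k≢1+2l (2 ℕ.^ m) k (≡.sym
    (≡.trans (≡.cong suc eq) (≡.trans (1+2^m∸1≡2^m (suc m))
      (≡.cong (2 ℕ.^ m ℕ.+_) (ℕ.+-identityʳ (2 ℕ.^ m))))))

module GaloisRing (R : CommutativeRing c ℓ) {m : ℕ} (isGR4 : IsGR4 R m)
    (β : CommutativeRing.Carrier R) (β-order : HasOrder R β (2 ℕ.^ m ∸ 1)) where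

  open CommutativeRing R renaming (refl to ≈-refl; sym to ≈-sym; trans to ≈-trans)
  open RawSemiringDefs (Semiring.rawSemiring semiring) using (_^_; sum) renaming (_×_ to _·_)
  open IsGR4 isGR4

  -- Equal to 2 ^ m; this form makes 0 the index of 0 ∈ 𝒯 and suc k the
  -- index of βᵏ.
  length : ℕ
  length = suc (2 ℕ.^ m ∸ 1)

  τ : Fin length → Carrier
  τ 0F          = 0#
  τ (Fin.suc k) = β ^ toℕ k

  2# : Carrier
  2# = 1# + 1#

  private
    open Exp semiring using (^-homo-*; ^-congʳ)
    open RingProperties ring using (-‿distribʳ-*)
    open SetoidReasoning setoid
    open Solver commutativeSemiring using (solve; _:+_; _:*_; _:=_; con)

    n : ℕ
    n = 2 ℕ.^ m ∸ 1

    4≈0 : 2# * 2# ≈ 0#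
    4≈0 = ≈-trans
      (solve 0 (con 2 :* con 2 := con 1 :+ (con 1 :+ (con 1 :+ (con 1 :+ con 0)))) ≈-refl)
      (Equivalence.from (characteristic 4) (∣-refl))

    ·-nonzero : ∀ k → ¬ 4 ∣ k → k · 1# ≉ 0#
    ·-nonzero k 4∤k eq = 4∤k (Equivalence.to (characteristic k) eq)

    1≉0 : 1# ≉ 0#
    1≉0 eq = ·-nonzero 1 (from-no (4 ∣? 1)) (≈-trans (+-identityʳ 1#) eq)

    2≉0 : 2# ≉ 0#
    2≉0 eq = ·-nonzero 2 (from-no (4 ∣? 2)) (≈-trans (+-congˡ (+-identityʳ 1#)) eq)

    _≈?_ : ∀ x y → Dec (x ≈ y)
    x ≈? y = map′
      (λ eq → ≈-trans (≈-sym (strictlyInverseʳ x))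
                (≈-trans (from-cong eq) (strictlyInverseʳ y)))
      to-cong (to x Fin.≟ to y)
      where open Inverse cardinality

    square : ∀ {x y} z → x ≈ y + 2# * z → x * x ≈ y * y
    square {x} {y} z eq = begin
      x * x                                          ≈⟨ *-cong eq eq ⟩
      (y + 2# * z) * (y + 2# * z)                    ≈⟨ solve 2 (λ y z →
        (y :+ con 2 :* z) :* (y :+ con 2 :* z)
        := y :* y :+ (con 2 :* con 2) :* (z :* y :+ z :* z)) ≈-refl y z ⟩
      y * y + (2# * 2#) * (z * y + z * z)            ≈⟨ +-congˡ (*-congʳ 4≈0) ⟩
      y * y + 0# * (z * y + z * z)                   ≈⟨ +-congˡ (zeroˡ _) ⟩
      y * y + 0#                                     ≈⟨ +-identityʳ _ ⟩
      y * y                                          ∎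

    βⁿ≈1 : β ^ n ≈ 1#
    βⁿ≈1 = proj₁ β-order

    β-inverse : ∀ {k} → k < n → β ^ (n ∸ k) * β ^ k ≈ 1#
    β-inverse {k} k<n = begin
      β ^ (n ∸ k) * β ^ k   ≈⟨ ^-homo-* β (n ∸ k) k ⟨
      β ^ (n ∸ k ℕ.+ k)     ≈⟨ ^-congʳ β (ℕ.m∸n+n≡m (ℕ.<⇒≤ k<n)) ⟩
      β ^ n                 ≈⟨ βⁿ≈1 ⟩
      1#                    ∎

    interchange : ∀ x y → (x * x) * (y * y) ≈ (x * y) * (x * y)
    interchange = solve 2 (λ x y → (x :* x) :* (y :* y) := (x :* y) :* (x :* y)) ≈-refl

    β²≉0 : ∀ {k} → k < n → β ^ k * β ^ k ≉ 0#
    β²≉0 {k} k<n eq = 1≉0 (begin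
      1#                                 ≈⟨ *-identityˡ 1# ⟨
      1# * 1#                            ≈⟨ *-cong (β-inverse k<n) (β-inverse k<n) ⟨
      (e * β ^ k) * (e * β ^ k)          ≈⟨ interchange e (β ^ k) ⟨
      (e * e) * (β ^ k * β ^ k)          ≈⟨ *-congˡ eq ⟩
      (e * e) * 0#                       ≈⟨ zeroʳ _ ⟩
      0#                                 ∎)
      where e = β ^ (n ∸ k)

    β²-nontrivial : ∀ d → 0 < d → d < n → ¬ β ^ (d ℕ.+ d) ≈ 1#
    β²-nontrivial d 0<d d<n eq with ℕ.<-cmp (d ℕ.+ d) n
    ... | tri< lt _ _ = proj₂ β-order (d ℕ.+ d) (ℕ.≤-trans 0<d (ℕ.m≤m+n d d)) lt eq
    ... | tri≈ _ eq′ _ = 2k≢2^m∸1 m d 0<d eq′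
    ... | tri> _ _ gt = proj₂ β-order (d ℕ.+ d ∸ n) (ℕ.m<n⇒0<n∸m gt) lt (begin
      β ^ (d ℕ.+ d ∸ n)            ≈⟨ *-identityʳ _ ⟨
      β ^ (d ℕ.+ d ∸ n) * 1#       ≈⟨ *-congˡ βⁿ≈1 ⟨
      β ^ (d ℕ.+ d ∸ n) * β ^ n    ≈⟨ ^-homo-* β (d ℕ.+ d ∸ n) n ⟨
      β ^ (d ℕ.+ d ∸ n ℕ.+ n)      ≈⟨ ^-congʳ β (ℕ.m∸n+n≡m (ℕ.<⇒≤ gt)) ⟩
      β ^ (d ℕ.+ d)                ≈⟨ eq ⟩
      1#                           ∎)
      where
      lt : d ℕ.+ d ∸ n < n
      lt = ℕ.+-cancelʳ-< n (d ℕ.+ d ∸ n) n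
        (≡.subst (_< n ℕ.+ n) (≡.sym (ℕ.m∸n+n≡m (ℕ.<⇒≤ gt))) (ℕ.+-mono-< d<n d<n))

    β²-injective : ∀ {k l} → k < l → l < n → ¬ β ^ k * β ^ k ≈ β ^ l * β ^ l
    β²-injective {k} {l} k<l l<n eq =
      β²-nontrivial (l ∸ k) (ℕ.m<n⇒0<n∸m k<l) (ℕ.≤-<-trans (ℕ.m∸n≤m l k) l<n) (begin
        β ^ (l ∸ k ℕ.+ (l ∸ k))                    ≈⟨ ^-homo-* β (l ∸ k) (l ∸ k) ⟩
        x * x                                      ≈⟨ *-identityˡ _ ⟨
        1# * (x * x)                               ≈⟨ *-congʳ 1≈ ⟩
        ((e * e) * (y * y)) * (x * x)              ≈⟨ *-assoc _ _ _ ⟩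
        (e * e) * ((y * y) * (x * x))              ≈⟨ *-congˡ (≈-trans (*-comm _ _) (interchange x y)) ⟩
        (e * e) * ((x * y) * (x * y))              ≈⟨ *-congˡ (*-cong xy xy) ⟩
        (e * e) * (β ^ l * β ^ l)                  ≈⟨ *-congˡ eq ⟨
        (e * e) * (y * y)                          ≈⟨ 1≈ ⟨
        1#                                         ∎)
      where
      x = β ^ (l ∸ k)
      y = β ^ k
      e = β ^ (n ∸ k)
      k<n = ℕ.<-trans k<l l<n
      xy : x * y ≈ β ^ l
      xy = ≈-trans (≈-sym (^-homo-* β (l ∸ k) k)) (^-congʳ β (ℕ.m∸n+n≡m (ℕ.<⇒≤ k<l)))
      1≈ : 1# ≈ (e * e) * (y * y)
      1≈ = begin
        1#                   ≈⟨ *-identityˡ 1# ⟨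
        1# * 1#              ≈⟨ *-cong (β-inverse k<n) (β-inverse k<n) ⟨
        (e * y) * (e * y)    ≈⟨ interchange e y ⟨
        (e * e) * (y * y)    ∎

    τ-injective-mod-2 : ∀ i i′ z → τ i ≈ τ i′ + 2# * z → i ≡ i′
    τ-injective-mod-2 i i′ z eq = go i i′ (square z eq)
      where
      go : ∀ i i′ → τ i * τ i ≈ τ i′ * τ i′ → i ≡ i′
      go 0F          0F           _  = refl
      go 0F          (Fin.suc k)  eq = contradiction (≈-trans (≈-sym eq) (zeroˡ 0#)) (β²≉0 (toℕ<n k))
      go (Fin.suc k) 0F           eq = contradiction (≈-trans eq (zeroˡ 0#)) (β²≉0 (toℕ<n k))
      go (Fin.suc k) (Fin.suc k′) eq with ℕ.<-cmp (toℕ k) (toℕ k′)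
      ... | tri< lt _ _  = contradiction eq (β²-injective lt (toℕ<n k′))
      ... | tri≈ _ eq′ _ = ≡.cong Fin.suc (toℕ-injective eq′)
      ... | tri> _ _ gt  = contradiction (≈-sym eq) (β²-injective gt (toℕ<n k))

    x-y+y : ∀ x y → x ≈ y + (x - y)
    x-y+y x y = ≈-sym (begin
      y + (x - y)      ≈⟨ +-comm y (x - y) ⟩
      x - y + y        ≈⟨ +-assoc x (- y) y ⟩
      x + (- y + y)    ≈⟨ +-congˡ (-‿inverseˡ y) ⟩
      x + 0#           ≈⟨ +-identityʳ x ⟩
      x                ∎)

    2x≈2y⇒x≡y : ∀ x y → 2# * x ≈ 2# * y → ∃ λ z → x ≈ y + 2# * z
    2x≈2y⇒x≡y x y eq with Equivalence.to (zeroDivisors (x - y)) x-y∈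
      where
      2[x-y]≈0 : (x - y) * 2# ≈ 0#
      2[x-y]≈0 = begin
        (x - y) * 2#            ≈⟨ *-comm (x - y) 2# ⟩
        2# * (x - y)            ≈⟨ distribˡ 2# x (- y) ⟩
        2# * x + 2# * - y       ≈⟨ +-congˡ (-‿distribʳ-* 2# y) ⟨
        2# * x - 2# * y         ≈⟨ +-congʳ eq ⟩
        2# * y - 2# * y         ≈⟨ -‿inverseʳ (2# * y) ⟩
        0#                      ∎
      x-y∈ : x - y ≈ 0# ⊎ ZeroDivisor R (x - y)
      x-y∈ with (x - y) ≈? 0#
      ... | yes eq = inj₁ eq
      ... | no neq = inj₂ (neq , 2# , 2≉0 , 2[x-y]≈0)
    ... | record { quotient = z ; equality = z2≈x-y } = z , ≈-trans (x-y+y x y) (+-congˡ (≈-trans (≈-sym z2≈x-y) (*-comm z 2#)))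

    digits-injective : ∀ i j i′ j′ → τ i + 2# * τ j ≈ τ i′ + 2# * τ j′ → i ≡ i′ × j ≡ j′
    digits-injective i j i′ j′ eq = i≡i′ , j≡j′
      where
      i≡i′ : i ≡ i′
      i≡i′ = τ-injective-mod-2 i i′ (τ j′ - τ j) (begin
        τ i                                        ≈⟨ x-y+y (τ i) (- (2# * τ j)) ⟩
        - (2# * τ j) + (τ i - - (2# * τ j))        ≈⟨ +-congˡ (+-congˡ (⁻¹-involutive _)) ⟩
        - (2# * τ j) + (τ i + 2# * τ j)            ≈⟨ +-congˡ eq ⟩
        - (2# * τ j) + (τ i′ + 2# * τ j′)          ≈⟨ +-comm _ _ ⟩
        τ i′ + 2# * τ j′ - 2# * τ j                ≈⟨ +-assoc _ _ _ ⟩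
        τ i′ + (2# * τ j′ - 2# * τ j)              ≈⟨ +-congˡ (+-congˡ (-‿distribʳ-* 2# (τ j))) ⟩
        τ i′ + (2# * τ j′ + 2# * - τ j)            ≈⟨ +-congˡ (distribˡ 2# (τ j′) (- τ j)) ⟨
        τ i′ + 2# * (τ j′ - τ j)                   ∎)
        where open AbelianGroupProperties +-abelianGroup using (⁻¹-involutive)
      j≡j′ : j ≡ j′
      j≡j′ = τ-injective-mod-2 j j′ (proj₁ τj≡τj′) (proj₂ τj≡τj′)
        where
        open AbelianGroupProperties +-abelianGroup using (∙-cancelˡ)
        τj≡τj′ : ∃ λ z → τ j ≈ τ j′ + 2# * z
        τj≡τj′ = 2x≈2y⇒x≡y (τ j) (τ j′) (∙-cancelˡ (τ i) _ _
          (≈-trans eq (+-congʳ (reflexive (≡.cong τ (≡.sym i≡i′))))))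

    length²≡4^m : length ℕ.* length ≡ 4 ℕ.^ m
    length²≡4^m =
      ≡.trans (≡.cong₂ ℕ._*_ (1+2^m∸1≡2^m m) (1+2^m∸1≡2^m m))
      (≡.trans (≡.sym (ℕ.^-distribˡ-+-* 2 m m))
        (≡.trans (≡.cong (λ k → 2 ℕ.^ (m ℕ.+ k)) (≡.sym (ℕ.+-identityʳ m)))
          (≡.sym (ℕ.^-*-assoc 2 2 m))))

    digits : Fin (length ℕ.* length) → Fin length × Fin length
    digits = remQuot {length} length

    value : Fin (length ℕ.* length) → Carrier
    value k = τ (proj₁ (digits k)) + 2# * τ (proj₂ (digits k))

    value-injective : ∀ k k′ → value k ≈ value k′ → k ≡ k′
    value-injective k k′ eq =
      ≡.trans (≡.sym (combine-remQuot {length} length k))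
        (≡.trans (≡.cong₂ combine (proj₁ digits≡) (proj₂ digits≡))
          (combine-remQuot {length} length k′))
      where
      digits≡ : proj₁ (digits k) ≡ proj₁ (digits k′) × proj₂ (digits k) ≡ proj₂ (digits k′)
      digits≡ = digits-injective _ _ _ _ eq

    Fin-surjective : ∀ {M N} → M ≡ N → (f : Fin M → Fin N) → Injective _≡_ _≡_ f →
                     ∀ y → ∃ λ k → f k ≡ y
    Fin-surjective refl = injective⇒surjective

    value-surjective : ∀ x → ∃ λ k → x ≈ value k
    value-surjective x = proj₁ preimage , to-injective (≡.sym (proj₂ preimage))
      where
      open Inverse cardinality
      to-injective : ∀ {x y} → to x ≡ to y → x ≈ y
      to-injective {x} {y} eq =
        ≈-trans (≈-sym (strictlyInverseʳ x)) (≈-trans (from-cong eq) (strictlyInverseʳ y))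
      preimage : ∃ λ k → to (value k) ≡ to x
      preimage = Fin-surjective length²≡4^m (to ∘ value)
        (λ {k} {k′} eq → value-injective k k′ (to-injective eq)) (to x)

  -- Abstract only to keep normal forms small: the digits are determined
  -- by decompose-unique.
  abstract
    decompose : ∀ x → ∃₂ λ i j → x ≈ τ i + 2# * τ j
    decompose x = proj₁ (digits k) , proj₂ (digits k) , proj₂ (value-surjective x)
      where
      k : Fin (length ℕ.* length)
      k = proj₁ (value-surjective x)

  decompose-unique : ∀ i j i′ j′ → τ i + 2# * τ j ≈ τ i′ + 2# * τ j′ → i ≡ i′ × j ≡ j′
  decompose-unique = digits-injective

  frobenius : Carrier → Carrier
  frobenius x = let i , j , _ = decompose x in τ i ^ 2 + 2# * τ j ^ 2

  trace : Carrier → Carrier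
  trace x = sum {m} λ i → iterate frobenius x (toℕ i)

  ι : Fin 4 → Carrier
  ι u = toℕ u · 1#

  open AbelianGroup (Words length) public
    using () renaming (Carrier to Word; _-_ to _⊖_)

  -- v is the word c(u, a, b), where b is given by its index in 𝒯.  The
  -- trace takes its values in the prime subring ι(ℤ₄), on which ι is
  -- injective.
  IsCodeword : Fin 4 → Carrier → Fin length → Pred Word ℓ
  IsCodeword u a b v = ∀ x → ι (v x) ≈ ι u + trace (a * τ x + 2# * τ b * τ x ^ 3)

  DelsarteGoethals : Pred Word (c ⊔ ℓ)
  DelsarteGoethals v = ∃ λ u → ∃ λ a → ∃ λ b → IsCodeword u a b v

  Kerdock : Pred Word (c ⊔ ℓ)
  Kerdock v = ∃₂ λ u a → IsCodeword u a 0F v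

  q : ℕ
  q = 2 ℕ.^ m

  -- w = k ∓ √l, where √l is a natural number (2q and q/2 are squares for odd m).
  infix 4 _≡_−√_ _≡_+√_

  _≡_−√_ : ℕ → ℕ → ℕ → Set
  w ≡ k −√ l = ∃ λ s → s ℕ.* s ≡ l × w ℕ.+ s ≡ k

  _≡_+√_ : ℕ → ℕ → ℕ → Set
  w ≡ k +√ l = ∃ λ s → s ℕ.* s ≡ l × w ≡ k ℕ.+ s

  data S : Fin 10 → Rel Word (c ⊔ ℓ) where
    S₀   : ∀ {x y} → leeWeight (x ⊖ y) ≡ 0                                     → S 0F x y
    S₁   : ∀ {x y} → leeWeight (x ⊖ y) ≡ q −√ (2 ℕ.* q)                        → S 1F x y
    S′₂₁ : ∀ {x y} → leeWeight (x ⊖ y) ≡ q −√ (q / 2) →   Kerdock (x ⊖ y)      → S 2F x y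
    S′₂₂ : ∀ {x y} → leeWeight (x ⊖ y) ≡ q −√ (q / 2) → ¬ Kerdock (x ⊖ y)      → S 3F x y
    S₃   : ∀ {x y} → leeWeight (x ⊖ y) ≡ q            →   Kerdock (x ⊖ y)      → S 4F x y
    S₄   : ∀ {x y} → leeWeight (x ⊖ y) ≡ q            → ¬ Kerdock (x ⊖ y)      → S 5F x y
    S′₅₁ : ∀ {x y} → leeWeight (x ⊖ y) ≡ q +√ (q / 2) → ¬ Kerdock (x ⊖ y)      → S 6F x y
    S′₅₂ : ∀ {x y} → leeWeight (x ⊖ y) ≡ q +√ (q / 2) →   Kerdock (x ⊖ y)      → S 7F x y
    S₆   : ∀ {x y} → leeWeight (x ⊖ y) ≡ q +√ (2 ℕ.* q)                        → S 8F x y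
    S₇   : ∀ {x y} → leeWeight (x ⊖ y) ≡ 2 ℕ.* q                               → S 9F x y

{-# OPTIONS --safe #-}

-- The codewords are indexed by the group G of triples (u, a, b) with u in ℤ₄,
-- a in R and b in the residue field R/2R.  The Lee weight of the word of g is
-- q − Re f(g), where f is the sum of the characters χ(g, -) of G over the points
-- (1, x, x³), x in 𝒯, for a self-duality χ of G.  The square |f|² is governed by
-- the kernel of the bilinear form of x ↦ tr(ax + 2bx³), hence by the roots γ of
-- the cubic 1 + a²γ² + bγ³.  So G falls into ten classes, given by Re f together
-- with the condition b = 0.
--
-- Intersection numbers exist as soon as class functions are closed under
-- convolution.  For this we give ten functions on the dual group G whose products
-- are multiples of the functions themselves and whose Fourier transforms span the
-- class functions.  They are 1 + χ(2, 0, 0), four functions on the subgroup L of the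
-- points (0, 2α, β), the sums of translates of these four by ±(1, x, x³), and a
-- correction of the double sum of translates of the point 0.  Three of the functions on
-- L are indicators; the fourth, V, has a transform that depends on whether the cubic
-- has a root.
module Submission where

open import Algebra.Bundles using (CommutativeRing; AbelianGroup; RawRing; Semiring)
import Algebra.Construct.DirectProduct as DirectProduct
import Algebra.Definitions.RawSemiring as RawSemiringDefs
import Algebra.Properties.AbelianGroup as AbelianGroupProperties
import Algebra.Properties.Group as GroupProperties
import Algebra.Properties.Semiring.Exp as Exp
import Algebra.Properties.Semiring.Mult as Mult
import Algebra.Properties.Semiring.Sum as SemiringSum
import Algebra.Solver.CommutativeMonoid as CommutativeMonoidSolver
import Algebra.Solver.Ring as RingSolver
open import Algebra.Solver.Ring.AlmostCommutativeRing using (fromCommutativeRing; _-Raw-AlmostCommutative⟶_)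
open import Data.Bool.Base using (Bool; true; false; if_then_else_; _xor_; _∧_)
import Data.Bool.Properties as Bool
open import Data.Fin.Base as Fin using (Fin; toℕ; combine; remQuot)
open import Data.Fin.Patterns
open import Data.Fin.Permutation using (permutation; Permutation)
import Data.Fin.Properties as Fin
open import Data.Integer.Base as ℤ using (ℤ; +_; ∣_∣)
import Data.Integer.Properties as ℤ
import Data.Integer.Solver as ℤ
open import Data.Maybe.Base using (Maybe; just; nothing)
open import Data.Nat.Base as ℕ using (ℕ; zero; suc)
open import Data.Nat.DivMod using (_mod_; _%_; _/_; m≡m%n+[m/n]*n; m%n<n; [m+kn]%n≡m%n; m*n%n≡0; m*n/n≡m)
open import Data.Nat.Divisibility using (_∣_; _∣?_; divides; n∣m*n)
open import Data.Nat.GeneralisedArithmetic using (iterate)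
import Data.Nat.Properties as ℕ
import Data.Nat.Solver as ℕ
open import Data.Product.Base using (Σ; ∃; ∃₂; _×_; _,_; proj₁; proj₂)
open import Data.Product.Properties using (≡-dec)
open import Data.Product.Relation.Binary.Pointwise.NonDependent using (×-setoid)
open import Data.Sum.Base as Sum using (_⊎_; inj₁; inj₂; [_,_]′)
open import Data.Vec.Base using (Vec; []; _∷_; lookup)
open import Defs
open import Function.Base using (_∘_; id)
open import Function.Bundles using (Inverse; _⇔_; Equivalence; mk⇔)
import Function.Construct.Identity as Identity
open import Function.Definitions using (Injective)
open import Level using (Level; 0ℓ; _⊔_)
open import Relation.Binary.Bundles using (Setoid)
open import Relation.Binary.Definitions using (tri<; tri≈; tri>)
open import Relation.Binary.PropositionalEquality as ≡ using (_≡_; _≢_; refl)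
import Relation.Binary.Reasoning.Setoid as SetoidReasoning
open import Relation.Nullary using (¬_; Dec; yes; no; does; contradiction)
open import Relation.Nullary.Decidable using (map′; from-yes; dec-true; dec-false; does-⇔; from-no; _→-dec_; _⊎-dec_; ¬?; _×-dec_)
open import Relation.Unary using (Pred; Decidable)

-- A class is a value of Re f together with one of four kinds of (a, b). Functions on L have
-- transforms that depend only on a modulo 2 and on b, so they detect kinds but no signs. Adding the
-- translates by ±(1, x, x³) multiplies a transform by 2 Re f; this turns four functions into eight
-- and supplies the signs. Two gaps remain. The transform of 1 + χ(2, 0, 0) lives on the points 0
-- and (2, 0, 0) and cuts them off from the rest of their kind. The corrected double sum has
-- transform 4(Re f)² - 2q and separates Re f = 0 from Re f = ±√(2q) among the reducible pairs. The
-- delicate function is V, as no indicator of a subgroup knows whether a cubic has a root. For c ≠ 0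
-- all roots of v³ = c(1 + v)² have the trace of c; there is one root if that trace is 0, and none
-- or three if it is 1. Weighting the roots by 3 or 1 according to their trace turns the count into
-- 0 or 3. So V is a multiple of an indicator, and the same trichotomy evaluates its transform.

module _ where

  private variable
    a b p ℓ₁ ℓ₂ ℓ₃ : Level

  -- Finite types

  injective⇒surjective : ∀ {n} (f : Fin n → Fin n) → Injective _≡_ _≡_ f →
                         ∀ y → ∃ λ x → f x ≡ y
  injective⇒surjective {suc n} f inj y with Fin.any? (λ x → f x Fin.≟ y)
  ... | yes hit = hit
  ... | no miss = contradiction
    (Fin.injective⇒≤ (λ {x} {x′} → inj ∘ Fin.punchOut-injective (y≢f x) (y≢f x′))) (ℕ.<⇒≱ ℕ.≤-refl)
    where
    y≢f : ∀ x → y ≢ f x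
    y≢f x eq = miss (x , ≡.sym eq)

  -- A section of a surjective `f` is injective, hence bijective, so `f` is its inverse and
  -- injective as well. This counting argument later supplies a cubic without a root.
  non-injective⇒non-surjective : ∀ {n} (f : Fin n → Fin n) {x x′} → x ≢ x′ → f x ≡ f x′ →
                                 ∃ λ y → ∀ z → f z ≢ y
  non-injective⇒non-surjective {n} f {x} {x′} x≢x′ eq
    with Fin.all? (λ y → Fin.any? (λ z → f z Fin.≟ y))
  ... | no ¬all = let y , miss , _ = Fin.¬∀⟶∃¬-smallest n _ (λ y → Fin.any? (λ z → f z Fin.≟ y)) ¬all
                  in y , λ z eq → miss (z , eq)
  ... | yes surj = contradiction (≡.trans (≡.sym (section x)) (≡.trans (≡.cong g eq) (section x′))) x≢x′
    where
    g : Fin n → Fin n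
    g y = proj₁ (surj y)

    g-injective : Injective _≡_ _≡_ g
    g-injective {y} {y′} eq = ≡.trans (≡.sym (proj₂ (surj y))) (≡.trans (≡.cong f eq) (proj₂ (surj y′)))

    section : ∀ z → g (f z) ≡ z
    section z with y , refl ← injective⇒surjective g g-injective z = ≡.cong g (proj₂ (surj y))

  module _ {X : Setoid a ℓ₁} {Y : Setoid b ℓ₂} where
    private
      module X = Setoid X
      module Y = Setoid Y

    HasSize-transport : (f : X.Carrier → Y.Carrier) (g : Y.Carrier → X.Carrier) →
      (∀ {x x′} → x X.≈ x′ → f x Y.≈ f x′) → (∀ {y y′} → y Y.≈ y′ → g y X.≈ g y′) →
      (∀ y → f (g y) Y.≈ y) → (∀ x → g (f x) X.≈ x) → ∀ {n} → HasSize X n → HasSize Y n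
    HasSize-transport f g f-cong g-cong fg gf size = record
      { to        = to ∘ g
      ; from      = f ∘ from
      ; to-cong   = to-cong ∘ g-cong
      ; from-cong = f-cong ∘ from-cong
      ; inverse   = (λ {k} {y} eq → ≡.trans (to-cong (X.trans (g-cong eq) (gf (from k)))) (strictlyInverseˡ k))
                  , (λ {y} {k} eq → Y.trans (f-cong (X.trans (from-cong eq) (strictlyInverseʳ (g y)))) (fg y))
      }
      where open Inverse size

    HasSize-× : ∀ {m n} → HasSize X m → HasSize Y n → HasSize (×-setoid X Y) (m ℕ.* n)
    HasSize-× {m} {n} I J = record
      { to        = λ (x , y) → combine (I.to x) (J.to y)
      ; from      = λ k → let i , j = remQuot {m} n k in I.from i , J.from j
      ; to-cong   = λ (eq , eq′) → ≡.cong₂ combine (I.to-cong eq) (J.to-cong eq′)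
      ; from-cong = λ { refl → X.refl , Y.refl }
      ; inverse   =
          (λ {k} (eq , eq′) → ≡.trans
            (≡.cong₂ combine (I.inverseˡ eq) (J.inverseˡ eq′))
            (Fin.combine-remQuot {m} n k))
        , (λ { {x , y} refl → let e = Fin.remQuot-combine (I.to x) (J.to y) in
            I.inverseʳ (≡.cong proj₁ e) , J.inverseʳ (≡.cong proj₂ e) })
      }
      where
      module I = Inverse I
      module J = Inverse J

  count : ∀ {n} {P : Pred (Fin n) p} → Decidable P → ℕ
  count {n = zero}  P? = 0
  count {n = suc n} P? = if does (P? 0F) then suc (count (P? ∘ Fin.suc)) else count (P? ∘ Fin.suc)

  count-size : ∀ {n} {P : Pred (Fin n) p} (P? : Decidable P) →
               HasSize (Subsetoid (≡.setoid (Fin n)) P) (count P?)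
  count-size {n = zero} P? = record
    { to = λ () ; from = λ () ; to-cong = λ { {()} } ; from-cong = λ { {()} }
    ; inverse = (λ { {()} }) , (λ { {()} }) }
  count-size {n = suc n} {P} P? with P? 0F | count-size (P? ∘ Fin.suc)
  ... | no ¬p | I = record
    { to        = to′
    ; from      = λ k → Fin.suc (proj₁ (I.from k)) , proj₂ (I.from k)
    ; to-cong   = λ {x} {y} → to′-cong x y
    ; from-cong = λ eq → ≡.cong Fin.suc (I.from-cong eq)
    ; inverse   = (λ { {k} {Fin.suc x , p} eq → I.inverseˡ (Fin.suc-injective eq)
                     ; {k} {0F , p} eq → contradiction p ¬p })
                , (λ { {Fin.suc x , p} eq → ≡.cong Fin.suc (I.inverseʳ eq)
                     ; {0F , p} eq → contradiction p ¬p })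
    }
    where
    module I = Inverse I
    to′ : Σ (Fin (suc n)) P → Fin (count (P? ∘ Fin.suc))
    to′ (0F , p)        = contradiction p ¬p
    to′ (Fin.suc x , p) = I.to (x , p)
    to′-cong : ∀ x y → proj₁ x ≡ proj₁ y → to′ x ≡ to′ y
    to′-cong (0F , p)        y                refl = contradiction p ¬p
    to′-cong (Fin.suc x , p) (Fin.suc y , p′) eq   = I.to-cong (Fin.suc-injective eq)
  ... | yes p₀ | I = record
    { to        = to′
    ; from      = from′
    ; to-cong   = λ {x} {y} → to′-cong x y
    ; from-cong = λ { refl → refl }
    ; inverse   = (λ { {0F} {0F , p} eq → refl
                     ; {Fin.suc k} {Fin.suc x , p} eq → ≡.cong Fin.suc (I.inverseˡ (Fin.suc-injective eq)) })
                , (λ { {0F , p} refl → refl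
                     ; {Fin.suc x , p} refl → ≡.cong Fin.suc (I.inverseʳ refl) })
    }
    where
    module I = Inverse I
    to′ : Σ (Fin (suc n)) P → Fin (suc (count (P? ∘ Fin.suc)))
    to′ (0F , p)        = 0F
    to′ (Fin.suc x , p) = Fin.suc (I.to (x , p))
    from′ : Fin (suc (count (P? ∘ Fin.suc))) → Σ (Fin (suc n)) P
    from′ 0F          = 0F , p₀
    from′ (Fin.suc k) = Fin.suc (proj₁ (I.from k)) , proj₂ (I.from k)
    to′-cong : ∀ x y → proj₁ x ≡ proj₁ y → to′ x ≡ to′ y
    to′-cong (0F , p)        (0F , p′)        eq = refl
    to′-cong (Fin.suc x , p) (Fin.suc y , p′) eq = ≡.cong Fin.suc (I.to-cong (Fin.suc-injective eq))

  abstract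
    -- Abstract, so that decisions of equality in `R`, in the residue field and in `G` do not unfold
    -- into computations with indices.
    HasSize-≟ : {X : Setoid a ℓ₁} → ∀ {n} → HasSize X n → ∀ x y → Dec (Setoid._≈_ X x y)
    HasSize-≟ {X = X} I x y = map′
      (λ eq → Setoid.trans X (Setoid.sym X (I.strictlyInverseʳ x)) (I.inverseʳ eq))
      I.to-cong (I.to x Fin.≟ I.to y)
      where module I = Inverse I

  HasSize-any? : {X : Setoid a ℓ₁} → ∀ {n} → HasSize X n → {P : Pred (Setoid.Carrier X) p} → Decidable P →
    (∀ {x x′} → Setoid._≈_ X x x′ → P x → P x′) → Dec (∃ P)
  HasSize-any? {X = X} I P? P-resp = map′ (λ (k , p) → I.from k , p)
    (λ (x , p) → I.to x , P-resp (Setoid.sym X (I.strictlyInverseʳ x)) p) (Fin.any? (P? ∘ I.from))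
    where module I = Inverse I

  module _ {X : Setoid a ℓ₁} {Y : Setoid b ℓ₂} {n} (I : HasSize X n)
      {P : Pred (Setoid.Carrier X) ℓ₃} (P? : Decidable P)
      (P-resp : ∀ {x x′} → Setoid._≈_ X x x′ → P x → P x′)
      {Q : Pred (Setoid.Carrier Y) p}
      (f : Setoid.Carrier X → Setoid.Carrier Y) (g : Setoid.Carrier Y → Setoid.Carrier X)
      (f-cong : ∀ {x x′} → Setoid._≈_ X x x′ → Setoid._≈_ Y (f x) (f x′))
      (g-cong : ∀ {y y′} → Setoid._≈_ Y y y′ → Setoid._≈_ X (g y) (g y′))
      (fg : ∀ y → Setoid._≈_ Y (f (g y)) y) (gf : ∀ x → Setoid._≈_ X (g (f x)) x)
      (P⇒Q : ∀ {x} → P x → Q (f x)) (Q⇒P : ∀ {y} → Q y → P (g y)) where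
    private
      module I = Inverse I
      module X = Setoid X
      module Y = Setoid Y

    -- The size comes out as a `count` over a fixed enumeration of `X`. Comparing the sizes of two
    -- such subsets is then a comparison of numbers, which `count-sum` turns into sums of brackets.
    HasSize-subset : HasSize (Subsetoid Y Q) (count (P? ∘ I.from))
    HasSize-subset = HasSize-transport {X = Subsetoid (≡.setoid (Fin n)) (P ∘ I.from)} {Y = Subsetoid Y Q}
      (λ (k , p) → f (I.from k) , P⇒Q p)
      (λ (y , q) → I.to (g y) , P-resp (X.sym (I.strictlyInverseʳ (g y))) (Q⇒P q))
      (f-cong ∘ I.from-cong) (I.to-cong ∘ g-cong)
      (λ (y , _) → Y.trans (f-cong (I.strictlyInverseʳ (g y))) (fg y))
      (λ (k , _) → ≡.trans (I.to-cong (gf (I.from k))) (I.strictlyInverseˡ k))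
      (count-size (P? ∘ I.from))

  -- Gaussian integers

  private
    open module ℤ-Solver = ℤ.+-*-Solver using (solve; _:+_; _:*_; :-_; _:-_; _:=_; con)

  abstract
    private
      _⊕_ _⊗_ : ℤ × ℤ → ℤ × ℤ → ℤ × ℤ
      (a , b) ⊕ (c , d) = a ℤ.+ c , b ℤ.+ d
      (a , b) ⊗ (c , d) = a ℤ.* c ℤ.- b ℤ.* d , a ℤ.* d ℤ.+ b ℤ.* c

      ⊖_ : ℤ × ℤ → ℤ × ℤ
      ⊖ (a , b) = ℤ.- a , ℤ.- b

    -- All characters of ℤ₄ have values in the fourth roots of unity, so Gaussian integers suffice
    -- for every sum below. The ring is abstract: equations in it go through the ring laws and the
    -- rules for `emb`, `conj`, `re` and `im`, not through pairs of integers.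
    ℤ[i] : CommutativeRing 0ℓ 0ℓ
    ℤ[i] = record
      { Carrier = ℤ × ℤ ; _≈_ = _≡_ ; _+_ = _⊕_ ; _*_ = _⊗_ ; -_ = ⊖_
      ; 0# = + 0 , + 0 ; 1# = + 1 , + 0
      ; isCommutativeRing = record
        { isRing = record
          { +-isAbelianGroup = record
            { isGroup = record
              { isMonoid = record
                { isSemigroup = record
                  { isMagma = record { isEquivalence = ≡.isEquivalence ; ∙-cong = ≡.cong₂ _⊕_ }
                  ; assoc = λ (a , b) (c , d) (e , f) → ≡.cong₂ _,_ (ℤ.+-assoc a c e) (ℤ.+-assoc b d f)
                  }
                ; identity = (λ (a , b) → ≡.cong₂ _,_ (ℤ.+-identityˡ a) (ℤ.+-identityˡ b))
                           , (λ (a , b) → ≡.cong₂ _,_ (ℤ.+-identityʳ a) (ℤ.+-identityʳ b))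
                }
              ; inverse = (λ (a , b) → ≡.cong₂ _,_ (ℤ.+-inverseˡ a) (ℤ.+-inverseˡ b))
                        , (λ (a , b) → ≡.cong₂ _,_ (ℤ.+-inverseʳ a) (ℤ.+-inverseʳ b))
              ; ⁻¹-cong = ≡.cong ⊖_
              }
            ; comm = λ (a , b) (c , d) → ≡.cong₂ _,_ (ℤ.+-comm a c) (ℤ.+-comm b d)
            }
          ; *-cong = ≡.cong₂ _⊗_
          ; *-assoc = λ (a , b) (c , d) (e , f) → ≡.cong₂ _,_
              (solve 6 (λ a b c d e f →
                (a :* c :- b :* d) :* e :- (a :* d :+ b :* c) :* f
                := a :* (c :* e :- d :* f) :- b :* (c :* f :+ d :* e)) refl a b c d e f)
              (solve 6 (λ a b c d e f →
                (a :* c :- b :* d) :* f :+ (a :* d :+ b :* c) :* e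
                := a :* (c :* f :+ d :* e) :+ b :* (c :* e :- d :* f)) refl a b c d e f)
          ; *-identity = (λ (a , b) → ≡.cong₂ _,_
                (solve 2 (λ a b → con (+ 1) :* a :- con (+ 0) :* b := a) refl a b)
                (solve 2 (λ a b → con (+ 1) :* b :+ con (+ 0) :* a := b) refl a b))
              , (λ (a , b) → ≡.cong₂ _,_
                (solve 2 (λ a b → a :* con (+ 1) :- b :* con (+ 0) := a) refl a b)
                (solve 2 (λ a b → a :* con (+ 0) :+ b :* con (+ 1) := b) refl a b))
          ; distrib = (λ (a , b) (c , d) (e , f) → ≡.cong₂ _,_
                (solve 6 (λ a b c d e f → a :* (c :+ e) :- b :* (d :+ f)
                  := (a :* c :- b :* d) :+ (a :* e :- b :* f)) refl a b c d e f)
                (solve 6 (λ a b c d e f → a :* (d :+ f) :+ b :* (c :+ e)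
                  := (a :* d :+ b :* c) :+ (a :* f :+ b :* e)) refl a b c d e f))
              , (λ (a , b) (c , d) (e , f) → ≡.cong₂ _,_
                (solve 6 (λ a b c d e f → (c :+ e) :* a :- (d :+ f) :* b
                  := (c :* a :- d :* b) :+ (e :* a :- f :* b)) refl a b c d e f)
                (solve 6 (λ a b c d e f → (c :+ e) :* b :+ (d :+ f) :* a
                  := (c :* b :+ d :* a) :+ (e :* b :+ f :* a)) refl a b c d e f))
          }
        ; *-comm = λ (a , b) (c , d) → ≡.cong₂ _,_
            (solve 4 (λ a b c d → a :* c :- b :* d := c :* a :- d :* b) refl a b c d)
            (solve 4 (λ a b c d → a :* d :+ b :* c := c :* b :+ d :* a) refl a b c d)
        }
      }

  open CommutativeRing ℤ[i] using (Carrier; _≈_; 0#; 1#; _+_; _*_; -_; setoid)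

  𝔾 : Set
  𝔾 = Carrier

  abstract
    emb : ℤ → 𝔾
    emb k = k , + 0

    𝕚 : 𝔾
    𝕚 = + 0 , + 1

    conj : 𝔾 → 𝔾
    conj (a , b) = a , ℤ.- b

    re im : 𝔾 → ℤ
    re = proj₁
    im = proj₂

    emb-cong : ∀ {j k} → j ≡ k → emb j ≈ emb k
    emb-cong = ≡.cong emb

    emb-0 : emb (+ 0) ≈ 0#
    emb-0 = refl

    emb-1 : emb (+ 1) ≈ 1#
    emb-1 = refl

    emb-+ : ∀ j k → emb (j ℤ.+ k) ≈ emb j + emb k
    emb-+ j k = refl

    emb-neg : ∀ k → emb (ℤ.- k) ≈ - emb k
    emb-neg k = refl

    emb-* : ∀ j k → emb (j ℤ.* k) ≈ emb j * emb k
    emb-* j k = ≡.cong₂ _,_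
      (solve 2 (λ j k → j :* k := j :* k :- con (+ 0) :* con (+ 0)) refl j k)
      (solve 2 (λ j k → con (+ 0) := j :* con (+ 0) :+ con (+ 0) :* k) refl j k)

    emb-injective : ∀ {j k} → emb j ≈ emb k → j ≡ k
    emb-injective = ≡.cong proj₁

    conj-cong : ∀ {x y} → x ≈ y → conj x ≈ conj y
    conj-cong = ≡.cong conj

    conj-0 : conj 0# ≈ 0#
    conj-0 = refl

    conj-𝕚 : conj 𝕚 ≈ - 𝕚
    conj-𝕚 = refl

    conj-+ : ∀ x y → conj (x + y) ≈ conj x + conj y
    conj-+ (a , b) (c , d) = ≡.cong (a ℤ.+ c ,_) (ℤ.neg-distrib-+ b d)

    conj-* : ∀ x y → conj (x * y) ≈ conj x * conj y
    conj-* (a , b) (c , d) = ≡.cong₂ _,_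
      (solve 4 (λ a b c d → a :* c :- b :* d := a :* c :- (:- b) :* (:- d)) refl a b c d)
      (solve 4 (λ a b c d → :- (a :* d :+ b :* c) := a :* (:- d) :+ (:- b) :* c) refl a b c d)

    re-cong : ∀ {x y} → x ≈ y → re x ≡ re y
    re-cong = ≡.cong re

    re-emb : ∀ k → re (emb k) ≡ k
    re-emb k = refl

    im-emb : ∀ k → im (emb k) ≡ + 0
    im-emb k = refl

    re-+ : ∀ x y → re (x + y) ≡ re x ℤ.+ re y
    re-+ _ _ = refl

    re-𝕚* : ∀ x → re (𝕚 * x) ≡ ℤ.- im x
    re-𝕚* (a , b) = solve 2 (λ a b → con (+ 0) :* a :- con (+ 1) :* b := :- b) refl a b

    re-neg : ∀ x → re (- x) ≡ ℤ.- re x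
    re-neg _ = refl

    +-conj : ∀ x → x + conj x ≈ emb (+ 2 ℤ.* re x)
    +-conj (a , b) = ≡.cong₂ _,_
      (solve 1 (λ a → a :+ a := con (+ 2) :* a) refl a) (ℤ.+-inverseʳ b)

    *-conj : ∀ x → x * conj x ≈ emb (re x ℤ.* re x ℤ.+ im x ℤ.* im x)
    *-conj (a , b) = ≡.cong₂ _,_
      (solve 2 (λ a b → a :* a :- b :* (:- b) := a :* a :+ b :* b) refl a b)
      (solve 2 (λ a b → a :* (:- b) :+ b :* a := con (+ 0)) refl a b)

    -- The substitute for division: the arguments in ℤ[i] divide by nonzero integers only.
    emb-*-cancel : ∀ k {x y} → k ≢ + 0 → emb k * x ≈ emb k * y → x ≈ y
    emb-*-cancel k {a , b} {c , d} k≢0 eq = ≡.cong₂ _,_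
      (ℤ.*-cancelˡ-≡ k a c (≡.trans (≡.sym (fst a b)) (≡.trans (≡.cong proj₁ eq) (fst c d))))
      (ℤ.*-cancelˡ-≡ k b d (≡.trans (≡.sym (snd a b)) (≡.trans (≡.cong proj₂ eq) (snd c d))))
      where
      instance
        k-nonZero : ℤ.NonZero k
        k-nonZero = ℤ.≢-nonZero k≢0
      fst : ∀ a b → k ℤ.* a ℤ.- + 0 ℤ.* b ≡ k ℤ.* a
      fst = solve 3 (λ k a b → k :* a :- con (+ 0) :* b := k :* a) refl k
      snd : ∀ a b → k ℤ.* b ℤ.+ + 0 ℤ.* a ≡ k ℤ.* b
      snd = solve 3 (λ k a b → k :* b :+ con (+ 0) :* a := k :* b) refl k

    -- e u = 𝕚ᵘ
    e : Fin 4 → 𝔾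
    e 0F = + 1 , + 0
    e 1F = + 0 , + 1
    e 2F = ℤ.- + 1 , + 0
    e 3F = + 0 , ℤ.- + 1

    e-0 : e 0F ≈ 1#
    e-0 = refl

    e-1 : e 1F ≈ 𝕚
    e-1 = refl

    e-2 : e 2F ≈ - 1#
    e-2 = refl

    e-+ : ∀ i j → e (i +₄ j) ≈ e i * e j
    e-+ = from-yes (Fin.all? λ i → Fin.all? λ j → ≡-dec ℤ._≟_ ℤ._≟_ (e (i +₄ j)) (e i * e j))

    conj-e : ∀ i → conj (e i) ≈ e (-₄ i)
    conj-e = from-yes (Fin.all? λ i → ≡-dec ℤ._≟_ ℤ._≟_ (conj (e i)) (e (-₄ i)))

    -- The real parts of 1, i, -1, -i are 1, 0, -1, 0 and the Lee weights are 0, 1, 2, 1. Summed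
    -- over the coordinates, this is the passage from weights to character sums.
    lee+re-e : ∀ i → + lee i ℤ.+ re (e i) ≡ + 1
    lee+re-e = from-yes (Fin.all? λ i → (+ lee i ℤ.+ re (e i)) ℤ.≟ + 1)

-- Finite sums of Gaussian integers

module _ where

  private variable
    a b p p′ ℓ₁ ℓ₂ : Level
    n N : ℕ

  open CommutativeRing ℤ[i] using (_≈_; 0#; 1#; _+_; _*_; -_)

  module ℂ = CommutativeRing ℤ[i]
  module ℂ-Reasoning = SetoidReasoning ℂ.setoid
  open SemiringSum ℂ.semiring using (sum; sum-cong-≋; ∑-comm; ∑-distrib-+; *-distribˡ-sum; *-distribʳ-sum; sum-permute)

  -- Agrees with emb but evaluates 0 and 1 to the constants of the ring.
  coe : ℤ → 𝔾
  coe (+ 0) = 0#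
  coe (+ 1) = 1#
  coe k     = emb k

  coe≈emb : ∀ k → coe k ≈ emb k
  coe≈emb (+ 0)             = ℂ.sym emb-0
  coe≈emb (+ 1)             = ℂ.sym emb-1
  coe≈emb (+ suc (suc k))   = ℂ.refl
  coe≈emb (ℤ.-[1+ k ])      = ℂ.refl

  private
    coe-≟ : ∀ j k → Maybe (coe j ≈ coe k)
    coe-≟ j k with j ℤ.≟ k
    ... | yes refl = just ℂ.refl
    ... | no _     = nothing

  private
    coe-+ : ∀ j k → coe (j ℤ.+ k) ≈ coe j + coe k
    coe-+ j k = ℂ.trans (coe≈emb (j ℤ.+ k)) (ℂ.trans (emb-+ j k) (ℂ.sym (ℂ.+-cong (coe≈emb j) (coe≈emb k))))

    coe-* : ∀ j k → coe (j ℤ.* k) ≈ coe j * coe k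
    coe-* j k = ℂ.trans (coe≈emb (j ℤ.* k)) (ℂ.trans (emb-* j k) (ℂ.sym (ℂ.*-cong (coe≈emb j) (coe≈emb k))))

    coe-neg : ∀ k → coe (ℤ.- k) ≈ - coe k
    coe-neg k = ℂ.trans (coe≈emb (ℤ.- k)) (ℂ.trans (emb-neg k) (ℂ.sym (ℂ.-‿cong (coe≈emb k))))

    coe-morphism : ℤ.+-*-rawRing -Raw-AlmostCommutative⟶ fromCommutativeRing ℤ[i]
    coe-morphism = record
      { ⟦_⟧    = coe
      ; +-homo = coe-+
      ; *-homo = coe-*
      ; -‿homo = coe-neg
      ; 0-homo = ℂ.refl
      ; 1-homo = ℂ.refl
      }

  module ℂ-Solver = RingSolver ℤ.+-*-rawRing (fromCommutativeRing ℤ[i]) coe-morphism coe-≟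

  open ℂ-Solver public using (solve; con)
    renaming (_:+_ to _⊕_; _:*_ to _⊗_; :-_ to ⊖_; _:-_ to _⊖_; _:=_ to _⊜_)

  x≈-x⇒x≈0 : ∀ {x} → x ≈ - x → x ≈ 0#
  x≈-x⇒x≈0 {x} eq = emb-*-cancel (+ 2) (λ ()) (begin
    emb (+ 2) * x    ≈⟨ solve 1 (λ x → con (+ 2) ⊗ x ⊜ x ⊕ x) ℂ.refl x ⟩
    x + x            ≈⟨ ℂ.+-congˡ eq ⟩
    x + - x          ≈⟨ solve 1 (λ x → x ⊕ ⊖ x ⊜ con (+ 2) ⊗ con (+ 0)) ℂ.refl x ⟩
    emb (+ 2) * 0#   ∎)
    where open ℂ-Reasoning

  -- The Iverson bracket. It reads only `does`, so equivalent propositions have equal brackets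
  -- whatever their decision procedures.
  ⟦_⟧ : {P : Set p} → Dec P → 𝔾
  ⟦ d ⟧ = if does d then 1# else 0#

  ⟦⟧-cong : {P : Set p} {Q : Set p′} (P? : Dec P) (Q? : Dec Q) → P ⇔ Q → ⟦ P? ⟧ ≈ ⟦ Q? ⟧
  ⟦⟧-cong P? Q? P⇔Q = ℂ.reflexive (≡.cong (if_then 1# else 0#) (does-⇔ P⇔Q P? Q?))

  ⟦⟧-true : {P : Set p} (P? : Dec P) → P → ⟦ P? ⟧ ≈ 1#
  ⟦⟧-true P? x = ℂ.reflexive (≡.cong (if_then 1# else 0#) (dec-true P? x))

  ⟦⟧-false : {P : Set p} (P? : Dec P) → ¬ P → ⟦ P? ⟧ ≈ 0#
  ⟦⟧-false P? ¬x = ℂ.reflexive (≡.cong (if_then 1# else 0#) (dec-false P? ¬x))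

  ⟦⟧-⊎ : {P : Set p} {A : Set p′} {B : Set a} (P? : Dec P) (A? : Dec A) (B? : Dec B) →
          (P → A ⊎ B) → (A → P) → (B → P) → (A → ¬ B) → ⟦ P? ⟧ ≈ ⟦ A? ⟧ + ⟦ B? ⟧
  ⟦⟧-⊎ P? (yes x) B? P⇒ A⇒ B⇒ ¬AB = ℂ.trans (⟦⟧-true P? (A⇒ x))
    (ℂ.sym (ℂ.trans (ℂ.+-congˡ (⟦⟧-false B? (¬AB x))) (ℂ.+-identityʳ 1#)))
  ⟦⟧-⊎ P? (no ¬x) B? P⇒ A⇒ B⇒ ¬AB = ℂ.trans
    (⟦⟧-cong P? B? (mk⇔ (λ p → [ (λ x → contradiction x ¬x) , (λ y → y) ]′ (P⇒ p)) B⇒)) (ℂ.sym (ℂ.+-identityˡ _))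

  sum-0 : (f : Fin n → 𝔾) → (∀ k → f k ≈ 0#) → sum f ≈ 0#
  sum-0 {zero}  f f≈0 = ℂ.refl
  sum-0 {suc n} f f≈0 = ℂ.trans (ℂ.+-cong (f≈0 0F) (sum-0 (f ∘ Fin.suc) (f≈0 ∘ Fin.suc))) (ℂ.+-identityʳ 0#)

  sum-1 : ∀ n → sum {n} (λ _ → 1#) ≈ emb (+ n)
  sum-1 zero    = ℂ.sym emb-0
  sum-1 (suc n) = ℂ.trans (ℂ.+-cong (ℂ.sym emb-1) (sum-1 n)) (ℂ.sym (emb-+ (+ 1) (+ n)))

  sum-const : ∀ n x → sum {n} (λ _ → x) ≈ emb (+ n) * x
  sum-const n x = begin
    sum {n} (λ _ → x)        ≈⟨ sum-cong-≋ {n} (λ _ → ℂ.sym (ℂ.*-identityˡ x)) ⟩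
    sum {n} (λ _ → 1# * x)   ≈⟨ *-distribʳ-sum {n} x (λ _ → 1#) ⟨
    sum {n} (λ _ → 1#) * x   ≈⟨ ℂ.*-congʳ (sum-1 n) ⟩
    emb (+ n) * x            ∎
    where open ℂ-Reasoning

  sum-δ : (j : Fin n) (f : Fin n → 𝔾) → sum (λ k → ⟦ k Fin.≟ j ⟧ * f k) ≈ f j
  sum-δ {suc n} 0F f = begin
    1# * f 0F + sum (λ k → 0# * f (Fin.suc k))  ≈⟨ ℂ.+-cong (ℂ.*-identityˡ _) (sum-0 {n} _ λ k → ℂ.zeroˡ _) ⟩
    f 0F + 0#                                   ≈⟨ ℂ.+-identityʳ _ ⟩
    f 0F                                        ∎
    where open ℂ-Reasoning
  sum-δ {suc n} (Fin.suc j) f = begin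
    0# * f 0F + sum (λ k → ⟦ k Fin.≟ j ⟧ * f (Fin.suc k)) ≈⟨ ℂ.+-cong (ℂ.zeroˡ _) (sum-δ j (f ∘ Fin.suc)) ⟩
    0# + f (Fin.suc j)                                    ≈⟨ ℂ.+-identityˡ _ ⟩
    f (Fin.suc j)                                         ∎
    where open ℂ-Reasoning

  conj-sum : (f : Fin n → 𝔾) → conj (sum f) ≈ sum (conj ∘ f)
  conj-sum {zero}  f = conj-0
  conj-sum {suc n} f = ℂ.trans (conj-+ _ _) (ℂ.+-congˡ (conj-sum (f ∘ Fin.suc)))

  count-sum : {P : Fin n → Set p} (P? : ∀ k → Dec (P k)) → emb (+ count P?) ≈ sum (λ k → ⟦ P? k ⟧)
  count-sum {zero} P? = emb-0
  count-sum {suc n} P? with does (P? 0F)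
  ... | true  = ℂ.trans (emb-+ (+ 1) _) (ℂ.+-cong emb-1 (count-sum (P? ∘ Fin.suc)))
  ... | false = ℂ.trans (count-sum (P? ∘ Fin.suc)) (ℂ.sym (ℂ.+-identityˡ _))

  -- Sums over a finite setoid

  module Summation {X : Setoid a ℓ₁} {n} (I : HasSize X n) where
    private
      module X = Setoid X
      module I = Inverse I
    open ℂ-Reasoning

    infix 4 _≟_
    _≟_ : ∀ x y → Dec (x X.≈ y)
    _≟_ = HasSize-≟ I

    Respectful : (X.Carrier → 𝔾) → Set _
    Respectful f = ∀ {x y} → x X.≈ y → f x ≈ f y

    abstract
      ∑ : (X.Carrier → 𝔾) → 𝔾
      ∑ f = sum (f ∘ I.from)

      ∑-cong : ∀ {f g} → (∀ x → f x ≈ g x) → ∑ f ≈ ∑ g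
      ∑-cong eq = sum-cong-≋ (eq ∘ I.from)

      ∑-+ : ∀ f g → ∑ (λ x → f x + g x) ≈ ∑ f + ∑ g
      ∑-+ f g = ∑-distrib-+ (f ∘ I.from) (g ∘ I.from)

      ∑-*ˡ : ∀ c f → ∑ (λ x → c * f x) ≈ c * ∑ f
      ∑-*ˡ c f = ℂ.sym (*-distribˡ-sum c (f ∘ I.from))

      ∑-*ʳ : ∀ c f → ∑ (λ x → f x * c) ≈ ∑ f * c
      ∑-*ʳ c f = ℂ.sym (*-distribʳ-sum c (f ∘ I.from))

      ∑≈sum : ∀ f → ∑ f ≈ sum (f ∘ I.from)
      ∑≈sum f = ℂ.refl

      ∑-sum-swap : (f : Fin N → X.Carrier → 𝔾) → sum (λ k → ∑ (f k)) ≈ ∑ (λ x → sum (λ k → f k x))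
      ∑-sum-swap f = ∑-comm (λ k → f k ∘ I.from)

      ∑-swap : (f : X.Carrier → X.Carrier → 𝔾) → ∑ (λ x → ∑ (f x)) ≈ ∑ (λ y → ∑ (λ x → f x y))
      ∑-swap f = ∑-comm (λ k l → f (I.from k) (I.from l))

      ∑-conj : ∀ f → conj (∑ f) ≈ ∑ (conj ∘ f)
      ∑-conj f = conj-sum (f ∘ I.from)

      ∑-1 : ∑ (λ _ → 1#) ≈ emb (+ n)
      ∑-1 = sum-1 n

      ∑-const : ∀ c → ∑ (λ _ → c) ≈ emb (+ n) * c
      ∑-const = sum-const n

      ∑-0 : ∀ f → (∀ x → f x ≈ 0#) → ∑ f ≈ 0#
      ∑-0 f f≈0 = sum-0 (f ∘ I.from) (f≈0 ∘ I.from)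

      ∑-δ : ∀ f c → Respectful f → ∑ (λ x → ⟦ x ≟ c ⟧ * f x) ≈ f c
      ∑-δ f c f-resp = begin
        sum (λ k → ⟦ I.from k ≟ c ⟧ * f (I.from k))          ≈⟨ sum-cong-≋ (λ k → ℂ.*-congʳ (⟦⟧-cong
          (I.from k ≟ c) (k Fin.≟ I.to c) (mk⇔
            (λ eq → ≡.trans (≡.sym (I.strictlyInverseˡ k)) (I.to-cong eq)) I.inverseʳ))) ⟩
        sum (λ k → ⟦ k Fin.≟ I.to c ⟧ * f (I.from k))        ≈⟨ sum-δ (I.to c) (f ∘ I.from) ⟩
        f (I.from (I.to c))                                  ≈⟨ f-resp (I.strictlyInverseʳ c) ⟩
        f c                                                  ∎

      ∑-reindex : ∀ f (σ τ : X.Carrier → X.Carrier) → Respectful f →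
        (∀ {x y} → x X.≈ y → σ x X.≈ σ y) → (∀ {x y} → x X.≈ y → τ x X.≈ τ y) →
        (∀ x → σ (τ x) X.≈ x) → (∀ x → τ (σ x) X.≈ x) → ∑ (f ∘ σ) ≈ ∑ f
      ∑-reindex f σ τ f-resp σ-cong τ-cong στ τσ = begin
        sum (λ k → f (σ (I.from k)))                  ≈⟨ sum-cong-≋ (λ k → f-resp (I.strictlyInverseʳ (σ (I.from k)))) ⟨
        sum (λ k → f (I.from (I.to (σ (I.from k)))))  ≈⟨ sum-permute (f ∘ I.from) π ⟨
        sum (λ k → f (I.from k))                      ∎
        where
        π : Permutation n n
        π = permutation (λ k → I.to (σ (I.from k))) (λ k → I.to (τ (I.from k)))
          ( (λ k → ≡.trans (I.to-cong (X.trans (σ-cong (I.strictlyInverseʳ _)) (στ _))) (I.strictlyInverseˡ k)))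
          ( (λ k → ≡.trans (I.to-cong (X.trans (τ-cong (I.strictlyInverseʳ _)) (τσ _))) (I.strictlyInverseˡ k)))

    -- The bijection `σ` preserves the sum and also negates it, and ℤ[i] has no 2-torsion. Every
    -- vanishing of a sum of nontrivial characters below rests on this.
    ∑-antisymmetric : ∀ f (σ τ : X.Carrier → X.Carrier) → Respectful f →
      (∀ {x y} → x X.≈ y → σ x X.≈ σ y) → (∀ {x y} → x X.≈ y → τ x X.≈ τ y) →
      (∀ x → σ (τ x) X.≈ x) → (∀ x → τ (σ x) X.≈ x) → (∀ x → f (σ x) ≈ - f x) → ∑ f ≈ 0#
    ∑-antisymmetric f σ τ f-resp σ-cong τ-cong στ τσ anti = x≈-x⇒x≈0 (begin
      ∑ f                       ≈⟨ ∑-reindex f σ τ f-resp σ-cong τ-cong στ τσ ⟨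
      ∑ (f ∘ σ)                 ≈⟨ ∑-cong (λ x → ℂ.trans (anti x) (solve 1 (λ y → ⊖ y ⊜ con (ℤ.- + 1) ⊗ y) ℂ.refl
          (f x))) ⟩
      ∑ (λ x → emb (ℤ.- + 1) * f x)  ≈⟨ ∑-*ˡ _ f ⟩
      emb (ℤ.- + 1) * ∑ f       ≈⟨ solve 1 (λ y → con (ℤ.- + 1) ⊗ y ⊜ ⊖ y) ℂ.refl (∑ f) ⟩
      - ∑ f                     ∎)

  -- The Fourier transform on a self-dual finite abelian group

  module Fourier (G : AbelianGroup a ℓ₁) {n} (I : HasSize (AbelianGroup.setoid G) n)
      (χ : AbelianGroup.Carrier G → AbelianGroup.Carrier G → 𝔾)
      (χ-congˡ : ∀ {g g′} h → AbelianGroup._≈_ G g g′ → χ g h ≈ χ g′ h)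
      (χ-sym : ∀ g h → χ g h ≈ χ h g)
      (χ-∙ : ∀ g g′ h → χ (AbelianGroup._∙_ G g g′) h ≈ χ g h * χ g′ h)
      (χ-ε : ∀ h → χ (AbelianGroup.ε G) h ≈ 1#)
      (χ-separates : ∀ h k → ¬ AbelianGroup._≈_ G h k →
        ∃ λ g → χ g h * χ (AbelianGroup._⁻¹ G g) k ≈ - 1#) where
    private
      module G = AbelianGroup G
    open AbelianGroup G using (_∙_; ε; _⁻¹) renaming (Carrier to M; _≈_ to _∼_; _-_ to _⊝_)
    open AbelianGroupProperties G using (⁻¹-∙-comm; ⁻¹-involutive; ε⁻¹≈ε)
    open Summation I public
    open ℂ-Reasoning

    χ-congʳ : ∀ g {h h′} → h ∼ h′ → χ g h ≈ χ g h′
    χ-congʳ g {h} {h′} eq = ℂ.trans (χ-sym g h) (ℂ.trans (χ-congˡ g eq) (χ-sym h′ g))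

    χ-∙ʳ : ∀ g h h′ → χ g (h ∙ h′) ≈ χ g h * χ g h′
    χ-∙ʳ g h h′ = ℂ.trans (χ-sym g (h ∙ h′)) (ℂ.trans (χ-∙ h h′ g) (ℂ.*-cong (χ-sym h g) (χ-sym h′ g)))

    ∙-⊝ : ∀ x c → (x ∙ c) ⊝ c ∼ x
    ∙-⊝ x c = G.trans (G.assoc x c (c ⁻¹)) (G.trans (G.∙-congˡ (G.inverseʳ c)) (G.identityʳ x))

    ⊝-∙ : ∀ x c → (x ⊝ c) ∙ c ∼ x
    ⊝-∙ x c = G.trans (G.assoc x (c ⁻¹) c) (G.trans (G.∙-congˡ (G.inverseˡ c)) (G.identityʳ x))

    ∑-translate : ∀ f c → Respectful f → ∑ (λ x → f (x ∙ c)) ≈ ∑ f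
    ∑-translate f c f-resp =
      ∑-reindex f (_∙ c) (_⊝ c) f-resp G.∙-congʳ G.∙-congʳ (λ x → ⊝-∙ x c) (λ x → ∙-⊝ x c)

    -- For `h` different from `k`, translation by the separating element negates each term. Asking
    -- that element for the value -1, and not merely for a value other than 1, makes
    -- `∑-antisymmetric` applicable and avoids a division.
    χ-orthogonality : ∀ h k → ∑ (λ w → χ w h * χ (w ⁻¹) k) ≈ ⟦ h ≟ k ⟧ * emb (+ n)
    χ-orthogonality h k with h ≟ k
    ... | yes h∼k = begin
      ∑ (λ w → χ w h * χ (w ⁻¹) k)    ≈⟨ ∑-cong (λ w → begin
        χ w h * χ (w ⁻¹) k              ≈⟨ ℂ.*-congˡ (χ-congʳ (w ⁻¹) h∼k) ⟨
        χ w h * χ (w ⁻¹) h              ≈⟨ χ-∙ w (w ⁻¹) h ⟨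
        χ (w ∙ w ⁻¹) h                  ≈⟨ χ-congˡ h (G.inverseʳ w) ⟩
        χ ε h                           ≈⟨ χ-ε h ⟩
        1#                              ∎) ⟩
      ∑ (λ _ → 1#)                    ≈⟨ ∑-1 ⟩
      emb (+ n)                       ≈⟨ ℂ.*-identityˡ _ ⟨
      1# * emb (+ n)                  ∎
    ... | no h≁k = ℂ.trans
      (∑-antisymmetric _ (_∙ g) (_⊝ g) (λ eq → ℂ.*-cong (χ-congˡ h eq) (χ-congˡ k (G.⁻¹-cong eq)))
        G.∙-congʳ G.∙-congʳ (λ x → ⊝-∙ x g) (λ x → ∙-⊝ x g) (λ w → begin
          χ (w ∙ g) h * χ ((w ∙ g) ⁻¹) k              ≈⟨ ℂ.*-cong (χ-∙ w g h)
            (ℂ.trans (χ-congˡ k (G.sym (⁻¹-∙-comm w g))) (χ-∙ (w ⁻¹) (g ⁻¹) k)) ⟩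
          (χ w h * χ g h) * (χ (w ⁻¹) k * χ (g ⁻¹) k) ≈⟨ solve 4 (λ x y z t →
            (x ⊗ y) ⊗ (z ⊗ t) ⊜ (x ⊗ z) ⊗ (y ⊗ t)) ℂ.refl (χ w h) (χ g h) (χ (w ⁻¹) k) (χ (g ⁻¹) k) ⟩
          (χ w h * χ (w ⁻¹) k) * (χ g h * χ (g ⁻¹) k) ≈⟨ ℂ.*-congˡ g-anti ⟩
          (χ w h * χ (w ⁻¹) k) * - 1#                 ≈⟨ solve 1 (λ x → x ⊗ ⊖ con (+ 1) ⊜ ⊖ x) ℂ.refl _ ⟩
          - (χ w h * χ (w ⁻¹) k)                      ∎))
      (ℂ.sym (ℂ.zeroˡ _))
      where
      g = proj₁ (χ-separates h k h≁k)
      g-anti = proj₂ (χ-separates h k h≁k)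

    χ-sum : ∀ g → ∑ (λ h → χ g h) ≈ ⟦ g ≟ ε ⟧ * emb (+ n)
    χ-sum g = ℂ.trans
      (∑-cong λ w → begin
        χ g w                  ≈⟨ χ-sym g w ⟩
        χ w g                  ≈⟨ ℂ.*-identityʳ _ ⟨
        χ w g * 1#             ≈⟨ ℂ.*-congˡ (ℂ.trans (χ-sym (w ⁻¹) ε) (χ-ε (w ⁻¹))) ⟨
        χ w g * χ (w ⁻¹) ε     ∎)
      (χ-orthogonality g ε)

    hat : (M → 𝔾) → M → 𝔾
    hat φ g = ∑ (λ h → φ h * χ g h)

    hat-cong : ∀ {φ ψ} → (∀ h → φ h ≈ ψ h) → ∀ g → hat φ g ≈ hat ψ g
    hat-cong eq g = ∑-cong (λ h → ℂ.*-congʳ (eq h))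

    hat-+ : ∀ φ ψ g → hat (λ h → φ h + ψ h) g ≈ hat φ g + hat ψ g
    hat-+ φ ψ g = ℂ.trans (∑-cong (λ h → ℂ.distribʳ _ _ _)) (∑-+ _ _)

    hat-* : ∀ c φ g → hat (λ h → c * φ h) g ≈ c * hat φ g
    hat-* c φ g = ℂ.trans (∑-cong (λ h → ℂ.*-assoc _ _ _)) (∑-*ˡ c _)

    -- Intersection numbers are convolutions of class indicators. Through this identity, closure of
    -- the transforms under convolution becomes closure of the functions on the dual under pointwise
    -- products.
    hat-convolution : ∀ φ ψ → Respectful φ → Respectful ψ → ∀ z →
      ∑ (λ w → hat φ w * hat ψ (z ⊝ w)) ≈ emb (+ n) * hat (λ h → φ h * ψ h) z
    hat-convolution φ ψ φ-resp ψ-resp z = begin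
      ∑ (λ w → hat φ w * hat ψ (z ⊝ w))
        ≈⟨ ∑-cong (λ w → ℂ.sym (∑-*ʳ _ _)) ⟩
      ∑ (λ w → ∑ (λ h → (φ h * χ w h) * hat ψ (z ⊝ w)))
        ≈⟨ ∑-cong (λ w → ∑-cong (λ h → ℂ.sym (∑-*ˡ (φ h * χ w h) _))) ⟩
      ∑ (λ w → ∑ (λ h → ∑ (λ k → (φ h * χ w h) * (ψ k * χ (z ⊝ w) k))))
        ≈⟨ ∑-swap _ ⟩
      ∑ (λ h → ∑ (λ w → ∑ (λ k → (φ h * χ w h) * (ψ k * χ (z ⊝ w) k))))
        ≈⟨ ∑-cong (λ h → ∑-swap _) ⟩
      ∑ (λ h → ∑ (λ k → ∑ (λ w → (φ h * χ w h) * (ψ k * χ (z ⊝ w) k))))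
        ≈⟨ ∑-cong (λ h → ∑-cong (λ k → ∑-cong (λ w → begin
           (φ h * χ w h) * (ψ k * χ (z ⊝ w) k)              ≈⟨ ℂ.*-congˡ (ℂ.*-congˡ (χ-∙ z (w ⁻¹) k)) ⟩
           (φ h * χ w h) * (ψ k * (χ z k * χ (w ⁻¹) k))     ≈⟨ solve 5 (λ a b c d e →
             (a ⊗ b) ⊗ (c ⊗ (d ⊗ e)) ⊜ (a ⊗ (c ⊗ d)) ⊗ (b ⊗ e)) ℂ.refl
             (φ h) (χ w h) (ψ k) (χ z k) (χ (w ⁻¹) k) ⟩
           (φ h * (ψ k * χ z k)) * (χ w h * χ (w ⁻¹) k)     ∎))) ⟩
      ∑ (λ h → ∑ (λ k → ∑ (λ w → (φ h * (ψ k * χ z k)) * (χ w h * χ (w ⁻¹) k))))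
        ≈⟨ ∑-cong (λ h → ∑-cong (λ k → ℂ.trans (∑-*ˡ _ _) (ℂ.*-congˡ (χ-orthogonality h k)))) ⟩
      ∑ (λ h → ∑ (λ k → (φ h * (ψ k * χ z k)) * (⟦ h ≟ k ⟧ * emb (+ n))))
        ≈⟨ ∑-cong (λ h → ∑-cong (λ k → begin
           (φ h * (ψ k * χ z k)) * (⟦ h ≟ k ⟧ * emb (+ n))  ≈⟨ ℂ.*-congˡ
               (ℂ.*-congʳ (⟦⟧-cong (h ≟ k) (k ≟ h) (mk⇔ G.sym G.sym))) ⟩
           (φ h * (ψ k * χ z k)) * (⟦ k ≟ h ⟧ * emb (+ n))  ≈⟨ solve 5 (λ a b c d e →
             (a ⊗ (b ⊗ c)) ⊗ (d ⊗ e) ⊜ d ⊗ (e ⊗ (a ⊗ b ⊗ c))) ℂ.refl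
             (φ h) (ψ k) (χ z k) ⟦ k ≟ h ⟧ (emb (+ n)) ⟩
           ⟦ k ≟ h ⟧ * (emb (+ n) * (φ h * ψ k * χ z k))    ∎)) ⟩
      ∑ (λ h → ∑ (λ k → ⟦ k ≟ h ⟧ * (emb (+ n) * (φ h * ψ k * χ z k))))
        ≈⟨ ∑-cong (λ h → ∑-δ (λ k → emb (+ n) * (φ h * ψ k * χ z k)) h
             (λ eq → ℂ.*-congˡ (ℂ.*-cong (ℂ.*-congˡ (ψ-resp eq)) (χ-congʳ z eq)))) ⟩
      ∑ (λ h → emb (+ n) * (φ h * ψ h * χ z h))
        ≈⟨ ∑-*ˡ _ _ ⟩
      emb (+ n) * hat (λ h → φ h * ψ h) z ∎

    hat-δ : ∀ c g → hat (λ h → ⟦ h ≟ c ⟧) g ≈ χ g c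
    hat-δ c g = ∑-δ (χ g) c (χ-congʳ g)

    hat-sum : (φ : Fin N → M → 𝔾) → ∀ g → hat (λ h → sum (λ k → φ k h)) g ≈ sum (λ k → hat (φ k) g)
    hat-sum φ g = ℂ.trans (∑-cong (λ h → *-distribʳ-sum (χ g h) (λ k → φ k h)))
        (ℂ.sym (∑-sum-swap (λ k h → φ k h * χ g h)))

    hat-translate : ∀ φ d → Respectful φ → ∀ g → hat (λ h → φ (h ⊝ d)) g ≈ χ g d * hat φ g
    hat-translate φ d φ-resp g = begin
      ∑ (λ h → φ (h ⊝ d) * χ g h)               ≈⟨ ∑-translate _ d (λ eq → ℂ.*-cong (φ-resp (G.∙-congʳ eq))
          (χ-congʳ g eq)) ⟨
      ∑ (λ h → φ ((h ∙ d) ⊝ d) * χ g (h ∙ d))   ≈⟨ ∑-cong (λ h → begin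
        φ ((h ∙ d) ⊝ d) * χ g (h ∙ d)             ≈⟨ ℂ.*-cong (φ-resp (∙-⊝ h d)) (χ-∙ʳ g h d) ⟩
        φ h * (χ g h * χ g d)                     ≈⟨ solve 3 (λ a b c → a ⊗ (b ⊗ c) ⊜ c ⊗ (a ⊗ b)) ℂ.refl (φ h)
            (χ g h) (χ g d) ⟩
        χ g d * (φ h * χ g h)                     ∎) ⟩
      ∑ (λ h → χ g d * (φ h * χ g h))           ≈⟨ ∑-*ˡ _ _ ⟩
      χ g d * hat φ g                           ∎

-- Arithmetic of the Galois ring and of its residue field

module GaloisField {c ℓ : Level} (m : ℕ) (3≤m : 3 ℕ.≤ m) (m-odd : ¬ (2 ∣ m))
    (R : CommutativeRing c ℓ) (isGR4 : IsGR4 R m)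
    (β : CommutativeRing.Carrier R) (β-order : HasOrder R β (2 ℕ.^ m ℕ.∸ 1)) where

  open GaloisRing R isGR4 β β-order public using
    (length; τ; 2#; decompose; decompose-unique; frobenius; trace; ι)
  open CommutativeRing R public
    using (Carrier; _≈_; _+_; _*_; -_; _-_; 0#; 1#; setoid; semiring; +-cong; +-congˡ; +-congʳ; *-cong; *-congˡ;
        *-congʳ)
  module R = CommutativeRing R
  open RawSemiringDefs (Semiring.rawSemiring semiring) using (_^_; sum) renaming (_×_ to _·_)
  open IsGR4 isGR4
  open Exp semiring using (^-homo-*; ^-congʳ; ^-congˡ; ^-assocʳ)
  open Mult semiring using (×-homo-+; ×1-homo-*)
  open SemiringSum semiring using (sum-cong-≋; ∑-distrib-+)
  open GroupProperties R.+-group using (∙-cancelˡ; ∙-cancelʳ; inverseˡ-unique)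
  open SetoidReasoning setoid

  -- The prime subring

  k·1≈0 : ∀ {k} → 4 ∣ k → k · 1# ≈ 0#
  k·1≈0 {k} = Equivalence.from (characteristic k)

  4∣ : ∀ {k} → k · 1# ≈ 0# → 4 ∣ k
  4∣ {k} = Equivalence.to (characteristic k)

  ι-mod : ∀ k → ι (k mod 4) ≈ k · 1#
  ι-mod k = begin
    toℕ (k mod 4) · 1#                        ≡⟨ ≡.cong (_· 1#) (Fin.toℕ-fromℕ< (m%n<n k 4)) ⟩
    (k % 4) · 1#                              ≈⟨ R.+-identityʳ _ ⟨
    (k % 4) · 1# + 0#                         ≈⟨ +-congˡ (k·1≈0 (n∣m*n (k / 4))) ⟨
    (k % 4) · 1# + (k / 4 ℕ.* 4) · 1#         ≈⟨ ×-homo-+ 1# (k % 4) _ ⟨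
    (k % 4 ℕ.+ k / 4 ℕ.* 4) · 1#              ≡⟨ ≡.cong (_· 1#) (m≡m%n+[m/n]*n k 4) ⟨
    k · 1#                                    ∎

  ι-+ : ∀ i j → ι (i +₄ j) ≈ ι i + ι j
  ι-+ i j = R.trans (ι-mod (toℕ i ℕ.+ toℕ j)) (×-homo-+ 1# (toℕ i) (toℕ j))

  ι-neg : ∀ i → ι (-₄ i) ≈ - ι i
  ι-neg i = inverseˡ-unique (ι (-₄ i)) (ι i)
    (R.trans (R.sym (ι-+ (-₄ i) i)) (R.reflexive (≡.cong ι (-₄i+i≡0 i))))
    where
    -₄i+i≡0 : ∀ i → (-₄ i) +₄ i ≡ 0F
    -₄i+i≡0 = from-yes (Fin.all? λ i → ((-₄ i) +₄ i) Fin.≟ 0F)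

  infixl 7 _*₄_
  _*₄_ : Fin 4 → Fin 4 → Fin 4
  i *₄ j = (toℕ i ℕ.* toℕ j) mod 4

  ι-* : ∀ i j → ι (i *₄ j) ≈ ι i * ι j
  ι-* i j = R.trans (ι-mod (toℕ i ℕ.* toℕ j)) (×1-homo-* (toℕ i) (toℕ j))

  -- Evaluates 0F, 1F and 2F to the constants 0#, 1# and 2#.
  coe₄ : Fin 4 → Carrier
  coe₄ 0F = 0#
  coe₄ 1F = 1#
  coe₄ 2F = 2#
  coe₄ 3F = ι 3F

  coe₄≈ι : ∀ i → coe₄ i ≈ ι i
  coe₄≈ι 0F = R.refl
  coe₄≈ι 1F = R.sym (R.+-identityʳ 1#)
  coe₄≈ι 2F = +-congˡ (R.sym (R.+-identityʳ 1#))
  coe₄≈ι 3F = R.refl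

  private
    coe₄-≟ : ∀ i j → Maybe (coe₄ i ≈ coe₄ j)
    coe₄-≟ i j with i Fin.≟ j
    ... | yes refl = just R.refl
    ... | no _     = nothing

  private
    rawRing₄ : RawRing 0ℓ 0ℓ
    rawRing₄ = record
      { Carrier = Fin 4 ; _≈_ = _≡_ ; _+_ = _+₄_ ; _*_ = _*₄_ ; -_ = -₄_ ; 0# = 0F ; 1# = 1F }

    coe₄-+ : ∀ i j → coe₄ (i +₄ j) ≈ coe₄ i + coe₄ j
    coe₄-+ i j = R.trans (coe₄≈ι (i +₄ j)) (R.trans (ι-+ i j) (R.sym (+-cong (coe₄≈ι i) (coe₄≈ι j))))

    coe₄-* : ∀ i j → coe₄ (i *₄ j) ≈ coe₄ i * coe₄ j
    coe₄-* i j = R.trans (coe₄≈ι (i *₄ j)) (R.trans (ι-* i j) (R.sym (*-cong (coe₄≈ι i) (coe₄≈ι j))))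

    coe₄-neg : ∀ i → coe₄ (-₄ i) ≈ - coe₄ i
    coe₄-neg i = R.trans (coe₄≈ι (-₄ i)) (R.trans (ι-neg i) (R.sym (R.-‿cong (coe₄≈ι i))))

    coe₄-morphism : rawRing₄ -Raw-AlmostCommutative⟶ fromCommutativeRing R
    coe₄-morphism = record
      { ⟦_⟧    = coe₄
      ; +-homo = coe₄-+
      ; *-homo = coe₄-*
      ; -‿homo = coe₄-neg
      ; 0-homo = R.refl
      ; 1-homo = R.refl
      }

  -- The solver knows that 4 = 0.
  module R-Solver = RingSolver rawRing₄ (fromCommutativeRing R) coe₄-morphism coe₄-≟

  open R-Solver public using () renaming (solve to solve₄; con to con₄;
    _:+_ to _:+₄_; _:*_ to _:*₄_; :-_ to :-₄_; _:-_ to _:-₄_; _:=_ to _:=₄_)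

  ι-injective : ∀ {i j} → ι i ≈ ι j → i ≡ j
  ι-injective {i} {j} eq = diff i j (4∣diff (i +₄ (-₄ j)) (begin
    ι (i +₄ (-₄ j))     ≈⟨ ι-+ i (-₄ j) ⟩
    ι i + ι (-₄ j)      ≈⟨ +-cong eq (ι-neg j) ⟩
    ι j + - ι j         ≈⟨ R.-‿inverseʳ (ι j) ⟩
    0#                  ∎))
    where
    4∣diff : ∀ k → ι k ≈ 0# → k ≡ 0F
    4∣diff 0F _  = refl
    4∣diff 1F eq = contradiction (4∣ {1} eq) (from-no (4 ∣? 1))
    4∣diff 2F eq = contradiction (4∣ {2} eq) (from-no (4 ∣? 2))
    4∣diff 3F eq = contradiction (4∣ {3} eq) (from-no (4 ∣? 3))
    diff : ∀ i j → i +₄ (-₄ j) ≡ 0F → i ≡ j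
    diff = from-yes (Fin.all? λ i → Fin.all? λ j → ((i +₄ (-₄ j)) Fin.≟ 0F) →-dec (i Fin.≟ j))

  -- The residue field

  infix 4 _≋_
  -- In a Galois ring of characteristic 4, 2z = 0 exactly when z lies in 2R, so this is congruence
  -- modulo 2. The residue field keeps the carrier of `R`, and `double` turns a congruence into an
  -- equation in `R` wherever the terms carry a factor 2.
  record _≋_ (x y : Carrier) : Set ℓ where
    constructor halve
    field double : 2# * x ≈ 2# * y
  open _≋_ public

  ≈⇒≋ : ∀ {x y} → x ≈ y → x ≋ y
  ≈⇒≋ eq = halve (*-congˡ eq)

  ≋-* : ∀ {x x′ y y′} → x ≋ x′ → y ≋ y′ → x * y ≋ x′ * y′
  ≋-* {x} {x′} {y} {y′} (halve eq) (halve eq′) = halve (begin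
    2# * (x * y)     ≈⟨ R.*-assoc 2# x y ⟨
    2# * x * y       ≈⟨ *-congʳ eq ⟩
    2# * x′ * y      ≈⟨ solve₄ 3 (λ t x y → t :*₄ x :*₄ y :=₄ x :*₄ (t :*₄ y)) R.refl 2# x′ y ⟩
    x′ * (2# * y)    ≈⟨ *-congˡ eq′ ⟩
    x′ * (2# * y′)   ≈⟨ solve₄ 3 (λ t x y → x :*₄ (t :*₄ y) :=₄ t :*₄ (x :*₄ y)) R.refl 2# x′ y′ ⟩
    2# * (x′ * y′)   ∎)

  R₂ : CommutativeRing c ℓ
  R₂ = record
    { Carrier = Carrier ; _≈_ = _≋_ ; _+_ = _+_ ; _*_ = _*_ ; -_ = -_ ; 0# = 0# ; 1# = 1#
    ; isCommutativeRing = record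
      { isRing = record
        { +-isAbelianGroup = record
          { isGroup = record
            { isMonoid = record
              { isSemigroup = record
                { isMagma = record
                  { isEquivalence = record
                    { refl  = halve R.refl
                    ; sym   = λ (halve eq) → halve (R.sym eq)
                    ; trans = λ (halve eq) (halve eq′) → halve (R.trans eq eq′)
                    }
                  ; ∙-cong = λ (halve eq) (halve eq′) → halve (R.trans (R.distribˡ 2# _ _)
                      (R.trans (+-cong eq eq′) (R.sym (R.distribˡ 2# _ _))))
                  }
                ; assoc = λ x y z → ≈⇒≋ (R.+-assoc x y z)
                }
              ; identity = (λ x → ≈⇒≋ (R.+-identityˡ x)) , (λ x → ≈⇒≋ (R.+-identityʳ x))
              }
            ; inverse = (λ x → ≈⇒≋ (R.-‿inverseˡ x)) , (λ x → ≈⇒≋ (R.-‿inverseʳ x))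
            ; ⁻¹-cong = λ {x} {y} (halve eq) → halve (R.trans
                (solve₄ 1 (λ x → con₄ 2F :*₄ :-₄ x :=₄ :-₄ (con₄ 2F :*₄ x)) R.refl x)
                (R.trans (R.-‿cong eq) (solve₄ 1 (λ x → :-₄ (con₄ 2F :*₄ x) :=₄ con₄ 2F :*₄ :-₄ x) R.refl y)))
            }
          ; comm = λ x y → ≈⇒≋ (R.+-comm x y)
          }
        ; *-cong = ≋-*
        ; *-assoc = λ x y z → ≈⇒≋ (R.*-assoc x y z)
        ; *-identity = (λ x → ≈⇒≋ (R.*-identityˡ x)) , (λ x → ≈⇒≋ (R.*-identityʳ x))
        ; distrib = (λ x y z → ≈⇒≋ (R.distribˡ x y z)) , (λ x y z → ≈⇒≋ (R.distribʳ x y z))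
        }
      ; *-comm = λ x y → ≈⇒≋ (R.*-comm x y)
      }
    }

  module R₂ = CommutativeRing R₂
  module ≋-Reasoning = SetoidReasoning R₂.setoid

  coe₂ : Bool → Carrier
  coe₂ false = 0#
  coe₂ true  = 1#

  private
    coe₂-≟ : ∀ i j → Maybe (coe₂ i ≋ coe₂ j)
    coe₂-≟ false false = just R₂.refl
    coe₂-≟ true  true  = just R₂.refl
    coe₂-≟ _     _     = nothing

  private
    rawRing₂ : RawRing 0ℓ 0ℓ
    rawRing₂ = record
      { Carrier = Bool ; _≈_ = _≡_ ; _+_ = _xor_ ; _*_ = _∧_ ; -_ = id ; 0# = false ; 1# = true }

    coe₂-+ : ∀ i j → coe₂ (i xor j) ≋ coe₂ i + coe₂ j
    coe₂-+ false j     = R₂.sym (R₂.+-identityˡ (coe₂ j))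
    coe₂-+ true  false = R₂.sym (R₂.+-identityʳ 1#)
    coe₂-+ true  true  = halve (solve₄ 0 (con₄ 2F :*₄ con₄ 0F :=₄ con₄ 2F :*₄ (con₄ 1F :+₄ con₄ 1F)) R.refl)

    coe₂-* : ∀ i j → coe₂ (i ∧ j) ≋ coe₂ i * coe₂ j
    coe₂-* false j = R₂.sym (R₂.zeroˡ (coe₂ j))
    coe₂-* true  j = R₂.sym (R₂.*-identityˡ (coe₂ j))

    coe₂-neg : ∀ i → coe₂ i ≋ - coe₂ i
    coe₂-neg false = halve (solve₄ 0 (con₄ 2F :*₄ con₄ 0F :=₄ con₄ 2F :*₄ :-₄ con₄ 0F) R.refl)
    coe₂-neg true  = halve (solve₄ 0 (con₄ 2F :*₄ con₄ 1F :=₄ con₄ 2F :*₄ :-₄ con₄ 1F) R.refl)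

    coe₂-morphism : rawRing₂ -Raw-AlmostCommutative⟶ fromCommutativeRing R₂
    coe₂-morphism = record
      { ⟦_⟧    = coe₂
      ; +-homo = coe₂-+
      ; *-homo = coe₂-*
      ; -‿homo = coe₂-neg
      ; 0-homo = R₂.refl
      ; 1-homo = R₂.refl
      }

  -- The solver knows that 2 = 0.
  module R₂-Solver = RingSolver rawRing₂ (fromCommutativeRing R₂) coe₂-morphism coe₂-≟

  open R₂-Solver public using (_:+_; _:*_; :-_; _:-_; _:=_) renaming (solve to solve₂; Polynomial to Polynomial₂)

  :0 :1 : ∀ {n : ℕ} → Polynomial₂ n
  :0 = R₂-Solver.con false
  :1 = R₂-Solver.con true

  2≉0 : ¬ 2# ≈ 0#
  2≉0 eq = contradiction (4∣ {2} (R.trans (R.sym (coe₄≈ι 2F)) eq)) (from-no (4 ∣? 2))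

  1≋̸0 : ¬ 1# ≋ 0#
  1≋̸0 (halve eq) = 2≉0 (R.trans (R.sym (R.*-identityʳ 2#)) (R.trans eq (R.zeroʳ 2#)))

  ≋-+2 : ∀ x w → x + 2# * w ≋ x
  ≋-+2 x w = halve (solve₄ 2 (λ x w → con₄ 2F :*₄ (x :+₄ con₄ 2F :*₄ w) :=₄ con₄ 2F :*₄ x) R.refl x w)

  τ-injective : ∀ {i j} → τ i ≋ τ j → i ≡ j
  τ-injective {i} {j} (halve eq) = proj₂ (decompose-unique 0F i 0F j (+-congˡ eq))

  -- Teichmüller representatives

  d₀ : Carrier → Fin length
  d₀ x = proj₁ (decompose x)

  ω : Carrier → Carrier
  ω x = τ (d₀ x)

  ω-≋ : ∀ x → ω x ≋ x
  ω-≋ x = let i , j , eq = decompose x in R₂.sym (R₂.trans (≈⇒≋ eq) (≋-+2 (τ i) (τ j)))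

  d₀-cong : ∀ {x y} → x ≋ y → d₀ x ≡ d₀ y
  d₀-cong {x} {y} eq = τ-injective (R₂.trans (ω-≋ x) (R₂.trans eq (R₂.sym (ω-≋ y))))

  d₀-τ : ∀ i → d₀ (τ i) ≡ i
  d₀-τ i = τ-injective (ω-≋ (τ i))

  ω-cong : ∀ {x y} → x ≋ y → ω x ≈ ω y
  ω-cong eq = R.reflexive (≡.cong τ (d₀-cong eq))

  ω-split : ∀ x → ∃ λ w → x ≈ ω x + 2# * w
  ω-split x = let i , j , eq = decompose x in τ j , eq

  residue-size : HasSize R₂.setoid length
  residue-size = record
    { to = d₀ ; from = τ ; to-cong = d₀-cong ; from-cong = λ { refl → R₂.refl }
    ; inverse = (λ { {i} eq → ≡.trans (d₀-cong eq) (d₀-τ i) }) , (λ { {x} refl → ω-≋ x }) }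

  private
    n : ℕ
    n = 2 ℕ.^ m ℕ.∸ 1

  q≡1+n : 2 ℕ.^ m ≡ suc n
  q≡1+n = ≡.sym (ℕ.m+[n∸m]≡n (ℕ.m^n>0 2 m))

  0<n : 0 ℕ.< n
  0<n = ℕ.m<n⇒0<n∸m (ℕ.≤-trans (ℕ.s≤s (ℕ.s≤s ℕ.z≤n)) (ℕ.^-monoʳ-≤ 2 {1} {m} (ℕ.≤-trans (ℕ.s≤s ℕ.z≤n) 3≤m)))

  instance
    n-nonZero : ℕ.NonZero n
    n-nonZero = ℕ.>-nonZero 0<n

  βⁿ≈1 : β ^ n ≈ 1#
  βⁿ≈1 = proj₁ β-order

  1^k≈1 : ∀ k → 1# ^ k ≈ 1#
  1^k≈1 zero    = R.refl
  1^k≈1 (suc k) = R.trans (R.*-identityˡ _) (1^k≈1 k)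

  β^≈τ : ∀ k → ∃ λ i → β ^ k ≈ τ i
  β^≈τ k = Fin.suc (Fin.fromℕ< (m%n<n k n)) , (begin
    β ^ k                                  ≈⟨ ^-congʳ β (m≡m%n+[m/n]*n k n) ⟩
    β ^ (k % n ℕ.+ k / n ℕ.* n)            ≈⟨ ^-homo-* β (k % n) _ ⟩
    β ^ (k % n) * β ^ (k / n ℕ.* n)        ≈⟨ *-congˡ (^-congʳ β (ℕ.*-comm (k / n) n)) ⟩
    β ^ (k % n) * β ^ (n ℕ.* (k / n))      ≈⟨ *-congˡ (^-assocʳ β n (k / n)) ⟨
    β ^ (k % n) * (β ^ n) ^ (k / n)        ≈⟨ *-congˡ (R.trans (^-congˡ (k / n) βⁿ≈1) (1^k≈1 (k / n))) ⟩
    β ^ (k % n) * 1#                       ≈⟨ R.*-identityʳ _ ⟩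
    β ^ (k % n)                            ≡⟨ ≡.cong (β ^_) (Fin.toℕ-fromℕ< (m%n<n k n)) ⟨
    τ (Fin.suc (Fin.fromℕ< (m%n<n k n)))   ∎)

  Teichmüller : Carrier → Set ℓ
  Teichmüller x = ∃ λ i → x ≈ τ i

  T-ω : ∀ x → Teichmüller (ω x)
  T-ω x = d₀ x , R.refl

  T-0 : Teichmüller 0#
  T-0 = 0F , R.refl

  T-1 : Teichmüller 1#
  T-1 = β^≈τ 0

  T-* : ∀ {x y} → Teichmüller x → Teichmüller y → Teichmüller (x * y)
  T-* (0F , x≈0) (j , y≈) = 0F , R.trans (*-congʳ x≈0) (R.zeroˡ _)
  T-* (Fin.suc i , x≈) (0F , y≈0) = 0F , R.trans (*-congˡ y≈0) (R.zeroʳ _)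
  T-* (Fin.suc k , x≈) (Fin.suc l , y≈) = let i , eq = β^≈τ (toℕ k ℕ.+ toℕ l) in
    i , R.trans (*-cong x≈ y≈) (R.trans (R.sym (^-homo-* β (toℕ k) (toℕ l))) eq)

  T-unique : ∀ {x y} → Teichmüller x → Teichmüller y → x ≋ y → x ≈ y
  T-unique (i , x≈) (j , y≈) eq =
    R.trans x≈ (R.trans (R.reflexive (≡.cong τ (τ-injective {i} {j}
      (R₂.trans (≈⇒≋ (R.sym x≈)) (R₂.trans eq (≈⇒≋ y≈)))))) (R.sym y≈))

  ω-T : ∀ {x} → Teichmüller x → ω x ≈ x
  ω-T {x} t = T-unique (T-ω x) t (ω-≋ x)

  T-power : ∀ {x} → Teichmüller x → x ^ (2 ℕ.^ m) ≈ x
  T-power {x} (0F , x≈0) = begin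
    x ^ (2 ℕ.^ m)     ≡⟨ ≡.cong (x ^_) q≡1+n ⟩
    x * x ^ n         ≈⟨ *-congʳ x≈0 ⟩
    0# * x ^ n        ≈⟨ R.zeroˡ _ ⟩
    0#                ≈⟨ x≈0 ⟨
    x                 ∎
  T-power {x} (Fin.suc k , x≈) = begin
    x ^ (2 ℕ.^ m)                   ≡⟨ ≡.cong (x ^_) q≡1+n ⟩
    x * x ^ n                       ≈⟨ *-congˡ (^-congˡ n x≈) ⟩
    x * (β ^ toℕ k) ^ n             ≈⟨ *-congˡ (^-assocʳ β (toℕ k) n) ⟩
    x * β ^ (toℕ k ℕ.* n)           ≈⟨ *-congˡ (^-congʳ β (ℕ.*-comm (toℕ k) n)) ⟩
    x * β ^ (n ℕ.* toℕ k)           ≈⟨ *-congˡ (^-assocʳ β n (toℕ k)) ⟨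
    x * (β ^ n) ^ toℕ k             ≈⟨ *-congˡ (R.trans (^-congˡ (toℕ k) βⁿ≈1) (1^k≈1 (toℕ k))) ⟩
    x * 1#                          ≈⟨ R.*-identityʳ x ⟩
    x                               ∎

  -- Inverses are read off from β^n = 1. The default 0 at the index of 0 gives `inv-0`, by which the
  -- map in `irreducible-exists` sends 0 to 0.
  inverseAt : Fin length → Carrier
  inverseAt 0F          = 0#
  inverseAt (Fin.suc k) = β ^ (n ℕ.∸ toℕ k)

  inv : Carrier → Carrier
  inv x = inverseAt (d₀ x)

  inv-0 : inv 0# ≡ 0#
  inv-0 = ≡.cong inverseAt (d₀-τ 0F)

  inv-inverse : ∀ {x} → ¬ x ≋ 0# → x * inv x ≋ 1#
  inv-inverse {x} x≢0 = go (d₀ x) (ω-≋ x)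
    where
    go : ∀ i → τ i ≋ x → x * inverseAt i ≋ 1#
    go 0F          eq = contradiction (R₂.sym eq) x≢0
    go (Fin.suc k) eq = R₂.trans (R₂.*-congʳ (R₂.sym eq)) (≈⇒≋ (begin
      β ^ toℕ k * β ^ (n ℕ.∸ toℕ k)      ≈⟨ ^-homo-* β (toℕ k) (n ℕ.∸ toℕ k) ⟨
      β ^ (toℕ k ℕ.+ (n ℕ.∸ toℕ k))      ≡⟨ ≡.cong (β ^_) (ℕ.m+[n∸m]≡n (ℕ.<⇒≤ (Fin.toℕ<n k))) ⟩
      β ^ n                              ≈⟨ βⁿ≈1 ⟩
      1#                                 ∎))

  infix 4 _≋?_
  _≋?_ : ∀ x y → Dec (x ≋ y)
  _≋?_ = HasSize-≟ residue-size

  ≋-cancelˡ : ∀ {x y z} → ¬ x ≋ 0# → x * y ≋ x * z → y ≋ z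
  ≋-cancelˡ {x} {y} {z} x≢0 eq = R₂.trans (lemma y) (R₂.trans (R₂.*-congˡ eq) (R₂.sym (lemma z)))
    where
    lemma : ∀ y → y ≋ inv x * (x * y)
    lemma y = R₂.trans (R₂.sym (R₂.*-identityˡ y)) (R₂.trans (R₂.*-congʳ (R₂.sym (inv-inverse x≢0)))
      (solve₂ 3 (λ x i y → x :* i :* y := i :* (x :* y)) R₂.refl x (inv x) y))

  ≋-domain : ∀ {x y} → x * y ≋ 0# → x ≋ 0# ⊎ y ≋ 0#
  ≋-domain {x} {y} eq with x ≋? 0#
  ... | yes x≋0 = inj₁ x≋0
  ... | no x≢0  = inj₂ (≋-cancelˡ x≢0 (R₂.trans eq (R₂.sym (R₂.zeroʳ x))))

  ≋-+≋0 : ∀ {x y} → x + y ≋ 0# → x ≋ y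
  ≋-+≋0 {x} {y} eq = R₂.trans
    (solve₂ 2 (λ x y → x := (x :+ y) :+ y) R₂.refl x y)
    (R₂.trans (R₂.+-congʳ eq) (R₂.+-identityˡ y))

  ≋⇒+≋0 : ∀ {x y} → x ≋ y → x + y ≋ 0#
  ≋⇒+≋0 {x} {y} eq = R₂.trans (R₂.+-congʳ eq) (solve₂ 1 (λ y → y :+ y := :0) R₂.refl y)

  2w≈0⇒ : ∀ {x} → x ≋ 0# → ∃ λ w → x ≈ 2# * w
  2w≈0⇒ {x} eq = let w , x≈ = ω-split x in w , (begin
    x                  ≈⟨ x≈ ⟩
    ω x + 2# * w       ≈⟨ +-congʳ (T-unique (T-ω x) T-0 (R₂.trans (ω-≋ x) eq)) ⟩
    0# + 2# * w        ≈⟨ R.+-identityˡ _ ⟩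
    2# * w             ∎)

  -- The inverse of squaring on the Teichmüller set. Its square is the Teichmüller representative
  -- exactly and not only modulo 2 (`ω-sqrt`), as the carry formula for `ω` requires.
  sqrt : Carrier → Carrier
  sqrt x = ω x ^ (2 ℕ.^ (m ℕ.∸ 1))

  ω-sqrt : ∀ x → sqrt x * sqrt x ≈ ω x
  ω-sqrt x = begin
    sqrt x * sqrt x                          ≈⟨ *-congˡ (R.*-identityʳ _) ⟨
    sqrt x ^ 2                               ≈⟨ ^-assocʳ (ω x) (2 ℕ.^ (m ℕ.∸ 1)) 2 ⟩
    ω x ^ (2 ℕ.^ (m ℕ.∸ 1) ℕ.* 2)            ≡⟨ ≡.cong (ω x ^_) (≡.trans (ℕ.*-comm (2 ℕ.^ (m ℕ.∸ 1)) 2)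
                                                  (≡.cong (2 ℕ.^_) (ℕ.m+[n∸m]≡n {1} {m}
                                                      (ℕ.≤-trans (ℕ.s≤s ℕ.z≤n) 3≤m)))) ⟩
    ω x ^ (2 ℕ.^ m)                          ≈⟨ T-power (T-ω x) ⟩
    ω x                                      ∎

  sqrt² : ∀ x → sqrt x * sqrt x ≋ x
  sqrt² x = R₂.trans (≈⇒≋ (ω-sqrt x)) (ω-≋ x)

  square-injective : ∀ {x y} → x * x ≋ y * y → x ≋ y
  square-injective {x} {y} eq = [ ≋-+≋0 , ≋-+≋0 ]′ (≋-domain {x + y} {x + y}
    (R₂.trans (solve₂ 2 (λ x y → (x :+ y) :* (x :+ y) := x :* x :+ y :* y) R₂.refl x y) (≋⇒+≋0 eq)))

  -- Frobenius and trace

  infix 10 _²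
  _² : Carrier → Carrier
  x ² = x * x

  ^2 : ∀ x → x ^ 2 ≈ x ²
  ^2 x = *-congˡ (R.*-identityʳ x)

  φ : Carrier → Carrier
  φ = frobenius

  -- The first digit is forced by its residue, and the second enters only as 2w², hence modulo 2. So
  -- `w` may be any representative, which spares the normalisation of digits in `φ-+`.
  φ-digits : ∀ {x t w} → Teichmüller t → x ≈ t + 2# * w → φ x ≈ t ² + 2# * w ²
  φ-digits {x} {t} {w} t∈T eq = let i , j , x≈ = decompose x in lemma i j x≈
    where
    lemma : ∀ i j → x ≈ τ i + 2# * τ j → τ i ^ 2 + 2# * τ j ^ 2 ≈ t ² + 2# * w ²
    lemma i j x≈ = +-cong (R.trans (^2 (τ i)) (*-cong τi≈t τi≈t))
      (R.trans (*-congˡ (^2 (τ j))) (double (≋-* τj≋w τj≋w)))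
      where
      τi≈t : τ i ≈ t
      τi≈t = T-unique (i , R.refl) t∈T (R₂.trans (R₂.sym (≋-+2 (τ i) (τ j)))
        (R₂.trans (≈⇒≋ (R.trans (R.sym x≈) eq)) (≋-+2 t w)))
      τj≋w : τ j ≋ w
      τj≋w = halve (∙-cancelˡ t _ _ (R.trans (+-congʳ (R.sym τi≈t)) (R.trans (R.sym x≈) eq)))

  φ-cong : ∀ {x y} → x ≈ y → φ x ≈ φ y
  φ-cong {x} {y} eq = let w , y≈ = ω-split y in
    R.trans (φ-digits {x} (T-ω y) (R.trans eq y≈)) (R.sym (φ-digits {y} (T-ω y) y≈))

  φ-T : ∀ {t} → Teichmüller t → φ t ≈ t ²
  φ-T {t} t∈T = R.trans (φ-digits {t} {t} {0#} t∈T (solve₄ 1 (λ t → t :=₄ t :+₄ con₄ 2F :*₄ con₄ 0F) R.refl t))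
    (solve₄ 1 (λ t → t :*₄ t :+₄ con₄ 2F :*₄ (con₄ 0F :*₄ con₄ 0F) :=₄ t :*₄ t) R.refl t)

  φ-2* : ∀ w → φ (2# * w) ≈ 2# * w ²
  φ-2* w = R.trans (φ-digits {2# * w} {0#} {w} T-0 (R.sym (R.+-identityˡ _)))
    (solve₄ 1 (λ w → con₄ 0F :*₄ con₄ 0F :+₄ con₄ 2F :*₄ (w :*₄ w) :=₄ con₄ 2F :*₄ (w :*₄ w)) R.refl w)

  φ-≋ : ∀ x → φ x ≋ x ²
  φ-≋ x = let w , x≈ = ω-split x in
    R₂.trans (≈⇒≋ (φ-digits (T-ω x) x≈)) (R₂.trans (≋-+2 (ω x ²) (w ²)) (R₂.*-cong (ω-≋ x) (ω-≋ x)))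

  -- The carry of the sum of two Teichmüller representatives is the square root of their product.
  ω-+ : ∀ x y → ω x + ω y ≈ ω (x + y) + 2# * (sqrt x * sqrt y)
  ω-+ x y = begin
    ω x + ω y                                     ≈⟨ +-cong (ω-sqrt x) (ω-sqrt y) ⟨
    u ² + v ²                                     ≈⟨ solve₄ 2 (λ u v → u :*₄ u :+₄ v :*₄ v :=₄
      (u :+₄ v) :*₄ (u :+₄ v) :+₄ con₄ 2F :*₄ (u :*₄ v)) R.refl u v ⟩
    (u + v) ² + 2# * (u * v)                      ≈⟨ +-congʳ (*-cong u+v≈ u+v≈) ⟩
    (s + 2# * w) ² + 2# * (u * v)                 ≈⟨ +-congʳ (solve₄ 2 (λ s w →
      (s :+₄ con₄ 2F :*₄ w) :*₄ (s :+₄ con₄ 2F :*₄ w) :=₄ s :*₄ s) R.refl s w) ⟩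
    s ² + 2# * (u * v)                            ≈⟨ +-congʳ (T-unique (T-* (T-ω _) (T-ω _)) (T-ω (x + y)) s²≋) ⟩
    ω (x + y) + 2# * (u * v)                      ∎
    where
    u = sqrt x
    v = sqrt y
    s = ω (u + v)
    w = proj₁ (ω-split (u + v))
    u+v≈ : u + v ≈ s + 2# * w
    u+v≈ = proj₂ (ω-split (u + v))
    s²≋ : s ² ≋ ω (x + y)
    s²≋ = R₂.trans (R₂.*-cong (ω-≋ (u + v)) (ω-≋ (u + v)))
      (R₂.trans (solve₂ 2 (λ u v → (u :+ v) :* (u :+ v) := u :* u :+ v :* v) R₂.refl u v)
        (R₂.trans (R₂.+-cong (sqrt² x) (sqrt² y)) (R₂.sym (ω-≋ (x + y)))))

  -- The carry of ω x + ω y contributes twice its square, which is 2 ω x ω y. This cancels the cross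
  -- term of (ω x + ω y)², because 4 = 0.
  φ-+ : ∀ x y → φ (x + y) ≈ φ x + φ y
  φ-+ x y = begin
    φ (x + y)                                       ≈⟨ φ-digits (T-ω (ω x + ω y)) digits ⟩
    s ² + 2# * (u * v + (w + w′)) ²                 ≈⟨ +-congʳ s²≈ ⟩
    (ω x + ω y) ² + 2# * (u * v + (w + w′)) ²       ≈⟨ solve₄ 6 (λ a b u v w w′ →
      (a :+₄ b) :*₄ (a :+₄ b) :+₄ con₄ 2F :*₄ ((u :*₄ v :+₄ (w :+₄ w′)) :*₄ (u :*₄ v :+₄ (w :+₄ w′)))
      :=₄ (a :*₄ a :+₄ con₄ 2F :*₄ (w :*₄ w)) :+₄ (b :*₄ b :+₄ con₄ 2F :*₄ (w′ :*₄ w′))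
         :+₄ con₄ 2F :*₄ ((a :*₄ b) :+₄ (u :*₄ u) :*₄ (v :*₄ v))) R.refl (ω x) (ω y) u v w w′ ⟩
    (ω x ² + 2# * w ²) + (ω y ² + 2# * w′ ²) + 2# * (ω x * ω y + u ² * v ²)
      ≈⟨ +-congˡ (*-congˡ (+-congˡ (*-cong (ω-sqrt x) (ω-sqrt y)))) ⟩
    (ω x ² + 2# * w ²) + (ω y ² + 2# * w′ ²) + 2# * (ω x * ω y + ω x * ω y)
      ≈⟨ solve₄ 2 (λ a b → a :+₄ con₄ 2F :*₄ (b :+₄ b) :=₄ a) R.refl _ (ω x * ω y) ⟩
    (ω x ² + 2# * w ²) + (ω y ² + 2# * w′ ²)        ≈⟨ +-cong (φ-digits (T-ω x) x≈) (φ-digits (T-ω y) y≈) ⟨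
    φ x + φ y                                       ∎
    where
    u = sqrt x
    v = sqrt y
    w = proj₁ (ω-split x)
    w′ = proj₁ (ω-split y)
    s = ω (ω x + ω y)
    x≈ : x ≈ ω x + 2# * w
    x≈ = proj₂ (ω-split x)
    y≈ : y ≈ ω y + 2# * w′
    y≈ = proj₂ (ω-split y)
    s≈ω[x+y] : s ≈ ω (x + y)
    s≈ω[x+y] = ω-cong (R₂.+-cong (ω-≋ x) (ω-≋ y))
    digits : x + y ≈ s + 2# * (u * v + (w + w′))
    digits = begin
      x + y                                       ≈⟨ +-cong x≈ y≈ ⟩
      (ω x + 2# * w) + (ω y + 2# * w′)            ≈⟨ solve₄ 4 (λ a b w w′ →
        (a :+₄ con₄ 2F :*₄ w) :+₄ (b :+₄ con₄ 2F :*₄ w′) :=₄ (a :+₄ b) :+₄ con₄ 2F :*₄ (w :+₄ w′)) R.refl (ω x)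
            (ω y) w w′ ⟩
      (ω x + ω y) + 2# * (w + w′)                 ≈⟨ +-congʳ (ω-+ x y) ⟩
      (ω (x + y) + 2# * (u * v)) + 2# * (w + w′)  ≈⟨ solve₄ 3 (λ s a b →
        (s :+₄ con₄ 2F :*₄ a) :+₄ con₄ 2F :*₄ b :=₄ s :+₄ con₄ 2F :*₄ (a :+₄ b)) R.refl _ (u * v) (w + w′) ⟩
      ω (x + y) + 2# * (u * v + (w + w′))         ≈⟨ +-congʳ s≈ω[x+y] ⟨
      s + 2# * (u * v + (w + w′))                 ∎
    s²≈ : s ² ≈ (ω x + ω y) ²
    s²≈ = begin
      s ²                                         ≈⟨ *-cong s≈ω[x+y] s≈ω[x+y] ⟩
      ω (x + y) ²                                 ≈⟨ solve₄ 2 (λ s a → s :*₄ s :=₄ (s :+₄ con₄ 2F :*₄ a) :*₄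
          (s :+₄ con₄ 2F :*₄ a)) R.refl _ (u * v) ⟩
      (ω (x + y) + 2# * (u * v)) ²                ≈⟨ *-cong (ω-+ x y) (ω-+ x y) ⟨
      (ω x + ω y) ²                               ∎


  m≡1+2k : ∃ λ k → m ≡ suc (k ℕ.* 2)
  m≡1+2k with m % 2 | m≡m%n+[m/n]*n m 2 | m%n<n m 2
  ... | 0 | eq | _ = contradiction (divides (m / 2) eq) m-odd
  ... | 1 | eq | _ = m / 2 , eq
  ... | suc (suc _) | _ | ℕ.s≤s (ℕ.s≤s ())

  iterate-shift : ∀ {A : Set c} (f : A → A) x k → iterate f (f x) k ≡ f (iterate f x k)
  iterate-shift f x zero    = refl
  iterate-shift f x (suc k) = iterate-shift f (f x) k

  iterate-φ-cong : ∀ {x y} k → x ≈ y → iterate φ x k ≈ iterate φ y k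
  iterate-φ-cong zero    eq = eq
  iterate-φ-cong (suc k) eq = iterate-φ-cong k (φ-cong eq)

  iterate-φ-+ : ∀ x y k → iterate φ (x + y) k ≈ iterate φ x k + iterate φ y k
  iterate-φ-+ x y zero    = R.refl
  iterate-φ-+ x y (suc k) = R.trans (iterate-φ-cong k (φ-+ x y)) (iterate-φ-+ (φ x) (φ y) k)

  ²-^ : ∀ x k → (x ²) ^ (2 ℕ.^ k) ≈ x ^ (2 ℕ.^ suc k)
  ²-^ x k = R.trans (^-congˡ (2 ℕ.^ k) (R.sym (^2 x))) (^-assocʳ x 2 (2 ℕ.^ k))

  iterate-φ-digits : ∀ k {x t w} → Teichmüller t → x ≈ t + 2# * w →
                     iterate φ x k ≈ t ^ (2 ℕ.^ k) + 2# * w ^ (2 ℕ.^ k)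
  iterate-φ-digits zero {x} {t} {w} t∈T eq =
    R.trans eq (+-cong (R.sym (R.*-identityʳ t)) (*-congˡ (R.sym (R.*-identityʳ w))))
  iterate-φ-digits (suc k) {x} {t} {w} t∈T eq = R.trans
    (iterate-φ-digits k {φ x} {t ²} {w ²} (T-* t∈T t∈T) (φ-digits t∈T eq))
    (+-cong (²-^ t k) (*-congˡ (²-^ w k)))

  φᵐ≈id : ∀ x → iterate φ x m ≈ x
  φᵐ≈id x = let i , j , eq = decompose x in
    R.trans (iterate-φ-digits m {x} {τ i} {τ j} (i , R.refl) eq)
      (R.trans (+-cong (T-power (i , R.refl)) (*-congˡ (T-power (j , R.refl)))) (R.sym eq))

  sum-telescope : ∀ k (g : ℕ → Carrier) → sum {k} (g ∘ suc ∘ toℕ) + g 0 ≈ sum {k} (g ∘ toℕ) + g k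
  sum-telescope zero    g = R.refl
  sum-telescope (suc k) g = begin
    (g 1 + sum {k} (g ∘ suc ∘ suc ∘ toℕ)) + g 0  ≈⟨ +-congʳ (R.+-comm _ _) ⟩
    (sum {k} (g ∘ suc ∘ suc ∘ toℕ) + g 1) + g 0  ≈⟨ +-congʳ (sum-telescope k (g ∘ suc)) ⟩
    (sum {k} (g ∘ suc ∘ toℕ) + g (suc k)) + g 0  ≈⟨ solve₄ 3 (λ a b c → (a :+₄ b) :+₄ c :=₄ (c :+₄ a) :+₄ b) R.refl _
        _ _ ⟩
    (g 0 + sum {k} (g ∘ suc ∘ toℕ)) + g (suc k)  ∎

  trace-cong : ∀ {x y} → x ≈ y → trace x ≈ trace y
  trace-cong eq = sum-cong-≋ {m} (λ i → iterate-φ-cong (toℕ i) eq)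

  trace-+ : ∀ x y → trace (x + y) ≈ trace x + trace y
  trace-+ x y = R.trans (sum-cong-≋ {m} (λ i → iterate-φ-+ x y (toℕ i)))
    (∑-distrib-+ {m} (λ i → iterate φ x (toℕ i)) (λ i → iterate φ y (toℕ i)))

  trace-φ : ∀ x → trace (φ x) ≈ trace x
  trace-φ x = ∙-cancelʳ x _ _ (R.trans (sum-telescope m (iterate φ x)) (+-congˡ (φᵐ≈id x)))

  φ-0 : φ 0# ≈ 0#
  φ-0 = R.trans (φ-T T-0) (R.zeroˡ 0#)

  φ-sum : ∀ k (g : ℕ → Carrier) → φ (sum {k} (g ∘ toℕ)) ≈ sum {k} (φ ∘ g ∘ toℕ)
  φ-sum zero    g = φ-0
  φ-sum (suc k) g = R.trans (φ-+ _ _) (+-congˡ (φ-sum k (g ∘ suc)))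

  φ-trace : ∀ x → φ (trace x) ≈ trace x
  φ-trace x = R.trans (φ-sum m (iterate φ x))
    (R.trans (sum-cong-≋ {m} (λ i → R.reflexive (≡.sym (iterate-shift φ x (toℕ i))))) (trace-φ x))

  T-idempotent : ∀ {t} → Teichmüller t → t ² ≋ t → t ≈ 0# ⊎ t ≈ 1#
  T-idempotent {t} t∈T eq = [ (λ t≋0 → inj₁ (T-unique t∈T T-0 t≋0))
                            , (λ t+1≋0 → inj₂ (T-unique t∈T T-1 (≋-+≋0 t+1≋0))) ]′
    (≋-domain {t} {t + 1#} (R₂.trans
      (solve₂ 1 (λ t → t :* (t :+ :1) := t :* t :+ t) R₂.refl t) (≋⇒+≋0 eq)))

  -- Uniqueness of the digits makes both of them idempotent, hence 0 or 1, and the four combinations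
  -- are the elements of the prime subring.
  φ-fixed : ∀ {x} → φ x ≈ x → ∃ λ u → ι u ≈ x
  φ-fixed {x} eq = go (T-idempotent i∈T i²≋i) (T-idempotent j∈T j²≋j)
    where
    i = τ (proj₁ (decompose x))
    j = τ (proj₁ (proj₂ (decompose x)))
    i∈T : Teichmüller i
    i∈T = proj₁ (decompose x) , R.refl
    j∈T : Teichmüller j
    j∈T = proj₁ (proj₂ (decompose x)) , R.refl
    x≈ : x ≈ i + 2# * j
    x≈ = proj₂ (proj₂ (decompose x))
    digits : i ² + 2# * j ² ≈ i + 2# * j
    digits = R.trans (R.sym (φ-digits i∈T x≈)) (R.trans eq x≈)
    i²≋i : i ² ≋ i
    i²≋i = R₂.trans (R₂.sym (≋-+2 (i ²) (j ²))) (R₂.trans (≈⇒≋ digits) (≋-+2 i j))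
    j²≋j : j ² ≋ j
    j²≋j = halve (∙-cancelˡ i _ _ (R.trans (+-congʳ (R.sym (T-unique (T-* i∈T i∈T) i∈T i²≋i))) digits))
    go : i ≈ 0# ⊎ i ≈ 1# → j ≈ 0# ⊎ j ≈ 1# → ∃ λ u → ι u ≈ x
    go (inj₁ i≈0) (inj₁ j≈0) = 0F , R.trans (solve₄ 0 (con₄ 0F :=₄ con₄ 0F :+₄ con₄ 2F :*₄ con₄ 0F) R.refl)
      (R.sym (R.trans x≈ (+-cong i≈0 (*-congˡ j≈0))))
    go (inj₂ i≈1) (inj₁ j≈0) = 1F , R.trans (R.sym (coe₄≈ι 1F))
        (R.trans (solve₄ 0 (con₄ 1F :=₄ con₄ 1F :+₄ con₄ 2F :*₄ con₄ 0F) R.refl)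
      (R.sym (R.trans x≈ (+-cong i≈1 (*-congˡ j≈0)))))
    go (inj₁ i≈0) (inj₂ j≈1) = 2F , R.trans (R.sym (coe₄≈ι 2F))
        (R.trans (solve₄ 0 (con₄ 2F :=₄ con₄ 0F :+₄ con₄ 2F :*₄ con₄ 1F) R.refl)
      (R.sym (R.trans x≈ (+-cong i≈0 (*-congˡ j≈1)))))
    go (inj₂ i≈1) (inj₂ j≈1) = 3F , R.trans (R.sym (coe₄≈ι 3F))
        (R.trans (solve₄ 0 (con₄ 3F :=₄ con₄ 1F :+₄ con₄ 2F :*₄ con₄ 1F) R.refl)
      (R.sym (R.trans x≈ (+-cong i≈1 (*-congˡ j≈1)))))

  abstract
    tr₄ : Carrier → Fin 4
    tr₄ x = proj₁ (φ-fixed (φ-trace x))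

    ι-tr₄ : ∀ x → ι (tr₄ x) ≈ trace x
    ι-tr₄ x = proj₂ (φ-fixed (φ-trace x))

  tr₄-cong : ∀ {x y} → x ≈ y → tr₄ x ≡ tr₄ y
  tr₄-cong {x} {y} eq = ι-injective (R.trans (ι-tr₄ x) (R.trans (trace-cong eq) (R.sym (ι-tr₄ y))))

  tr₄-+ : ∀ x y → tr₄ (x + y) ≡ tr₄ x +₄ tr₄ y
  tr₄-+ x y = ι-injective (begin
    ι (tr₄ (x + y))          ≈⟨ ι-tr₄ (x + y) ⟩
    trace (x + y)            ≈⟨ trace-+ x y ⟩
    trace x + trace y        ≈⟨ +-cong (ι-tr₄ x) (ι-tr₄ y) ⟨
    ι (tr₄ x) + ι (tr₄ y)    ≈⟨ ι-+ (tr₄ x) (tr₄ y) ⟨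
    ι (tr₄ x +₄ tr₄ y)       ∎)

  tr₄-φ : ∀ x → tr₄ (φ x) ≡ tr₄ x
  tr₄-φ x = ι-injective (R.trans (ι-tr₄ (φ x)) (R.trans (trace-φ x) (R.sym (ι-tr₄ x))))

  tr₄-2² : ∀ w → tr₄ (2# * w ²) ≡ tr₄ (2# * w)
  tr₄-2² w = ≡.trans (tr₄-cong (R.sym (φ-2* w))) (tr₄-φ (2# * w))

  tr₄-0 : tr₄ 0# ≡ 0F
  tr₄-0 = idem (tr₄ 0#) (≡.trans (≡.sym (tr₄-+ 0# 0#)) (tr₄-cong (R.+-identityˡ 0#)))
    where
    idem : ∀ u → u +₄ u ≡ u → u ≡ 0F
    idem = from-yes (Fin.all? λ u → ((u +₄ u) Fin.≟ u) →-dec (u Fin.≟ 0F))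

  tr₄-2* : ∀ x → tr₄ (2# * x) ≡ tr₄ x +₄ tr₄ x
  tr₄-2* x = ≡.trans (tr₄-cong (solve₄ 1 (λ x → con₄ 2F :*₄ x :=₄ x :+₄ x) R.refl x)) (tr₄-+ x x)

  tr₄-≋ : ∀ {x y} → x ≋ y → tr₄ (2# * x) ≡ tr₄ (2# * y)
  tr₄-≋ (halve eq) = tr₄-cong eq

  tr₄-2*-even : ∀ x → tr₄ (2# * x) ≡ 0F ⊎ tr₄ (2# * x) ≡ 2F
  tr₄-2*-even x = ≡.subst (λ u → u ≡ 0F ⊎ u ≡ 2F) (≡.sym (tr₄-2* x)) (even (tr₄ x))
    where
    even : ∀ u → u +₄ u ≡ 0F ⊎ u +₄ u ≡ 2F
    even = from-yes (Fin.all? λ u → ((u +₄ u) Fin.≟ 0F) ⊎-dec ((u +₄ u) Fin.≟ 2F))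

  trace-1 : trace 1# ≈ m · 1#
  trace-1 = go m 1# R.refl
    where
    go : ∀ k x → x ≈ 1# → sum {k} (λ i → iterate φ x (toℕ i)) ≈ k · 1#
    go zero    x x≈1 = R.refl
    go (suc k) x x≈1 = +-cong x≈1 (go k (φ x)
      (R.trans (φ-cong x≈1) (R.trans (φ-T T-1) (R.*-identityˡ 1#))))

  -- This is where m is odd.
  tr₄-2 : tr₄ (2# * 1#) ≡ 2F
  tr₄-2 = let k , m≡ = m≡1+2k in ι-injective (begin
    ι (tr₄ (2# * 1#))                         ≡⟨ ≡.cong ι (tr₄-2* 1#) ⟩
    ι (tr₄ 1# +₄ tr₄ 1#)                      ≈⟨ ι-+ (tr₄ 1#) (tr₄ 1#) ⟩
    ι (tr₄ 1#) + ι (tr₄ 1#)                   ≈⟨ +-cong (ι-tr₄ 1#) (ι-tr₄ 1#) ⟩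
    trace 1# + trace 1#                       ≈⟨ +-cong trace-1 trace-1 ⟩
    m · 1# + m · 1#                           ≡⟨ ≡.cong (λ m → m · 1# + m · 1#) m≡ ⟩
    suc (k ℕ.* 2) · 1# + suc (k ℕ.* 2) · 1#   ≈⟨ +-cong (+-congˡ (×1-homo-* k 2)) (+-congˡ (×1-homo-* k 2)) ⟩
    (1# + (k · 1#) * (2 · 1#)) + (1# + (k · 1#) * (2 · 1#))
      ≈⟨ +-cong (+-congˡ (*-congˡ (R.sym (coe₄≈ι 2F)))) (+-congˡ (*-congˡ (R.sym (coe₄≈ι 2F)))) ⟩
    (1# + (k · 1#) * 2#) + (1# + (k · 1#) * 2#)
      ≈⟨ solve₄ 1 (λ k → (con₄ 1F :+₄ k :*₄ con₄ 2F) :+₄ (con₄ 1F :+₄ k :*₄ con₄ 2F) :=₄ con₄ 2F) R.refl (k · 1#) ⟩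
    2#                                        ≈⟨ coe₄≈ι 2F ⟩
    ι 2F                                      ∎)

  -- Quadratic and cubic equations over the residue field

  private
    S : ℕ → Carrier → Carrier
    S zero    x = 0#
    S (suc k) x = x + S k (x ²)

    S-snoc : ∀ k x → S (suc k) x ≋ S k x + x ^ (2 ℕ.^ k)
    S-snoc zero    x = ≈⇒≋ (R.trans (R.+-comm x 0#) (+-congˡ (R.sym (R.*-identityʳ x))))
    S-snoc (suc k) x = R₂.trans (R₂.+-congˡ {x} (S-snoc k (x ²)))
      (≈⇒≋ (R.trans (R.sym (R.+-assoc _ _ _)) (+-congˡ (²-^ x k))))

    trace-S : ∀ k {x y} → x ≋ y → sum {k} (λ i → iterate φ x (toℕ i)) ≋ S k y
    trace-S zero    eq = R₂.refl
    trace-S (suc k) {x} {y} eq = R₂.+-cong eq (trace-S k (R₂.trans (φ-≋ x) (R₂.*-cong eq eq)))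

    -- The sum x + x⁴ + ... + x^(4^k). Adding its square fills in the missing powers of Frobenius.
    half-trace : ℕ → Carrier → Carrier
    half-trace zero    x = x
    half-trace (suc k) x = x + half-trace k ((x ²) ²)

    half-trace-S : ∀ k x → half-trace k x ² + half-trace k x ≋ S (suc (suc (k ℕ.* 2))) x
    half-trace-S zero    x = solve₂ 1 (λ x → x :* x :+ x := x :+ (x :* x :+ :0)) R₂.refl x
    half-trace-S (suc k) x = R₂.trans
      (solve₂ 2 (λ x h → (x :+ h) :* (x :+ h) :+ (x :+ h)
        := x :+ (x :* x :+ (h :* h :+ h))) R₂.refl x (half-trace k ((x ²) ²)))
      (R₂.+-congˡ {x} (R₂.+-congˡ {x ²} (half-trace-S k ((x ²) ²))))

  x^q≋x : ∀ x → x ^ (2 ℕ.^ m) ≋ x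
  x^q≋x x = R₂.trans (lemma (2 ℕ.^ m)) (R₂.trans (≈⇒≋ (T-power (T-ω x))) (ω-≋ x))
    where
    lemma : ∀ k → x ^ k ≋ ω x ^ k
    lemma zero    = R₂.refl
    lemma (suc k) = R₂.*-cong (R₂.sym (ω-≋ x)) (lemma k)

  -- For m = 2k + 1 the half trace h satisfies h² + h = (x + x² + ... + x^(2^(m-1))) + x^(2^m). The
  -- bracket is the trace of x, which vanishes, and the last term is x.
  artin-schreier : ∀ {x} → tr₄ (2# * x) ≡ 0F → ∃ λ w → w ² + w ≋ x
  artin-schreier {x} tr≡0 = let k , m≡ = m≡1+2k in half-trace k x , R₂.trans (half-trace-S k x)
    (≡.subst (λ m → S (suc m) x ≋ x) m≡ (R₂.trans (S-snoc m x) (R₂.trans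
      (R₂.+-cong (R₂.trans (R₂.sym (trace-S m R₂.refl)) trace≋0) (x^q≋x x)) (R₂.+-identityˡ x))))
    where
    trace≋0 : trace x ≋ 0#
    trace≋0 = halve (begin
      2# * trace x              ≈⟨ *-congˡ (ι-tr₄ x) ⟨
      2# * ι (tr₄ x)            ≈⟨ solve₄ 1 (λ x → con₄ 2F :*₄ x :=₄ x :+₄ x) R.refl _ ⟩
      ι (tr₄ x) + ι (tr₄ x)     ≈⟨ ι-+ (tr₄ x) (tr₄ x) ⟨
      ι (tr₄ x +₄ tr₄ x)        ≡⟨ ≡.cong ι (≡.trans (≡.sym (tr₄-2* x)) tr≡0) ⟩
      0#                        ≈⟨ R.zeroʳ 2# ⟨
      2# * 0#                   ∎)

  4^k≡1+3e : ∀ k → ∃ λ e → 4 ℕ.^ k ≡ suc (e ℕ.* 3)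
  4^k≡1+3e zero    = 0 , refl
  4^k≡1+3e (suc k) = let e , eq = 4^k≡1+3e k in suc (4 ℕ.* e) ,
    ≡.trans (≡.cong (4 ℕ.*_) eq) (≡.trans (ℕ.*-suc 4 (e ℕ.* 3)) (≡.cong (4 ℕ.+_) (≡.sym (ℕ.*-assoc 4 e 3))))

  -- Write 4^(k+1) = 1 + 3j. For m = 2k + 1 this power is also 2·2^m, so x (x^j)³ = x^(2·2^m) = x²,
  -- and x cancels.
  cube-root : ∀ x → ∃ λ t → t * (t * t) ≋ x
  cube-root x with x ≋? 0#
  ... | yes x≋0 = 0# , R₂.trans (R₂.zeroˡ _) (R₂.sym x≋0)
  ... | no x≢0  = go m≡1+2k
    where
    go : (∃ λ k → m ≡ suc (k ℕ.* 2)) → ∃ λ t → t * (t * t) ≋ x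
    go (k , m≡) = x ^ j , ≋-cancelˡ x≢0 (R₂.trans (≈⇒≋ (begin
        x * (x ^ j * (x ^ j * x ^ j))     ≈⟨ *-congˡ (*-congˡ (*-congˡ (R.*-identityʳ _))) ⟨
        x * (x ^ j) ^ 3                   ≈⟨ *-congˡ (^-assocʳ x j 3) ⟩
        x ^ suc (j ℕ.* 3)                 ≡⟨ ≡.cong (x ^_) (≡.trans (≡.sym 4^≡) 4^[k+1]≡) ⟩
        x ^ (2 ℕ.^ m ℕ.+ 2 ℕ.^ m)         ≈⟨ ^-homo-* x (2 ℕ.^ m) (2 ℕ.^ m) ⟩
        x ^ (2 ℕ.^ m) * x ^ (2 ℕ.^ m)     ∎)) (R₂.*-cong (x^q≋x x) (x^q≋x x)))
      where
      j = proj₁ (4^k≡1+3e (suc k))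
      4^≡ : 4 ℕ.^ suc k ≡ suc (j ℕ.* 3)
      4^≡ = proj₂ (4^k≡1+3e (suc k))
      4^[k+1]≡ : 4 ℕ.^ suc k ≡ 2 ℕ.^ m ℕ.+ 2 ℕ.^ m
      4^[k+1]≡ = ≡.trans (ℕ.^-*-assoc 2 2 (suc k)) (≡.trans
        (≡.cong (2 ℕ.^_) (≡.trans (ℕ.*-comm 2 (suc k)) (≡.cong suc (≡.sym m≡))))
        (≡.cong (2 ℕ.^ m ℕ.+_) (ℕ.+-identityʳ (2 ℕ.^ m))))

  -- The binary trace of the residue field, written as 0 or 2 in ℤ₄; thus `e (tr x)` is the sign
  -- (-1)^Tr(x).
  tr : Carrier → Fin 4
  tr x = tr₄ (2# * x)

  tr-cong : ∀ {x y} → x ≋ y → tr x ≡ tr y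
  tr-cong = tr₄-≋

  tr-+ : ∀ x y → tr (x + y) ≡ tr x +₄ tr y
  tr-+ x y = ≡.trans (tr₄-cong (R.distribˡ 2# x y)) (tr₄-+ (2# * x) (2# * y))

  tr-² : ∀ x → tr (x ²) ≡ tr x
  tr-² = tr₄-2²

  tr-1 : tr 1# ≡ 2F
  tr-1 = tr₄-2

  tr-0 : tr 0# ≡ 0F
  tr-0 = ≡.trans (tr₄-cong (R.zeroʳ 2#)) tr₄-0

  tr-double : ∀ x → tr x +₄ tr x ≡ 0F
  tr-double x = [ ≡.cong (λ u → u +₄ u) , ≡.cong (λ u → u +₄ u) ]′ (tr₄-2*-even x)

  tr-²+ : ∀ x → tr (x ² + x) ≡ 0F
  tr-²+ x = ≡.trans (tr-+ (x ²) x) (≡.trans (≡.cong (_+₄ tr x) (tr-² x)) (tr-double x))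

  -- Ideal membership: a + b is the combination of the hypotheses with cofactors c, c′, c″.
  certificate₁ : ∀ {p q a b} c → p ≋ q → a + b ≋ c * (p + q) → a ≋ b
  certificate₁ c p≋q eq = ≋-+≋0 (R₂.trans eq (R₂.trans (R₂.*-congˡ (≋⇒+≋0 p≋q)) (R₂.zeroʳ c)))

  certificate₂ : ∀ {p q p′ q′ a b} c c′ → p ≋ q → p′ ≋ q′ →
                 a + b ≋ c * (p + q) + c′ * (p′ + q′) → a ≋ b
  certificate₂ c c′ p≋q p′≋q′ eq = ≋-+≋0 (R₂.trans eq (R₂.trans
    (R₂.+-cong (R₂.trans (R₂.*-congˡ (≋⇒+≋0 p≋q)) (R₂.zeroʳ c))
               (R₂.trans (R₂.*-congˡ (≋⇒+≋0 p′≋q′)) (R₂.zeroʳ c′))) (R₂.+-identityˡ 0#)))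

  certificate₃ : ∀ {p q p′ q′ p″ q″ a b} c c′ c″ → p ≋ q → p′ ≋ q′ → p″ ≋ q″ →
                 a + b ≋ c * (p + q) + (c′ * (p′ + q′) + c″ * (p″ + q″)) → a ≋ b
  certificate₃ c c′ c″ p≋q p′≋q′ p″≋q″ eq = ≋-+≋0 (R₂.trans eq (R₂.trans
    (R₂.+-cong (R₂.trans (R₂.*-congˡ (≋⇒+≋0 p≋q)) (R₂.zeroʳ c))
      (R₂.+-cong (R₂.trans (R₂.*-congˡ (≋⇒+≋0 p′≋q′)) (R₂.zeroʳ c′))
                 (R₂.trans (R₂.*-congˡ (≋⇒+≋0 p″≋q″)) (R₂.zeroʳ c″))))
    (R₂.trans (R₂.+-identityˡ _) (R₂.+-identityˡ 0#))))

  -- The equation v³ = c (1 + v)²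

  Root : Carrier → Carrier → Set ℓ
  Root c v = v * (v * v) ≋ c * (1# + v) ²

  root-cong : ∀ {c c′ v v′} → c ≋ c′ → v ≋ v′ → Root c v → Root c′ v′
  root-cong c≋ v≋ root = R₂.trans (R₂.sym (R₂.*-cong v≋ (R₂.*-cong v≋ v≋))) (R₂.trans root
    (R₂.*-cong c≋ (R₂.*-cong (R₂.+-congˡ v≋) (R₂.+-congˡ v≋))))

  root≢0 : ∀ {c v} → ¬ c ≋ 0# → Root c v → ¬ v ≋ 0#
  root≢0 {c} {v} c≢0 root v≋0 = c≢0 (certificate₂ {b = 0#} 1# (v * v + c * v) root v≋0
    (solve₂ 2 (λ c v → c :+ :0 := :1 :* (v :* (v :* v) :+ c :* ((:1 :+ v) :* (:1 :+ v)))
      :+ (v :* v :+ c :* v) :* (v :+ :0)) R₂.refl c v))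

  root≢1 : ∀ {c v} → Root c v → ¬ 1# + v ≋ 0#
  root≢1 {c} {v} root 1+v≋0 = 1≋̸0 (certificate₂ {b = 0#} 1# (1# + v + v * v + c * (1# + v)) root 1+v≋0
    (solve₂ 2 (λ c v → :1 :+ :0 := :1 :* (v :* (v :* v) :+ c :* ((:1 :+ v) :* (:1 :+ v)))
      :+ (:1 :+ v :+ v :* v :+ c :* (:1 :+ v)) :* (:1 :+ v :+ :0)) R₂.refl c v))

  -- With p = (1 + v)⁻¹ the equation reads c = v + (p² + p).
  tr-root : ∀ {c v} → Root c v → tr v ≡ tr c
  tr-root {c} {v} root = ≡.trans (≡.sym (≡.trans (tr-+ v (p ² + p))
      (≡.trans (≡.cong (tr v +₄_) (tr-²+ p)) (u+0 (tr v)))))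
    (≡.sym (tr-cong c≋))
    where
    p = inv (1# + v)
    u+0 : ∀ u → u +₄ 0F ≡ u
    u+0 0F = refl
    u+0 1F = refl
    u+0 2F = refl
    u+0 3F = refl
    c≋ : c ≋ v + (p ² + p)
    c≋ = certificate₂ (p * p) ((c + v) * ((1# + v) * p + 1#) + p) root (inv-inverse (root≢1 root))
      (solve₂ 3 (λ c v p → c :+ (v :+ (p :* p :+ p)) :=
        (p :* p) :* (v :* (v :* v) :+ c :* ((:1 :+ v) :* (:1 :+ v)))
        :+ ((c :+ v) :* ((:1 :+ v) :* p :+ :1) :+ p) :* ((:1 :+ v) :* p :+ :1)) R₂.refl c v p)

  -- Two distinct roots v and v′ satisfy w² + w = 1 + v² for w = v / v′.
  root-quotient : ∀ {c v v′} → ¬ c ≋ 0# → Root c v → Root c v′ → ¬ v ≋ v′ →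
                  (v * inv v′) ² + v * inv v′ ≋ 1# + v ²
  root-quotient {c} {v} {v′} c≢0 root root′ v≢v′ =
    [ (λ v+v′≋0 → contradiction (≋-+≋0 v+v′≋0) v≢v′)
    , (λ Q≋0 → certificate₂ (r * r) (v * r + Y + v * v * Y) Q≋0 (inv-inverse (root≢0 c≢0 root′))
        (solve₂ 3 (λ v v′ r → (v :* r) :* (v :* r) :+ v :* r :+ (:1 :+ v :* v) :=
          (r :* r) :* (v :* v :+ v :* v′ :+ v′ :* v′ :+ (v :* v) :* (v′ :* v′) :+ :0)
          :+ (v :* r :+ (v′ :* r :+ :1) :+ v :* v :* (v′ :* r :+ :1)) :* (v′ :* r :+ :1)) R₂.refl v v′ r)) ]′
    (≋-domain (≋-cancelˡ c≢0 c[v+v′]Q≋0))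
    where
    r = inv v′
    Y = v′ * r + 1#
    Q = v * v + v * v′ + v′ * v′ + (v * v) * (v′ * v′)
    c[v+v′]Q≋0 : c * ((v + v′) * Q) ≋ c * 0#
    c[v+v′]Q≋0 = certificate₂ (v′ * (v′ * v′)) (v * (v * v)) root root′
      (solve₂ 3 (λ c v v′ →
        c :* ((v :+ v′) :* (v :* v :+ v :* v′ :+ v′ :* v′ :+ (v :* v) :* (v′ :* v′))) :+ c :* :0
        := (v′ :* (v′ :* v′)) :* (v :* (v :* v) :+ c :* ((:1 :+ v) :* (:1 :+ v)))
        :+ (v :* (v :* v)) :* (v′ :* (v′ :* v′) :+ c :* ((:1 :+ v′) :* (:1 :+ v′)))) R₂.refl c v v′)

  tr-1+² : ∀ v → tr (1# + v ²) ≡ 2F +₄ tr v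
  tr-1+² v = ≡.trans (tr-+ 1# (v ²)) (≡.cong₂ _+₄_ tr-1 (tr-² v))

  -- For a second root, `root-quotient` writes 1 + v² as w² + w, which has trace 0. But Tr(1 + v²) =
  -- 1 + Tr v = 1 + Tr c, so two roots force Tr c = 1.
  root-unique : ∀ {c v v′} → ¬ c ≋ 0# → tr c ≡ 0F → Root c v → Root c v′ → v ≋ v′
  root-unique {c} {v} {v′} c≢0 tr≡0 root root′ with v ≋? v′
  ... | yes v≋v′ = v≋v′
  ... | no v≢v′  = contradiction
    (≡.trans (≡.sym (tr-²+ (v * inv v′))) (≡.trans (tr-cong (root-quotient c≢0 root root′ v≢v′))
      (≡.trans (tr-1+² v) (≡.cong (2F +₄_) (≡.trans (tr-root root) tr≡0))))) λ ()

  -- Cardano's formula: with y = v⁻¹ the equation reads y³ + y = c⁻¹.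
  root-exists : ∀ {c} → ¬ c ≋ 0# → tr c ≡ 0F → ∃ (Root c)
  root-exists {c} c≢0 tr≡0 = inv y , certificate₃ (z * (z * z)) (z * (z * z) * c) (c * (K * K + K + 1# + z * z))
      cd≋1 y³+y≋d yz≋1 (solve₂ 4 (λ c d y z →
        z :* (z :* z) :+ c :* ((:1 :+ z) :* (:1 :+ z))
        := (z :* (z :* z)) :* (c :* d :+ :1)
        :+ ((z :* (z :* z) :* c) :* (y :* (y :* y) :+ y :+ d)
        :+ (c :* ((y :* z) :* (y :* z) :+ y :* z :+ :1 :+ z :* z)) :* (y :* z :+ :1))) R₂.refl c d y z)
    where
    d = inv c
    cd≋1 : c * d ≋ 1#
    cd≋1 = inv-inverse c≢0
    -- For y = t + 1/t the equation y³ + y = d becomes T² + dT + 1 = 0 with T = t³. The substitution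
    -- T = dw turns it into w² + w = c².
    solution = artin-schreier {c ²} (≡.trans (tr-² c) tr≡0)
    w = proj₁ solution
    w²+w≋c² : w ² + w ≋ c ²
    w²+w≋c² = proj₂ solution
    t = proj₁ (cube-root (d * w))
    t³≋dw : t * (t * t) ≋ d * w
    t³≋dw = proj₂ (cube-root (d * w))
    u = inv t
    y = t + u
    z = inv y
    K = y * z
    s₁ : t * (t * t) * (t * (t * t)) + d * (t * (t * t)) + 1# ≋ 0#
    s₁ = certificate₃ (t * (t * t) + d * w + d) (d * d) (c * d + 1#) t³≋dw w²+w≋c² cd≋1
      (solve₂ 4 (λ c d w t →
        t :* (t :* t) :* (t :* (t :* t)) :+ d :* (t :* (t :* t)) :+ :1 :+ :0
        := (t :* (t :* t) :+ d :* w :+ d) :* (t :* (t :* t) :+ d :* w)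
        :+ ((d :* d) :* (w :* w :+ w :+ c :* c) :+ (c :* d :+ :1) :* (c :* d :+ :1))) R₂.refl c d w t)
    t≢0 : ¬ t ≋ 0#
    t≢0 t≋0 = 1≋̸0 (certificate₂ {b = 0#} 1# ((t * t) * (t * (t * t)) + d * (t * t)) s₁ t≋0
      (solve₂ 2 (λ d t → :1 :+ :0
        := :1 :* (t :* (t :* t) :* (t :* (t :* t)) :+ d :* (t :* (t :* t)) :+ :1 :+ :0)
        :+ ((t :* t) :* (t :* (t :* t)) :+ d :* (t :* t)) :* (t :+ :0)) R₂.refl d t))
    y³+y≋d : y * (y * y) + y ≋ d
    y³+y≋d = certificate₂ (u * (u * u)) ((t * u * (t * u) + t * u + 1#) * (t * (t * t) + d) + (t + u)) s₁
        (inv-inverse t≢0)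
      (solve₂ 3 (λ d t u → (t :+ u) :* ((t :+ u) :* (t :+ u)) :+ (t :+ u) :+ d
        := (u :* (u :* u)) :* (t :* (t :* t) :* (t :* (t :* t)) :+ d :* (t :* (t :* t)) :+ :1 :+ :0)
        :+ ((t :* u :* (t :* u) :+ t :* u :+ :1) :* (t :* (t :* t) :+ d) :+ (t :+ u)) :* (t :* u :+ :1)) R₂.refl d t u)
    d≢0 : ¬ d ≋ 0#
    d≢0 d≋0 = 1≋̸0 (R₂.trans (R₂.sym cd≋1) (R₂.trans (R₂.*-congˡ d≋0) (R₂.zeroʳ c)))
    yz≋1 : y * z ≋ 1#
    yz≋1 = inv-inverse λ y≋0 → d≢0 (R₂.trans (R₂.sym y³+y≋d)
      (R₂.trans (R₂.+-cong (R₂.trans (R₂.*-congʳ y≋0) (R₂.zeroˡ _)) y≋0) (R₂.+-identityˡ 0#)))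

  record ThreeRoots (a : Carrier) (v : Carrier) : Set (c Level.⊔ ℓ) where
    field
      v₂ v₃     : Carrier
      root₂     : Root a v₂
      root₃     : Root a v₃
      v≢v₂      : ¬ v ≋ v₂
      v≢v₃      : ¬ v ≋ v₃
      v₂≢v₃     : ¬ v₂ ≋ v₃
      complete  : ∀ {v′} → Root a v′ → v′ ≋ v ⊎ v′ ≋ v₂ ⊎ v′ ≋ v₃

  -- Now Tr(1 + v²) = 1 + Tr c = 0, so w² + w = 1 + v² is solvable. By `root-quotient` any further
  -- root is v divided by a solution, and the two solutions w and w + 1 both give roots.
  three-roots : ∀ {c v} → ¬ c ≋ 0# → tr c ≡ 2F → Root c v → ThreeRoots c v
  three-roots {c} {v} c≢0 tr≡2 root = record
    { v₂ = v * inv w ; v₃ = v * inv w′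
    ; root₂ = quotient-root w≢0 w²+w≋ ; root₃ = quotient-root w′≢0 w′²+w′≋
    ; v≢v₂ = λ eq → w≢1 (≋-cancelˡ v≢0 (R₂.trans (quotient-eq w≢0 eq) (R₂.sym (R₂.*-identityʳ v))))
    ; v≢v₃ = λ eq → w≢0 (certificate₁ {b = 0#} 1#
        (≋-cancelˡ v≢0 (R₂.trans (quotient-eq w′≢0 eq) (R₂.sym (R₂.*-identityʳ v))))
        (solve₂ 1 (λ w → w :+ :0 := :1 :* (w :+ :1 :+ :1)) R₂.refl w))
    ; v₂≢v₃ = λ eq → 1≋̸0 (certificate₁ {b = 0#} 1# (≋-cancelˡ v≢0 (same-quotient w≢0 w′≢0 eq))
        (solve₂ 1 (λ w → :1 :+ :0 := :1 :* (w :+ (w :+ :1))) R₂.refl w))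
    ; complete = λ {v′} → complete {v′}
    }
    where
    v≢0 : ¬ v ≋ 0#
    v≢0 = root≢0 c≢0 root
    solution = artin-schreier {1# + v ²} (≡.trans (tr-1+² v) (≡.cong (2F +₄_) (≡.trans (tr-root root) tr≡2)))
    w = proj₁ solution
    w′ = w + 1#
    w²+w≋ : w ² + w ≋ 1# + v ²
    w²+w≋ = proj₂ solution
    w′²+w′≋ : w′ ² + w′ ≋ 1# + v ²
    w′²+w′≋ = certificate₁ 1# w²+w≋ (solve₂ 2 (λ w v →
      (w :+ :1) :* (w :+ :1) :+ (w :+ :1) :+ (:1 :+ v :* v) := :1 :* (w :* w :+ w :+ (:1 :+ v :* v))) R₂.refl w v)
    1+v²≢0 : ¬ 1# + v ² ≋ 0#
    1+v²≢0 eq = root≢1 root ([ id , id ]′ (≋-domain (R₂.trans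
      (solve₂ 1 (λ v → (:1 :+ v) :* (:1 :+ v) := :1 :+ v :* v) R₂.refl v) eq)))
    quotient≢0 : ∀ {x} → x ² + x ≋ 1# + v ² → ¬ x ≋ 0#
    quotient≢0 {x} eq x≋0 = 1+v²≢0 (certificate₂ 1# (x + 1#) eq x≋0
      (solve₂ 2 (λ x v → :1 :+ v :* v :+ :0
        := :1 :* (x :* x :+ x :+ (:1 :+ v :* v)) :+ (x :+ :1) :* (x :+ :0)) R₂.refl x v))
    w≢0 : ¬ w ≋ 0#
    w≢0 = quotient≢0 w²+w≋
    w′≢0 : ¬ w′ ≋ 0#
    w′≢0 = quotient≢0 w′²+w′≋
    w≢1 : ¬ w ≋ 1#
    w≢1 eq = w′≢0 (≋⇒+≋0 eq)
    quotient-root : ∀ {x} → ¬ x ≋ 0# → x ² + x ≋ 1# + v ² → Root c (v * inv x)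
    quotient-root {x} x≢0 eq = certificate₃ (i * (i * i)) (c * (i * (i * i) + i * i))
        (c * (i * (x * i) + i * i + (x * i + 1#)))
      root eq (inv-inverse x≢0) (solve₂ 4 (λ c v x i →
        (v :* i) :* ((v :* i) :* (v :* i)) :+ c :* ((:1 :+ v :* i) :* (:1 :+ v :* i))
        := (i :* (i :* i)) :* (v :* (v :* v) :+ c :* ((:1 :+ v) :* (:1 :+ v)))
        :+ ((c :* (i :* (i :* i) :+ i :* i)) :* (x :* x :+ x :+ (:1 :+ v :* v))
        :+ (c :* (i :* (x :* i) :+ i :* i :+ (x :* i :+ :1))) :* (x :* i :+ :1))) R₂.refl c v x i)
      where i = inv x
    quotient-eq : ∀ {x y} → ¬ x ≋ 0# → y ≋ v * inv x → y * x ≋ v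
    quotient-eq {x} {y} x≢0 eq = certificate₂ x v eq (inv-inverse x≢0)
      (solve₂ 4 (λ v x i y → y :* x :+ v := x :* (y :+ v :* i) :+ v :* (x :* i :+ :1)) R₂.refl v x (inv x) y)
    same-quotient : ∀ {x y} → ¬ x ≋ 0# → ¬ y ≋ 0# → v * inv x ≋ v * inv y → v * x ≋ v * y
    same-quotient {x} {y} x≢0 y≢0 eq = certificate₃ (x * y) (v * y) (v * x) eq (inv-inverse x≢0) (inv-inverse y≢0)
      (solve₂ 5 (λ v x y i j → v :* x :+ v :* y
        := (x :* y) :* (v :* i :+ v :* j) :+ ((v :* y) :* (x :* i :+ :1) :+ (v :* x) :* (y :* j :+ :1)))
        R₂.refl v x y (inv x) (inv y))
    complete : ∀ {v′} → Root c v′ → v′ ≋ v ⊎ v′ ≋ v * inv w ⊎ v′ ≋ v * inv w′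
    complete {v′} root′ with v′ ≋? v
    ... | yes eq = inj₁ eq
    ... | no neq = inj₂ ([ (λ e → inj₁ (from-quotient w≢0 (≋-+≋0 e)))
                         , (λ e → inj₂ (from-quotient w′≢0 (≋-+≋0 e))) ]′
      (≋-domain {x + w} {x + w′} (certificate₂ {b = 0#} 1# 1# x²+x≋ w²+w≋
        (solve₂ 3 (λ v w x → (x :+ w) :* (x :+ (w :+ :1)) :+ :0
          := :1 :* (x :* x :+ x :+ (:1 :+ v :* v)) :+ :1 :* (w :* w :+ w :+ (:1 :+ v :* v))) R₂.refl v w x))))
      where
      x = v * inv v′
      x²+x≋ : x ² + x ≋ 1# + v ²
      x²+x≋ = root-quotient c≢0 root root′ (neq ∘ R₂.sym)
      from-quotient : ∀ {y} → ¬ y ≋ 0# → x ≋ y → v′ ≋ v * inv y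
      from-quotient {y} y≢0 eq = certificate₃ (v′ * inv y) v′ (v * inv y) eq (inv-inverse y≢0)
          (inv-inverse (root≢0 c≢0 root′))
        (solve₂ 5 (λ v v′ y i j → v′ :+ v :* i
          := (v′ :* i) :* (v :* j :+ y) :+ (v′ :* (y :* i :+ :1) :+ (v :* i) :* (v′ :* j :+ :1)))
          R₂.refl v v′ y (inv y) (inv v′))

-- The group of parameters, its characters and the scheme on the codewords

module DelsarteGoethalsScheme {c ℓ : Level} (m : ℕ) (3≤m : 3 ℕ.≤ m) (m-odd : ¬ (2 ∣ m))
    (R : CommutativeRing c ℓ) (isGR4 : IsGR4 R m)
    (β : CommutativeRing.Carrier R) (β-order : HasOrder R β (2 ℕ.^ m ℕ.∸ 1)) where

  open GaloisField m 3≤m m-odd R isGR4 β β-order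
  open ℂ-Reasoning
  open ℕ.+-*-Solver using ()
    renaming (_:+_ to _+ₙ_; _:*_ to _*ₙ_; _:=_ to _=ₙ_; solve to solveₙ; con to conₙ)
  open ℤ.+-*-Solver using (Polynomial; ⟦_⟧↓; prove) renaming
    ( _:+_ to _+ₚ_; _:*_ to _*ₚ_; :-_ to -ₚ_; _:-_ to _-ₚ_; _:=_ to _=ₚ_
    ; solve to solveₚ; con to conₚ; var to varₚ; ⟦_⟧ to ⟦_⟧ₚ)

  module ℤ₄ = AbelianGroup ℤ₄
  module +₄-Solver = CommutativeMonoidSolver ℤ₄.commutativeMonoid

  -- The group of triples (u, a, b), identified with its dual through χ

  G : AbelianGroup c ℓ
  G = DirectProduct.abelianGroup ℤ₄ (DirectProduct.abelianGroup R.+-abelianGroup R₂.+-abelianGroup)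

  module G = AbelianGroup G
  open G public using () renaming (Carrier to M; _≈_ to _∼_; _-_ to _⊝_)

  infixl 6 _⊞_
  _⊞_ : M → M → M
  _⊞_ = G._∙_

  N : ℕ
  N = 4 ℕ.* (4 ℕ.^ m ℕ.* length)

  G-size : HasSize G.setoid N
  G-size = HasSize-× (Identity.inverse _) (HasSize-× (IsGR4.cardinality isGR4) residue-size)

  ⟪_,_⟫ : M → M → Fin 4
  ⟪ (u , a , b) , (s , α , β) ⟫ = u *₄ s +₄ (tr₄ (a * α) +₄ tr (b * β))

  ⟪⟫-congˡ : ∀ {g g′} h → g ∼ g′ → ⟪ g , h ⟫ ≡ ⟪ g′ , h ⟫
  ⟪⟫-congˡ h (u≡ , a≈ , b≋) = ≡.cong₂ _+₄_ (≡.cong (_*₄ _) u≡)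
    (≡.cong₂ _+₄_ (tr₄-cong (*-congʳ a≈)) (tr-cong (R₂.*-congʳ b≋)))

  *₄-comm : ∀ i j → i *₄ j ≡ j *₄ i
  *₄-comm = from-yes (Fin.all? λ i → Fin.all? λ j → (i *₄ j) Fin.≟ (j *₄ i))

  *₄-distrib : ∀ i j k → (i +₄ j) *₄ k ≡ i *₄ k +₄ j *₄ k
  *₄-distrib = from-yes (Fin.all? λ i → Fin.all? λ j → Fin.all? λ k → ((i +₄ j) *₄ k) Fin.≟ (i *₄ k +₄ j *₄ k))

  ⟪⟫-sym : ∀ g h → ⟪ g , h ⟫ ≡ ⟪ h , g ⟫
  ⟪⟫-sym (u , a , b) (s , α , β) = ≡.cong₂ _+₄_ (*₄-comm u s)
    (≡.cong₂ _+₄_ (tr₄-cong (R.*-comm a α)) (tr-cong (R₂.*-comm b β)))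

  ⟪⟫-∙ : ∀ g g′ h → ⟪ g ⊞ g′ , h ⟫ ≡ ⟪ g , h ⟫ +₄ ⟪ g′ , h ⟫
  ⟪⟫-∙ (u , a , b) (u′ , a′ , b′) (s , α , β) = ≡.trans
    (≡.cong₂ _+₄_ (*₄-distrib u u′ s) (≡.cong₂ _+₄_
      (≡.trans (tr₄-cong (R.distribʳ α a a′)) (tr₄-+ _ _))
      (≡.trans (tr-cong (R₂.distribʳ β b b′)) (tr-+ _ _))))
    (+₄-Solver.solve 6 (λ u u′ a a′ b b′ →
      (u +₄-Solver.⊕ u′) +₄-Solver.⊕ ((a +₄-Solver.⊕ a′) +₄-Solver.⊕ (b +₄-Solver.⊕ b′))
      +₄-Solver.⊜ (u +₄-Solver.⊕ (a +₄-Solver.⊕ b)) +₄-Solver.⊕ (u′ +₄-Solver.⊕ (a′ +₄-Solver.⊕ b′)))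
      refl (u *₄ s) (u′ *₄ s) (tr₄ (a * α)) (tr₄ (a′ * α)) (tr (b * β)) (tr (b′ * β)))

  ⟪⟫-ε : ∀ h → ⟪ G.ε , h ⟫ ≡ 0F
  ⟪⟫-ε (s , α , β) = ≡.cong₂ (λ x y → 0F +₄ (x +₄ y))
    (≡.trans (tr₄-cong (R.zeroˡ α)) tr₄-0) (≡.trans (tr-cong (R₂.zeroˡ β)) tr-0)

  χ : M → M → 𝔾
  χ g h = e ⟪ g , h ⟫

  e-cong : ∀ {i j} → i ≡ j → e i ℂ.≈ e j
  e-cong = ℂ.reflexive ∘ ≡.cong e

  χ-∙ : ∀ g g′ h → χ (g ⊞ g′) h ℂ.≈ χ g h ℂ.* χ g′ h
  χ-∙ g g′ h = ℂ.trans (e-cong (⟪⟫-∙ g g′ h)) (e-+ _ _)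

  private
    0-tr : ∀ α β → tr₄ (0# * α) +₄ tr (0# * β) ≡ 0F
    0-tr α β = ≡.cong₂ _+₄_ (≡.trans (tr₄-cong (R.zeroˡ α)) tr₄-0) (≡.trans (tr-cong (R₂.zeroˡ β)) tr-0)

    0-tr′ : ∀ α β → tr₄ (- 0# * α) +₄ tr (- 0# * β) ≡ 0F
    0-tr′ α β = ≡.trans (≡.cong₂ _+₄_ (tr₄-cong (*-congʳ -0≈0)) (tr-cong (R₂.*-congʳ (≈⇒≋ -0≈0)))) (0-tr α β)
      where
      -0≈0 : - 0# ≈ 0#
      -0≈0 = solve₄ 0 (:-₄ con₄ 0F :=₄ con₄ 0F) R.refl

    abstract
      separates-ℤ₄ : ∀ s s′ → s ≢ s′ → ∃ λ u → u *₄ s +₄ 0F +₄ ((-₄ u) *₄ s′ +₄ 0F) ≡ 2F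
      separates-ℤ₄ = from-yes (Fin.all? λ s → Fin.all? λ s′ → ¬? (s Fin.≟ s′) →-dec
        (Fin.any? λ u → (u *₄ s +₄ 0F +₄ ((-₄ u) *₄ s′ +₄ 0F)) Fin.≟ 2F))

    x+0 : ∀ i → i +₄ 0F ≡ i
    x+0 = ℤ₄.identityʳ

    0+x : ∀ i → 0F +₄ i ≡ i
    0+x = ℤ₄.identityˡ

    -0*x≋0 : ∀ β → - 0# * β ≋ 0#
    -0*x≋0 β = solve₂ 1 (λ β → :- :0 :* β := :0) R₂.refl β

    -0*x≈0 : ∀ α → - 0# * α ≈ 0#
    -0*x≈0 α = solve₄ 1 (λ α → :-₄ con₄ 0F :*₄ α :=₄ con₄ 0F) R.refl α

  -- The trace form of R is non-degenerate.
  tr₄-separates : ∀ α α′ → ¬ α ≈ α′ → ∃ λ a → tr₄ (a * α) +₄ tr₄ (- a * α′) ≡ 2F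
  tr₄-separates α α′ α≉α′ = let a , eq = multiple in a , ≡.trans (≡.sym (tr₄-+ _ _)) (≡.trans
    (tr₄-cong (R.trans (solve₄ 3 (λ a α α′ → a :*₄ α :+₄ :-₄ a :*₄ α′
      :=₄ a :*₄ (α :-₄ α′)) R.refl a α α′) eq)) tr₄-2)
    where
    multiple : ∃ λ a → a * (α - α′) ≈ 2# * 1#
    multiple with (α - α′) ≋? 0#
    ... | no δ≢0 = 2# * inv (α - α′) , R.trans
      (solve₄ 2 (λ i δ → (con₄ 2F :*₄ i) :*₄ δ :=₄ con₄ 2F :*₄ (δ :*₄ i))
        R.refl (inv (α - α′)) (α - α′)) (double (inv-inverse δ≢0))
    ... | yes δ≋0 = let w , δ≈ = 2w≈0⇒ δ≋0 in inv w , R.trans (*-congˡ δ≈) (R.trans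
      (solve₄ 2 (λ i w → i :*₄ (con₄ 2F :*₄ w) :=₄ con₄ 2F :*₄ (w :*₄ i)) R.refl (inv w) w)
      (double (inv-inverse λ w≋0 → α≉α′ (δ≈0 (R.trans δ≈ (R.trans (double w≋0) (R.zeroʳ 2#)))))))
      where
      δ≈0 : α - α′ ≈ 0# → α ≈ α′
      δ≈0 eq = R.trans (solve₄ 2 (λ α α′ → α :=₄ (α :-₄ α′) :+₄ α′) R.refl α α′)
        (R.trans (+-congʳ eq) (R.+-identityˡ α′))

  private
    separates₁ : ∀ u {s s′} α β α′ β′ → u *₄ s +₄ 0F +₄ ((-₄ u) *₄ s′ +₄ 0F) ≡ 2F →
      ⟪ (u , 0# , 0#) , (s , α , β) ⟫ +₄ ⟪ (u , 0# , 0#) G.⁻¹ , (s′ , α′ , β′) ⟫ ≡ 2F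
    separates₁ u {s} {s′} α β α′ β′ =
      ≡.trans (≡.cong₂ (λ x y → (u *₄ s +₄ x) +₄ ((-₄ u) *₄ s′ +₄ y)) (0-tr α β) (0-tr′ α′ β′))

    separates₂ : ∀ a {α α′} s β s′ β′ → tr₄ (a * α) +₄ tr₄ (- a * α′) ≡ 2F →
      ⟪ (0F , a , 0#) , (s , α , β) ⟫ +₄ ⟪ (0F , a , 0#) G.⁻¹ , (s′ , α′ , β′) ⟫ ≡ 2F
    separates₂ a {α} {α′} s β s′ β′ = ≡.trans (≡.cong₂ _+₄_
      (simplify (tr₄ (a * α)) (≡.trans (tr-cong (R₂.zeroˡ β)) tr-0))
      (simplify (tr₄ (- a * α′)) (≡.trans (tr-cong (-0*x≋0 β′)) tr-0)))
      where
      simplify : ∀ x {y} → y ≡ 0F → 0F +₄ (x +₄ y) ≡ x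
      simplify x refl = ≡.trans (0+x (x +₄ 0F)) (x+0 x)

    separates₃ : ∀ b {β β′} s α s′ α′ → tr (b * β) +₄ tr (- b * β′) ≡ 2F →
      ⟪ (0F , 0# , b) , (s , α , β) ⟫ +₄ ⟪ (0F , 0# , b) G.⁻¹ , (s′ , α′ , β′) ⟫ ≡ 2F
    separates₃ b {β} {β′} s α s′ α′ = ≡.trans (≡.cong₂ _+₄_
      (simplify (tr (b * β)) (≡.trans (tr₄-cong (R.zeroˡ α)) tr₄-0))
      (simplify (tr (- b * β′)) (≡.trans (tr₄-cong (-0*x≈0 α′)) tr₄-0)))
      where
      simplify : ∀ y {x} → x ≡ 0F → 0F +₄ (x +₄ y) ≡ y
      simplify y refl = ≡.trans (0+x (0F +₄ y)) (0+x y)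

    tr-separates : ∀ β β′ → ¬ β ≋ β′ → tr (inv (β + β′) * β) +₄ tr (- inv (β + β′) * β′) ≡ 2F
    tr-separates β β′ β≢β′ = ≡.trans (≡.sym (tr-+ _ _)) (≡.trans (tr-cong (R₂.trans
      (solve₂ 3 (λ i β β′ → i :* β :+ :- i :* β′ := (β :+ β′) :* i) R₂.refl (inv (β + β′)) β β′)
      (inv-inverse λ eq → β≢β′ (≋-+≋0 eq)))) tr-1)

  χ-separates : ∀ h k → ¬ h ∼ k → ∃ λ g → χ g h ℂ.* χ (g G.⁻¹) k ℂ.≈ ℂ.- ℂ.1#
  χ-separates (s , α , β) (s′ , α′ , β′) h≁k =
    go (s Fin.≟ s′) (HasSize-≟ (IsGR4.cardinality isGR4) α α′) (β ≋? β′)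
    where
    witness : ∀ g → ⟪ g , (s , α , β) ⟫ +₄ ⟪ g G.⁻¹ , (s′ , α′ , β′) ⟫ ≡ 2F →
              ∃ λ g → χ g (s , α , β) ℂ.* χ (g G.⁻¹) (s′ , α′ , β′) ℂ.≈ ℂ.- ℂ.1#
    witness g eq = g , ℂ.trans (ℂ.sym (e-+ ⟪ g , (s , α , β) ⟫ ⟪ g G.⁻¹ , (s′ , α′ , β′) ⟫)) (ℂ.trans (e-cong eq) e-2)
    go : Dec (s ≡ s′) → Dec (α ≈ α′) → Dec (β ≋ β′) →
         ∃ λ g → χ g (s , α , β) ℂ.* χ (g G.⁻¹) (s′ , α′ , β′) ℂ.≈ ℂ.- ℂ.1#
    go (no s≢) _ _ = let u , eq = separates-ℤ₄ s s′ s≢ in witness (u , 0# , 0#) (separates₁ u {s} {s′} α β α′ β′ eq)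
    go (yes _) (no α≉) _ = let a , eq = tr₄-separates α α′ α≉ in
      witness (0F , a , 0#) (separates₂ a {α} {α′} s β s′ β′ eq)
    go (yes _) (yes _) (no β≢) =
      witness (0F , 0# , inv (β + β′)) (separates₃ (inv (β + β′)) {β} {β′} s α s′ α′ (tr-separates β β′ β≢))
    go (yes s≡) (yes α≈) (yes β≋) = contradiction (s≡ , α≈ , β≋) h≁k

  χ-congˡ : ∀ {g g′} h → g ∼ g′ → χ g h ℂ.≈ χ g′ h
  χ-congˡ h g∼g′ = e-cong (⟪⟫-congˡ h g∼g′)

  χ-sym : ∀ g h → χ g h ℂ.≈ χ h g
  χ-sym g h = e-cong (⟪⟫-sym g h)

  χ-ε : ∀ h → χ G.ε h ℂ.≈ ℂ.1#
  χ-ε h = ℂ.trans (e-cong (⟪⟫-ε h)) e-0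

  module 𝓕 = Fourier G G-size χ χ-congˡ χ-sym χ-∙ χ-ε χ-separates

  -- Character sums over the residue field

  module Σ₂ = Summation residue-size

  private
    +-invol : ∀ c x → (x + c) + c ≋ x
    +-invol c x = solve₂ 2 (λ c x → (x :+ c) :+ c := x) R₂.refl c x

  Σ₂-antiperiodic : ∀ f c → Σ₂.Respectful f → (∀ x → f (x + c) ℂ.≈ ℂ.- f x) → Σ₂.∑ f ℂ.≈ ℂ.0#
  Σ₂-antiperiodic f c f-resp = Σ₂.∑-antisymmetric f (_+ c) (_+ c) f-resp R₂.+-congʳ R₂.+-congʳ (+-invol c) (+-invol c)

  Σ₂-translate : ∀ f c → Σ₂.Respectful f → Σ₂.∑ (λ x → f (x + c)) ℂ.≈ Σ₂.∑ f
  Σ₂-translate f c f-resp = Σ₂.∑-reindex f (_+ c) (_+ c) f-resp R₂.+-congʳ R₂.+-congʳ (+-invol c) (+-invol c)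

  Q : 𝔾
  Q = emb (+ length)

  e-+2 : ∀ i → e (i +₄ 2F) ℂ.≈ ℂ.- e i
  e-+2 i = ℂ.trans (e-+ i 2F) (ℂ.trans (ℂ.*-congˡ e-2)
    (solve 1 (λ x → x ⊗ ⊖ con (+ 1) ⊜ ⊖ x) ℂ.refl (e i)))

  Σ₂-tr : ∀ k → Σ₂.∑ (λ x → e (tr (x * k))) ℂ.≈ ⟦ k ≋? 0# ⟧ ℂ.* Q
  Σ₂-tr k with k ≋? 0#
  ... | yes k≋0 = ℂ.trans (Σ₂.∑-cong (λ x → ℂ.trans
      (e-cong (≡.trans (tr-cong (R₂.trans (R₂.*-congˡ k≋0) (R₂.zeroʳ x))) tr-0)) e-0))
    (ℂ.trans Σ₂.∑-1 (ℂ.sym (ℂ.*-identityˡ Q)))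
  ... | no k≢0 = ℂ.trans (Σ₂-antiperiodic _ (inv k) (λ eq → e-cong (tr-cong (R₂.*-congʳ eq)))
    (λ x → ℂ.trans (e-cong (≡.trans (tr-cong (R₂.distribʳ k x (inv k))) (≡.trans (tr-+ _ _)
      (≡.cong (tr (x * k) +₄_) (≡.trans (tr-cong (R₂.trans (R₂.*-comm (inv k) k) (inv-inverse k≢0))) tr-1)))))
      (e-+2 (tr (x * k))))) (ℂ.sym (ℂ.zeroˡ Q))

  Σ₂-tr² : ∀ k → Σ₂.∑ (λ x → e (tr (x ² * k))) ℂ.≈ ⟦ k ≋? 0# ⟧ ℂ.* Q
  Σ₂-tr² k = begin
    Σ₂.∑ (λ x → e (tr (x ² * k)))         ≈⟨ Σ₂.∑-cong (λ x → e-cong (≡.trans (tr-cong (R₂.trans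
      (R₂.*-congˡ (R₂.sym (sqrt² k))) (solve₂ 2 (λ x s → (x :* x) :* (s :* s) := (x :* s) :* (x :* s)) R₂.refl x
          (sqrt k))))
      (tr-² (x * sqrt k)))) ⟩
    Σ₂.∑ (λ x → e (tr (x * sqrt k)))      ≈⟨ Σ₂-tr (sqrt k) ⟩
    ⟦ sqrt k ≋? 0# ⟧ ℂ.* Q                ≈⟨ ℂ.*-congʳ (⟦⟧-cong (sqrt k ≋? 0#) (k ≋? 0#) (mk⇔
      (λ eq → R₂.trans (R₂.sym (sqrt² k)) (R₂.trans (R₂.*-congʳ eq) (R₂.zeroˡ _)))
      (λ eq → [ id , id ]′ (≋-domain (R₂.trans (sqrt² k) eq))))) ⟩
    ⟦ k ≋? 0# ⟧ ℂ.* Q                     ∎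

  -- Exponential sums

  phase : Carrier → Carrier → Carrier → Fin 4
  phase a b x = tr₄ (a * ω x) +₄ tr (b * (x * (x * x)))

  point : Carrier → M
  point x = 1F , ω x , x * (x * x)

  phase-cong : ∀ {a a′ b b′ x x′} → a ≈ a′ → b ≋ b′ → x ≋ x′ → phase a b x ≡ phase a′ b′ x′
  phase-cong a≈ b≋ x≋ = ≡.cong₂ _+₄_ (tr₄-cong (*-cong a≈ (ω-cong x≋)))
    (tr-cong (R₂.*-cong b≋ (R₂.*-cong x≋ (R₂.*-cong x≋ x≋))))

  point-cong : ∀ {x x′} → x ≋ x′ → point x ∼ point x′
  point-cong x≋ = refl , ω-cong x≋ , R₂.*-cong x≋ (R₂.*-cong x≋ x≋)

  u*1 : ∀ u → u *₄ 1F ≡ u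
  u*1 = from-yes (Fin.all? λ u → (u *₄ 1F) Fin.≟ u)

  χ-point : ∀ u a b x → χ (u , a , b) (point x) ℂ.≈ e u ℂ.* e (phase a b x)
  χ-point u a b x = ℂ.trans (e-+ _ _) (ℂ.*-congʳ (e-cong (u*1 u)))

  f : M → 𝔾
  f g = Σ₂.∑ (λ x → χ g (point x))

  E : Carrier → Carrier → 𝔾
  E a b = Σ₂.∑ (λ x → e (phase a b x))

  f≈eE : ∀ u a b → f (u , a , b) ℂ.≈ e u ℂ.* E a b
  f≈eE u a b = ℂ.trans (Σ₂.∑-cong (χ-point u a b)) (Σ₂.∑-*ˡ (e u) _)

  -- The kernel of the symmetric bilinear form attached to phase a b
  κ : Carrier → Carrier → Carrier → Carrier
  κ a b x = (a ² * a ²) * x ² + b * x + b ² * (x ² * x ²)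

  κ-cong : ∀ {a b x x′} → x ≋ x′ → κ a b x ≋ κ a b x′
  κ-cong {a} {b} x≋ = R₂.+-cong (R₂.+-cong (R₂.*-congˡ x²≋) (R₂.*-congˡ x≋)) (R₂.*-congˡ (R₂.*-cong x²≋ x²≋))
    where x²≋ = R₂.*-cong x≋ x≋

  κ-+ : ∀ a b x y → κ a b (x + y) ≋ κ a b x + κ a b y
  κ-+ a b x y = solve₂ 4 (λ a b x y → k a b (x :+ y) := k a b x :+ k a b y) R₂.refl a b x y
    where
    k : ∀ {n} → Polynomial₂ n → Polynomial₂ n → Polynomial₂ n → Polynomial₂ n
    k a b x = (a :* a :* (a :* a)) :* (x :* x) :+ b :* x
      :+ (b :* b) :* ((x :* x) :* (x :* x))

  -- The carry of `ω` contributes tr(a√x√y), and the cube contributes tr(bx²y + bxy²). Invariance of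
  -- the trace under squaring replaces a√x√y by a⁴x²y² and bx²y by b²x⁴y², so y² becomes a common
  -- factor with cofactor `κ a b x`.
  phase-+ : ∀ a b x y → phase a b (x + y) ≡ phase a b x +₄ phase a b y +₄ tr (y ² * κ a b x)
  phase-+ a b x y = ≡.trans (≡.cong₂ _+₄_ linear cubic) (≡.trans
    (+₄-Solver.solve 6 (λ p q r s t v → ((p +₄-Solver.⊕ q) +₄-Solver.⊕ r) +₄-Solver.⊕ ((s +₄-Solver.⊕ t) +₄-Solver.⊕ v)
      +₄-Solver.⊜ ((p +₄-Solver.⊕ s) +₄-Solver.⊕ (q +₄-Solver.⊕ t)) +₄-Solver.⊕ (r +₄-Solver.⊕ v)) refl
      (tr₄ (a * ω x)) (tr₄ (a * ω y)) (tr (a * (sqrt x * sqrt y)))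
      (tr (b * (x * (x * x)))) (tr (b * (y * (y * y)))) (tr (b * (x * x * y + x * y * y))))
    (≡.cong (phase a b x +₄ phase a b y +₄_) mixed))
    where
    linear : tr₄ (a * ω (x + y)) ≡ tr₄ (a * ω x) +₄ tr₄ (a * ω y) +₄ tr (a * (sqrt x * sqrt y))
    linear = ≡.trans (tr₄-cong (R.trans
      (solve₄ 3 (λ a s t → a :*₄ s :=₄
        a :*₄ (s :+₄ con₄ 2F :*₄ t) :+₄ con₄ 2F :*₄ (a :*₄ t))
        R.refl a (ω (x + y)) (sqrt x * sqrt y))
      (+-congʳ (R.trans (*-congˡ (R.sym (ω-+ x y))) (R.distribˡ a (ω x) (ω y))))))
      (≡.trans (tr₄-+ _ _) (≡.cong (_+₄ tr (a * (sqrt x * sqrt y))) (tr₄-+ _ _)))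
    cubic : tr (b * ((x + y) * ((x + y) * (x + y)))) ≡
            tr (b * (x * (x * x))) +₄ tr (b * (y * (y * y))) +₄ tr (b * (x * x * y + x * y * y))
    cubic = ≡.trans (tr-cong (solve₂ 3 (λ b x y →
      b :* ((x :+ y) :* ((x :+ y) :* (x :+ y)))
      := b :* (x :* (x :* x)) :+ b :* (y :* (y :* y))
        :+ b :* (x :* x :* y :+ x :* y :* y)) R₂.refl b x y))
      (≡.trans (tr-+ _ _) (≡.cong (_+₄ tr (b * (x * x * y + x * y * y))) (tr-+ _ _)))
    mixed : tr (a * (sqrt x * sqrt y)) +₄ tr (b * (x * x * y + x * y * y)) ≡ tr (y ² * κ a b x)
    mixed = ≡.trans (≡.cong₂ _+₄_
      (≡.trans (≡.sym (tr-² _)) (≡.trans (≡.sym (tr-² _)) (tr-cong (R₂.trans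
        (solve₂ 3 (λ a u v → (a :* (u :* v) :* (a :* (u :* v))) :* (a :* (u :* v) :* (a :* (u :* v)))
          := (a :* a :* (a :* a)) :* ((u :* u) :* (u :* u) :* ((v :* v) :* (v :* v))))
          R₂.refl a (sqrt x) (sqrt y))
        (R₂.*-congˡ (R₂.*-cong (R₂.*-cong (sqrt² x) (sqrt² x)) (R₂.*-cong (sqrt² y) (sqrt² y))))))))
      (≡.trans (tr-cong (R₂.distribˡ b _ _)) (≡.trans (tr-+ _ _)
        (≡.cong (_+₄ tr (b * (x * y * y))) (≡.sym (tr-² (b * (x * x * y))))))))
      (≡.trans (≡.cong (tr ((a ² * a ²) * (x * x * (y * y))) +₄_) (≡.sym (tr-+ _ _))) (≡.trans (≡.sym (tr-+ _ _))
        (tr-cong (solve₂ 4 (λ a b x y →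
          (a :* a :* (a :* a)) :* (x :* x :* (y :* y))
          :+ ((b :* (x :* x :* y)) :* (b :* (x :* x :* y)) :+ b :* (x :* y :* y))
          := (y :* y) :* ((a :* a :* (a :* a)) :* (x :* x) :+ b :* x
            :+ (b :* b) :* ((x :* x) :* (x :* x)))) R₂.refl a b x y))))

  kernelSum : Carrier → Carrier → 𝔾
  kernelSum a b = Σ₂.∑ (λ x → ⟦ κ a b x ≋? 0# ⟧ ℂ.* e (phase a b x))

  -- Substituting x + y for x in the double sum leaves, for each x, a sum of the characters y ↦
  -- tr(y² κ(x)). It is q on the kernel of `κ` and 0 elsewhere.
  E-norm : ∀ a b → E a b ℂ.* conj (E a b) ℂ.≈ Q ℂ.* kernelSum a b
  E-norm a b = begin
    E a b ℂ.* conj (E a b)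
      ≈⟨ ℂ.*-congˡ (Σ₂.∑-conj _) ⟩
    E a b ℂ.* Σ₂.∑ (λ y → conj (e (phase a b y)))
      ≈⟨ Σ₂.∑-*ˡ (E a b) _ ⟨
    Σ₂.∑ (λ y → E a b ℂ.* conj (e (phase a b y)))
      ≈⟨ Σ₂.∑-cong (λ y → ℂ.trans (ℂ.*-congʳ (ℂ.sym (Σ₂-translate (λ x → e (phase a b x)) y
          (λ eq → e-cong (phase-cong R.refl R₂.refl eq)))))
           (ℂ.sym (Σ₂.∑-*ʳ (conj (e (phase a b y))) _))) ⟩
    Σ₂.∑ (λ y → Σ₂.∑ (λ x → e (phase a b (x + y)) ℂ.* conj (e (phase a b y))))
      ≈⟨ Σ₂.∑-cong (λ y → Σ₂.∑-cong (λ x → term x y)) ⟩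
    Σ₂.∑ (λ y → Σ₂.∑ (λ x → e (phase a b x) ℂ.* e (tr (y ² * κ a b x))))
      ≈⟨ Σ₂.∑-swap _ ⟩
    Σ₂.∑ (λ x → Σ₂.∑ (λ y → e (phase a b x) ℂ.* e (tr (y ² * κ a b x))))
      ≈⟨ Σ₂.∑-cong (λ x → ℂ.trans (Σ₂.∑-*ˡ (e (phase a b x)) _) (ℂ.trans (ℂ.*-congˡ (Σ₂-tr² (κ a b x)))
           (solve 3 (λ p k q → p ⊗ (k ⊗ q) ⊜ q ⊗ (k ⊗ p))
             ℂ.refl (e (phase a b x)) ⟦ κ a b x ≋? 0# ⟧ Q))) ⟩
    Σ₂.∑ (λ x → Q ℂ.* (⟦ κ a b x ≋? 0# ⟧ ℂ.* e (phase a b x)))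
      ≈⟨ Σ₂.∑-*ˡ Q _ ⟩
    Q ℂ.* kernelSum a b ∎
    where
    term : ∀ x y → e (phase a b (x + y)) ℂ.* conj (e (phase a b y)) ℂ.≈ e (phase a b x) ℂ.* e (tr (y ² * κ a b x))
    term x y = begin
      e (phase a b (x + y)) ℂ.* conj (e (phase a b y))
        ≈⟨ ℂ.*-cong (e-cong (phase-+ a b x y)) (conj-e _) ⟩
      e (phase a b x +₄ phase a b y +₄ tr (y ² * κ a b x)) ℂ.* e (-₄ phase a b y)
        ≈⟨ ℂ.*-congʳ (ℂ.trans (e-+ _ _) (ℂ.*-congʳ (e-+ _ _))) ⟩
      ((e (phase a b x) ℂ.* e (phase a b y)) ℂ.* e (tr (y ² * κ a b x))) ℂ.* e (-₄ phase a b y)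
        ≈⟨ solve 4 (λ p q r s → ((p ⊗ q) ⊗ r) ⊗ s
             ⊜ (p ⊗ r) ⊗ (q ⊗ s)) ℂ.refl
             (e (phase a b x)) (e (phase a b y)) (e (tr (y ² * κ a b x))) (e (-₄ phase a b y)) ⟩
      (e (phase a b x) ℂ.* e (tr (y ² * κ a b x))) ℂ.* (e (phase a b y) ℂ.* e (-₄ phase a b y))
        ≈⟨ ℂ.*-congˡ (ℂ.trans (ℂ.sym (e-+ _ _)) (ℂ.trans (e-cong (ℤ₄.inverseʳ (phase a b y))) e-0)) ⟩
      (e (phase a b x) ℂ.* e (tr (y ² * κ a b x))) ℂ.* ℂ.1#
        ≈⟨ ℂ.*-identityʳ _ ⟩
      e (phase a b x) ℂ.* e (tr (y ² * κ a b x)) ∎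

  phase-0 : ∀ a b → phase a b 0# ≡ 0F
  phase-0 a b = ≡.cong₂ _+₄_
    (≡.trans (tr₄-cong (R.trans (*-congˡ (ω-T T-0)) (R.zeroʳ a))) tr₄-0)
    (≡.trans (tr-cong (solve₂ 1 (λ b → b :* (:0 :* (:0 :* :0)) := :0) R₂.refl b)) tr-0)

  phase-kernel-+ : ∀ {a b x} y → κ a b x ≋ 0# → phase a b (x + y) ≡ phase a b x +₄ phase a b y
  phase-kernel-+ {a} {b} {x} y κx≋0 = ≡.trans (phase-+ a b x y) (≡.trans
    (≡.cong (phase a b x +₄ phase a b y +₄_) (≡.trans (tr-cong (R₂.trans (R₂.*-congˡ κx≋0) (R₂.zeroʳ (y ²)))) tr-0))
    (ℤ₄.identityʳ _))

  -- The phase is additive on the kernel, and x + x is 0 in the residue field, so twice the phase is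
  -- 0.
  phase-kernel : ∀ {a b x} → κ a b x ≋ 0# → phase a b x ≡ 0F ⊎ phase a b x ≡ 2F
  phase-kernel {a} {b} {x} κx≋0 = halves (phase a b x) (≡.trans (≡.sym (phase-kernel-+ x κx≋0)) (≡.trans
    (phase-cong {a} {a} {b} {b} R.refl R₂.refl (≋⇒+≋0 R₂.refl)) (phase-0 a b)))
    where
    halves : ∀ i → i +₄ i ≡ 0F → i ≡ 0F ⊎ i ≡ 2F
    halves = from-yes (Fin.all? λ i → ((i +₄ i) Fin.≟ 0F) →-dec ((i Fin.≟ 0F) ⊎-dec (i Fin.≟ 2F)))

  κ-0 : ∀ a b → κ a b 0# ≋ 0#
  κ-0 a b = solve₂ 2 (λ a b → (a :* a :* (a :* a)) :* (:0 :* :0) :+ b :* :0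
    :+ (b :* b) :* ((:0 :* :0) :* (:0 :* :0)) := :0) R₂.refl a b

  private
    module Kernel (a b : Carrier) where
      p : Carrier → 𝔾
      p x = e (phase a b x)

      p-resp : Σ₂.Respectful p
      p-resp eq = e-cong (phase-cong R.refl R₂.refl eq)

      p-0 : p 0# ℂ.≈ ℂ.1#
      p-0 = ℂ.trans (e-cong (phase-0 a b)) e-0

      δ-term : ∀ y → Σ₂.∑ (λ x → ⟦ x ≋? y ⟧ ℂ.* p x) ℂ.≈ p y
      δ-term y = Σ₂.∑-δ p y p-resp

      K? : ∀ x → Dec (κ a b x ≋ 0#)
      K? x = κ a b x ≋? 0#

      K-resp : ∀ {x y} → x ≋ y → κ a b x ≋ 0# → κ a b y ≋ 0#
      K-resp eq κx≋0 = R₂.trans (R₂.sym (κ-cong {a} {b} eq)) κx≋0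

      K-+ : ∀ {x y} → κ a b x ≋ 0# → κ a b y ≋ 0# → κ a b (x + y) ≋ 0#
      K-+ {x} {y} κx≋0 κy≋0 = R₂.trans (κ-+ a b x y) (R₂.trans (R₂.+-cong κx≋0 κy≋0) (R₂.+-identityˡ 0#))

  kernelSum-trivial : ∀ a b → (∀ {x} → κ a b x ≋ 0# → x ≋ 0#) → kernelSum a b ℂ.≈ ℂ.1#
  kernelSum-trivial a b trivial = ℂ.trans
    (Σ₂.∑-cong (λ x → ℂ.*-congʳ (⟦⟧-cong (K? x) (x ≋? 0#) (mk⇔ trivial (λ eq → K-resp (R₂.sym eq) (κ-0 a b))))))
    (ℂ.trans (δ-term 0#) p-0)
    where open Kernel a b

  -- Two kernel elements other than 0 and y₁ agree up to y₁.
  kernel-two : ∀ {a b y₁ y y′} → ¬ b ≋ 0# → ¬ y₁ ≋ 0# → κ a b y₁ ≋ 0# →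
    κ a b y ≋ 0# → ¬ y ≋ 0# → ¬ y ≋ y₁ → κ a b y′ ≋ 0# → ¬ y′ ≋ 0# → ¬ y′ ≋ y₁ →
    y′ ≋ y ⊎ y′ ≋ y₁ + y
  kernel-two {a} {b} {y₁} {y} {y′} b≢0 y₁≢0 Ky₁ Ky y≢0 y≢y₁ Ky′ y′≢0 y′≢y₁ =
    Sum.map ≋-+≋0 ≋-+≋0 (≋-domain {y′ + y} {y′ + (y₁ + y)}
      (≋-cancelˡ b²≢0 (certificate₂ {b = b ² * 0#} 1# 1# (quadratic Ky y≢0 y≢y₁) (quadratic Ky′ y′≢0 y′≢y₁)
        (solve₂ 5 (λ a b y₁ y y′ →
          (b :* b) :* ((y′ :+ y) :* (y′ :+ (y₁ :+ y))) :+ (b :* b) :* :0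
          := :1 :* ((b :* b) :* (y :* y :+ y :* y₁ :+ y₁ :* y₁) :+ a :* a :* (a :* a) :+ :0)
          :+ :1 :* ((b :* b) :* (y′ :* y′ :+ y′ :* y₁ :+ y₁ :* y₁) :+ a :* a :* (a :* a) :+ :0))
          R₂.refl a b y₁ y y′))))
    where
    b²≢0 : ¬ b ² ≋ 0#
    b²≢0 eq = [ b≢0 , b≢0 ]′ (≋-domain eq)
    quartic : ∀ {y} → κ a b y ≋ 0# → ¬ y ≋ 0# → (a ² * a ²) * y + b + b ² * (y * y ²) ≋ 0#
    quartic {y} Ky y≢0 = ≋-cancelˡ y≢0 (R₂.trans (solve₂ 3 (λ a b y →
      y :* ((a :* a :* (a :* a)) :* y :+ b :+ (b :* b) :* (y :* (y :* y)))
      := (a :* a :* (a :* a)) :* (y :* y) :+ b :* y :+ (b :* b) :* ((y :* y) :* (y :* y)))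
      R₂.refl a b y) (R₂.trans Ky (R₂.sym (R₂.zeroʳ y))))
    quadratic : ∀ {y} → κ a b y ≋ 0# → ¬ y ≋ 0# → ¬ y ≋ y₁ → b ² * (y * y + y * y₁ + y₁ * y₁) + a ² * a ² ≋ 0#
    quadratic {y} Ky y≢0 y≢y₁ = ≋-cancelˡ {y + y₁} (y≢y₁ ∘ ≋-+≋0) (certificate₂ {b = (y + y₁) * 0#} 1# 1#
      (quartic Ky y≢0) (quartic Ky₁ y₁≢0) (solve₂ 4 (λ a b y₁ y →
        (y :+ y₁) :* ((b :* b) :* (y :* y :+ y :* y₁ :+ y₁ :* y₁) :+ a :* a :* (a :* a))
          :+ (y :+ y₁) :* :0
        := :1 :* ((a :* a :* (a :* a)) :* y :+ b :+ (b :* b) :* (y :* (y :* y)) :+ :0)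
        :+ :1 :* ((a :* a :* (a :* a)) :* y₁ :+ b :+ (b :* b) :* (y₁ :* (y₁ :* y₁)) :+ :0))
        R₂.refl a b y₁ y))

  data ZeroTwoFour : ℤ → Set where
    zero : ZeroTwoFour (+ 0)
    two  : ZeroTwoFour (+ 2)
    four : ZeroTwoFour (+ 4)

  -- The kernel is a group of order 2 or 4, on which e of the phase is a character with values ±1.
  -- The sum is 1 + p(y₁), respectively (1 + p(y₁))(1 + p(y₂)).
  kernelSum-nontrivial : ∀ a b {y₁} → ¬ b ≋ 0# → ¬ y₁ ≋ 0# → κ a b y₁ ≋ 0# →
                         ∃ λ k → ZeroTwoFour k × kernelSum a b ℂ.≈ emb k
  kernelSum-nontrivial a b {y₁} b≢0 y₁≢0 Ky₁ = go (HasSize-any? residue-size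
      (λ y → K? y ×-dec ¬? (y ≋? 0#) ×-dec ¬? (y ≋? y₁))
      (λ eq (k , n , n′) → K-resp eq k , n ∘ R₂.trans eq , n′ ∘ R₂.trans eq))
    where
    open Kernel a b
    value : ∀ {y} → κ a b y ≋ 0# → p y ℂ.≈ ℂ.1# ⊎ p y ℂ.≈ ℂ.- ℂ.1#
    value Ky = [ (λ eq → inj₁ (ℂ.trans (e-cong eq) e-0)) , (λ eq → inj₂ (ℂ.trans (e-cong eq) e-2)) ]′ (phase-kernel Ky)
    go : Dec (∃ λ y → κ a b y ≋ 0# × ¬ y ≋ 0# × ¬ y ≋ y₁) → ∃ λ k → ZeroTwoFour k × kernelSum a b ℂ.≈ emb k
    go (no none) = [ (λ eq → + 2 , two , ℂ.trans sum≈ (ℂ.trans (ℂ.+-congˡ eq)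
                       (solve 0 (con (+ 1) ⊕ con (+ 1) ⊜ con (+ 2)) ℂ.refl)))
                   , (λ eq → + 0 , zero , ℂ.trans sum≈ (ℂ.trans (ℂ.+-congˡ eq)
                       (ℂ.trans (ℂ.-‿inverseʳ ℂ.1#) (ℂ.sym emb-0)))) ]′ (value Ky₁)
      where
      sum≈ : kernelSum a b ℂ.≈ ℂ.1# ℂ.+ p y₁
      sum≈ = begin
        kernelSum a b
          ≈⟨ Σ₂.∑-cong (λ x → ℂ.trans (ℂ.*-congʳ (⟦⟧-⊎ (K? x) (x ≋? 0#) (x ≋? y₁) (cover x)
               (λ eq → K-resp (R₂.sym eq) (κ-0 a b)) (λ eq → K-resp (R₂.sym eq) Ky₁)
               (λ eq eq′ → y₁≢0 (R₂.trans (R₂.sym eq′) eq)))) (ℂ.distribʳ _ _ _)) ⟩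
        Σ₂.∑ (λ x → ⟦ x ≋? 0# ⟧ ℂ.* p x ℂ.+ ⟦ x ≋? y₁ ⟧ ℂ.* p x)
          ≈⟨ ℂ.trans (Σ₂.∑-+ _ _) (ℂ.+-cong (ℂ.trans (δ-term 0#) p-0) (δ-term y₁)) ⟩
        ℂ.1# ℂ.+ p y₁ ∎
        where
        cover : ∀ x → κ a b x ≋ 0# → x ≋ 0# ⊎ x ≋ y₁
        cover x Kx with x ≋? 0# | x ≋? y₁
        ... | yes eq | _      = inj₁ eq
        ... | no _   | yes eq = inj₂ eq
        ... | no n   | no n′  = contradiction (x , Kx , n , n′) none
    go (yes (y₂ , Ky₂ , y₂≢0 , y₂≢y₁)) = finish′ (value Ky₁) (value Ky₂)
      where
      y₃ = y₁ + y₂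
      Ky₃ : κ a b y₃ ≋ 0#
      Ky₃ = K-+ Ky₁ Ky₂
      y₃≢0 : ¬ y₃ ≋ 0#
      y₃≢0 eq = y₂≢y₁ (R₂.sym (≋-+≋0 eq))
      y₃≢y₁ : ¬ y₃ ≋ y₁
      y₃≢y₁ eq = y₂≢0 (certificate₁ {b = 0#} 1# eq (solve₂ 2 (λ y₁ y₂ → y₂ :+ :0
        := :1 :* ((y₁ :+ y₂) :+ y₁)) R₂.refl y₁ y₂))
      y₃≢y₂ : ¬ y₃ ≋ y₂
      y₃≢y₂ eq = y₁≢0 (certificate₁ {b = 0#} 1# eq (solve₂ 2 (λ y₁ y₂ → y₁ :+ :0
        := :1 :* ((y₁ :+ y₂) :+ y₂)) R₂.refl y₁ y₂))
      A? : ∀ x → Dec (x ≋ 0# ⊎ x ≋ y₁)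
      A? x = (x ≋? 0#) ⊎-dec (x ≋? y₁)
      B? : ∀ x → Dec (x ≋ y₂ ⊎ x ≋ y₃)
      B? x = (x ≋? y₂) ⊎-dec (x ≋? y₃)
      cover : ∀ x → κ a b x ≋ 0# → (x ≋ 0# ⊎ x ≋ y₁) ⊎ (x ≋ y₂ ⊎ x ≋ y₃)
      cover x Kx with x ≋? 0# | x ≋? y₁
      ... | yes eq | _      = inj₁ (inj₁ eq)
      ... | no _   | yes eq = inj₁ (inj₂ eq)
      ... | no n   | no n′  = inj₂ (kernel-two b≢0 y₁≢0 Ky₁ Ky₂ y₂≢0 y₂≢y₁ Kx n n′)
      disjoint : ∀ {x} → x ≋ 0# ⊎ x ≋ y₁ → ¬ (x ≋ y₂ ⊎ x ≋ y₃)
      disjoint (inj₁ eq) (inj₁ eq′) = y₂≢0 (R₂.trans (R₂.sym eq′) eq)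
      disjoint (inj₁ eq) (inj₂ eq′) = y₃≢0 (R₂.trans (R₂.sym eq′) eq)
      disjoint (inj₂ eq) (inj₁ eq′) = y₂≢y₁ (R₂.trans (R₂.sym eq′) eq)
      disjoint (inj₂ eq) (inj₂ eq′) = y₃≢y₁ (R₂.trans (R₂.sym eq′) eq)
      bracket : ∀ x → ⟦ K? x ⟧ ℂ.≈ (⟦ x ≋? 0# ⟧ ℂ.+ ⟦ x ≋? y₁ ⟧) ℂ.+ (⟦ x ≋? y₂ ⟧ ℂ.+ ⟦ x ≋? y₃ ⟧)
      bracket x = ℂ.trans (⟦⟧-⊎ (K? x) (A? x) (B? x) (cover x)
          [ (λ eq → K-resp (R₂.sym eq) (κ-0 a b)) , (λ eq → K-resp (R₂.sym eq) Ky₁) ]′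
          [ (λ eq → K-resp (R₂.sym eq) Ky₂) , (λ eq → K-resp (R₂.sym eq) Ky₃) ]′ disjoint)
        (ℂ.+-cong (⟦⟧-⊎ (A? x) (x ≋? 0#) (x ≋? y₁) id inj₁ inj₂ (λ eq eq′ → y₁≢0 (R₂.trans (R₂.sym eq′) eq)))
                  (⟦⟧-⊎ (B? x) (x ≋? y₂) (x ≋? y₃) id inj₁ inj₂ (λ eq eq′ → y₃≢y₂ (R₂.trans (R₂.sym eq′) eq))))
      p₃ : p y₃ ℂ.≈ p y₁ ℂ.* p y₂
      p₃ = ℂ.trans (e-cong (phase-kernel-+ y₂ Ky₁)) (e-+ _ _)
      sum≈ : kernelSum a b ℂ.≈ (ℂ.1# ℂ.+ p y₁) ℂ.* (ℂ.1# ℂ.+ p y₂)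
      sum≈ = begin
        kernelSum a b
          ≈⟨ Σ₂.∑-cong (λ x → ℂ.trans (ℂ.*-congʳ (bracket x)) (solve 5 (λ i j k l p →
               ((i ⊕ j) ⊕ (k ⊕ l)) ⊗ p
               ⊜ (i ⊗ p ⊕ j ⊗ p) ⊕ (k ⊗ p ⊕ l ⊗ p))
               ℂ.refl ⟦ x ≋? 0# ⟧ ⟦ x ≋? y₁ ⟧ ⟦ x ≋? y₂ ⟧ ⟦ x ≋? y₃ ⟧ (p x))) ⟩
        Σ₂.∑ (λ x → (⟦ x ≋? 0# ⟧ ℂ.* p x ℂ.+ ⟦ x ≋? y₁ ⟧ ℂ.* p x) ℂ.+ (⟦ x ≋? y₂ ⟧ ℂ.* p x ℂ.+ ⟦ x ≋? y₃ ⟧ ℂ.* p x))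
          ≈⟨ ℂ.trans (Σ₂.∑-+ _ _) (ℂ.+-cong (Σ₂.∑-+ _ _) (Σ₂.∑-+ _ _)) ⟩
        (Σ₂.∑ (λ x → ⟦ x ≋? 0# ⟧ ℂ.* p x) ℂ.+ Σ₂.∑ (λ x → ⟦ x ≋? y₁ ⟧ ℂ.* p x)) ℂ.+
        (Σ₂.∑ (λ x → ⟦ x ≋? y₂ ⟧ ℂ.* p x) ℂ.+ Σ₂.∑ (λ x → ⟦ x ≋? y₃ ⟧ ℂ.* p x))
          ≈⟨ ℂ.+-cong (ℂ.+-cong (ℂ.trans (δ-term 0#) p-0) (δ-term y₁)) (ℂ.+-cong (δ-term y₂) (ℂ.trans (δ-term y₃) p₃)) ⟩
        (ℂ.1# ℂ.+ p y₁) ℂ.+ (p y₂ ℂ.+ p y₁ ℂ.* p y₂)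
          ≈⟨ solve 2 (λ s t → (con (+ 1) ⊕ s) ⊕ (t ⊕ s ⊗ t)
               ⊜ (con (+ 1) ⊕ s) ⊗ (con (+ 1) ⊕ t)) ℂ.refl (p y₁) (p y₂) ⟩
        (ℂ.1# ℂ.+ p y₁) ℂ.* (ℂ.1# ℂ.+ p y₂) ∎
      finish′ : p y₁ ℂ.≈ ℂ.1# ⊎ p y₁ ℂ.≈ ℂ.- ℂ.1# → p y₂ ℂ.≈ ℂ.1# ⊎ p y₂ ℂ.≈ ℂ.- ℂ.1# →
                ∃ λ k → ZeroTwoFour k × kernelSum a b ℂ.≈ emb k
      finish′ (inj₁ eq) (inj₁ eq′) = + 4 , four , ℂ.trans sum≈ (ℂ.trans (ℂ.*-cong (ℂ.+-congˡ eq) (ℂ.+-congˡ eq′))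
        (solve 0 ((con (+ 1) ⊕ con (+ 1)) ⊗ (con (+ 1) ⊕ con (+ 1))
          ⊜ con (+ 4)) ℂ.refl))
      finish′ (inj₂ eq) _ = + 0 , zero , ℂ.trans sum≈ (ℂ.trans (ℂ.*-congʳ (ℂ.trans (ℂ.+-congˡ eq) (ℂ.-‿inverseʳ ℂ.1#)))
        (ℂ.trans (ℂ.zeroˡ _) (ℂ.sym emb-0)))
      finish′ _ (inj₂ eq) = + 0 , zero , ℂ.trans sum≈ (ℂ.trans (ℂ.*-congˡ (ℂ.trans (ℂ.+-congˡ eq) (ℂ.-‿inverseʳ ℂ.1#)))
        (ℂ.trans (ℂ.zeroʳ _) (ℂ.sym emb-0)))

  -- Kernel elements y ≠ 0 correspond to the roots γ of a cubic through y = (bγ²)⁻¹.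

  Cubic : Carrier → Carrier → Carrier → Set ℓ
  Cubic a b γ = 1# + a ² * γ ² + b * (γ * γ ²) ≋ 0#

  cubic≢0 : ∀ {a b γ} → Cubic a b γ → ¬ γ ≋ 0#
  cubic≢0 {a} {b} {γ} cubic γ≋0 = 1≋̸0 (certificate₂ {b = 0#} 1# (a ² * γ + b * γ ²) cubic γ≋0
    (solve₂ 3 (λ a b γ → :1 :+ :0
      := :1 :* (:1 :+ (a :* a) :* (γ :* γ) :+ b :* (γ :* (γ :* γ)) :+ :0)
      :+ ((a :* a) :* γ :+ b :* (γ :* γ)) :* (γ :+ :0)) R₂.refl a b γ))

  cubic⇒kernel : ∀ {a b γ} → ¬ b ≋ 0# → Cubic a b γ → ∃ λ y → ¬ y ≋ 0# × κ a b y ≋ 0#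
  cubic⇒kernel {a} {b} {γ} b≢0 cubic = y , y≢0 , ≋-cancelˡ B²≢0
    (certificate₂ {b = B ² * 0#} (1# + a ² * γ ² + b * (γ * γ ²))
      ((P + 1#) * (a ² * a ² * (γ ² * γ ²)) + b ² * (γ ² * (γ ² * γ ²)) + (P + 1#) * ((P + 1#) * (P + 1#))) cubic
          (inv-inverse bγ²≢0)
      (solve₂ 4 (λ a b γ y → let P = (b :* (γ :* γ)) :* y ; B = b :* ((γ :* γ) :* (γ :* γ)); 1′ = :1 in
        (B :* B) :* ((a :* a :* (a :* a)) :* (y :* y) :+ b :* y :+ (b :* b) :* ((y :* y) :* (y :* y)))
          :+ (B :* B) :* :0
        := (1′ :+ (a :* a) :* (γ :* γ) :+ b :* (γ :* (γ :* γ)))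
          :* (1′ :+ (a :* a) :* (γ :* γ) :+ b :* (γ :* (γ :* γ)) :+ :0)
        :+ ((P :+ 1′) :* (a :* a :* (a :* a) :* (γ :* γ :* (γ :* γ)))
          :+ (b :* b) :* ((γ :* γ) :* ((γ :* γ) :* (γ :* γ)))
          :+ (P :+ 1′) :* ((P :+ 1′) :* (P :+ 1′))) :* (P :+ 1′)) R₂.refl a b γ y))
    where
    γ≢0 : ¬ γ ≋ 0#
    γ≢0 = cubic≢0 cubic
    product≢0 : ∀ {x y} → ¬ x ≋ 0# → ¬ y ≋ 0# → ¬ x * y ≋ 0#
    product≢0 x≢0 y≢0 eq = [ x≢0 , y≢0 ]′ (≋-domain eq)
    bγ²≢0 : ¬ b * γ ² ≋ 0#
    bγ²≢0 = product≢0 b≢0 (product≢0 γ≢0 γ≢0)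
    y = inv (b * γ ²)
    P = b * γ ² * y
    -- At y = 1/(bγ²) the factor B² clears the denominators of `κ` and leaves 1 + a⁴γ⁴ + b²γ⁶, the
    -- square of the cubic.
    B = b * (γ ² * γ ²)
    B²≢0 : ¬ B ² ≋ 0#
    B²≢0 = product≢0 B≢0 B≢0
      where
      B≢0 : ¬ B ≋ 0#
      B≢0 = product≢0 b≢0 (product≢0 (product≢0 γ≢0 γ≢0) (product≢0 γ≢0 γ≢0))
    y≢0 : ¬ y ≋ 0#
    y≢0 y≋0 = 1≋̸0 (R₂.trans (R₂.sym (inv-inverse bγ²≢0)) (R₂.trans (R₂.*-congˡ y≋0) (R₂.zeroʳ _)))

  kernel⇒cubic : ∀ {a b y} → ¬ b ≋ 0# → ¬ y ≋ 0# → κ a b y ≋ 0# → ∃ (Cubic a b)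
  kernel⇒cubic {a} {b} {y} b≢0 y≢0 Ky = γ , [ id , id ]′ (≋-domain (≋-cancelˡ y≢0
    (certificate₃ {b = y * 0#} (y * (a ² * a ² * (γ ² + g) + b ² * (γ ² * γ ² + γ ² * g + g * g)))
        (g * (g * g) * b) (y * (a ² * a ² * (g * g) + P * P + P + 1#)) (sqrt² g) Ky (inv-inverse by≢0)
      (solve₂ 5 (λ a b y γ g → let 1′ = :1 ; P = (b :* y) :* g ; G = γ :* γ
                                   c = 1′ :+ (a :* a) :* G :+ b :* (γ :* G) in
        y :* (c :* c) :+ y :* :0
        := (y :* (a :* a :* (a :* a) :* (G :+ g) :+ b :* b :* (G :* G :+ G :* g :+ g :* g))) :* (G :+ g)
        :+ (g :* (g :* g) :* b :* ((a :* a :* (a :* a)) :* (y :* y) :+ b :* y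
          :+ (b :* b) :* ((y :* y) :* (y :* y)) :+ :0)
        :+ (y :* (a :* a :* (a :* a) :* (g :* g) :+ P :* P :+ P :+ 1′)) :* (P :+ 1′))) R₂.refl a b y γ g))))
    where
    by≢0 : ¬ b * y ≋ 0#
    by≢0 eq = [ b≢0 , y≢0 ]′ (≋-domain eq)
    g = inv (b * y)
    γ = sqrt g
    P = (b * y) * g

  -- Sums of two squares

  private
    parity : ∀ x → ∃ λ h → x ≡ h ℕ.* 2 ⊎ x ≡ suc (h ℕ.* 2)
    parity x with x % 2 | m≡m%n+[m/n]*n x 2 | m%n<n x 2
    ... | 0 | eq | _ = x / 2 , inj₁ eq
    ... | 1 | eq | _ = x / 2 , inj₂ eq
    ... | suc (suc _) | _ | ℕ.s≤s (ℕ.s≤s ())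

    not-4∣ : ∀ r k n → r % 4 ≢ 0 → 4 ℕ.* n ≢ r ℕ.+ k ℕ.* 4
    not-4∣ r k n r≢0 eq = r≢0 (≡.trans (≡.sym ([m+kn]%n≡m%n r k 4))
      (≡.trans (≡.cong (_% 4) (≡.trans (≡.sym eq) (ℕ.*-comm 4 n))) (m*n%n≡0 n 4)))

  even-squares : ∀ x y n → x ℕ.* x ℕ.+ y ℕ.* y ≡ 4 ℕ.* n →
                 ∃₂ λ h k → x ≡ 2 ℕ.* h × y ≡ 2 ℕ.* k × h ℕ.* h ℕ.+ k ℕ.* k ≡ n
  even-squares x y n eq with parity x | parity y
  ... | h , inj₁ refl | k , inj₁ refl = h , k , ℕ.*-comm h 2 , ℕ.*-comm k 2 ,
    ℕ.*-cancelˡ-≡ _ _ 4 (≡.trans (solveₙ 2 (λ h k → conₙ 4 *ₙ (h *ₙ h +ₙ k *ₙ k) =ₙ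
      (h *ₙ conₙ 2) *ₙ (h *ₙ conₙ 2) +ₙ (k *ₙ conₙ 2) *ₙ (k *ₙ conₙ 2)) refl h k) eq)
  ... | h , inj₂ refl | k , inj₁ refl = contradiction (≡.trans (≡.sym eq)
    (solveₙ 2 (λ h k → (conₙ 1 +ₙ h *ₙ conₙ 2) *ₙ (conₙ 1 +ₙ h *ₙ conₙ 2) +ₙ (k *ₙ conₙ 2) *ₙ (k *ₙ conₙ 2)
      =ₙ conₙ 1 +ₙ (h *ₙ h +ₙ h +ₙ k *ₙ k) *ₙ conₙ 4) refl h k)) (not-4∣ 1 (h ℕ.* h ℕ.+ h ℕ.+ k ℕ.* k) n λ ())
  ... | h , inj₁ refl | k , inj₂ refl = contradiction (≡.trans (≡.sym eq)
    (solveₙ 2 (λ h k → (h *ₙ conₙ 2) *ₙ (h *ₙ conₙ 2) +ₙ (conₙ 1 +ₙ k *ₙ conₙ 2) *ₙ (conₙ 1 +ₙ k *ₙ conₙ 2)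
      =ₙ conₙ 1 +ₙ (h *ₙ h +ₙ k +ₙ k *ₙ k) *ₙ conₙ 4) refl h k)) (not-4∣ 1 (h ℕ.* h ℕ.+ k ℕ.+ k ℕ.* k) n λ ())
  ... | h , inj₂ refl | k , inj₂ refl = contradiction (≡.trans (≡.sym eq)
    (solveₙ 2 (λ h k → (conₙ 1 +ₙ h *ₙ conₙ 2) *ₙ (conₙ 1 +ₙ h *ₙ conₙ 2) +ₙ (conₙ 1 +ₙ k *ₙ conₙ 2) *ₙ
        (conₙ 1 +ₙ k *ₙ conₙ 2)
      =ₙ conₙ 2 +ₙ (h *ₙ h +ₙ h +ₙ k +ₙ k *ₙ k) *ₙ conₙ 4) refl h k))
          (not-4∣ 2 (h ℕ.* h ℕ.+ h ℕ.+ k ℕ.+ k ℕ.* k) n λ ())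

  -- Both parts of f are halved as long as 4 divides |f|². In the cases of use |f|² is a power of 4
  -- times 1 or 2, and the remaining sum of two squares is solved by inspection.
  descent : ∀ j x y r → x ℕ.* x ℕ.+ y ℕ.* y ≡ 2 ℕ.^ j ℕ.* 2 ℕ.^ j ℕ.* r →
            ∃₂ λ h k → x ≡ 2 ℕ.^ j ℕ.* h × y ≡ 2 ℕ.^ j ℕ.* k × h ℕ.* h ℕ.+ k ℕ.* k ≡ r
  descent zero x y r eq = x , y , ≡.sym (ℕ.+-identityʳ x) , ≡.sym (ℕ.+-identityʳ y) , ≡.trans eq (ℕ.+-identityʳ r)
  descent (suc j) x y r eq =
    let h , k , x≡ , y≡ , eq′ = even-squares x y (2 ℕ.^ j ℕ.* 2 ℕ.^ j ℕ.* r) (≡.trans eq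
          (solveₙ 2 (λ p r → (conₙ 2 *ₙ p) *ₙ (conₙ 2 *ₙ p) *ₙ r =ₙ conₙ 4 *ₙ (p *ₙ p *ₙ r)) refl (2 ℕ.^ j) r))
        h′ , k′ , h≡ , k≡ , eq″ = descent j h k r eq′
    in h′ , k′ , ≡.trans x≡ (≡.trans (≡.cong (2 ℕ.*_) h≡) (≡.sym (ℕ.*-assoc 2 (2 ℕ.^ j) h′)))
               , ≡.trans y≡ (≡.trans (≡.cong (2 ℕ.*_) k≡) (≡.sym (ℕ.*-assoc 2 (2 ℕ.^ j) k′))) , eq″

  private
    <2 : ∀ x y r → r ℕ.≤ 2 → x ℕ.* x ℕ.+ y ℕ.* y ≡ r → x ≡ 0 ⊎ x ≡ 1
    <2 0 y r _ eq = inj₁ refl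
    <2 1 y r _ eq = inj₂ refl
    <2 x@(suc (suc _)) y r r≤2 eq = contradiction
      (ℕ.≤-trans (ℕ.*-mono-≤ {2} {x} {2} {x} (ℕ.s≤s (ℕ.s≤s ℕ.z≤n)) (ℕ.s≤s (ℕ.s≤s ℕ.z≤n)))
        (ℕ.≤-trans (ℕ.m≤m+n (x ℕ.* x) (y ℕ.* y)) (ℕ.≤-trans (ℕ.≤-reflexive eq) r≤2))) λ { (ℕ.s≤s (ℕ.s≤s ())) }

  square-one : ∀ j x y → x ℕ.* x ℕ.+ y ℕ.* y ≡ 2 ℕ.^ j ℕ.* 2 ℕ.^ j ℕ.* 1 → x ≡ 0 ⊎ x ≡ 2 ℕ.^ j
  square-one j x y eq with descent j x y 1 eq
  ... | h , k , refl , refl , eq′ = Sum.map (λ { refl → ℕ.*-zeroʳ (2 ℕ.^ j) }) (λ { refl → ℕ.*-identityʳ (2 ℕ.^ j) })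
    (<2 h k 1 (ℕ.s≤s ℕ.z≤n) eq′)

  square-two : ∀ j x y → x ℕ.* x ℕ.+ y ℕ.* y ≡ 2 ℕ.^ j ℕ.* 2 ℕ.^ j ℕ.* 2 → x ≡ 2 ℕ.^ j
  square-two j x y eq with descent j x y 2 eq
  ... | h , k , refl , refl , eq′ = one (<2 h k 2 ℕ.≤-refl eq′)
      (<2 k h 2 ℕ.≤-refl (≡.trans (ℕ.+-comm (k ℕ.* k) (h ℕ.* h)) eq′)) eq′
    where
    one : ∀ {h k} → h ≡ 0 ⊎ h ≡ 1 → k ≡ 0 ⊎ k ≡ 1 → h ℕ.* h ℕ.+ k ℕ.* k ≡ 2 → 2 ℕ.^ j ℕ.* h ≡ 2 ℕ.^ j
    one (inj₂ refl) _ _ = ℕ.*-identityʳ (2 ℕ.^ j)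
    one (inj₁ refl) (inj₁ refl) ()
    one (inj₁ refl) (inj₂ refl) ()

  abs-square : ∀ x → + (∣ x ∣ ℕ.* ∣ x ∣) ≡ x ℤ.* x
  abs-square (+ k)       = ℤ.pos-* k k
  abs-square ℤ.-[1+ k ] = refl

  abs-squares : ∀ x y n → x ℤ.* x ℤ.+ y ℤ.* y ≡ + n → ∣ x ∣ ℕ.* ∣ x ∣ ℕ.+ ∣ y ∣ ℕ.* ∣ y ∣ ≡ n
  abs-squares x y n eq = ℤ.+-injective (≡.trans (ℤ.pos-+ (∣ x ∣ ℕ.* ∣ x ∣) (∣ y ∣ ℕ.* ∣ y ∣))
      (≡.trans (≡.cong₂ ℤ._+_ (abs-square x) (abs-square y)) eq))

  abs-cases : ∀ x {k} → ∣ x ∣ ≡ k → x ≡ + k ⊎ x ≡ ℤ.- (+ k)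
  abs-cases (+ k) refl = inj₁ refl
  abs-cases ℤ.-[1+ k ] refl = inj₂ refl

  k₀ : ℕ
  k₀ = proj₁ m≡1+2k

  -- Since q = 2s², the roots √(q/2) and √(2q) in the weights are s and 2s.
  s : ℕ
  s = 2 ℕ.^ k₀

  length≡2s² : length ≡ 2 ℕ.* (s ℕ.* s)
  length≡2s² = ≡.trans (≡.sym q≡1+n) (≡.trans (≡.cong (2 ℕ.^_) (proj₂ m≡1+2k))
    (≡.cong (2 ℕ.*_) (≡.trans (≡.cong (2 ℕ.^_) (≡.trans (ℕ.*-comm k₀ 2) (≡.cong (k₀ ℕ.+_) (ℕ.+-identityʳ k₀))))
      (ℕ.^-distribˡ-+-* 2 k₀ k₀))))

  -- From m ≥ 3. For s = 1 the values 2s and q = 2s² of Re f would coincide.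
  2≤s : 2 ℕ.≤ s
  2≤s with k₀ | proj₂ m≡1+2k
  ... | zero  | eq = contradiction (≡.subst (3 ℕ.≤_) eq 3≤m) λ { (ℕ.s≤s ()) }
  ... | suc k | eq = ℕ.*-monoʳ-≤ 2 (ℕ.m^n>0 2 k)

  -- The ten classes of G, numbered as the relations: the real part of f and the kind of the pair (a, b)

  data Kind : Set where
    null line irreducible reducible : Kind

  HasKind : Kind → Carrier → Carrier → Set (c Level.⊔ ℓ)
  HasKind null        a b = Level.Lift (c Level.⊔ ℓ) (a ≋ 0# × b ≋ 0#)
  HasKind line        a b = Level.Lift (c Level.⊔ ℓ) (¬ a ≋ 0# × b ≋ 0#)
  HasKind irreducible a b = ¬ b ≋ 0# × ¬ ∃ (Cubic a b)
  HasKind reducible   a b = ¬ b ≋ 0# × ∃ (Cubic a b)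

  kind : Fin 10 → Kind
  kind 0F = null
  kind 1F = reducible
  kind 2F = line
  kind 3F = irreducible
  kind 4F = null
  kind 5F = reducible
  kind 6F = irreducible
  kind 7F = line
  kind 8F = reducible
  kind 9F = null

  -- The position of Re f among its seven possible values in increasing order. Two classes of equal
  -- rank differ by the condition b = 0, that is, by membership in the Kerdock code.
  rank : Fin 10 → Fin 7
  rank 0F = 6F
  rank 1F = 5F
  rank 2F = 4F
  rank 3F = 4F
  rank 4F = 3F
  rank 5F = 3F
  rank 6F = 2F
  rank 7F = 2F
  rank 8F = 1F
  rank 9F = 0F

  value : ℤ → Fin 7 → ℤ
  value s 0F = ℤ.- (+ 2 ℤ.* (s ℤ.* s))
  value s 1F = ℤ.- (+ 2 ℤ.* s)
  value s 2F = ℤ.- s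
  value s 3F = + 0
  value s 4F = s
  value s 5F = + 2 ℤ.* s
  value s 6F = + 2 ℤ.* (s ℤ.* s)

  F̂ : ℤ → Fin 10 → ℤ
  F̂ s i = value s (rank i)

  -- The last two fields say that classes 0 and 9 are single points. The first of these gives the
  -- diagonal relation and the injectivity of `word`; both give the transform of `even`.
  record InClass (g : M) (i : Fin 10) : Set (c Level.⊔ ℓ) where
    constructor inClass
    field
      re-f     : re (f g) ≡ F̂ (+ s) i
      hasKind  : HasKind (kind i) (proj₁ (proj₂ g)) (proj₂ (proj₂ g))
      origin   : i ≡ 0F → g ∼ G.ε
      antipode : i ≡ 9F → g ∼ (2F , 0# , 0#)

  step-monotone⇒monotone : ∀ {n} (v : Fin (suc n) → ℤ) → (∀ i → v (Fin.inject₁ i) ℤ.< v (Fin.suc i)) →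
                           ∀ {i j} → i Fin.< j → v i ℤ.< v j
  step-monotone⇒monotone {suc n} v step {0F} {Fin.suc 0F} _ = step 0F
  step-monotone⇒monotone {suc n} v step {0F} {Fin.suc (Fin.suc j)} _ = ℤ.<-trans (step 0F)
    (step-monotone⇒monotone (v ∘ Fin.suc) (step ∘ Fin.suc) {0F} {Fin.suc j} (ℕ.s≤s ℕ.z≤n))
  step-monotone⇒monotone {suc n} v step {Fin.suc i} {Fin.suc j} (ℕ.s≤s i<j) =
    step-monotone⇒monotone (v ∘ Fin.suc) (step ∘ Fin.suc) i<j

  private
    0<s : 0 ℕ.< s
    0<s = ℕ.≤-trans (ℕ.s≤s ℕ.z≤n) 2≤s

    s<2s : + s ℤ.< + 2 ℤ.* + s
    s<2s = ≡.subst (+ s ℤ.<_) (ℤ.pos-* 2 s) (ℤ.+<+ (≡.subst (s ℕ.<_) (≡.cong (s ℕ.+_) (≡.sym (ℕ.+-identityʳ s)))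
        (ℕ.m<m+n s 0<s)))

    2s<2s² : + 2 ℤ.* + s ℤ.< + 2 ℤ.* (+ s ℤ.* + s)
    2s<2s² = ≡.subst₂ ℤ._<_ (ℤ.pos-* 2 s) (≡.trans (ℤ.pos-* 2 (s ℕ.* s)) (≡.cong (+ 2 ℤ.*_) (ℤ.pos-* s s)))
      (ℤ.+<+ (ℕ.*-monoʳ-< 2 (≡.subst (ℕ._< s ℕ.* s) (ℕ.*-identityʳ s) (ℕ.*-monoʳ-< s ⦃ ℕ.>-nonZero 0<s ⦄ 2≤s))))

  value-step : ∀ i → value (+ s) (Fin.inject₁ i) ℤ.< value (+ s) (Fin.suc i)
  value-step 0F = ℤ.neg-mono-< 2s<2s²
  value-step 1F = ℤ.neg-mono-< s<2s
  value-step 2F = ℤ.neg-mono-< {+ 0} {+ s} (ℤ.+<+ 0<s)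
  value-step 3F = ℤ.+<+ 0<s
  value-step 4F = s<2s
  value-step 5F = 2s<2s²

  value-injective : ∀ {i j} → value (+ s) i ≡ value (+ s) j → i ≡ j
  value-injective {i} {j} eq with Fin.<-cmp i j
  ... | tri< i<j _ _ = contradiction (step-monotone⇒monotone (value (+ s)) value-step i<j) (ℤ.<-irrefl eq)
  ... | tri≈ _ i≡j _ = i≡j
  ... | tri> _ _ j<i = contradiction (step-monotone⇒monotone (value (+ s)) value-step j<i) (ℤ.<-irrefl (≡.sym eq))

  inKerdock : Kind → Bool
  inKerdock null        = true
  inKerdock line        = true
  inKerdock irreducible = false
  inKerdock reducible   = false

  hasKind⇒inKerdock : ∀ k {a b} → HasKind k a b → inKerdock k ≡ does (b ≋? 0#)
  hasKind⇒inKerdock null        {b = b} (Level.lift (_ , b≋0)) = ≡.sym (dec-true (b ≋? 0#) b≋0)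
  hasKind⇒inKerdock line        {b = b} (Level.lift (_ , b≋0)) = ≡.sym (dec-true (b ≋? 0#) b≋0)
  hasKind⇒inKerdock irreducible {b = b} (b≢0 , _)              = ≡.sym (dec-false (b ≋? 0#) b≢0)
  hasKind⇒inKerdock reducible   {b = b} (b≢0 , _)              = ≡.sym (dec-false (b ≋? 0#) b≢0)

  class-unique : ∀ {i j} → rank i ≡ rank j → inKerdock (kind i) ≡ inKerdock (kind j) → i ≡ j
  class-unique {i} {j} = from-yes (Fin.all? λ i → Fin.all? λ j →
    (rank i Fin.≟ rank j) →-dec (inKerdock (kind i) Bool.≟ inKerdock (kind j)) →-dec (i Fin.≟ j)) i j

  inClass-unique : ∀ {g i j} → InClass g i → InClass g j → i ≡ j
  inClass-unique {g} {i} {j} I J = class-unique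
    (value-injective (≡.trans (≡.sym (InClass.re-f I)) (InClass.re-f J)))
    (≡.trans (hasKind⇒inKerdock (kind i) (InClass.hasKind I)) (≡.sym (hasKind⇒inKerdock (kind j) (InClass.hasKind J))))

  -- Classification of the elements of G

  E-null : ∀ {a b w} → a ≈ 2# * w → b ≋ 0# → E a b ℂ.≈ ⟦ w ≋? 0# ⟧ ℂ.* Q
  E-null {a} {b} {w} a≈ b≋0 = ℂ.trans (Σ₂.∑-cong (λ x → e-cong (≡.trans (≡.cong₂ _+₄_
      (tr₄-cong (R.trans (*-congʳ a≈) (R.*-assoc 2# w (ω x))))
      (≡.trans (tr-cong (R₂.trans (R₂.*-congʳ b≋0) (R₂.zeroˡ _))) tr-0))
    (≡.trans (ℤ₄.identityʳ _) (tr-cong (R₂.trans (R₂.*-congˡ (ω-≋ x)) (R₂.*-comm w x))))))) (Σ₂-tr w)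

  private
    conj-square : ∀ u → e u ℂ.* conj (e u) ℂ.≈ ℂ.1#
    conj-square u = ℂ.trans (ℂ.*-congˡ (conj-e u)) (ℂ.trans (ℂ.sym (e-+ u (-₄ u)))
        (ℂ.trans (e-cong (ℤ₄.inverseʳ u)) e-0))

  f-norm : ∀ u a b {k} → kernelSum a b ℂ.≈ emb k →
    re (f (u , a , b)) ℤ.* re (f (u , a , b)) ℤ.+ im (f (u , a , b)) ℤ.* im (f (u , a , b)) ≡ + length ℤ.* k
  f-norm u a b {k} kernel≈ = emb-injective (begin
    emb (re (f g) ℤ.* re (f g) ℤ.+ im (f g) ℤ.* im (f g))      ≈⟨ *-conj (f g) ⟨
    f g ℂ.* conj (f g)                                         ≈⟨ ℂ.*-cong (f≈eE u a b)
        (ℂ.trans (conj-cong (f≈eE u a b)) (conj-* (e u) (E a b))) ⟩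
    (e u ℂ.* E a b) ℂ.* (conj (e u) ℂ.* conj (E a b))          ≈⟨ solve 4 (λ x y z t →
      (x ⊗ y) ⊗ (z ⊗ t) ⊜ (x ⊗ z) ⊗ (y ⊗ t))
      ℂ.refl (e u) (E a b) (conj (e u)) (conj (E a b)) ⟩
    (e u ℂ.* conj (e u)) ℂ.* (E a b ℂ.* conj (E a b))          ≈⟨ ℂ.*-cong (conj-square u)
        (ℂ.trans (E-norm a b) (ℂ.*-congˡ kernel≈)) ⟩
    ℂ.1# ℂ.* (Q ℂ.* emb k)                                     ≈⟨ ℂ.trans (ℂ.*-identityˡ _)
        (ℂ.sym (emb-* (+ length) k)) ⟩
    emb (+ length ℤ.* k)                                       ∎)
    where
    open ℂ-Reasoning
    g = (u , a , b)

  private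
    abs-norm : ∀ u a b {k} n → kernelSum a b ℂ.≈ emb (+ k) → length ℕ.* k ≡ n →
      ∣ re (f (u , a , b)) ∣ ℕ.* ∣ re (f (u , a , b)) ∣ ℕ.+ ∣ im (f (u , a , b)) ∣ ℕ.* ∣ im (f (u , a , b)) ∣ ≡ n
    abs-norm u a b {k} n kernel≈ eq = abs-squares (re (f (u , a , b))) (im (f (u , a , b))) n
      (≡.trans (f-norm u a b kernel≈) (≡.trans (≡.sym (ℤ.pos-* length k)) (≡.cong +_ eq)))

    len* : ∀ k n → 2 ℕ.* (s ℕ.* s) ℕ.* k ≡ n → length ℕ.* k ≡ n
    len* k n eq = ≡.trans (≡.cong (ℕ._* k) length≡2s²) eq

  re-±s : ∀ u a b → kernelSum a b ℂ.≈ ℂ.1# → re (f (u , a , b)) ≡ + s ⊎ re (f (u , a , b)) ≡ ℤ.- + s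
  re-±s u a b kernel≈1 = abs-cases (re (f (u , a , b))) (square-two k₀ _ ∣ im (f (u , a , b)) ∣
    (abs-norm u a b {1} _ (ℂ.trans kernel≈1 (ℂ.sym emb-1))
      (len* 1 _ (solveₙ 1 (λ s → conₙ 2 *ₙ (s *ₙ s) *ₙ conₙ 1 =ₙ s *ₙ s *ₙ conₙ 2) refl s))))

  -- Here |f|² = qk is 0, (2s)² or 2(2s)². In the second case one of the real and imaginary parts
  -- vanishes, in the third both have absolute value 2s.
  re-0-or-±2s : ∀ u a b {k} → ZeroTwoFour k → kernelSum a b ℂ.≈ emb k →
    re (f (u , a , b)) ≡ + 0 ⊎ ∣ re (f (u , a , b)) ∣ ≡ 2 ℕ.* s
  re-0-or-±2s u a b zero kernel≈ = inj₁ (ℤ.∣i∣≡0⇒i≡0 ([ id , id ]′ (ℕ.m*n≡0⇒m≡0∨n≡0 ∣ re (f (u , a , b)) ∣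
    (ℕ.m+n≡0⇒m≡0 (∣ re (f (u , a , b)) ∣ ℕ.* ∣ re (f (u , a , b)) ∣)
        (abs-norm u a b {0} 0 kernel≈ (ℕ.*-zeroʳ length))))))
  re-0-or-±2s u a b two kernel≈ = Sum.map ℤ.∣i∣≡0⇒i≡0 id (square-one (suc k₀) _ ∣ im (f (u , a , b)) ∣
    (abs-norm u a b {2} _ kernel≈
      (len* 2 _ (solveₙ 1 (λ s → conₙ 2 *ₙ (s *ₙ s) *ₙ conₙ 2 =ₙ (conₙ 2 *ₙ s) *ₙ (conₙ 2 *ₙ s) *ₙ conₙ 1) refl s))))
  re-0-or-±2s u a b four kernel≈ = inj₂ (square-two (suc k₀) _ ∣ im (f (u , a , b)) ∣
    (abs-norm u a b {4} _ kernel≈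
      (len* 4 _ (solveₙ 1 (λ s → conₙ 2 *ₙ (s *ₙ s) *ₙ conₙ 4 =ₙ (conₙ 2 *ₙ s) *ₙ (conₙ 2 *ₙ s) *ₙ conₙ 2) refl s))))

  kernel-line : ∀ {a b} → ¬ a ≋ 0# → b ≋ 0# → kernelSum a b ℂ.≈ ℂ.1#
  kernel-line {a} {b} a≢0 b≋0 = kernelSum-trivial a b λ {x} κx≋0 → square
      (cancel (certificate₂ {b = (a ² * a ²) * 0#} 1# (x + b * (x ² * x ²)) κx≋0 b≋0
    (solve₂ 3 (λ a b x → (a :* a :* (a :* a)) :* (x :* x) :+ (a :* a :* (a :* a)) :* :0
      := :1 :* ((a :* a :* (a :* a)) :* (x :* x) :+ b :* x
        :+ (b :* b) :* ((x :* x) :* (x :* x)) :+ :0)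
      :+ (x :+ b :* ((x :* x) :* (x :* x))) :* (b :+ :0)) R₂.refl a b x)))
    where
    square : ∀ {x} → x ² ≋ 0# → x ≋ 0#
    square eq = [ id , id ]′ (≋-domain eq)
    cancel : ∀ {y} → (a ² * a ²) * y ≋ (a ² * a ²) * 0# → y ≋ 0#
    cancel = ≋-cancelˡ λ eq → a≢0 (square (square eq))

  kernel-irreducible : ∀ {a b} → ¬ b ≋ 0# → ¬ ∃ (Cubic a b) → kernelSum a b ℂ.≈ ℂ.1#
  kernel-irreducible {a} {b} b≢0 none = kernelSum-trivial a b λ {x} κx≋0 → trivial x κx≋0
    where
    trivial : ∀ x → κ a b x ≋ 0# → x ≋ 0#
    trivial x κx≋0 with x ≋? 0#
    ... | yes eq = eq
    ... | no x≢0 = contradiction (kernel⇒cubic b≢0 x≢0 κx≋0) none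

  cubic? : ∀ a b → Dec (∃ (Cubic a b))
  cubic? a b = HasSize-any? residue-size (λ γ → _ ≋? _) λ {γ} {γ′} eq cubic → R₂.trans
    (R₂.sym (R₂.+-cong (R₂.+-congˡ {1#} (R₂.*-congˡ {a ²} (R₂.*-cong eq eq)))
        (R₂.*-congˡ {b} (R₂.*-cong eq (R₂.*-cong eq eq))))) cubic

  2s≡ : + (2 ℕ.* s) ≡ + 2 ℤ.* + s
  2s≡ = ℤ.pos-* 2 s

  q≡ : + length ≡ + 2 ℤ.* (+ s ℤ.* + s)
  q≡ = ≡.trans (≡.cong +_ length≡2s²) (≡.trans (ℤ.pos-* 2 (s ℕ.* s)) (≡.cong (+ 2 ℤ.*_) (ℤ.pos-* s s)))

  -- For a = 2w and b = 0 the phase is linear in x, so f is iᵘq for w = 0 and 0 otherwise. Class 4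
  -- unites the case w ≠ 0 with the odd values of u.
  classify-null : ∀ u a b → a ≋ 0# → b ≋ 0# → ∃ (InClass (u , a , b))
  classify-null u a b a≋0 b≋0 = let w , a≈ = 2w≈0⇒ a≋0 in go w a≈ u
    where
    go : ∀ w → a ≈ 2# * w → ∀ u → ∃ (InClass (u , a , b))
    go w a≈ u = decide (w ≋? 0#)
     where
     decide : Dec (w ≋ 0#) → ∃ (InClass (u , a , b))
     decide (no w≢0) = 4F , inClass
      (≡.trans (re-cong (ℂ.trans (f≈eE u a b) (ℂ.trans (ℂ.*-congˡ
          (ℂ.trans (E-null a≈ b≋0) (ℂ.trans (ℂ.*-congʳ (⟦⟧-false (w ≋? 0#) w≢0)) (ℂ.zeroˡ Q))))
          (ℂ.trans (ℂ.zeroʳ (e u)) (ℂ.sym emb-0))))) (re-emb (+ 0)))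
      (Level.lift (a≋0 , b≋0)) (λ ()) (λ ())
     decide (yes w≋0) = cases u (ℂ.trans (f≈eE u a b) (ℂ.*-congˡ
         (ℂ.trans (E-null a≈ b≋0) (ℂ.trans (ℂ.*-congʳ (⟦⟧-true (w ≋? 0#) w≋0)) (ℂ.*-identityˡ Q)))))
      where
      a≈0 : a ≈ 0#
      a≈0 = R.trans a≈ (R.trans (double w≋0) (R.zeroʳ 2#))
      cases : ∀ u → f (u , a , b) ℂ.≈ e u ℂ.* Q → ∃ (InClass (u , a , b))
      cases 0F f≈ = 0F , inClass (≡.trans (re-cong (ℂ.trans f≈ (ℂ.trans (ℂ.*-congʳ e-0) (ℂ.*-identityˡ Q))))
          (≡.trans (re-emb _) q≡))
        (Level.lift (a≋0 , b≋0)) (λ _ → refl , a≈0 , b≋0) (λ ())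
      cases 1F f≈ = 4F , inClass (≡.trans (re-cong (ℂ.trans f≈ (ℂ.*-congʳ e-1)))
          (≡.trans (re-𝕚* Q) (≡.cong ℤ.-_ (im-emb _))))
        (Level.lift (a≋0 , b≋0)) (λ ()) (λ ())
      cases 2F f≈ = 9F , inClass (≡.trans (re-cong (ℂ.trans f≈ (ℂ.trans (ℂ.*-congʳ e-2)
          (solve 1 (λ q → ⊖ con (+ 1) ⊗ q ⊜ ⊖ q) ℂ.refl Q))))
          (≡.trans (re-neg Q) (≡.cong ℤ.-_ (≡.trans (re-emb _) q≡))))
        (Level.lift (a≋0 , b≋0)) (λ ()) (λ _ → refl , a≈0 , b≋0)
      cases 3F f≈ = 4F , inClass (≡.trans (re-cong (ℂ.trans f≈
          (ℂ.trans (ℂ.*-congʳ (ℂ.trans (e-+ 1F 2F) (ℂ.*-cong e-1 e-2)))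
          (solve 2 (λ i q → (i ⊗ ⊖ con (+ 1)) ⊗ q ⊜ ⊖ (i ⊗ q)) ℂ.refl 𝕚 Q))))
          (≡.trans (re-neg _) (≡.cong ℤ.-_ (≡.trans (re-𝕚* Q) (≡.cong ℤ.-_ (im-emb _))))))
        (Level.lift (a≋0 , b≋0)) (λ ()) (λ ())

  classify : ∀ g → ∃ (InClass g)
  classify (u , a , b) = go (a ≋? 0#) (b ≋? 0#) (cubic? a b)
    where
    go : Dec (a ≋ 0#) → Dec (b ≋ 0#) → Dec (∃ (Cubic a b)) → ∃ (InClass (u , a , b))
    go (yes a≋0) (yes b≋0) _ = classify-null u a b a≋0 b≋0
    go (no a≢0)  (yes b≋0) _ =
      [ (λ eq → 2F , inClass eq (Level.lift (a≢0 , b≋0)) (λ ()) (λ ()))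
      , (λ eq → 7F , inClass eq (Level.lift (a≢0 , b≋0)) (λ ()) (λ ())) ]′ (re-±s u a b (kernel-line a≢0 b≋0))
    go _ (no b≢0) (no none) =
      [ (λ eq → 3F , inClass eq (b≢0 , none) (λ ()) (λ ()))
      , (λ eq → 6F , inClass eq (b≢0 , none) (λ ()) (λ ())) ]′ (re-±s u a b (kernel-irreducible b≢0 none))
    go _ (no b≢0) (yes cubic@(γ , root)) =
      let y , y≢0 , Ky = cubic⇒kernel b≢0 root
          k , range , kernel≈ = kernelSum-nontrivial a b b≢0 y≢0 Ky
      in [ (λ eq → 5F , inClass eq (b≢0 , cubic) (λ ()) (λ ()))
         , (λ abs → [ (λ eq → 1F , inClass (≡.trans eq 2s≡) (b≢0 , cubic) (λ ()) (λ ()))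
                    , (λ eq → 8F , inClass (≡.trans eq (≡.cong ℤ.-_ 2s≡)) (b≢0 , cubic) (λ ()) (λ ())) ]′
                    (abs-cases (re (f (u , a , b))) abs)) ]′ (re-0-or-±2s u a b range kernel≈)

  abstract
    class : M → Fin 10
    class g = proj₁ (classify g)

    class-spec : ∀ g → InClass g (class g)
    class-spec g = proj₂ (classify g)

  product≢0 : ∀ {x y} → ¬ x ≋ 0# → ¬ y ≋ 0# → ¬ x * y ≋ 0#
  product≢0 x≢0 y≢0 eq = [ x≢0 , y≢0 ]′ (≋-domain eq)

  inv≢0 : ∀ {x} → ¬ x ≋ 0# → ¬ inv x ≋ 0#
  inv≢0 {x} x≢0 eq = 1≋̸0 (R₂.trans (R₂.sym (inv-inverse x≢0)) (R₂.trans (R₂.*-congˡ eq) (R₂.zeroʳ x)))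

  -- Counting the roots of v³ = c(1 + v)²

  root? : ∀ a v → Dec (Root a v)
  root? a v = _ ≋? _

  rootCount : Carrier → 𝔾
  rootCount a = Σ₂.∑ (λ v → ⟦ root? a v ⟧)

  Σ₂-⟦≋⟧ : ∀ y → Σ₂.∑ (λ x → ⟦ x ≋? y ⟧) ℂ.≈ ℂ.1#
  Σ₂-⟦≋⟧ y = ℂ.trans (Σ₂.∑-cong (λ x → ℂ.sym (ℂ.*-identityʳ _))) (Σ₂.∑-δ (λ _ → ℂ.1#) y (λ _ → ℂ.refl))

  rootCount-0 : ∀ a → ¬ ∃ (Root a) → rootCount a ℂ.≈ ℂ.0#
  rootCount-0 a none = Σ₂.∑-0 _ (λ v → ⟦⟧-false (root? a v) (λ r → none (v , r)))

  rootCount-1 : ∀ a → ¬ a ≋ 0# → tr a ≡ 0F → rootCount a ℂ.≈ ℂ.1#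
  rootCount-1 a a≢0 tr≡0 = let v₀ , r₀ = root-exists a≢0 tr≡0 in ℂ.trans
    (Σ₂.∑-cong (λ v → ⟦⟧-cong (root? a v) (v ≋? v₀) (mk⇔
      (λ r → root-unique a≢0 tr≡0 r r₀) (λ eq → root-cong R₂.refl (R₂.sym eq) r₀))))
    (Σ₂-⟦≋⟧ v₀)

  rootCount-3 : ∀ {a v} → ¬ a ≋ 0# → tr a ≡ 2F → Root a v → rootCount a ℂ.≈ emb (+ 3)
  rootCount-3 {a} {v₁} a≢0 tr≡2 r = begin
    rootCount a
      ≈⟨ Σ₂.∑-cong (λ v → ℂ.trans
           (⟦⟧-⊎ (root? a v) (v ≋? v₁) ((v ≋? v₂) ⊎-dec (v ≋? v₃)) complete (λ eq → root-cong R₂.refl (R₂.sym eq) r)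
             [ (λ eq → root-cong R₂.refl (R₂.sym eq) root₂) , (λ eq → root-cong R₂.refl (R₂.sym eq) root₃) ]′
             (λ eq → [ (λ eq′ → v≢v₂ (R₂.trans (R₂.sym eq) eq′)) , (λ eq′ → v≢v₃ (R₂.trans (R₂.sym eq) eq′)) ]′))
           (ℂ.+-congˡ (⟦⟧-⊎ ((v ≋? v₂) ⊎-dec (v ≋? v₃)) (v ≋? v₂) (v ≋? v₃) id inj₁ inj₂
             (λ eq eq′ → v₂≢v₃ (R₂.trans (R₂.sym eq) eq′))))) ⟩
    Σ₂.∑ (λ v → ⟦ v ≋? v₁ ⟧ ℂ.+ (⟦ v ≋? v₂ ⟧ ℂ.+ ⟦ v ≋? v₃ ⟧))
      ≈⟨ ℂ.trans (Σ₂.∑-+ _ _) (ℂ.+-cong (Σ₂-⟦≋⟧ v₁) (ℂ.trans (Σ₂.∑-+ _ _) (ℂ.+-cong (Σ₂-⟦≋⟧ v₂) (Σ₂-⟦≋⟧ v₃)))) ⟩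
    ℂ.1# ℂ.+ (ℂ.1# ℂ.+ ℂ.1#)
      ≈⟨ solve 0 (con (+ 1) ⊕ (con (+ 1) ⊕ con (+ 1)) ⊜ con (+ 3)) ℂ.refl ⟩
    emb (+ 3) ∎
    where open ThreeRoots (three-roots a≢0 tr≡2 r)

  -- The function `V` on L and its values

  ℓ-point : Carrier → Carrier → M
  ℓ-point x y = 0F , 2# * x , y

  ℓ-point-cong : ∀ {x x′ y y′} → x ≋ x′ → y ≋ y′ → ℓ-point x y ∼ ℓ-point x′ y′
  ℓ-point-cong (halve x≋) y≋ = refl , x≋ , y≋

  ℓ-point-injective : ∀ {h α β x y} → h ∼ ℓ-point α β → h ∼ ℓ-point x y → x ≋ α × y ≋ β
  ℓ-point-injective (_ , a≈ , b≋) (_ , a≈′ , b≋′) = halve (R.trans (R.sym a≈′) a≈) , R₂.trans (R₂.sym b≋′) b≋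

  abstract
    _≟_ : ∀ g h → Dec (g ∼ h)
    _≟_ = 𝓕._≟_

  χ-ℓ : ∀ u a b x y → χ (u , a , b) (ℓ-point x y) ℂ.≈ e (tr (a * x)) ℂ.* e (tr (b * y))
  χ-ℓ u a b x y = ℂ.trans (e-cong (≡.trans (≡.cong₂ _+₄_ (u*0 u)
      (≡.cong (_+₄ tr (b * y)) (tr₄-cong (solve₄ 2 (λ a x → a :*₄ (con₄ 2F :*₄ x)
        :=₄ con₄ 2F :*₄ (a :*₄ x)) R.refl a x))))
    (ℤ₄.identityˡ _))) (e-+ _ _)
    where
    u*0 : ∀ u → u *₄ 0F ≡ 0F
    u*0 = from-yes (Fin.all? λ u → (u *₄ 0F) Fin.≟ 0F)

  nz : Carrier → 𝔾
  nz x = ⟦ ¬? (x ≋? 0#) ⟧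

  nz≈ : ∀ x → nz x ℂ.≈ ℂ.1# ℂ.- ⟦ x ≋? 0# ⟧
  nz≈ x = go (x ≋? 0#)
    where
    go : (d : Dec (x ≋ 0#)) → ⟦ ¬? d ⟧ ℂ.≈ ℂ.1# ℂ.- ⟦ d ⟧
    go (yes _) = ℂ.sym (ℂ.-‿inverseʳ ℂ.1#)
    go (no _)  = solve 0 (con (+ 1) ⊜ con (+ 1) ⊖ con (+ 0)) ℂ.refl

  nz-cong : ∀ {x y} → x ≋ y → nz x ℂ.≈ nz y
  nz-cong {x} {y} eq = ⟦⟧-cong (¬? (x ≋? 0#)) (¬? (y ≋? 0#))
    (mk⇔ (λ n y≋0 → n (R₂.trans eq y≋0)) (λ n x≋0 → n (R₂.trans (R₂.sym eq) x≋0)))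

  -- For v ≠ 0 this is 3 if v has trace 0, and 1 if it has trace 1. With one root in the first case
  -- and none or three in the second, the weighted count of roots is always 0 or 3.
  weight : Carrier → 𝔾
  weight v = nz v ℂ.* (emb (+ 2) ℂ.+ e (tr v))

  -- With α = vγ and β = γ³(1 + v)² one has βv³ = α³(1 + v)² identically. So γ and v parametrise
  -- points of L together with a root of their equation.
  B-coordinate : Carrier → Carrier → Carrier
  B-coordinate γ v = (γ * (γ * γ)) * (1# + v) ²

  -- The Fourier transform of V separates reducible from irreducible pairs.
  -- It is supported on the points (0, 2α, β) with α ≠ 0, where it counts, with
  -- weight 3 or 1 according to the trace, the roots v of (α³/β)(1 + v)² = v³.
  V : M → 𝔾
  V h = Σ₂.∑ (λ γ → nz γ ℂ.* Σ₂.∑ (λ v → weight v ℂ.* ⟦ h ≟ ℓ-point (v * γ) (B-coordinate γ v) ⟧))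
        -- Points with β = 0 are reached by v = 1 only, whose weight is 1. This summand raises their
        -- value to 3.
        ℂ.+ emb (+ 2) ℂ.* Σ₂.∑ (λ α → nz α ℂ.* ⟦ h ≟ ℓ-point α 0# ⟧)

  V-resp : 𝓕.Respectful V
  V-resp {g} {h} g∼h = ℂ.+-cong
    (Σ₂.∑-cong (λ γ → ℂ.*-congˡ (Σ₂.∑-cong (λ v → ℂ.*-congˡ (bracket (ℓ-point (v * γ) (B-coordinate γ v)))))))
    (ℂ.*-congˡ (Σ₂.∑-cong (λ α → ℂ.*-congˡ (bracket (ℓ-point α 0#)))))
    where
    bracket : ∀ k → ⟦ g ≟ k ⟧ ℂ.≈ ⟦ h ≟ k ⟧
    bracket k = ⟦⟧-cong (g ≟ k) (h ≟ k) (mk⇔ (G.trans (G.sym g∼h)) (G.trans g∼h))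

  OnL : M → Set _
  OnL h = ∃₂ λ α β → h ∼ ℓ-point α β

  V-off : ∀ h → ¬ OnL h → V h ℂ.≈ ℂ.0#
  V-off h off = ℂ.trans (ℂ.+-cong
      (Σ₂.∑-0 _ (λ γ → ℂ.trans (ℂ.*-congˡ (Σ₂.∑-0 _ (λ v → ℂ.trans (ℂ.*-congˡ (bracket _ _)) (ℂ.zeroʳ _))))
          (ℂ.zeroʳ _)))
      (ℂ.trans (ℂ.*-congˡ (Σ₂.∑-0 _ (λ α → ℂ.trans (ℂ.*-congˡ (bracket _ _)) (ℂ.zeroʳ _)))) (ℂ.zeroʳ _)))
    (ℂ.+-identityʳ ℂ.0#)
    where
    bracket : ∀ x y → ⟦ h ≟ ℓ-point x y ⟧ ℂ.≈ ℂ.0#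
    bracket x y = ⟦⟧-false (h ≟ ℓ-point x y) (λ eq → off (x , y , eq))

  V-null : ∀ {h} β → h ∼ ℓ-point 0# β → V h ℂ.≈ ℂ.0#
  V-null {h} β h∼ = ℂ.trans (ℂ.+-cong
      (Σ₂.∑-0 _ (λ γ → [ (λ γ≋0 → ℂ.trans (ℂ.*-congʳ (vanish γ≋0)) (ℂ.zeroˡ _)) , (λ γ≢0 →
        ℂ.trans (ℂ.*-congˡ (Σ₂.∑-0 _ (λ v → [ (λ v≋0 → ℂ.trans
            (ℂ.*-congʳ (ℂ.trans (ℂ.*-congʳ (vanish v≋0)) (ℂ.zeroˡ _))) (ℂ.zeroˡ _))
          , (λ v≢0 → ℂ.trans (ℂ.*-congˡ (miss {v * γ} {B-coordinate γ v} (product≢0 v≢0 γ≢0))) (ℂ.zeroʳ _)) ]′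
              (dec v)))) (ℂ.zeroʳ _)) ]′ (dec γ)))
      (ℂ.trans (ℂ.*-congˡ (Σ₂.∑-0 _ (λ α → [ (λ α≋0 → ℂ.trans (ℂ.*-congʳ (vanish α≋0)) (ℂ.zeroˡ _))
        , (λ α≢0 → ℂ.trans (ℂ.*-congˡ (miss {α} {0#} α≢0)) (ℂ.zeroʳ _)) ]′ (dec α)))) (ℂ.zeroʳ _)))
    (ℂ.+-identityʳ ℂ.0#)
    where
    dec : ∀ x → x ≋ 0# ⊎ ¬ x ≋ 0#
    dec x with x ≋? 0#
    ... | yes eq = inj₁ eq
    ... | no neq = inj₂ neq
    vanish : ∀ {x} → x ≋ 0# → nz x ℂ.≈ ℂ.0#
    vanish {x} eq = ⟦⟧-false (¬? (x ≋? 0#)) (λ n → n eq)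
    miss : ∀ {x y} → ¬ x ≋ 0# → ⟦ h ≟ ℓ-point x y ⟧ ℂ.≈ ℂ.0#
    miss {x} {y} x≢0 = ⟦⟧-false (h ≟ ℓ-point x y)
      (λ eq → x≢0 (proj₁ (ℓ-point-injective {h} {0#} {β} {x} {y} h∼ eq)))

  ⟦ℓ⟧ : ∀ {h α β} x y → h ∼ ℓ-point α β → ⟦ h ≟ ℓ-point x y ⟧ ℂ.≈ ⟦ x ≋? α ⟧ ℂ.* ⟦ y ≋? β ⟧
  ⟦ℓ⟧ {h} {α} {β} x y h∼ = go (x ≋? α) (y ≋? β)
    where
    go : (d : Dec (x ≋ α)) (d′ : Dec (y ≋ β)) → ⟦ h ≟ ℓ-point x y ⟧ ℂ.≈ ⟦ d ⟧ ℂ.* ⟦ d′ ⟧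
    go (yes x≋) (yes y≋) = ℂ.trans (⟦⟧-true (h ≟ ℓ-point x y) (G.trans {h} {ℓ-point α β} {ℓ-point x y} h∼
        (ℓ-point-cong {α} {x} {β} {y} (R₂.sym x≋) (R₂.sym y≋)))) (ℂ.sym (ℂ.*-identityˡ _))
    go (no x≢) d′ = ℂ.trans (⟦⟧-false (h ≟ ℓ-point x y) (λ eq → x≢
        (proj₁ (ℓ-point-injective {h} {α} {β} {x} {y} h∼ eq))))
      (ℂ.sym (ℂ.zeroˡ _))
    go (yes _) (no y≢) = ℂ.trans (⟦⟧-false (h ≟ ℓ-point x y)
        (λ eq → y≢ (proj₂ (ℓ-point-injective {h} {α} {β} {x} {y} h∼ eq))))
      (ℂ.sym (ℂ.zeroʳ _))

  B-coordinate-cong : ∀ {γ γ′ v v′} → γ ≋ γ′ → v ≋ v′ → B-coordinate γ v ≋ B-coordinate γ′ v′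
  B-coordinate-cong γ≋ v≋ = R₂.*-cong (R₂.*-cong γ≋ (R₂.*-cong γ≋ γ≋)) (R₂.*-cong (R₂.+-congˡ v≋) (R₂.+-congˡ v≋))

  -- For v ≠ 0 the first coordinate determines γ = α/v, so the double sum collapses to a sum over v.
  V-value : ∀ {h α β} → h ∼ ℓ-point α β → ¬ α ≋ 0# →
    V h ℂ.≈ Σ₂.∑ (λ v → weight v ℂ.* ⟦ B-coordinate (α * inv v) v ≋? β ⟧) ℂ.+ emb (+ 2) ℂ.* ⟦ 0# ≋? β ⟧
  V-value {h} {α} {β} h∼ α≢0 = ℂ.+-cong
    (begin
      Σ₂.∑ (λ γ → nz γ ℂ.* Σ₂.∑ (λ v → weight v ℂ.* ⟦ h ≟ ℓ-point (v * γ) (B-coordinate γ v) ⟧))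
        ≈⟨ Σ₂.∑-cong (λ γ → ℂ.sym (Σ₂.∑-*ˡ (nz γ) _)) ⟩
      Σ₂.∑ (λ γ → Σ₂.∑ (λ v → nz γ ℂ.* (weight v ℂ.* ⟦ h ≟ ℓ-point (v * γ) (B-coordinate γ v) ⟧)))
        ≈⟨ Σ₂.∑-cong (λ γ → Σ₂.∑-cong (λ v → term γ v (v ≋? 0#))) ⟩
      Σ₂.∑ (λ γ → Σ₂.∑ (λ v → ⟦ γ ≋? α * inv v ⟧ ℂ.* (weight v ℂ.* ⟦ B-coordinate γ v ≋? β ⟧)))
        ≈⟨ Σ₂.∑-swap _ ⟩
      Σ₂.∑ (λ v → Σ₂.∑ (λ γ → ⟦ γ ≋? α * inv v ⟧ ℂ.* (weight v ℂ.* ⟦ B-coordinate γ v ≋? β ⟧)))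
        ≈⟨ Σ₂.∑-cong (λ v → Σ₂.∑-δ (λ γ → weight v ℂ.* ⟦ B-coordinate γ v ≋? β ⟧) (α * inv v) (λ {γ} {γ′} eq → ℂ.*-congˡ
             (⟦⟧-cong (B-coordinate γ v ≋? β) (B-coordinate γ′ v ≋? β) (mk⇔
               (R₂.trans (B-coordinate-cong (R₂.sym eq) R₂.refl)) (R₂.trans (B-coordinate-cong eq R₂.refl)))))) ⟩
      Σ₂.∑ (λ v → weight v ℂ.* ⟦ B-coordinate (α * inv v) v ≋? β ⟧) ∎)
    (ℂ.*-congˡ (begin
      Σ₂.∑ (λ x → nz x ℂ.* ⟦ h ≟ ℓ-point x 0# ⟧)
        ≈⟨ Σ₂.∑-cong (λ x → ℂ.trans (ℂ.*-congˡ (⟦ℓ⟧ x 0# h∼))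
             (solve 3 (λ n x y → n ⊗ (x ⊗ y) ⊜ x ⊗ (n ⊗ y)) ℂ.refl (nz x) ⟦ x ≋? α ⟧ ⟦ 0# ≋? β ⟧)) ⟩
      Σ₂.∑ (λ x → ⟦ x ≋? α ⟧ ℂ.* (nz x ℂ.* ⟦ 0# ≋? β ⟧))
        ≈⟨ Σ₂.∑-δ (λ x → nz x ℂ.* ⟦ 0# ≋? β ⟧) α (λ eq → ℂ.*-congʳ (nz-cong eq)) ⟩
      nz α ℂ.* ⟦ 0# ≋? β ⟧
        ≈⟨ ℂ.trans (ℂ.*-congʳ (⟦⟧-true (¬? (α ≋? 0#)) α≢0)) (ℂ.*-identityˡ _) ⟩
      ⟦ 0# ≋? β ⟧ ∎))
    where
    term : ∀ γ v → Dec (v ≋ 0#) → nz γ ℂ.* (weight v ℂ.* ⟦ h ≟ ℓ-point (v * γ) (B-coordinate γ v) ⟧) ℂ.≈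
           ⟦ γ ≋? α * inv v ⟧ ℂ.* (weight v ℂ.* ⟦ B-coordinate γ v ≋? β ⟧)
    term γ v (yes v≋0) = ℂ.trans (ℂ.trans (ℂ.*-congˡ (vanish _)) (ℂ.zeroʳ _))
        (ℂ.sym (ℂ.trans (ℂ.*-congˡ (vanish _)) (ℂ.zeroʳ _)))
      where
      vanish : ∀ x → weight v ℂ.* x ℂ.≈ ℂ.0#
      vanish x = ℂ.trans (ℂ.*-congʳ (ℂ.trans (ℂ.*-congʳ (⟦⟧-false (¬? (v ≋? 0#)) (λ n → n v≋0))) (ℂ.zeroˡ _)))
          (ℂ.zeroˡ x)
    term γ v (no v≢0) = begin
      nz γ ℂ.* (weight v ℂ.* ⟦ h ≟ ℓ-point (v * γ) (B-coordinate γ v) ⟧)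
        ≈⟨ ℂ.*-congˡ (ℂ.*-congˡ (⟦ℓ⟧ (v * γ) (B-coordinate γ v) h∼)) ⟩
      nz γ ℂ.* (weight v ℂ.* (⟦ v * γ ≋? α ⟧ ℂ.* ⟦ B-coordinate γ v ≋? β ⟧))
        ≈⟨ solve 4 (λ n w x y → n ⊗ (w ⊗ (x ⊗ y)) ⊜ (n ⊗ x) ⊗ (w ⊗ y)) ℂ.refl
             (nz γ) (weight v) ⟦ v * γ ≋? α ⟧ ⟦ B-coordinate γ v ≋? β ⟧ ⟩
      (nz γ ℂ.* ⟦ v * γ ≋? α ⟧) ℂ.* (weight v ℂ.* ⟦ B-coordinate γ v ≋? β ⟧)
        ≈⟨ ℂ.*-congʳ (solution (v * γ ≋? α)) ⟩
      ⟦ γ ≋? α * inv v ⟧ ℂ.* (weight v ℂ.* ⟦ B-coordinate γ v ≋? β ⟧) ∎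
      where
      to : v * γ ≋ α → γ ≋ α * inv v
      to eq = certificate₂ (inv v) γ eq (inv-inverse v≢0) (solve₂ 4 (λ α v i γ →
        γ :+ α :* i := i :* (v :* γ :+ α) :+ γ :* (v :* i :+ :1)) R₂.refl α v (inv v) γ)
      from : γ ≋ α * inv v → v * γ ≋ α
      from eq = certificate₂ v α eq (inv-inverse v≢0) (solve₂ 4 (λ α v i γ →
        v :* γ :+ α := v :* (γ :+ α :* i) :+ α :* (v :* i :+ :1)) R₂.refl α v (inv v) γ)
      solution : (d : Dec (v * γ ≋ α)) → nz γ ℂ.* ⟦ d ⟧ ℂ.≈ ⟦ γ ≋? α * inv v ⟧
      solution (yes eq) = ℂ.trans (ℂ.*-identityʳ _) (ℂ.trans
        (⟦⟧-true (¬? (γ ≋? 0#)) (λ γ≋0 → α≢0 (R₂.trans (R₂.sym eq) (R₂.trans (R₂.*-congˡ γ≋0) (R₂.zeroʳ v)))))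
        (ℂ.sym (⟦⟧-true (γ ≋? α * inv v) (to eq))))
      solution (no neq) = ℂ.trans (ℂ.zeroʳ _) (ℂ.sym (⟦⟧-false (γ ≋? α * inv v) (neq ∘ from)))

  0-or-3 : 𝔾 → Set
  0-or-3 x = x ℂ.≈ ℂ.0# ⊎ x ℂ.≈ emb (+ 3)

  -- For β ≠ 0 the weight is constant on the roots, since they all have the trace of d = α³/β. The
  -- products of weight and number of roots are 3·1, 1·3 and 1·0.
  V-0-or-3 : ∀ {h α β} → h ∼ ℓ-point α β → ¬ α ≋ 0# → 0-or-3 (V h)
  V-0-or-3 {h} {α} {β} h∼ α≢0 = go (β ≋? 0#)
    where
    go : Dec (β ≋ 0#) → 0-or-3 (V h)
    go (yes β≋0) = inj₂ (begin
      V h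
        ≈⟨ V-value h∼ α≢0 ⟩
      Σ₂.∑ (λ v → weight v ℂ.* ⟦ B-coordinate (α * inv v) v ≋? β ⟧) ℂ.+ emb (+ 2) ℂ.* ⟦ 0# ≋? β ⟧
        ≈⟨ ℂ.+-cong (Σ₂.∑-cong (λ v → term v (v ≋? 0#))) (ℂ.trans (ℂ.*-congˡ (⟦⟧-true (0# ≋? β) (R₂.sym β≋0)))
            (ℂ.*-identityʳ _)) ⟩
      Σ₂.∑ (λ v → ⟦ v ≋? 1# ⟧ ℂ.* weight v) ℂ.+ emb (+ 2)
        ≈⟨ ℂ.+-congʳ (Σ₂.∑-δ weight 1# weight-cong) ⟩
      weight 1# ℂ.+ emb (+ 2)
        ≈⟨ ℂ.+-congʳ (ℂ.*-cong (⟦⟧-true (¬? (1# ≋? 0#)) 1≋̸0) (ℂ.+-congˡ (ℂ.trans (e-cong tr-1) e-2))) ⟩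
      ℂ.1# ℂ.* (emb (+ 2) ℂ.+ ℂ.- ℂ.1#) ℂ.+ emb (+ 2)
        ≈⟨ solve 0 (con (+ 1) ⊗ (con (+ 2) ⊕ ⊖ con (+ 1)) ⊕ con (+ 2) ⊜ con (+ 3)) ℂ.refl ⟩
      emb (+ 3) ∎)
      where
      weight-cong : Σ₂.Respectful weight
      weight-cong eq = ℂ.*-cong (nz-cong eq) (ℂ.+-congˡ (e-cong (tr-cong eq)))
      term : ∀ v → Dec (v ≋ 0#) → weight v ℂ.* ⟦ B-coordinate (α * inv v) v ≋? β ⟧ ℂ.≈ ⟦ v ≋? 1# ⟧ ℂ.* weight v
      term v (yes v≋0) = ℂ.trans (ℂ.*-congʳ w≈0) (ℂ.trans (ℂ.zeroˡ _) (ℂ.sym (ℂ.trans (ℂ.*-congˡ w≈0) (ℂ.zeroʳ _))))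
        where
        w≈0 : weight v ℂ.≈ ℂ.0#
        w≈0 = ℂ.trans (ℂ.*-congʳ (⟦⟧-false (¬? (v ≋? 0#)) (λ n → n v≋0))) (ℂ.zeroˡ _)
      term v (no v≢0) = ℂ.trans (ℂ.*-comm _ _) (ℂ.*-congʳ (⟦⟧-cong (B-coordinate (α * inv v) v ≋? β) (v ≋? 1#)
          (mk⇔ to from)))
        where
        αi≢0 : ¬ α * inv v ≋ 0#
        αi≢0 = product≢0 α≢0 (inv≢0 v≢0)
        to : B-coordinate (α * inv v) v ≋ β → v ≋ 1#
        to eq = [ (λ z → contradiction z (product≢0 αi≢0 (product≢0 αi≢0 αi≢0)))
                , (λ z → R₂.sym (≋-+≋0 ([ id , id ]′ (≋-domain z)))) ]′ (≋-domain (R₂.trans eq β≋0))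
        from : v ≋ 1# → B-coordinate (α * inv v) v ≋ β
        from eq = R₂.trans (R₂.*-congˡ (R₂.*-cong 1+v≋0 1+v≋0)) (R₂.trans
          (solve₂ 1 (λ x → x :* (:0 :* :0) := :0) R₂.refl _) (R₂.sym β≋0))
          where
          1+v≋0 : 1# + v ≋ 0#
          1+v≋0 = ≋⇒+≋0 (R₂.sym eq)
    go (no β≢0) = [ (λ tr≡0 → inj₂ (ℂ.trans V≈ (ℂ.trans (ℂ.*-cong (ℂ.+-congˡ (ℂ.trans (e-cong tr≡0) e-0))
        (rootCount-1 d d≢0 tr≡0))
                      (solve 0 ((con (+ 2) ⊕ con (+ 1)) ⊗ con (+ 1) ⊜ con (+ 3)) ℂ.refl))))
                  , (λ tr≡2 → case-2 tr≡2 (HasSize-any? residue-size (root? d) (root-cong R₂.refl))) ]′ (tr₄-2*-even d)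
      where
      d = (α * (α * α)) * inv β
      d≢0 : ¬ d ≋ 0#
      d≢0 = product≢0 (product≢0 α≢0 (product≢0 α≢0 α≢0)) (inv≢0 β≢0)
      V≈ : V h ℂ.≈ (emb (+ 2) ℂ.+ e (tr d)) ℂ.* rootCount d
      V≈ = begin
        V h
          ≈⟨ V-value h∼ α≢0 ⟩
        Σ₂.∑ (λ v → weight v ℂ.* ⟦ B-coordinate (α * inv v) v ≋? β ⟧) ℂ.+ emb (+ 2) ℂ.* ⟦ 0# ≋? β ⟧
          ≈⟨ ℂ.+-cong (Σ₂.∑-cong (λ v → term v (v ≋? 0#))) (ℂ.*-congˡ (⟦⟧-false (0# ≋? β) (β≢0 ∘ R₂.sym))) ⟩
        Σ₂.∑ (λ v → (emb (+ 2) ℂ.+ e (tr d)) ℂ.* ⟦ root? d v ⟧) ℂ.+ emb (+ 2) ℂ.* ℂ.0#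
          ≈⟨ ℂ.trans (ℂ.+-cong (Σ₂.∑-*ˡ _ _) (ℂ.zeroʳ _)) (ℂ.+-identityʳ _) ⟩
        (emb (+ 2) ℂ.+ e (tr d)) ℂ.* rootCount d ∎
        where
        term : ∀ v → Dec (v ≋ 0#) → weight v ℂ.* ⟦ B-coordinate (α * inv v) v ≋? β ⟧ ℂ.≈ (emb (+ 2) ℂ.+ e (tr d)) ℂ.*
            ⟦ root? d v ⟧
        term v (yes v≋0) = ℂ.trans (ℂ.*-congʳ (ℂ.trans (ℂ.*-congʳ (⟦⟧-false (¬? (v ≋? 0#)) (λ n → n v≋0)))
            (ℂ.zeroˡ _))) (ℂ.trans (ℂ.zeroˡ _)
          (ℂ.sym (ℂ.trans (ℂ.*-congˡ (⟦⟧-false (root? d v) (λ r → root≢0 d≢0 r v≋0))) (ℂ.zeroʳ _))))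
        term v (no v≢0) = branch (root? d v)
          where
          A = α * (α * α)
          w = (1# + v) ²
          p = v * (v * v)
          r = inv v * (inv v * inv v)
          pr≋1 : p * r ≋ 1#
          pr≋1 = R₂.trans (solve₂ 2 (λ v i → v :* (v :* v) :* (i :* (i :* i))
            := (v :* i) :* ((v :* i) :* (v :* i))) R₂.refl v (inv v))
            (R₂.trans (R₂.*-cong vi≋1 (R₂.*-cong vi≋1 vi≋1)) (R₂.trans (R₂.*-identityˡ _) (R₂.*-identityˡ 1#)))
            where
            vi≋1 = inv-inverse v≢0
          B≋ : B-coordinate (α * inv v) v ≋ A * r * w
          B≋ = R₂.*-congʳ (solve₂ 2 (λ α i → (α :* i) :* ((α :* i) :* (α :* i))
            := (α :* (α :* α)) :* (i :* (i :* i))) R₂.refl α (inv v))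
          to : B-coordinate (α * inv v) v ≋ β → Root d v
          to eq = certificate₃ (p * inv β) p (A * inv β * w) (R₂.trans (R₂.sym B≋) eq) (inv-inverse β≢0) pr≋1
            (solve₂ 6 (λ A w β p r j → p :+ (A :* j) :* w
              := (p :* j) :* (A :* r :* w :+ β)
              :+ (p :* (β :* j :+ :1) :+ (A :* j :* w) :* (p :* r :+ :1)))
              R₂.refl A w β p r (inv β))
          from : Root d v → B-coordinate (α * inv v) v ≋ β
          from root = R₂.trans B≋ (certificate₃ (β * r) (A * r * w) β root (inv-inverse β≢0) pr≋1
            (solve₂ 6 (λ A w β p r j → A :* r :* w :+ β
              := (β :* r) :* (p :+ (A :* j) :* w)
              :+ ((A :* r :* w) :* (β :* j :+ :1) :+ β :* (p :* r :+ :1)))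
              R₂.refl A w β p r (inv β)))
          branch : (r? : Dec (Root d v)) → weight v ℂ.* ⟦ B-coordinate (α * inv v) v ≋? β ⟧ ℂ.≈
              (emb (+ 2) ℂ.+ e (tr d)) ℂ.* ⟦ r? ⟧
          branch (yes r) = ℂ.*-cong (ℂ.trans (ℂ.*-congʳ (⟦⟧-true (¬? (v ≋? 0#)) v≢0)) (ℂ.trans (ℂ.*-identityˡ _)
              (ℂ.+-congˡ (e-cong (tr-root r)))))
            (⟦⟧-true (B-coordinate (α * inv v) v ≋? β) (from r))
          branch (no ¬r) = ℂ.trans (ℂ.*-congˡ (⟦⟧-false (B-coordinate (α * inv v) v ≋? β) (¬r ∘ to)))
              (ℂ.trans (ℂ.zeroʳ _) (ℂ.sym (ℂ.zeroʳ _)))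
      case-2 : tr d ≡ 2F → Dec (∃ (Root d)) → 0-or-3 (V h)
      case-2 tr≡2 (yes (v , r)) = inj₂ (ℂ.trans V≈ (ℂ.trans
        (ℂ.*-cong (ℂ.+-congˡ (ℂ.trans (e-cong tr≡2) e-2)) (rootCount-3 d≢0 tr≡2 r))
        (solve 0 ((con (+ 2) ⊕ ⊖ con (+ 1)) ⊗ con (+ 3) ⊜ con (+ 3)) ℂ.refl)))
      case-2 tr≡2 (no none) = inj₁ (ℂ.trans V≈ (ℂ.trans (ℂ.*-congˡ (rootCount-0 d none)) (ℂ.zeroʳ _)))

  -- The Fourier transform of `V`

  hat-Σ₂ : ∀ (φ : Carrier → M → 𝔾) g → 𝓕.hat (λ h → Σ₂.∑ (λ x → φ x h)) g ℂ.≈ Σ₂.∑ (λ x → 𝓕.hat (φ x) g)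
  hat-Σ₂ φ g = ℂ.trans (𝓕.hat-cong (λ h → Σ₂.∑≈sum (λ x → φ x h)) g)
    (ℂ.trans (𝓕.hat-sum (λ k h → φ (τ k) h) g) (ℂ.sym (Σ₂.∑≈sum (λ x → 𝓕.hat (φ x) g))))

  hat-⟦≟⟧ : ∀ k g → 𝓕.hat (λ h → ⟦ h ≟ k ⟧) g ℂ.≈ χ g k
  hat-⟦≟⟧ k g = ℂ.trans (𝓕.hat-cong (λ h → ⟦⟧-cong (h ≟ k) (h 𝓕.≟ k) (mk⇔ id id)) g) (𝓕.hat-δ k g)

  hat-V : ∀ u a b → 𝓕.hat V (u , a , b) ℂ.≈
    Σ₂.∑ (λ γ → nz γ ℂ.* Σ₂.∑ (λ v → weight v ℂ.* (e (tr (a * (v * γ))) ℂ.* e (tr (b * B-coordinate γ v)))))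
    ℂ.+ emb (+ 2) ℂ.* Σ₂.∑ (λ α → nz α ℂ.* (e (tr (a * α)) ℂ.* e (tr (b * 0#))))
  hat-V u a b = ℂ.trans (𝓕.hat-+ _ _ g) (ℂ.+-cong
    (ℂ.trans (hat-Σ₂ (λ γ h → nz γ ℂ.* Σ₂.∑ (λ v → weight v ℂ.* ⟦ h ≟ ℓ-point (v * γ) (B-coordinate γ v) ⟧)) g)
      (Σ₂.∑-cong (λ γ → ℂ.trans (𝓕.hat-* (nz γ) (λ h → Σ₂.∑ (λ v → weight v ℂ.* ⟦ h ≟ ℓ-point (v * γ)
          (B-coordinate γ v) ⟧)) g)
        (ℂ.*-congˡ (ℂ.trans (hat-Σ₂ (λ v h → weight v ℂ.* ⟦ h ≟ ℓ-point (v * γ) (B-coordinate γ v) ⟧) g)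
          (Σ₂.∑-cong (λ v → ℂ.trans (𝓕.hat-* (weight v) (λ h → ⟦ h ≟ ℓ-point (v * γ) (B-coordinate γ v) ⟧) g)
            (ℂ.*-congˡ (ℂ.trans (hat-⟦≟⟧ (ℓ-point (v * γ) (B-coordinate γ v)) g)
                (χ-ℓ u a b (v * γ) (B-coordinate γ v)))))))))))
    (ℂ.trans (𝓕.hat-* (emb (+ 2)) (λ h → Σ₂.∑ (λ α → nz α ℂ.* ⟦ h ≟ ℓ-point α 0# ⟧)) g)
      (ℂ.*-congˡ (ℂ.trans (hat-Σ₂ (λ α h → nz α ℂ.* ⟦ h ≟ ℓ-point α 0# ⟧) g)
        (Σ₂.∑-cong (λ α → ℂ.trans (𝓕.hat-* (nz α) (λ h → ⟦ h ≟ ℓ-point α 0# ⟧) g)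
          (ℂ.*-congˡ (ℂ.trans (hat-⟦≟⟧ (ℓ-point α 0#) g) (χ-ℓ u a b α 0#)))))))))
    where
    g : M
    g = (u , a , b)

  cube : Carrier → Carrier
  cube x = x * (x * x)

  -- The coefficient of v in the trace argument, after tr(bγ³v²) has been rewritten as tr(v√(bγ³)).
  -- Its square is γ²(a² + bγ), and (1 + slope)² is the cubic 1 + a²γ² + bγ³; so the brackets in
  -- `inner-sum` pick out a²/b and the roots of the cubic.
  slope : Carrier → Carrier → Carrier → Carrier
  slope a b γ = a * γ + sqrt (b * cube γ)

  Eγ : Carrier → Carrier → 𝔾
  Eγ b γ = e (tr (b * cube γ))

  Σ₂-nz : ∀ f → Σ₂.Respectful f → Σ₂.∑ (λ x → nz x ℂ.* f x) ℂ.≈ Σ₂.∑ f ℂ.- f 0#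
  Σ₂-nz f f-resp = begin
    Σ₂.∑ (λ x → nz x ℂ.* f x)
      ≈⟨ Σ₂.∑-cong (λ x → ℂ.trans (ℂ.*-congʳ (nz≈ x)) (solve 2 (λ d y → (con (+ 1) ⊖ d) ⊗ y ⊜ y ⊕ con (ℤ.- + 1) ⊗
          (d ⊗ y)) ℂ.refl ⟦ x ≋? 0# ⟧ (f x))) ⟩
    Σ₂.∑ (λ x → f x ℂ.+ emb (ℤ.- + 1) ℂ.* (⟦ x ≋? 0# ⟧ ℂ.* f x))
      ≈⟨ ℂ.trans (Σ₂.∑-+ _ _) (ℂ.+-congˡ (ℂ.trans (Σ₂.∑-*ˡ _ _) (ℂ.*-congˡ (Σ₂.∑-δ f 0# f-resp)))) ⟩
    Σ₂.∑ f ℂ.+ emb (ℤ.- + 1) ℂ.* f 0#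
      ≈⟨ solve 2 (λ x y → x ⊕ con (ℤ.- + 1) ⊗ y ⊜ x ⊖ y) ℂ.refl _ _ ⟩
    Σ₂.∑ f ℂ.- f 0# ∎

  e-tr-0 : ∀ {x} → x ≋ 0# → e (tr x) ℂ.≈ ℂ.1#
  e-tr-0 x≋0 = ℂ.trans (e-cong (≡.trans (tr-cong x≋0) tr-0)) e-0

  e-tr-+ : ∀ x y → e (tr (x + y)) ℂ.≈ e (tr x) ℂ.* e (tr y)
  e-tr-+ x y = ℂ.trans (e-cong (tr-+ x y)) (e-+ _ _)

  -- The arguments of the characters are linear in v, up to squares.
  inner-sum : ∀ a b γ →
    Σ₂.∑ (λ v → weight v ℂ.* (e (tr (a * (v * γ))) ℂ.* e (tr (b * B-coordinate γ v)))) ℂ.≈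
    Eγ b γ ℂ.* (emb (+ 2) ℂ.* (⟦ slope a b γ ≋? 0# ⟧ ℂ.* Q) ℂ.+ ⟦ 1# + slope a b γ ≋? 0# ⟧ ℂ.* Q ℂ.- emb (+ 3))
  inner-sum a b γ = begin
    Σ₂.∑ (λ v → weight v ℂ.* (e (tr (a * (v * γ))) ℂ.* e (tr (b * B-coordinate γ v))))
      ≈⟨ Σ₂.∑-cong (λ v → ℂ.trans (ℂ.*-congˡ (ℂ.trans (ℂ.sym (e-tr-+ _ _)) (ℂ.trans (e-cong (linearise v)) (e-+ _ _))))
           (solve 4 (λ n t p y → (n ⊗ t) ⊗ (p ⊗ y) ⊜ p ⊗ (n ⊗ (t ⊗ y))) ℂ.refl (nz v) (emb (+ 2) ℂ.+ e (tr v))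
               (Eγ b γ) (e (tr (v * k))))) ⟩
    Σ₂.∑ (λ v → Eγ b γ ℂ.* (nz v ℂ.* F v))
      ≈⟨ ℂ.trans (Σ₂.∑-*ˡ (Eγ b γ) _) (ℂ.*-congˡ (Σ₂-nz F F-resp)) ⟩
    Eγ b γ ℂ.* (Σ₂.∑ F ℂ.- F 0#)
      ≈⟨ ℂ.*-congˡ (ℂ.+-cong ΣF (ℂ.-‿cong F0)) ⟩
    Eγ b γ ℂ.* (emb (+ 2) ℂ.* (⟦ k ≋? 0# ⟧ ℂ.* Q) ℂ.+ ⟦ 1# + k ≋? 0# ⟧ ℂ.* Q ℂ.- emb (+ 3)) ∎
    where
    k = slope a b γ
    σ = sqrt (b * cube γ)
    F : Carrier → 𝔾
    F v = (emb (+ 2) ℂ.+ e (tr v)) ℂ.* e (tr (v * k))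
    F-resp : Σ₂.Respectful F
    F-resp eq = ℂ.*-cong (ℂ.+-congˡ (e-cong (tr-cong eq))) (e-cong (tr-cong (R₂.*-congʳ eq)))
    linearise : ∀ v → tr (a * (v * γ) + b * B-coordinate γ v) ≡ tr (b * cube γ) +₄ tr (v * k)
    linearise v = ≡.trans (tr-cong (solve₂ 4 (λ a b γ v →
        a :* (v :* γ) :+ b :* ((γ :* (γ :* γ)) :* ((:1 :+ v) :* (:1 :+ v)))
        := b :* (γ :* (γ :* γ)) :+ (v :* (a :* γ) :+ (b :* (γ :* (γ :* γ))) :* (v :* v))) R₂.refl a b γ v))
      (≡.trans (tr-+ _ _) (≡.cong (tr (b * cube γ) +₄_) (≡.trans (tr-+ _ _) (≡.trans
        (≡.cong (tr (v * (a * γ)) +₄_) (≡.trans (tr-cong (R₂.trans (R₂.*-congʳ (R₂.sym (sqrt² (b * cube γ))))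
          (solve₂ 2 (λ σ v → (σ :* σ) :* (v :* v) := (v :* σ) :* (v :* σ)) R₂.refl σ v))) (tr-² (v * σ))))
        (≡.trans (≡.sym (tr-+ _ _)) (tr-cong (R₂.sym (R₂.distribˡ v (a * γ) σ))))))))
    F0 : F 0# ℂ.≈ emb (+ 3)
    F0 = ℂ.trans (ℂ.*-cong (ℂ.+-congˡ (e-tr-0 R₂.refl)) (e-tr-0 (R₂.zeroˡ k)))
        (solve 0 ((con (+ 2) ⊕ con (+ 1)) ⊗ con (+ 1) ⊜ con (+ 3)) ℂ.refl)
    ΣF : Σ₂.∑ F ℂ.≈ emb (+ 2) ℂ.* (⟦ k ≋? 0# ⟧ ℂ.* Q) ℂ.+ ⟦ 1# + k ≋? 0# ⟧ ℂ.* Q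
    ΣF = begin
      Σ₂.∑ F
        ≈⟨ Σ₂.∑-cong (λ v → ℂ.trans (ℂ.distribʳ _ _ _) (ℂ.+-congˡ (ℂ.trans (ℂ.sym (e-tr-+ v (v * k)))
             (e-cong (tr-cong (solve₂ 2 (λ v k → v :+ v :* k := v :* (:1 :+ k)) R₂.refl v k)))))) ⟩
      Σ₂.∑ (λ v → emb (+ 2) ℂ.* e (tr (v * k)) ℂ.+ e (tr (v * (1# + k))))
        ≈⟨ ℂ.trans (Σ₂.∑-+ _ _) (ℂ.+-cong (ℂ.trans (Σ₂.∑-*ˡ _ _) (ℂ.*-congˡ (Σ₂-tr k))) (Σ₂-tr (1# + k))) ⟩
      emb (+ 2) ℂ.* (⟦ k ≋? 0# ⟧ ℂ.* Q) ℂ.+ ⟦ 1# + k ≋? 0# ⟧ ℂ.* Q ∎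

  main-term : Carrier → Carrier → Carrier → 𝔾
  main-term a b γ = Eγ b γ ℂ.* (emb (+ 2) ℂ.* (⟦ slope a b γ ≋? 0# ⟧ ℂ.* Q) ℂ.+ ⟦ 1# + slope a b γ ≋? 0# ⟧ ℂ.* Q
      ℂ.- emb (+ 3))

  hat-V′ : ∀ u a b → 𝓕.hat V (u , a , b) ℂ.≈
    Σ₂.∑ (λ γ → nz γ ℂ.* main-term a b γ) ℂ.+ emb (+ 2) ℂ.* (⟦ a ≋? 0# ⟧ ℂ.* Q ℂ.- ℂ.1#)
  hat-V′ u a b = ℂ.trans (hat-V u a b) (ℂ.+-cong
    (Σ₂.∑-cong (λ γ → ℂ.*-congˡ (inner-sum a b γ)))
    (ℂ.*-congˡ (begin
      Σ₂.∑ (λ α → nz α ℂ.* (e (tr (a * α)) ℂ.* e (tr (b * 0#))))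
        ≈⟨ Σ₂.∑-cong (λ α → ℂ.*-congˡ (ℂ.trans (ℂ.*-congˡ (e-tr-0 (R₂.zeroʳ b)))
            (ℂ.trans (ℂ.*-identityʳ _) (e-cong (tr-cong (R₂.*-comm a α)))))) ⟩
      Σ₂.∑ (λ α → nz α ℂ.* e (tr (α * a)))
        ≈⟨ Σ₂-nz (λ α → e (tr (α * a))) (λ eq → e-cong (tr-cong (R₂.*-congʳ eq))) ⟩
      Σ₂.∑ (λ α → e (tr (α * a))) ℂ.- e (tr (0# * a))
        ≈⟨ ℂ.+-cong (Σ₂-tr a) (ℂ.-‿cong (e-tr-0 (R₂.zeroˡ a))) ⟩
      ⟦ a ≋? 0# ⟧ ℂ.* Q ℂ.- ℂ.1# ∎)))

  Σ₂-nz-const : ∀ x → Σ₂.∑ (λ γ → nz γ ℂ.* x) ℂ.≈ Q ℂ.* x ℂ.- x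
  Σ₂-nz-const x = ℂ.trans (Σ₂-nz (λ _ → x) (λ _ → ℂ.refl)) (ℂ.+-congʳ (Σ₂.∑-const x))

  slope-b≋0 : ∀ {a b} γ → b ≋ 0# → slope a b γ ≋ a * γ
  slope-b≋0 {a} {b} γ b≋0 = R₂.trans (R₂.+-congˡ σ≋0) (R₂.+-identityʳ _)
    where
    σ≋0 : sqrt (b * cube γ) ≋ 0#
    σ≋0 = [ id , id ]′ (≋-domain (R₂.trans (sqrt² (b * cube γ)) (R₂.trans (R₂.*-congʳ b≋0) (R₂.zeroˡ (cube γ)))))

  main-term-b≋0 : ∀ {a b} γ → b ≋ 0# → main-term a b γ ℂ.≈
    emb (+ 2) ℂ.* (⟦ a * γ ≋? 0# ⟧ ℂ.* Q) ℂ.+ ⟦ 1# + a * γ ≋? 0# ⟧ ℂ.* Q ℂ.- emb (+ 3)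
  main-term-b≋0 {a} {b} γ b≋0 = ℂ.trans (ℂ.*-congʳ (e-tr-0 (R₂.trans (R₂.*-congʳ b≋0) (R₂.zeroˡ (cube γ)))))
      (ℂ.trans (ℂ.*-identityˡ _)
    (ℂ.+-congʳ (ℂ.+-cong
      (ℂ.*-congˡ (ℂ.*-congʳ (⟦⟧-cong (slope a b γ ≋? 0#) (a * γ ≋? 0#) (mk⇔ (R₂.trans (R₂.sym k≋)) (R₂.trans k≋)))))
      (ℂ.*-congʳ (⟦⟧-cong (1# + slope a b γ ≋? 0#) (1# + a * γ ≋? 0#)
        (mk⇔ (R₂.trans (R₂.+-congˡ (R₂.sym k≋))) (R₂.trans (R₂.+-congˡ k≋))))))))
    where
    k≋ : slope a b γ ≋ a * γ
    k≋ = slope-b≋0 γ b≋0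

  -- The kinds `line` and `irreducible` share a value; the transform of `ψ 1F`, which detects b = 0,
  -- tells them apart.
  Ŷ-kind : Kind → 𝔾
  Ŷ-kind null        = (Q ℂ.- ℂ.1#) ℂ.* (emb (+ 2) ℂ.* Q ℂ.- ℂ.1#)
  Ŷ-kind line        = ℂ.1# ℂ.- emb (+ 2) ℂ.* Q
  Ŷ-kind irreducible = ℂ.1# ℂ.- emb (+ 2) ℂ.* Q
  Ŷ-kind reducible   = Q ℂ.+ ℂ.1#

  hat-V-null : ∀ u {a b} → a ≋ 0# → b ≋ 0# → 𝓕.hat V (u , a , b) ℂ.≈ Ŷ-kind null
  hat-V-null u {a} {b} a≋0 b≋0 = begin
    𝓕.hat V (u , a , b)
      ≈⟨ hat-V′ u a b ⟩
    Σ₂.∑ (λ γ → nz γ ℂ.* main-term a b γ) ℂ.+ emb (+ 2) ℂ.* (⟦ a ≋? 0# ⟧ ℂ.* Q ℂ.- ℂ.1#)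
      ≈⟨ ℂ.+-cong (ℂ.trans (Σ₂.∑-cong (λ γ → ℂ.*-congˡ (term γ))) (Σ₂-nz-const (emb (+ 2) ℂ.* Q ℂ.- emb (+ 3))))
           (ℂ.*-congˡ (ℂ.+-congʳ (ℂ.trans (ℂ.*-congʳ (⟦⟧-true (a ≋? 0#) a≋0)) (ℂ.*-identityˡ Q)))) ⟩
    (Q ℂ.* (emb (+ 2) ℂ.* Q ℂ.- emb (+ 3)) ℂ.- (emb (+ 2) ℂ.* Q ℂ.- emb (+ 3))) ℂ.+ emb (+ 2) ℂ.* (Q ℂ.- ℂ.1#)
      ≈⟨ solve 1 (λ q → (q ⊗ (con (+ 2) ⊗ q ⊖ con (+ 3)) ⊖ (con (+ 2) ⊗ q ⊖ con (+ 3))) ⊕ con (+ 2) ⊗ (q ⊖ con (+ 1))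
           ⊜ (q ⊖ con (+ 1)) ⊗ (con (+ 2) ⊗ q ⊖ con (+ 1))) ℂ.refl Q ⟩
    Ŷ-kind null ∎
    where
    aγ≋0 : ∀ γ → a * γ ≋ 0#
    aγ≋0 γ = R₂.trans (R₂.*-congʳ a≋0) (R₂.zeroˡ γ)
    term : ∀ γ → main-term a b γ ℂ.≈ emb (+ 2) ℂ.* Q ℂ.- emb (+ 3)
    term γ = ℂ.trans (main-term-b≋0 γ b≋0) (ℂ.+-congʳ (ℂ.trans (ℂ.+-cong
      (ℂ.*-congˡ (ℂ.trans (ℂ.*-congʳ (⟦⟧-true (a * γ ≋? 0#) (aγ≋0 γ))) (ℂ.*-identityˡ Q)))
      (ℂ.trans (ℂ.*-congʳ (⟦⟧-false (1# + a * γ ≋? 0#) (λ eq → 1≋̸0 (R₂.trans (≋-+≋0 eq) (aγ≋0 γ))))) (ℂ.zeroˡ Q)))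
          (ℂ.+-identityʳ _)))

  hat-V-line : ∀ u {a b} → ¬ a ≋ 0# → b ≋ 0# → 𝓕.hat V (u , a , b) ℂ.≈ Ŷ-kind line
  hat-V-line u {a} {b} a≢0 b≋0 = begin
    𝓕.hat V (u , a , b)
      ≈⟨ hat-V′ u a b ⟩
    Σ₂.∑ (λ γ → nz γ ℂ.* main-term a b γ) ℂ.+ emb (+ 2) ℂ.* (⟦ a ≋? 0# ⟧ ℂ.* Q ℂ.- ℂ.1#)
      ≈⟨ ℂ.+-cong (ℂ.trans (Σ₂.∑-cong (λ γ → term γ (γ ≋? 0#))) (ℂ.trans (Σ₂.∑-+ _ _)
             (ℂ.+-cong (ℂ.trans (Σ₂.∑-*ʳ Q _) (ℂ.*-congʳ (Σ₂-⟦≋⟧ (inv a)))) (Σ₂-nz-const (ℂ.- emb (+ 3))))))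
           (ℂ.*-congˡ (ℂ.+-congʳ (ℂ.trans (ℂ.*-congʳ (⟦⟧-false (a ≋? 0#) a≢0)) (ℂ.zeroˡ Q)))) ⟩
    (ℂ.1# ℂ.* Q ℂ.+ (Q ℂ.* ℂ.- emb (+ 3) ℂ.- ℂ.- emb (+ 3))) ℂ.+ emb (+ 2) ℂ.* (ℂ.0# ℂ.- ℂ.1#)
      ≈⟨ solve 1 (λ q → (con (+ 1) ⊗ q ⊕ (q ⊗ ⊖ con (+ 3) ⊖ ⊖ con (+ 3))) ⊕ con (+ 2) ⊗ (con (+ 0) ⊖ con (+ 1))
           ⊜ con (+ 1) ⊖ con (+ 2) ⊗ q) ℂ.refl Q ⟩
    Ŷ-kind line ∎
    where
    to : ∀ {γ} → 1# + a * γ ≋ 0# → γ ≋ inv a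
    to {γ} eq = certificate₂ (inv a) γ eq (inv-inverse a≢0) (solve₂ 3 (λ a i γ →
      γ :+ i := i :* (:1 :+ a :* γ :+ :0) :+ γ :* (a :* i :+ :1)) R₂.refl a (inv a) γ)
    from : ∀ {γ} → γ ≋ inv a → 1# + a * γ ≋ 0#
    from eq = ≋⇒+≋0 (R₂.sym (R₂.trans (R₂.*-congˡ eq) (inv-inverse a≢0)))
    term : ∀ γ → Dec (γ ≋ 0#) → nz γ ℂ.* main-term a b γ ℂ.≈ ⟦ γ ≋? inv a ⟧ ℂ.* Q ℂ.+ nz γ ℂ.* ℂ.- emb (+ 3)
    term γ (yes γ≋0) = ℂ.trans (ℂ.trans (ℂ.*-congʳ nz≈0) (ℂ.zeroˡ _)) (ℂ.sym (ℂ.trans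
      (ℂ.+-cong (ℂ.trans (ℂ.*-congʳ (⟦⟧-false (γ ≋? inv a) (λ eq → inv≢0 a≢0 (R₂.trans (R₂.sym eq) γ≋0)))) (ℂ.zeroˡ Q))
                (ℂ.trans (ℂ.*-congʳ nz≈0) (ℂ.zeroˡ _))) (ℂ.+-identityʳ ℂ.0#)))
      where
      nz≈0 : nz γ ℂ.≈ ℂ.0#
      nz≈0 = ⟦⟧-false (¬? (γ ≋? 0#)) (λ n → n γ≋0)
    term γ (no γ≢0) = begin
      nz γ ℂ.* main-term a b γ
        ≈⟨ ℂ.*-cong nz≈1 (main-term-b≋0 γ b≋0) ⟩
      ℂ.1# ℂ.* (emb (+ 2) ℂ.* (⟦ a * γ ≋? 0# ⟧ ℂ.* Q) ℂ.+ ⟦ 1# + a * γ ≋? 0# ⟧ ℂ.* Q ℂ.- emb (+ 3))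
        ≈⟨ ℂ.*-congˡ (ℂ.+-congʳ (ℂ.+-cong (ℂ.*-congˡ (ℂ.*-congʳ (⟦⟧-false (a * γ ≋? 0#) (product≢0 a≢0 γ≢0))))
             (ℂ.*-congʳ (⟦⟧-cong (1# + a * γ ≋? 0#) (γ ≋? inv a) (mk⇔ to from))))) ⟩
      ℂ.1# ℂ.* (emb (+ 2) ℂ.* (ℂ.0# ℂ.* Q) ℂ.+ ⟦ γ ≋? inv a ⟧ ℂ.* Q ℂ.- emb (+ 3))
        ≈⟨ solve 2 (λ q d → con (+ 1) ⊗ (con (+ 2) ⊗ (con (+ 0) ⊗ q) ⊕ d ⊗ q ⊖ con (+ 3)) ⊜ d ⊗ q ⊕ con (+ 1) ⊗ ⊖ con
            (+ 3)) ℂ.refl Q ⟦ γ ≋? inv a ⟧ ⟩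
      ⟦ γ ≋? inv a ⟧ ℂ.* Q ℂ.+ ℂ.1# ℂ.* ℂ.- emb (+ 3)
        ≈⟨ ℂ.+-congˡ (ℂ.*-congʳ nz≈1) ⟨
      ⟦ γ ≋? inv a ⟧ ℂ.* Q ℂ.+ nz γ ℂ.* ℂ.- emb (+ 3) ∎
      where
      nz≈1 : nz γ ℂ.≈ ℂ.1#
      nz≈1 = ⟦⟧-true (¬? (γ ≋? 0#)) γ≢0

  -- Since tr 1 ≠ 0, the polynomial r² + r + 1 has no root.
  norm-form≢0 : ∀ {x y} → ¬ y ≋ 0# → ¬ x * x + x * y + y * y ≋ 0#
  norm-form≢0 {x} {y} y≢0 eq =
    contradiction (≡.trans (≡.sym (tr-²+ (x * inv y))) (≡.trans (tr-cong ratio) tr-1)) λ ()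
    where
    ratio : (x * inv y) ² + x * inv y ≋ 1#
    ratio = certificate₂ (inv y * inv y) (x * inv y + y * inv y + 1#) eq (inv-inverse y≢0) (solve₂ 3 (λ x y i →
      (x :* i) :* (x :* i) :+ x :* i :+ :1
      := (i :* i) :* (x :* x :+ x :* y :+ y :* y :+ :0)
      :+ (x :* i :+ y :* i :+ :1) :* (y :* i :+ :1)) R₂.refl x y (inv y))

  cube-injective : ∀ {x y} → cube x ≋ cube y → x ≋ y
  cube-injective {x} {y} eq = go (y ≋? 0#)
    where
    difference : (x + y) * (x * x + x * y + y * y) ≋ 0#
    difference = certificate₁ {b = 0#} 1# eq (solve₂ 2 (λ x y →
      (x :+ y) :* (x :* x :+ x :* y :+ y :* y) :+ :0
      := :1 :* (x :* (x :* x) :+ y :* (y :* y))) R₂.refl x y)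
    go : Dec (y ≋ 0#) → x ≋ y
    go (yes y≋0) = R₂.trans ([ id , (λ x²≋0 → [ id , id ]′ (≋-domain x²≋0)) ]′ (≋-domain {x} {x * x}
      (R₂.trans eq (R₂.trans (R₂.*-congʳ y≋0) (R₂.zeroˡ _))))) (R₂.sym y≋0)
    go (no y≢0) = [ ≋-+≋0 , (λ eq′ → contradiction eq′ (norm-form≢0 y≢0)) ]′ (≋-domain difference)

  cube-cong : ∀ {x y} → x ≋ y → cube x ≋ cube y
  cube-cong eq = R₂.*-cong eq (R₂.*-cong eq eq)

  cbrt : Carrier → Carrier
  cbrt x = proj₁ (cube-root x)

  cbrt³ : ∀ x → cube (cbrt x) ≋ x
  cbrt³ x = proj₂ (cube-root x)

  -- By `cube-root` and `cube-injective` cubing permutes the residue field, so this is the sum of a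
  -- nontrivial additive character.
  Σ₂-Eγ : ∀ {b} → ¬ b ≋ 0# → Σ₂.∑ (Eγ b) ℂ.≈ ℂ.0#
  Σ₂-Eγ {b} b≢0 = begin
    Σ₂.∑ (Eγ b)
      ≈⟨ Σ₂.∑-cong (λ γ → e-cong (tr-cong (R₂.*-comm b (cube γ)))) ⟩
    Σ₂.∑ (λ γ → e (tr (cube γ * b)))
      ≈⟨ Σ₂.∑-reindex (λ x → e (tr (x * b))) cube cbrt (λ eq → e-cong (tr-cong (R₂.*-congʳ eq))) cube-cong
           (λ {x} {y} eq → cube-injective (R₂.trans (cbrt³ x) (R₂.trans eq (R₂.sym (cbrt³ y))))) cbrt³
           (λ x → cube-injective (cbrt³ (cube x))) ⟩
    Σ₂.∑ (λ x → e (tr (x * b)))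
      ≈⟨ ℂ.trans (Σ₂-tr b) (ℂ.trans (ℂ.*-congʳ (⟦⟧-false (b ≋? 0#) b≢0)) (ℂ.zeroˡ Q)) ⟩
    ℂ.0# ∎

  cubicDec : ∀ a b γ → Dec (Cubic a b γ)
  cubicDec a b γ = _ ≋? _

  slope-cubic : ∀ a b γ → (1# + slope a b γ) ² ≋ 1# + a ² * γ ² + b * cube γ
  slope-cubic a b γ = R₂.trans (solve₂ 3 (λ a γ σ → (:1 :+ (a :* γ :+ σ)) :* (:1 :+ (a :* γ :+ σ))
    := :1 :+ (a :* a) :* (γ :* γ) :+ σ :* σ) R₂.refl a γ (sqrt (b * cube γ))) (R₂.+-congˡ (sqrt² (b * cube γ)))

  TA TC : Carrier → Carrier → 𝔾
  TA a b = Σ₂.∑ (λ γ → nz γ ℂ.* (Eγ b γ ℂ.* ⟦ slope a b γ ≋? 0# ⟧))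
  TC a b = Σ₂.∑ (λ γ → Eγ b γ ℂ.* ⟦ cubicDec a b γ ⟧)

  -- `TA` collects the γ of slope 0 and `TC` the roots of the cubic. The constant 3 is -3 times the
  -- sum of `Eγ b` over γ ≠ 0, which is -1 by `Σ₂-Eγ`.
  main-sum : ∀ a b → ¬ b ≋ 0# → Σ₂.∑ (λ γ → nz γ ℂ.* main-term a b γ) ℂ.≈
    emb (+ 2) ℂ.* Q ℂ.* TA a b ℂ.+ Q ℂ.* TC a b ℂ.+ emb (+ 3)
  main-sum a b b≢0 = begin
    Σ₂.∑ (λ γ → nz γ ℂ.* main-term a b γ)
      ≈⟨ Σ₂.∑-cong (λ γ → ℂ.trans
           (solve 5 (λ n ε q x y → n ⊗ (ε ⊗ (con (+ 2) ⊗ (x ⊗ q) ⊕ y ⊗ q ⊖ con (+ 3)))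
             ⊜ ((con (+ 2) ⊗ q) ⊗ (n ⊗ (ε ⊗ x)) ⊕ q ⊗ (n ⊗ (ε ⊗ y))) ⊕ con (ℤ.- + 3) ⊗ (n ⊗ ε)) ℂ.refl
             (nz γ) (Eγ b γ) Q ⟦ slope a b γ ≋? 0# ⟧ ⟦ 1# + slope a b γ ≋? 0# ⟧)
           (ℂ.+-congʳ (ℂ.+-congˡ (ℂ.*-congˡ (cubic-term γ))))) ⟩
    Σ₂.∑ (λ γ → ((emb (+ 2) ℂ.* Q) ℂ.* (nz γ ℂ.* (Eγ b γ ℂ.* ⟦ slope a b γ ≋? 0# ⟧)) ℂ.+ Q ℂ.*
        (Eγ b γ ℂ.* ⟦ cubicDec a b γ ⟧))
                  ℂ.+ emb (ℤ.- + 3) ℂ.* (nz γ ℂ.* Eγ b γ))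
      ≈⟨ ℂ.trans (Σ₂.∑-+ _ _) (ℂ.+-cong (ℂ.trans (Σ₂.∑-+ _ _) (ℂ.+-cong (Σ₂.∑-*ˡ _ _) (Σ₂.∑-*ˡ Q _)))
           (ℂ.trans (Σ₂.∑-*ˡ _ _) (ℂ.*-congˡ (ℂ.trans (Σ₂-nz (Eγ b)
               (λ eq → e-cong (tr-cong (R₂.*-congˡ (cube-cong eq)))))
             (ℂ.+-cong (Σ₂-Eγ b≢0) (ℂ.-‿cong (e-tr-0 (solve₂ 1 (λ b → b :* (:0 :* (:0 :* :0)) := :0) R₂.refl b)))))))) ⟩
    ((emb (+ 2) ℂ.* Q) ℂ.* TA a b ℂ.+ Q ℂ.* TC a b) ℂ.+ emb (ℤ.- + 3) ℂ.* (ℂ.0# ℂ.- ℂ.1#)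
      ≈⟨ ℂ.+-congˡ (solve 0 (con (ℤ.- + 3) ⊗ (con (+ 0) ⊖ con (+ 1)) ⊜ con (+ 3)) ℂ.refl) ⟩
    emb (+ 2) ℂ.* Q ℂ.* TA a b ℂ.+ Q ℂ.* TC a b ℂ.+ emb (+ 3) ∎
    where
    cubic-term : ∀ γ → nz γ ℂ.* (Eγ b γ ℂ.* ⟦ 1# + slope a b γ ≋? 0# ⟧) ℂ.≈ Eγ b γ ℂ.* ⟦ cubicDec a b γ ⟧
    cubic-term γ = ℂ.trans (ℂ.*-congˡ (ℂ.*-congˡ (⟦⟧-cong (1# + slope a b γ ≋? 0#) (cubicDec a b γ) (mk⇔
        (λ eq → R₂.trans (R₂.sym (slope-cubic a b γ)) (R₂.trans (R₂.*-congʳ eq) (R₂.zeroˡ _)))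
        (λ cubic → [ id , id ]′ (≋-domain (R₂.trans (slope-cubic a b γ) cubic)))))))
      (go (cubicDec a b γ))
      where
      go : (d : Dec (Cubic a b γ)) → nz γ ℂ.* (Eγ b γ ℂ.* ⟦ d ⟧) ℂ.≈ Eγ b γ ℂ.* ⟦ d ⟧
      go (yes cubic) = ℂ.trans (ℂ.*-congʳ (⟦⟧-true (¬? (γ ≋? 0#)) (cubic≢0 cubic))) (ℂ.*-identityˡ _)
      go (no _) = ℂ.trans (ℂ.*-congˡ (ℂ.zeroʳ _)) (ℂ.trans (ℂ.zeroʳ _) (ℂ.sym (ℂ.zeroʳ _)))

  -- At a root of the cubic, tr (bγ³) = tr (1 + a²γ²).
  Eγ-cubic : ∀ {a b γ} → Cubic a b γ → Eγ b γ ℂ.≈ ℂ.- e (tr (a * γ))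
  Eγ-cubic {a} {b} {γ} cubic = ℂ.trans (e-cong (≡.trans (tr-cong (certificate₁ 1# cubic (solve₂ 3 (λ a b γ →
      b :* (γ :* (γ :* γ)) :+ ((a :* γ) :* (a :* γ) :+ :1)
      := :1 :* (:1 :+ (a :* a) :* (γ :* γ) :+ b :* (γ :* (γ :* γ)) :+ :0)) R₂.refl a b γ)))
    (≡.trans (tr-+ _ _) (≡.cong₂ _+₄_ (tr-² (a * γ)) tr-1)))) (e-+2 (tr (a * γ)))

  -- For a ≠ 0 the substitution v = aγ turns the cubic into v³ = (a³/b)(1 + v)².
  module NonNull {a b} (a≢0 : ¬ a ≋ 0#) (b≢0 : ¬ b ≋ 0#) where
    d : Carrier
    d = cube a * inv b

    d≢0 : ¬ d ≋ 0#
    d≢0 = product≢0 (product≢0 a≢0 (product≢0 a≢0 a≢0)) (inv≢0 b≢0)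

    cubic⇒root : ∀ {γ} → Cubic a b γ → Root d (a * γ)
    cubic⇒root {γ} cubic = certificate₂ (cube a * inv b) (cube a * cube γ) cubic (inv-inverse b≢0)
      (solve₂ 4 (λ a b γ i → (a :* γ) :* ((a :* γ) :* (a :* γ))
          :+ ((a :* (a :* a)) :* i) :* ((:1 :+ a :* γ) :* (:1 :+ a :* γ))
        := ((a :* (a :* a)) :* i) :* (:1 :+ (a :* a) :* (γ :* γ) :+ b :* (γ :* (γ :* γ)) :+ :0)
        :+ ((a :* (a :* a)) :* (γ :* (γ :* γ))) :* (b :* i :+ :1)) R₂.refl a b γ (inv b))

    root⇒cubic : ∀ {γ} → Root d (a * γ) → Cubic a b γ
    root⇒cubic {γ} root = ≋-cancelˡ d≢0 (certificate₂ {b = d * 0#} 1# (cube a * cube γ) root (inv-inverse b≢0)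
      (solve₂ 4 (λ a b γ i →
        ((a :* (a :* a)) :* i) :* (:1 :+ (a :* a) :* (γ :* γ) :+ b :* (γ :* (γ :* γ)))
          :+ ((a :* (a :* a)) :* i) :* :0
        := :1 :* ((a :* γ) :* ((a :* γ) :* (a :* γ))
          :+ ((a :* (a :* a)) :* i) :* ((:1 :+ a :* γ) :* (:1 :+ a :* γ)))
        :+ ((a :* (a :* a)) :* (γ :* (γ :* γ))) :* (b :* i :+ :1)) R₂.refl a b γ (inv b)))

    a[x/a] : ∀ x → a * (x * inv a) ≋ x
    a[x/a] x = certificate₁ x (inv-inverse a≢0) (solve₂ 3 (λ a x i →
      a :* (x :* i) :+ x := x :* (a :* i :+ :1)) R₂.refl a x (inv a))

    [ax]/a : ∀ x → (a * x) * inv a ≋ x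
    [ax]/a x = certificate₁ x (inv-inverse a≢0) (solve₂ 3 (λ a x i →
      (a :* x) :* i :+ x := x :* (a :* i :+ :1)) R₂.refl a x (inv a))

    root⇒∃cubic : ∀ {v} → Root d v → ∃ (Cubic a b)
    root⇒∃cubic {v} root = v * inv a , root⇒cubic (root-cong R₂.refl (R₂.sym (a[x/a] v)) root)

    ΣCubic : Σ₂.∑ (λ γ → ⟦ cubicDec a b γ ⟧) ℂ.≈ rootCount d
    ΣCubic = ℂ.trans
      (Σ₂.∑-cong (λ γ → ⟦⟧-cong (cubicDec a b γ) (root? d (a * γ)) (mk⇔ cubic⇒root root⇒cubic)))
      (Σ₂.∑-reindex (λ v → ⟦ root? d v ⟧) (a *_) (_* inv a)
        (λ {x} {y} eq → ⟦⟧-cong (root? d x) (root? d y) (mk⇔ (root-cong R₂.refl eq) (root-cong R₂.refl (R₂.sym eq))))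
        R₂.*-congˡ R₂.*-congʳ a[x/a] [ax]/a)

    TC≈ : TC a b ℂ.≈ ℂ.- e (tr d) ℂ.* rootCount d
    TC≈ = ℂ.trans (Σ₂.∑-cong (λ γ → go γ (cubicDec a b γ))) (ℂ.trans (Σ₂.∑-*ˡ _ _) (ℂ.*-congˡ ΣCubic))
      where
      go : ∀ γ (c? : Dec (Cubic a b γ)) → Eγ b γ ℂ.* ⟦ c? ⟧ ℂ.≈ ℂ.- e (tr d) ℂ.* ⟦ c? ⟧
      go γ (yes cubic) = ℂ.*-congʳ (ℂ.trans (Eγ-cubic cubic) (ℂ.-‿cong (e-cong (tr-root (cubic⇒root cubic)))))
      go γ (no _) = ℂ.trans (ℂ.zeroʳ _) (ℂ.sym (ℂ.zeroʳ _))

    -- The only γ ≠ 0 with slope 0, by the factorisation in `slope²`. Since bγ₀³ = d², the sum `TA`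
    -- is the sign of tr d.
    γ₀ : Carrier
    γ₀ = a ² * inv b

    γ₀≢0 : ¬ γ₀ ≋ 0#
    γ₀≢0 = product≢0 (product≢0 a≢0 a≢0) (inv≢0 b≢0)

    slope² : ∀ γ → slope a b γ ² ≋ γ ² * (a ² + b * γ)
    slope² γ = R₂.trans (solve₂ 3 (λ a γ σ → (a :* γ :+ σ) :* (a :* γ :+ σ) := (a :* a) :* (γ :* γ) :+ σ :* σ)
        R₂.refl a γ (sqrt (b * cube γ)))
      (R₂.trans (R₂.+-congˡ (sqrt² (b * cube γ))) (solve₂ 3 (λ a b γ → (a :* a) :* (γ :* γ) :+ b :* (γ :* (γ :* γ))
        := (γ :* γ) :* (a :* a :+ b :* γ)) R₂.refl a b γ))

    slope≋0⇒ : ∀ {γ} → ¬ γ ≋ 0# → slope a b γ ≋ 0# → γ ≋ γ₀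
    slope≋0⇒ {γ} γ≢0 eq = [ (λ γ²≋0 → contradiction γ²≋0 (product≢0 γ≢0 γ≢0))
      , (λ eq′ → certificate₂ (inv b) γ eq′ (inv-inverse b≢0) (solve₂ 4 (λ a b γ i → γ :+ (a :* a) :* i
          := i :* (a :* a :+ b :* γ :+ :0) :+ γ :* (b :* i :+ :1)) R₂.refl a b γ (inv b))) ]′
      (≋-domain (R₂.trans (R₂.sym (slope² γ)) (R₂.trans (R₂.*-congʳ eq) (R₂.zeroˡ _))))

    ⇒slope≋0 : ∀ {γ} → γ ≋ γ₀ → slope a b γ ≋ 0#
    ⇒slope≋0 {γ} eq = [ id , id ]′ (≋-domain (R₂.trans (slope² γ)
        (R₂.trans (R₂.*-congˡ {γ ²} vanish) (R₂.zeroʳ (γ ²)))))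
      where
      vanish : a ² + b * γ ≋ 0#
      vanish = certificate₂ {b = 0#} b (a ²) eq (inv-inverse b≢0) (solve₂ 4 (λ a b γ i → a :* a :+ b :* γ :+ :0
        := b :* (γ :+ (a :* a) :* i) :+ (a :* a) :* (b :* i :+ :1)) R₂.refl a b γ (inv b))

    TA≈ : TA a b ℂ.≈ e (tr d)
    TA≈ = ℂ.trans (Σ₂.∑-cong (λ γ → go γ (γ ≋? 0#))) (ℂ.trans
        (Σ₂.∑-δ (Eγ b) γ₀ (λ eq → e-cong (tr-cong (R₂.*-congˡ (cube-cong eq)))))
      (e-cong (≡.trans (tr-cong bγ₀³≋) (tr-² d))))
      where
      bγ₀³≋ : b * cube γ₀ ≋ d ²
      bγ₀³≋ = certificate₁ (cube (a ²) * inv b ²) (inv-inverse b≢0) (solve₂ 3 (λ A b i →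
        b :* ((A :* i) :* ((A :* i) :* (A :* i))) :+ (A :* (A :* A)) :* (i :* i)
        := ((A :* (A :* A)) :* (i :* i)) :* (b :* i :+ :1)) R₂.refl (a ²) b (inv b))
        ⟨≋⟩ solve₂ 2 (λ a i → (a :* a :* ((a :* a) :* (a :* a))) :* (i :* i)
          := ((a :* (a :* a)) :* i) :* ((a :* (a :* a)) :* i)) R₂.refl a (inv b)
        where
        _⟨≋⟩_ : ∀ {x y z} → x ≋ y → y ≋ z → x ≋ z
        _⟨≋⟩_ = R₂.trans
      go : ∀ γ → Dec (γ ≋ 0#) → nz γ ℂ.* (Eγ b γ ℂ.* ⟦ slope a b γ ≋? 0# ⟧) ℂ.≈ ⟦ γ ≋? γ₀ ⟧ ℂ.* Eγ b γ
      go γ (yes γ≋0) = ℂ.trans (ℂ.trans (ℂ.*-congʳ (⟦⟧-false (¬? (γ ≋? 0#)) (λ n → n γ≋0))) (ℂ.zeroˡ _))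
        (ℂ.sym (ℂ.trans (ℂ.*-congʳ (⟦⟧-false (γ ≋? γ₀) (λ eq → γ₀≢0 (R₂.trans (R₂.sym eq) γ≋0)))) (ℂ.zeroˡ _)))
      go γ (no γ≢0) = ℂ.trans (ℂ.*-congʳ (⟦⟧-true (¬? (γ ≋? 0#)) γ≢0))
          (ℂ.trans (ℂ.*-identityˡ _) (ℂ.trans (ℂ.*-comm _ _)
        (ℂ.*-congʳ (⟦⟧-cong (slope a b γ ≋? 0#) (γ ≋? γ₀) (mk⇔ (slope≋0⇒ γ≢0) ⇒slope≋0)))))

    -- With ε = (-1)^Tr(d) and r roots, ε(2 - r) is 1 both for r = 1, where ε = 1, and for r = 3,
    -- where ε = -1; for r = 0, where ε = -1, it is -2. So the transform records only whether there
    -- is a root.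
    hat-V≈ : ∀ u → 𝓕.hat V (u , a , b) ℂ.≈ Q ℂ.* (e (tr d) ℂ.* (emb (+ 2) ℂ.- rootCount d)) ℂ.+ ℂ.1#
    hat-V≈ u = begin
      𝓕.hat V (u , a , b)
        ≈⟨ ℂ.trans (hat-V′ u a b) (ℂ.+-cong (main-sum a b b≢0)
            (ℂ.*-congˡ (ℂ.+-congʳ (ℂ.trans (ℂ.*-congʳ (⟦⟧-false (a ≋? 0#) a≢0)) (ℂ.zeroˡ Q))))) ⟩
      (emb (+ 2) ℂ.* Q ℂ.* TA a b ℂ.+ Q ℂ.* TC a b ℂ.+ emb (+ 3)) ℂ.+ emb (+ 2) ℂ.* (ℂ.0# ℂ.- ℂ.1#)
        ≈⟨ ℂ.+-congʳ (ℂ.+-congʳ (ℂ.+-cong (ℂ.*-congˡ TA≈) (ℂ.*-congˡ TC≈))) ⟩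
      (emb (+ 2) ℂ.* Q ℂ.* e (tr d) ℂ.+ Q ℂ.* (ℂ.- e (tr d) ℂ.* rootCount d) ℂ.+ emb (+ 3)) ℂ.+ emb (+ 2) ℂ.*
          (ℂ.0# ℂ.- ℂ.1#)
        ≈⟨ solve 3 (λ q ε r → (con (+ 2) ⊗ q ⊗ ε ⊕ q ⊗ (⊖ ε ⊗ r) ⊕ con (+ 3)) ⊕ con (+ 2) ⊗ (con (+ 0) ⊖ con (+ 1))
             ⊜ q ⊗ (ε ⊗ (con (+ 2) ⊖ r)) ⊕ con (+ 1)) ℂ.refl Q (e (tr d)) (rootCount d) ⟩
      Q ℂ.* (e (tr d) ℂ.* (emb (+ 2) ℂ.- rootCount d)) ℂ.+ ℂ.1# ∎

    hat-V-irreducible : ∀ u → ¬ ∃ (Cubic a b) → 𝓕.hat V (u , a , b) ℂ.≈ Ŷ-kind irreducible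
    hat-V-irreducible u none = [ (λ tr≡0 → contradiction (root⇒∃cubic (proj₂ (root-exists d≢0 tr≡0))) none)
      , (λ tr≡2 → ℂ.trans (hat-V≈ u) (ℂ.trans
          (ℂ.+-congʳ (ℂ.*-congˡ (ℂ.*-cong (ℂ.trans (e-cong tr≡2) e-2)
              (ℂ.+-congˡ (ℂ.-‿cong (rootCount-0 d (none ∘ root⇒∃cubic ∘ proj₂)))))))
          (solve 1 (λ q → q ⊗ (⊖ con (+ 1) ⊗ (con (+ 2) ⊖ con (+ 0))) ⊕ con (+ 1) ⊜ con (+ 1) ⊖ con (+ 2) ⊗ q) ℂ.refl
              Q))) ]′ (tr₄-2*-even d)

    hat-V-reducible : ∀ u → ∃ (Cubic a b) → 𝓕.hat V (u , a , b) ℂ.≈ Ŷ-kind reducible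
    hat-V-reducible u (γ , cubic) = [
        (λ tr≡0 → ℂ.trans (hat-V≈ u) (ℂ.trans
          (ℂ.+-congʳ (ℂ.*-congˡ (ℂ.*-cong (ℂ.trans (e-cong tr≡0) e-0) (ℂ.+-congˡ (ℂ.-‿cong (rootCount-1 d d≢0 tr≡0))))))
          (solve 1 (λ q → q ⊗ (con (+ 1) ⊗ (con (+ 2) ⊖ con (+ 1))) ⊕ con (+ 1) ⊜ q ⊕ con (+ 1)) ℂ.refl Q)))
      , (λ tr≡2 → ℂ.trans (hat-V≈ u) (ℂ.trans
          (ℂ.+-congʳ (ℂ.*-congˡ (ℂ.*-cong (ℂ.trans (e-cong tr≡2) e-2)
              (ℂ.+-congˡ (ℂ.-‿cong (rootCount-3 d≢0 tr≡2 (cubic⇒root cubic)))))))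
          (solve 1 (λ q → q ⊗ (⊖ con (+ 1) ⊗ (con (+ 2) ⊖ con (+ 3))) ⊕ con (+ 1) ⊜ q ⊕ con (+ 1)) ℂ.refl Q))) ]′
              (tr₄-2*-even d)

  -- For a = 0 the cubic has exactly one root.
  module Null {a b} (a≋0 : a ≋ 0#) (b≢0 : ¬ b ≋ 0#) where
    γ₁ : Carrier
    γ₁ = cbrt (inv b)

    cubic⇔ : ∀ {γ} → Cubic a b γ → γ ≋ γ₁
    cubic⇔ {γ} cubic = cube-injective (R₂.trans (≋-cancelˡ b≢0 (R₂.trans (certificate₂ 1# (a * γ ²) cubic a≋0
      (solve₂ 3 (λ a b γ → b :* (γ :* (γ :* γ)) :+ :1
        := :1 :* (:1 :+ (a :* a) :* (γ :* γ) :+ b :* (γ :* (γ :* γ)) :+ :0)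
        :+ (a :* (γ :* γ)) :* (a :+ :0)) R₂.refl a b γ)) (R₂.sym (inv-inverse b≢0)))) (R₂.sym (cbrt³ (inv b))))

    ⇒cubic : ∀ {γ} → γ ≋ γ₁ → Cubic a b γ
    ⇒cubic {γ} eq = certificate₂ {b = 0#} 1# (a * γ ²) bγ³≋1 a≋0
      (solve₂ 3 (λ a b γ → :1 :+ (a :* a) :* (γ :* γ) :+ b :* (γ :* (γ :* γ)) :+ :0
        := :1 :* (b :* (γ :* (γ :* γ)) :+ :1)
        :+ (a :* (γ :* γ)) :* (a :+ :0)) R₂.refl a b γ)
      where
      bγ³≋1 : b * cube γ ≋ 1#
      bγ³≋1 = R₂.trans (R₂.*-congˡ (R₂.trans (cube-cong eq) (cbrt³ (inv b)))) (inv-inverse b≢0)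

    TA≈ : TA a b ℂ.≈ ℂ.0#
    TA≈ = Σ₂.∑-0 _ (λ γ → go γ (γ ≋? 0#))
      where
      go : ∀ γ → Dec (γ ≋ 0#) → nz γ ℂ.* (Eγ b γ ℂ.* ⟦ slope a b γ ≋? 0# ⟧) ℂ.≈ ℂ.0#
      go γ (yes γ≋0) = ℂ.trans (ℂ.*-congʳ (⟦⟧-false (¬? (γ ≋? 0#)) (λ n → n γ≋0))) (ℂ.zeroˡ _)
      go γ (no γ≢0) = ℂ.trans (ℂ.*-congˡ (ℂ.trans (ℂ.*-congˡ (⟦⟧-false (slope a b γ ≋? 0#) slope≢0)) (ℂ.zeroʳ _)))
          (ℂ.zeroʳ _)
        where
        σ = sqrt (b * cube γ)
        slope≢0 : ¬ slope a b γ ≋ 0#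
        slope≢0 eq = product≢0 b≢0 (product≢0 γ≢0 (product≢0 γ≢0 γ≢0)) (R₂.trans (R₂.sym (sqrt² (b * cube γ)))
          (R₂.trans (R₂.*-congʳ (R₂.trans (R₂.sym (R₂.trans (R₂.+-congʳ (R₂.trans (R₂.*-congʳ a≋0) (R₂.zeroˡ γ)))
              (R₂.+-identityˡ σ))) eq)) (R₂.zeroˡ σ)))

    TC≈ : TC a b ℂ.≈ ℂ.- ℂ.1#
    TC≈ = ℂ.trans (Σ₂.∑-cong (λ γ → ℂ.trans (go γ (cubicDec a b γ))
        (ℂ.*-congˡ (⟦⟧-cong (cubicDec a b γ) (γ ≋? γ₁) (mk⇔ cubic⇔ ⇒cubic)))))
      (ℂ.trans (Σ₂.∑-*ˡ _ _) (ℂ.trans (ℂ.*-congˡ (Σ₂-⟦≋⟧ γ₁)) (ℂ.*-identityʳ _)))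
      where
      go : ∀ γ (c? : Dec (Cubic a b γ)) → Eγ b γ ℂ.* ⟦ c? ⟧ ℂ.≈ ℂ.- ℂ.1# ℂ.* ⟦ c? ⟧
      go γ (yes cubic) = ℂ.*-congʳ (ℂ.trans (Eγ-cubic cubic)
          (ℂ.-‿cong (e-tr-0 (R₂.trans (R₂.*-congʳ a≋0) (R₂.zeroˡ γ)))))
      go γ (no _) = ℂ.trans (ℂ.zeroʳ _) (ℂ.sym (ℂ.zeroʳ _))

    hat-V-reducible : ∀ u → 𝓕.hat V (u , a , b) ℂ.≈ Ŷ-kind reducible
    hat-V-reducible u = begin
      𝓕.hat V (u , a , b)
        ≈⟨ ℂ.trans (hat-V′ u a b) (ℂ.+-cong (main-sum a b b≢0)
            (ℂ.*-congˡ (ℂ.+-congʳ (ℂ.trans (ℂ.*-congʳ (⟦⟧-true (a ≋? 0#) a≋0)) (ℂ.*-identityˡ Q))))) ⟩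
      (emb (+ 2) ℂ.* Q ℂ.* TA a b ℂ.+ Q ℂ.* TC a b ℂ.+ emb (+ 3)) ℂ.+ emb (+ 2) ℂ.* (Q ℂ.- ℂ.1#)
        ≈⟨ ℂ.+-congʳ (ℂ.+-congʳ (ℂ.+-cong (ℂ.*-congˡ TA≈) (ℂ.*-congˡ TC≈))) ⟩
      (emb (+ 2) ℂ.* Q ℂ.* ℂ.0# ℂ.+ Q ℂ.* ℂ.- ℂ.1# ℂ.+ emb (+ 3)) ℂ.+ emb (+ 2) ℂ.* (Q ℂ.- ℂ.1#)
        ≈⟨ solve 1 (λ q → (con (+ 2) ⊗ q ⊗ con (+ 0) ⊕ q ⊗ ⊖ con (+ 1) ⊕ con (+ 3)) ⊕ con (+ 2) ⊗
            (q ⊖ con (+ 1)) ⊜ q ⊕ con (+ 1)) ℂ.refl Q ⟩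
      Ŷ-kind reducible ∎

  hat-V-kind : ∀ k u a b → HasKind k a b → 𝓕.hat V (u , a , b) ℂ.≈ Ŷ-kind k
  hat-V-kind null        u a b (Level.lift (a≋0 , b≋0)) = hat-V-null u a≋0 b≋0
  hat-V-kind line        u a b (Level.lift (a≢0 , b≋0)) = hat-V-line u a≢0 b≋0
  hat-V-kind irreducible u a b (b≢0 , none) = go (a ≋? 0#)
    where
    go : Dec (a ≋ 0#) → 𝓕.hat V (u , a , b) ℂ.≈ Ŷ-kind irreducible
    go (yes a≋0) = contradiction (_ , Null.⇒cubic a≋0 b≢0 R₂.refl) none
    go (no a≢0)  = NonNull.hat-V-irreducible a≢0 b≢0 u none
  hat-V-kind reducible   u a b (b≢0 , cubic) = go (a ≋? 0#)
    where
    go : Dec (a ≋ 0#) → 𝓕.hat V (u , a , b) ℂ.≈ Ŷ-kind reducible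
    go (yes a≋0) = Null.hat-V-reducible a≋0 b≢0 u
    go (no a≢0)  = NonNull.hat-V-reducible a≢0 b≢0 u cubic

  module GP = AbelianGroupProperties G

  -- Functions supported on the subgroup L of the points (0, 2α, β)

  ψ : Fin 4 → M → 𝔾
  ψ 0F h = ⟦ h ≟ ℓ-point 0# 0# ⟧
  ψ 1F h = Σ₂.∑ (λ y → ⟦ h ≟ ℓ-point 0# y ⟧)
  ψ 2F h = V h
  ψ 3F h = Σ₂.∑ (λ x → Σ₂.∑ (λ y → ⟦ h ≟ ℓ-point x y ⟧))

  ≟-cong : ∀ {g h} k → g ∼ h → ⟦ g ≟ k ⟧ ℂ.≈ ⟦ h ≟ k ⟧
  ≟-cong {g} {h} k g∼h = ⟦⟧-cong (g ≟ k) (h ≟ k) (mk⇔ (G.trans {h} {g} {k} (G.sym {g} {h} g∼h))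
      (G.trans {g} {h} {k} g∼h))

  ψ-resp : ∀ i {g h} → g ∼ h → ψ i g ℂ.≈ ψ i h
  ψ-resp 0F eq = ≟-cong (ℓ-point 0# 0#) eq
  ψ-resp 1F eq = Σ₂.∑-cong (λ y → ≟-cong (ℓ-point 0# y) eq)
  ψ-resp 2F eq = V-resp eq
  ψ-resp 3F eq = Σ₂.∑-cong (λ x → Σ₂.∑-cong (λ y → ≟-cong (ℓ-point x y) eq))

  ψ-off : ∀ i h → ¬ OnL h → ψ i h ℂ.≈ ℂ.0#
  ψ-off 0F h off = ⟦⟧-false (h ≟ ℓ-point 0# 0#) (λ eq → off (0# , 0# , eq))
  ψ-off 1F h off = Σ₂.∑-0 _ (λ y → ⟦⟧-false (h ≟ ℓ-point 0# y) (λ eq → off (0# , y , eq)))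
  ψ-off 2F h off = V-off h off
  ψ-off 3F h off = Σ₂.∑-0 _ (λ x → Σ₂.∑-0 _ (λ y → ⟦⟧-false (h ≟ ℓ-point x y) (λ eq → off (x , y , eq))))

  -- The first argument is the state of a point of L: 0 for the zero point, 1 for α = 0 and β ≠ 0,
  -- and 2 or 3 for α ≠ 0 with `V` equal to 0 or 3.
  ψ-value : Fin 4 → Fin 4 → ℕ
  ψ-value 0F 0F = 1
  ψ-value 0F 1F = 1
  ψ-value 0F 3F = 1
  ψ-value 1F 1F = 1
  ψ-value 1F 3F = 1
  ψ-value 2F 3F = 1
  ψ-value 3F 2F = 3
  ψ-value 3F 3F = 1
  ψ-value _  _  = 0

  private
    ⟦⟧-emb : ∀ {p} {P : Set p} (P? : Dec P) → P → ⟦ P? ⟧ ℂ.≈ emb (+ 1)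
    ⟦⟧-emb P? x = ℂ.trans (⟦⟧-true P? x) (ℂ.sym emb-1)

    ⟦⟧-emb′ : ∀ {p} {P : Set p} (P? : Dec P) → ¬ P → ⟦ P? ⟧ ℂ.≈ emb (+ 0)
    ⟦⟧-emb′ P? x = ℂ.trans (⟦⟧-false P? x) (ℂ.sym emb-0)

  Σ-row : ∀ {h α β} x → h ∼ ℓ-point α β → Σ₂.∑ (λ y → ⟦ h ≟ ℓ-point x y ⟧) ℂ.≈ ⟦ x ≋? α ⟧
  Σ-row {h} {α} {β} x h∼ = ℂ.trans (Σ₂.∑-cong (λ y → ⟦ℓ⟧ {h} {α} {β} x y h∼)) (ℂ.trans (Σ₂.∑-*ˡ ⟦ x ≋? α ⟧ _)
    (ℂ.trans (ℂ.*-congˡ (Σ₂-⟦≋⟧ β)) (ℂ.*-identityʳ _)))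

  ψ₃-on : ∀ {h α β} → h ∼ ℓ-point α β → ψ 3F h ℂ.≈ emb (+ 1)
  ψ₃-on {h} {α} {β} h∼ = ℂ.trans (Σ₂.∑-cong (λ x → Σ-row {h} {α} {β} x h∼)) (ℂ.trans (Σ₂-⟦≋⟧ α) (ℂ.sym emb-1))

  ψ-on : ∀ h → OnL h → ∃ λ st → ∀ i → ψ i h ℂ.≈ emb (+ ψ-value st i)
  ψ-on h (α , β , h∼) = go (α ≋? 0#) (β ≋? 0#)
    where
    δ-value : ψ 0F h ℂ.≈ ⟦ 0# ≋? α ⟧ ℂ.* ⟦ 0# ≋? β ⟧
    δ-value = ⟦ℓ⟧ {h} {α} {β} 0# 0# h∼
    go : Dec (α ≋ 0#) → Dec (β ≋ 0#) → ∃ λ st → ∀ i → ψ i h ℂ.≈ emb (+ ψ-value st i)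
    go (yes α≋0) (yes β≋0) = 0F , λ
      { 0F → ℂ.trans δ-value (ℂ.trans (ℂ.*-cong (⟦⟧-true (0# ≋? α) (R₂.sym α≋0)) (⟦⟧-true (0# ≋? β) (R₂.sym β≋0)))
          (ℂ.trans (ℂ.*-identityˡ _) (ℂ.sym emb-1)))
      ; 1F → ℂ.trans (Σ-row {h} {α} {β} 0# h∼) (⟦⟧-emb (0# ≋? α) (R₂.sym α≋0))
      ; 2F → ℂ.trans (V-null {h} β (G.trans {h} {ℓ-point α β} {ℓ-point 0# β} h∼ (ℓ-point-cong α≋0 R₂.refl)))
          (ℂ.sym emb-0)
      ; 3F → ψ₃-on {h} {α} {β} h∼ }
    go (yes α≋0) (no β≢0) = 1F , λ
      { 0F → ℂ.trans δ-value (ℂ.trans (ℂ.*-congˡ (⟦⟧-false (0# ≋? β) (β≢0 ∘ R₂.sym)))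
          (ℂ.trans (ℂ.zeroʳ _) (ℂ.sym emb-0)))
      ; 1F → ℂ.trans (Σ-row {h} {α} {β} 0# h∼) (⟦⟧-emb (0# ≋? α) (R₂.sym α≋0))
      ; 2F → ℂ.trans (V-null {h} β (G.trans {h} {ℓ-point α β} {ℓ-point 0# β} h∼ (ℓ-point-cong α≋0 R₂.refl)))
          (ℂ.sym emb-0)
      ; 3F → ψ₃-on {h} {α} {β} h∼ }
    go (no α≢0) _ = [ (λ V≈0 → 2F , λ
        { 0F → δ≈0 ; 1F → H≈0 ; 2F → ℂ.trans V≈0 (ℂ.sym emb-0) ; 3F → ψ₃-on {h} {α} {β} h∼ })
      , (λ V≈3 → 3F , λ { 0F → δ≈0 ; 1F → H≈0 ; 2F → V≈3 ; 3F → ψ₃-on {h} {α} {β} h∼ }) ]′ (V-0-or-3 {h} {α} {β} h∼ α≢0)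
      where
      δ≈0 : ψ 0F h ℂ.≈ emb (+ 0)
      δ≈0 = ℂ.trans δ-value (ℂ.trans (ℂ.*-congʳ (⟦⟧-false (0# ≋? α) (α≢0 ∘ R₂.sym)))
          (ℂ.trans (ℂ.zeroˡ _) (ℂ.sym emb-0)))
      H≈0 : ψ 1F h ℂ.≈ emb (+ 0)
      H≈0 = ℂ.trans (Σ-row {h} {α} {β} 0# h∼) (⟦⟧-emb′ (0# ≋? α) (α≢0 ∘ R₂.sym))

  onL : ∀ {α β} → α ≋ 0# → OnL (0F , α , β)
  onL {α} {β} α≋0 = let w , α≈ = 2w≈0⇒ α≋0 in w , β , refl , α≈ , R₂.refl

  onL-s : ∀ {s α β} → OnL (s , α , β) → s ≡ 0F
  onL-s (_ , _ , s≡ , _) = s≡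

  onL-α : ∀ {s α β} → OnL (s , α , β) → α ≋ 0#
  onL-α (x , _ , _ , α≈ , _) = R₂.trans (≈⇒≋ α≈) (R₂.trans (≈⇒≋ (R.sym (R.+-identityˡ _))) (≋-+2 0# x))

  -- Convolution with the indicator of the points ±(1, x, x³)

  od : (M → 𝔾) → M → 𝔾
  od φ h = Σ₂.∑ (λ x → φ (h ⊝ point x)) ℂ.+ Σ₂.∑ (λ x → φ (h ⊞ point x))

  od-resp : ∀ {φ} → 𝓕.Respectful φ → 𝓕.Respectful (od φ)
  od-resp φ-resp g∼h = ℂ.+-cong
    (Σ₂.∑-cong (λ x → φ-resp (G.∙-congʳ {(point x) G.⁻¹} g∼h))) (Σ₂.∑-cong (λ x → φ-resp (G.∙-congʳ {point x} g∼h)))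

  χ-inverse : ∀ g k → χ g (k G.⁻¹) ℂ.≈ conj (χ g k)
  χ-inverse g k = ℂ.trans (e-cong (ℤ₄P.inverseʳ-unique ⟪ g , k ⟫ ⟪ g , k G.⁻¹ ⟫ (≡.trans
      (≡.cong₂ _+₄_ (⟪⟫-sym g k) (⟪⟫-sym g (k G.⁻¹))) (≡.trans (≡.sym (⟪⟫-∙ k (k G.⁻¹) g))
        (≡.trans (⟪⟫-congˡ {k G.∙ k G.⁻¹} {G.ε} g (G.inverseʳ k)) (⟪⟫-ε g)))))) (ℂ.sym (conj-e _))
    where module ℤ₄P = AbelianGroupProperties ℤ₄

  -- A translation multiplies the transform by a character value, and the opposite translation by
  -- its conjugate. Together they give f + conj f, which is how the weights enter on the dual side.
  hat-od : ∀ φ → 𝓕.Respectful φ → ∀ g → 𝓕.hat (od φ) g ℂ.≈ emb (+ 2 ℤ.* re (f g)) ℂ.* 𝓕.hat φ g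
  hat-od φ φ-resp g = begin
    𝓕.hat (od φ) g
      ≈⟨ 𝓕.hat-+ (λ h → Σ₂.∑ (λ x → φ (h ⊝ point x))) (λ h → Σ₂.∑ (λ x → φ (h ⊞ point x))) g ⟩
    𝓕.hat (λ h → Σ₂.∑ (λ x → φ (h ⊝ point x))) g ℂ.+ 𝓕.hat (λ h → Σ₂.∑ (λ x → φ (h ⊞ point x))) g
      ≈⟨ ℂ.+-cong
           (ℂ.trans (hat-Σ₂ (λ x h → φ (h ⊝ point x)) g) (Σ₂.∑-cong (λ x → 𝓕.hat-translate φ (point x) φ-resp g)))
           (ℂ.trans (hat-Σ₂ (λ x h → φ (h ⊞ point x)) g) (Σ₂.∑-cong (λ x → ℂ.trans
             (𝓕.hat-cong (λ h → φ-resp (G.∙-congˡ {h} (G.sym {(point x G.⁻¹) G.⁻¹} {point x}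
                 (GP.⁻¹-involutive (point x))))) g)
             (ℂ.trans (𝓕.hat-translate φ (point x G.⁻¹) φ-resp g) (ℂ.*-congʳ (χ-inverse g (point x))))))) ⟩
    Σ₂.∑ (λ x → χ g (point x) ℂ.* 𝓕.hat φ g) ℂ.+ Σ₂.∑ (λ x → conj (χ g (point x)) ℂ.* 𝓕.hat φ g)
      ≈⟨ ℂ.+-cong (Σ₂.∑-*ʳ _ _) (ℂ.trans (Σ₂.∑-*ʳ _ _) (ℂ.*-congʳ (ℂ.sym (Σ₂.∑-conj _)))) ⟩
    f g ℂ.* 𝓕.hat φ g ℂ.+ conj (f g) ℂ.* 𝓕.hat φ g
      ≈⟨ ℂ.trans (ℂ.sym (ℂ.distribʳ _ _ _)) (ℂ.*-congʳ (+-conj (f g))) ⟩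
    emb (+ 2 ℤ.* re (f g)) ℂ.* 𝓕.hat φ g ∎

  -- Only one of the 2q translates can meet L: adding a point gives first coordinate 2, and
  -- subtracting `point x` leaves an element of 2R in the second only for x congruent to α.
  od-1 : ∀ φ → 𝓕.Respectful φ → (∀ h → ¬ OnL h → φ h ℂ.≈ ℂ.0#) → ∀ α β →
         od φ (1F , α , β) ℂ.≈ φ ((1F , α , β) ⊝ point α)
  od-1 φ φ-resp φ-off α β = ℂ.trans (ℂ.+-cong
      (ℂ.trans (Σ₂.∑-cong (λ x → term x (x ≋? α))) (Σ₂.∑-δ (λ x → φ ((1F , α , β) ⊝ point x)) α
        (λ {x} {y} eq → φ-resp (G.∙-congˡ {(1F , α , β)} (G.⁻¹-cong {point x} {point y} (point-cong eq))))))
      (Σ₂.∑-0 _ (λ x → φ-off _ (λ on → contradiction (onL-s {_} {α + ω x} {β + x * (x * x)} on) λ ()))))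
    (ℂ.+-identityʳ _)
    where
    term : ∀ x (d : Dec (x ≋ α)) → φ ((1F , α , β) ⊝ point x) ℂ.≈ ⟦ d ⟧ ℂ.* φ ((1F , α , β) ⊝ point x)
    term x (yes _) = ℂ.sym (ℂ.*-identityˡ _)
    term x (no n)  = ℂ.trans (φ-off _ (λ on → n (R₂.sym (certificate₂ {b = x} 1# 1#
        (onL-α {_} {α - ω x} {β - x * (x * x)} on) (ω-≋ x)
      (solve₂ 3 (λ α w x → α :+ x := :1 :* (α :- w :+ :0) :+ :1 :* (w :+ x)) R₂.refl α (ω x) x))))) (ℂ.sym (ℂ.zeroˡ _))

  od-3 : ∀ φ → 𝓕.Respectful φ → (∀ h → ¬ OnL h → φ h ℂ.≈ ℂ.0#) → ∀ α β →
         od φ (3F , α , β) ℂ.≈ φ ((3F , α , β) ⊞ point α)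
  od-3 φ φ-resp φ-off α β = ℂ.trans (ℂ.+-cong
      (Σ₂.∑-0 _ (λ x → φ-off _ (λ on → contradiction (onL-s {_} {α - ω x} {β - x * (x * x)} on) λ ())))
      (ℂ.trans (Σ₂.∑-cong (λ x → term x (x ≋? α))) (Σ₂.∑-δ (λ x → φ ((3F , α , β) ⊞ point x)) α
        (λ {x} {y} eq → φ-resp (G.∙-congˡ {(3F , α , β)} {point x} {point y} (point-cong eq))))))
    (ℂ.+-identityˡ _)
    where
    term : ∀ x (d : Dec (x ≋ α)) → φ ((3F , α , β) ⊞ point x) ℂ.≈ ⟦ d ⟧ ℂ.* φ ((3F , α , β) ⊞ point x)
    term x (yes _) = ℂ.sym (ℂ.*-identityˡ _)
    term x (no n)  = ℂ.trans (φ-off _ (λ on → n (R₂.sym (certificate₂ {b = x} 1# 1#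
        (onL-α {_} {α + ω x} {β + x * (x * x)} on) (ω-≋ x)
      (solve₂ 3 (λ α w x → α :+ x := :1 :* (α :+ w :+ :0) :+ :1 :* (w :+ x)) R₂.refl α (ω x) x))))) (ℂ.sym (ℂ.zeroˡ _))

  od-0 : ∀ φ → (∀ h → ¬ OnL h → φ h ℂ.≈ ℂ.0#) → ∀ α β → od φ (0F , α , β) ℂ.≈ ℂ.0#
  od-0 φ φ-off α β = ℂ.trans (ℂ.+-cong
    (Σ₂.∑-0 _ (λ x → φ-off _ (λ on → contradiction (onL-s {_} {α - ω x} {β - x * (x * x)} on) λ ())))
    (Σ₂.∑-0 _ (λ x → φ-off _ (λ on → contradiction (onL-s {_} {α + ω x} {β + x * (x * x)} on) λ ()))))
        (ℂ.+-identityʳ ℂ.0#)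

  od-2 : ∀ φ → (∀ h → ¬ OnL h → φ h ℂ.≈ ℂ.0#) → ∀ α β → od φ (2F , α , β) ℂ.≈ ℂ.0#
  od-2 φ φ-off α β = ℂ.trans (ℂ.+-cong
    (Σ₂.∑-0 _ (λ x → φ-off _ (λ on → contradiction (onL-s {_} {α - ω x} {β - x * (x * x)} on) λ ())))
    (Σ₂.∑-0 _ (λ x → φ-off _ (λ on → contradiction (onL-s {_} {α + ω x} {β + x * (x * x)} on) λ ()))))
        (ℂ.+-identityʳ ℂ.0#)

  -- Sums of two points ±(1, x, x³)

  -- The subtracted term removes the 2q trivial representations of 0, as `point x` minus itself with
  -- either sign. What remains counts ordered pairs of signed points with a given sum.
  φ₄ : M → 𝔾
  φ₄ h = od (od (ψ 0F)) h ℂ.- emb (+ 2) ℂ.* (Q ℂ.* ψ 0F h)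

  φ₄-resp : 𝓕.Respectful φ₄
  φ₄-resp {g} {h} eq = ℂ.+-cong (od-resp {od (ψ 0F)} (λ {x} {y} → od-resp {ψ 0F} (λ {x} {y} → ψ-resp 0F {x} {y}) {x}
      {y}) {g} {h} eq)
    (ℂ.-‿cong (ℂ.*-congˡ (ℂ.*-congˡ (ψ-resp 0F {g} {h} eq))))

  private
    δ-resp : 𝓕.Respectful (ψ 0F)
    δ-resp {g} {h} = ψ-resp 0F {g} {h}

    δ-off : ∀ h → ¬ OnL h → ψ 0F h ℂ.≈ ℂ.0#
    δ-off = ψ-off 0F

  IsZero : Carrier → Carrier → Set ℓ
  IsZero α β = α ≈ 0# × β ≋ 0#

  δ-1 : ∀ {α β} → IsZero α β → ψ 0F (0F , α , β) ℂ.≈ ℂ.1#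
  δ-1 {α} {β} (α≈0 , β≋0) = ⟦⟧-true ((0F , α , β) ≟ ℓ-point 0# 0#) (refl , R.trans α≈0 (R.sym (R.zeroʳ 2#)) , β≋0)

  δ-0 : ∀ {α β} → ¬ IsZero α β → ψ 0F (0F , α , β) ℂ.≈ ℂ.0#
  δ-0 {α} {β} n = ⟦⟧-false ((0F , α , β) ≟ ℓ-point 0# 0#) (λ (_ , α≈ , β≋) → n (R.trans α≈ (R.zeroʳ 2#) , β≋))

  δ-cong : ∀ {α α′ β β′} → α ≈ α′ → β ≋ β′ → ψ 0F (0F , α , β) ℂ.≈ ψ 0F (0F , α′ , β′)
  δ-cong {α} {α′} {β} {β′} α≈ β≋ = δ-resp {0F , α , β} {0F , α′ , β′} (refl , α≈ , β≋)

  Indicates : (Carrier → 𝔾) → (Carrier → Set ℓ) → Set _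
  Indicates t P = ∀ x → (P x → t x ℂ.≈ ℂ.1#) × (¬ P x → t x ℂ.≈ ℂ.0#)

  module _ {t : Carrier → 𝔾} {P : Carrier → Set ℓ} (P? : ∀ x → Dec (P x)) (P-resp : ∀ {x y} → x ≋ y → P x → P y)
      (t≈ : Indicates t P) where

    Σ₂-none : (¬ ∃ P) → Σ₂.∑ t ℂ.≈ ℂ.0#
    Σ₂-none none = Σ₂.∑-0 t (λ x → proj₂ (t≈ x) (λ p → none (x , p)))

    private
      bracket : ∀ x → t x ℂ.≈ ⟦ P? x ⟧
      bracket x = go (P? x)
        where
        go : (d : Dec (P x)) → t x ℂ.≈ ⟦ d ⟧
        go (yes p) = proj₁ (t≈ x) p
        go (no ¬p) = proj₂ (t≈ x) ¬p

    Σ₂-unique : ∀ {x₀} → P x₀ → (∀ {x} → P x → x ≋ x₀) → Σ₂.∑ t ℂ.≈ ℂ.1#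
    Σ₂-unique {x₀} p₀ unique = ℂ.trans (Σ₂.∑-cong (λ x → ℂ.trans (bracket x) (⟦⟧-cong (P? x) (x ≋? x₀)
      (mk⇔ unique (λ eq → P-resp (R₂.sym eq) p₀))))) (Σ₂-⟦≋⟧ x₀)

    Σ₂-pair : ∀ {x₀ x₁} → P x₀ → P x₁ → ¬ x₀ ≋ x₁ → (∀ {x} → P x → x ≋ x₀ ⊎ x ≋ x₁) → Σ₂.∑ t ℂ.≈ emb (+ 2)
    Σ₂-pair {x₀} {x₁} p₀ p₁ x₀≢x₁ complete = ℂ.trans (Σ₂.∑-cong
        (λ x → ℂ.trans (bracket x) (⟦⟧-⊎ (P? x) (x ≋? x₀) (x ≋? x₁)
        complete (λ eq → P-resp (R₂.sym eq) p₀) (λ eq → P-resp (R₂.sym eq) p₁)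
            (λ eq eq′ → x₀≢x₁ (R₂.trans (R₂.sym eq) eq′)))))
      (ℂ.trans (Σ₂.∑-+ _ _) (ℂ.trans (ℂ.+-cong (Σ₂-⟦≋⟧ x₀) (Σ₂-⟦≋⟧ x₁))
          (solve 0 (con (+ 1) ⊕ con (+ 1) ⊜ con (+ 2)) ℂ.refl)))

  0-or-2 : 𝔾 → Set
  0-or-2 x = x ℂ.≈ emb (+ 0) ⊎ x ℂ.≈ emb (+ 2)

  sqrt-cong : ∀ {x y} → x ≋ y → sqrt x ≋ sqrt y
  sqrt-cong {x} {y} eq = square-injective (R₂.trans (sqrt² x) (R₂.trans eq (R₂.sym (sqrt² y))))

  sqrt-+ : ∀ x y → sqrt (x + y) ≋ sqrt x + sqrt y
  sqrt-+ x y = square-injective (R₂.trans (sqrt² (x + y)) (R₂.trans (R₂.sym (R₂.+-cong (sqrt² x) (sqrt² y)))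
    (solve₂ 2 (λ u v → u :* u :+ v :* v := (u :+ v) :* (u :+ v)) R₂.refl (sqrt x) (sqrt y))))

  ω-sum : ∀ α x → ω (α + x) ≈ ω α + ω x + 2# * (sqrt α * sqrt x)
  ω-sum α x = R.trans (solve₄ 2 (λ s t → s :=₄ (s :+₄ con₄ 2F :*₄ t) :+₄ con₄ 2F :*₄ t)
    R.refl (ω (α + x)) (sqrt α * sqrt x)) (+-congʳ (R.sym (ω-+ α x)))

  φ₄-odd-1 : ∀ α β → φ₄ (1F , α , β) ℂ.≈ ℂ.0#
  φ₄-odd-1 α β = ℂ.trans (ℂ.+-cong (ℂ.trans (ℂ.+-cong
      (Σ₂.∑-0 _ (λ x → od-0 (ψ 0F) δ-off (α - ω x) (β - x * (x * x))))
      (Σ₂.∑-0 _ (λ x → od-2 (ψ 0F) δ-off (α + ω x) (β + x * (x * x))))) (ℂ.+-identityʳ ℂ.0#))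
    (ℂ.-‿cong (ℂ.*-congˡ (ℂ.*-congˡ (δ-off (1F , α , β) (λ on → contradiction (onL-s {_} {α} {β} on) λ ()))))))
    (solve 1 (λ q → con (+ 0) ⊖ con (+ 2) ⊗ (q ⊗ con (+ 0)) ⊜ con (+ 0)) ℂ.refl Q)

  φ₄-odd-3 : ∀ α β → φ₄ (3F , α , β) ℂ.≈ ℂ.0#
  φ₄-odd-3 α β = ℂ.trans (ℂ.+-cong (ℂ.trans (ℂ.+-cong
      (Σ₂.∑-0 _ (λ x → od-2 (ψ 0F) δ-off (α - ω x) (β - x * (x * x))))
      (Σ₂.∑-0 _ (λ x → od-0 (ψ 0F) δ-off (α + ω x) (β + x * (x * x))))) (ℂ.+-identityʳ ℂ.0#))
    (ℂ.-‿cong (ℂ.*-congˡ (ℂ.*-congˡ (δ-off (3F , α , β) (λ on → contradiction (onL-s {_} {α} {β} on) λ ()))))))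
    (solve 1 (λ q → con (+ 0) ⊖ con (+ 2) ⊗ (q ⊗ con (+ 0)) ⊜ con (+ 0)) ℂ.refl Q)

  -- `T₁` tests whether h = (0, α, β) is `point x` minus `point y`, and `T₂` whether it is `point y`
  -- minus `point x`; y is forced by the second coordinate.
  T₁ T₂ : Carrier → Carrier → Carrier → 𝔾
  T₁ α β x = ψ 0F (0F , (α - ω x) + ω (α - ω x) , (β - cube x) + cube (α - ω x))
  T₂ α β x = ψ 0F (0F , (α + ω x) - ω (α + ω x) , (β + cube x) - cube (α + ω x))

  od²-0 : ∀ α β → od (od (ψ 0F)) (0F , α , β) ℂ.≈ Σ₂.∑ (T₁ α β) ℂ.+ Σ₂.∑ (T₂ α β)
  od²-0 α β = ℂ.+-cong
    (Σ₂.∑-cong (λ x → od-3 (ψ 0F) (λ {g} {h} → δ-resp {g} {h}) δ-off (α - ω x) (β - cube x)))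
    (Σ₂.∑-cong (λ x → od-1 (ψ 0F) (λ {g} {h} → δ-resp {g} {h}) δ-off (α + ω x) (β + cube x)))

  -- The same for (2, α, β), with `point x` plus `point y` in `U₁` and the negative of such a sum in
  -- `U₂`.
  U₁ U₂ : Carrier → Carrier → Carrier → 𝔾
  U₁ α β x = ψ 0F (0F , (α - ω x) - ω (α - ω x) , (β - cube x) - cube (α - ω x))
  U₂ α β x = ψ 0F (0F , (α + ω x) + ω (α + ω x) , (β + cube x) + cube (α + ω x))

  od²-2 : ∀ α β → od (od (ψ 0F)) (2F , α , β) ℂ.≈ Σ₂.∑ (U₁ α β) ℂ.+ Σ₂.∑ (U₂ α β)
  od²-2 α β = ℂ.+-cong
    (Σ₂.∑-cong (λ x → od-1 (ψ 0F) (λ {g} {h} → δ-resp {g} {h}) δ-off (α - ω x) (β - cube x)))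
    (Σ₂.∑-cong (λ x → od-3 (ψ 0F) (λ {g} {h} → δ-resp {g} {h}) δ-off (α + ω x) (β + cube x)))

  α-ω≋ : ∀ α x → α - ω x ≋ α + x
  α-ω≋ α x = R₂.trans (R₂.+-congˡ (R₂.-‿cong (ω-≋ x))) (solve₂ 2 (λ α x → α :- x := α :+ x) R₂.refl α x)

  α+ω≋ : ∀ α x → α + ω x ≋ α + x
  α+ω≋ α x = R₂.+-congˡ (ω-≋ x)

  -- For α in 2R the two points have the same residue and cancel, so each of the 2q terms equals
  -- `ψ 0F` at h, and the correction in `φ₄` removes them all.
  φ₄-L : ∀ {α} β → α ≋ 0# → φ₄ (0F , α , β) ℂ.≈ emb (+ 0)
  φ₄-L {α} β α≋0 = begin
    φ₄ (0F , α , β)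
      ≈⟨ ℂ.+-congʳ (ℂ.trans (od²-0 α β) (ℂ.+-cong
           (ℂ.trans (Σ₂.∑-cong (λ x → δ-cong (R.trans (+-congˡ (ω-cong (x≋ x (α-ω≋ α x)))) (cancel₁ α (ω x)))
             (R₂.trans (R₂.+-congˡ (cube-cong (x≋ x (α-ω≋ α x)))) (cancel₂ β (cube x))))) (Σ₂.∑-const δh))
           (ℂ.trans (Σ₂.∑-cong (λ x → δ-cong (R.trans (+-congˡ (R.-‿cong (ω-cong (x≋ x (α+ω≋ α x))))) (cancel₃ α (ω x)))
             (R₂.trans (R₂.+-congˡ (R₂.-‿cong (cube-cong (x≋ x (α+ω≋ α x))))) (cancel₄ β (cube x)))))
                 (Σ₂.∑-const δh)))) ⟩
    (Q ℂ.* δh ℂ.+ Q ℂ.* δh) ℂ.- emb (+ 2) ℂ.* (Q ℂ.* δh)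
      ≈⟨ solve 2 (λ q d → (q ⊗ d ⊕ q ⊗ d) ⊖ con (+ 2) ⊗ (q ⊗ d) ⊜ con (+ 0)) ℂ.refl Q δh ⟩
    ℂ.0#
      ≈⟨ emb-0 ⟨
    emb (+ 0) ∎
    where
    δh : 𝔾
    δh = ψ 0F (0F , α , β)
    x≋ : ∀ x {y} → y ≋ α + x → y ≋ x
    x≋ x eq = R₂.trans eq (R₂.trans (R₂.+-congʳ α≋0) (R₂.+-identityˡ x))
    cancel₁ : ∀ a b → (a - b) + b ≈ a
    cancel₁ = solve₄ 2 (λ a b → (a :-₄ b) :+₄ b :=₄ a) R.refl
    cancel₂ : ∀ a b → (a - b) + b ≋ a
    cancel₂ = solve₂ 2 (λ a b → (a :- b) :+ b := a) R₂.refl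
    cancel₃ : ∀ a b → (a + b) - b ≈ a
    cancel₃ = solve₄ 2 (λ a b → (a :+₄ b) :-₄ b :=₄ a) R.refl
    cancel₄ : ∀ a b → (a + b) - b ≋ a
    cancel₄ = solve₂ 2 (λ a b → (a :+ b) :- b := a) R₂.refl

  private
    zero? : ∀ α β → Dec (IsZero α β)
    zero? α β = HasSize-≟ (IsGR4.cardinality isGR4) α 0# ×-dec (β ≋? 0#)

  -- By the carry formula, h being a difference of points fixes 2√α√x, hence x because α is a unit.
  -- Exchanging the two points maps `T₁` to `T₂`, so the one possible solution is counted twice.
  φ₄-0 : ∀ {α} β → ¬ α ≋ 0# → 0-or-2 (φ₄ (0F , α , β))
  φ₄-0 {α} β α≢0 = go (HasSize-any? residue-size P? P-resp)
    where
    P : Carrier → Set ℓ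
    P x = IsZero ((α - ω x) + ω (α - ω x)) ((β - cube x) + cube (α - ω x))
    P? : ∀ x → Dec (P x)
    P? x = zero? ((α - ω x) + ω (α - ω x)) ((β - cube x) + cube (α - ω x))
    α-ω-cong : ∀ {x y} → x ≋ y → α - ω x ≈ α - ω y
    α-ω-cong eq = +-congˡ (R.-‿cong (ω-cong eq))
    A-cong : ∀ {x y} → x ≋ y → (α - ω x) + ω (α - ω x) ≈ (α - ω y) + ω (α - ω y)
    A-cong eq = +-cong (α-ω-cong eq) (ω-cong (≈⇒≋ (α-ω-cong eq)))
    B-cong : ∀ {x y} → x ≋ y → (β - cube x) + cube (α - ω x) ≋ (β - cube y) + cube (α - ω y)
    B-cong eq = R₂.+-cong (R₂.+-congˡ (R₂.-‿cong (cube-cong eq))) (cube-cong (≈⇒≋ (α-ω-cong eq)))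
    P-resp : ∀ {x y} → x ≋ y → P x → P y
    P-resp eq (A≈0 , B≋0) = R.trans (R.sym (A-cong eq)) A≈0 , R₂.trans (R₂.sym (B-cong eq)) B≋0
    T₁≈ : Indicates (T₁ α β) P
    T₁≈ x = δ-1 {(α - ω x) + ω (α - ω x)} {(β - cube x) + cube (α - ω x)} , δ-0 {(α - ω x) + ω (α - ω x)}
        {(β - cube x) + cube (α - ω x)}
    T₂≈T₁ : ∀ x → T₂ α β x ℂ.≈ T₁ α β (x + α)
    T₂≈T₁ x = δ-cong
      (R.trans (solve₄ 3 (λ α w y → (α :+₄ w) :-₄ y :=₄ (α :-₄ y) :+₄ w) R.refl α (ω x) (ω (α + ω x)))
        (+-cong (+-congˡ (R.-‿cong (ω-cong y≋))) (ω-cong (R₂.sym z≋))))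
      (R₂.trans (solve₂ 3 (λ β w y → (β :+ w) :- y := (β :- y) :+ w) R₂.refl β (cube x) (cube (α + ω x)))
        (R₂.+-cong (R₂.+-congˡ (R₂.-‿cong (cube-cong y≋))) (cube-cong (R₂.sym z≋))))
      where
      y≋ : α + ω x ≋ x + α
      y≋ = R₂.trans (α+ω≋ α x) (R₂.+-comm α x)
      z≋ : α - ω (x + α) ≋ x
      z≋ = R₂.trans (α-ω≋ α (x + α)) (solve₂ 2 (λ α x → α :+ (x :+ α) := x) R₂.refl α x)
    φ₄≈ : φ₄ (0F , α , β) ℂ.≈ emb (+ 2) ℂ.* Σ₂.∑ (T₁ α β)
    φ₄≈ = begin
      φ₄ (0F , α , β)
        ≈⟨ ℂ.+-cong (ℂ.trans (od²-0 α β) (ℂ.+-congˡ (ℂ.trans (Σ₂.∑-cong T₂≈T₁)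
            (Σ₂-translate (T₁ α β) α (λ eq → δ-cong (A-cong eq) (B-cong eq))))))
             (ℂ.-‿cong (ℂ.*-congˡ (ℂ.*-congˡ (δ-off (0F , α , β) (λ on → α≢0 (onL-α {0F} {α} {β} on)))))) ⟩
      (Σ₂.∑ (T₁ α β) ℂ.+ Σ₂.∑ (T₁ α β)) ℂ.- emb (+ 2) ℂ.* (Q ℂ.* ℂ.0#)
        ≈⟨ solve 2 (λ q t → (t ⊕ t) ⊖ con (+ 2) ⊗ (q ⊗ con (+ 0)) ⊜ con (+ 2) ⊗ t) ℂ.refl Q _ ⟩
      emb (+ 2) ℂ.* Σ₂.∑ (T₁ α β) ∎
    A≈ : ∀ x → (α - ω x) + ω (α - ω x) ≈ (α + ω α) + 2# * (sqrt α * sqrt x)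
    A≈ x = R.trans (+-congˡ (R.trans (ω-cong (α-ω≋ α x)) (ω-sum α x)))
      (solve₄ 4 (λ α w y t → (α :-₄ w) :+₄ (y :+₄ w :+₄ t) :=₄ (α :+₄ y) :+₄ t)
        R.refl α (ω x) (ω α) (2# * (sqrt α * sqrt x)))
    unique : ∀ {x y} → P x → P y → x ≋ y
    unique {x} {y} (Ax , _) (Ay , _) = R₂.trans (R₂.sym (sqrt² x)) (R₂.trans (R₂.*-cong sx≋sy sx≋sy) (sqrt² y))
      where
      2st : 2# * (sqrt α * sqrt x) ≈ 2# * (sqrt α * sqrt y)
      2st = R.trans (solve₄ 2 (λ p t → t :=₄ (p :+₄ t) :-₄ p) R.refl (α + ω α) (2# * (sqrt α * sqrt x)))
        (R.trans (+-congʳ (R.trans (R.sym (A≈ x)) (R.trans Ax (R.trans (R.sym Ay) (A≈ y)))))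
          (solve₄ 2 (λ p t → (p :+₄ t) :-₄ p :=₄ t) R.refl (α + ω α) (2# * (sqrt α * sqrt y))))
      sx≋sy : sqrt x ≋ sqrt y
      sx≋sy = ≋-cancelˡ (λ eq → α≢0 (R₂.trans (R₂.sym (sqrt² α)) (R₂.trans (R₂.*-congʳ eq) (R₂.zeroˡ _)))) (halve 2st)
    go : Dec (∃ P) → 0-or-2 (φ₄ (0F , α , β))
    go (no none) = inj₁ (ℂ.trans φ₄≈ (ℂ.trans (ℂ.*-congˡ (Σ₂-none P? P-resp T₁≈ none))
        (ℂ.trans (ℂ.zeroʳ _) (ℂ.sym emb-0))))
    go (yes (x₀ , p₀)) = inj₂ (ℂ.trans φ₄≈ (ℂ.trans (ℂ.*-congˡ (Σ₂-unique P? P-resp T₁≈ p₀ (λ p → unique p p₀)))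
        (ℂ.*-identityʳ _)))

  -- Write α = ω α + 2w. By the carry formula ω x + ω(α + x) = ω α + 2(x + √α√x), so being a sum of
  -- two points requires w = `quad x` modulo 2 besides the condition on cubes. For the negative of a
  -- sum, -ω α = ω α + 2ω α shifts the requirement by α.
  module SumOfPoints (α β : Carrier) where
    w : Carrier
    w = proj₁ (ω-split α)

    α≈ : α ≈ ω α + 2# * w
    α≈ = proj₂ (ω-split α)

    quad : Carrier → Carrier
    quad x = x + sqrt α * sqrt x

    quad-cong : ∀ {x y} → x ≋ y → quad x ≋ quad y
    quad-cong eq = R₂.+-cong eq (R₂.*-congˡ (sqrt-cong eq))

    CubeSum : Carrier → Set ℓ
    CubeSum x = β ≋ cube x + cube (α + x)

    P₁ P₂ : Carrier → Set ℓ
    P₁ x = w ≋ quad x × CubeSum x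
    P₂ x = w ≋ α + quad x × CubeSum x

    P₁? : ∀ x → Dec (P₁ x)
    P₁? x = (w ≋? quad x) ×-dec (β ≋? cube x + cube (α + x))

    P₂? : ∀ x → Dec (P₂ x)
    P₂? x = (w ≋? α + quad x) ×-dec (β ≋? cube x + cube (α + x))

    CubeSum-resp : ∀ {x y} → x ≋ y → CubeSum x → CubeSum y
    CubeSum-resp eq = λ β≋ → R₂.trans β≋ (R₂.+-cong (cube-cong eq) (cube-cong (R₂.+-congˡ eq)))

    P₁-resp : ∀ {x y} → x ≋ y → P₁ x → P₁ y
    P₁-resp eq (w≋ , β≋) = R₂.trans w≋ (quad-cong eq) , CubeSum-resp eq β≋

    P₂-resp : ∀ {x y} → x ≋ y → P₂ x → P₂ y
    P₂-resp eq (w≋ , β≋) = R₂.trans w≋ (R₂.+-congˡ (quad-cong eq)) , CubeSum-resp eq β≋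

    ω+ω : ∀ x → ω x + ω (α + x) ≈ ω α + 2# * quad x
    ω+ω x = R.trans (+-congˡ (ω-sum α x)) (R.trans
      (solve₄ 3 (λ w a t → w :+₄ (a :+₄ w :+₄ con₄ 2F :*₄ t)
        :=₄ a :+₄ (con₄ 2F :*₄ w :+₄ con₄ 2F :*₄ t)) R.refl (ω x) (ω α) (sqrt α * sqrt x))
      (+-congˡ (R.trans (+-congʳ (double (ω-≋ x))) (R.sym (R.distribˡ 2# x (sqrt α * sqrt x))))))

    A₁≈ : ∀ x → (α - ω x) - ω (α - ω x) ≈ 2# * (w + quad x)
    A₁≈ x = R.trans (solve₄ 3 (λ a y z → (a :-₄ y) :-₄ z :=₄ a :-₄ (y :+₄ z)) R.refl α (ω x) (ω (α - ω x)))
      (R.trans (+-cong α≈ (R.-‿cong (R.trans (+-congˡ (ω-cong (α-ω≋ α x))) (ω+ω x))))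
        (solve₄ 3 (λ a w q → (a :+₄ con₄ 2F :*₄ w) :-₄ (a :+₄ con₄ 2F :*₄ q)
          :=₄ con₄ 2F :*₄ (w :+₄ q)) R.refl (ω α) w (quad x)))

    A₂≈ : ∀ x → (α + ω x) + ω (α + ω x) ≈ 2# * (w + (α + quad x))
    A₂≈ x = R.trans (solve₄ 3 (λ a y z → (a :+₄ y) :+₄ z :=₄ a :+₄ (y :+₄ z)) R.refl α (ω x) (ω (α + ω x)))
      (R.trans (+-cong α≈ (R.trans (+-congˡ (ω-cong (α+ω≋ α x))) (ω+ω x))) (R.trans
        (solve₄ 3 (λ a w q → (a :+₄ con₄ 2F :*₄ w) :+₄ (a :+₄ con₄ 2F :*₄ q)
          :=₄ con₄ 2F :*₄ a :+₄ con₄ 2F :*₄ (w :+₄ q)) R.refl (ω α) w (quad x))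
        (R.trans (+-congʳ (double (ω-≋ α))) (solve₄ 3 (λ a w q → con₄ 2F :*₄ a :+₄ con₄ 2F :*₄ (w :+₄ q)
          :=₄ con₄ 2F :*₄ (w :+₄ (a :+₄ q))) R.refl α w (quad x)))))

    2*≈0 : ∀ {x y z} → z ≈ 2# * (x + y) → z ≈ 0# → x ≋ y
    2*≈0 z≈ z≈0 = ≋-+≋0 (halve (R.trans (R.sym z≈) (R.trans z≈0 (R.sym (R.zeroʳ 2#)))))

    ⇒2*≈0 : ∀ {x y z} → z ≈ 2# * (x + y) → x ≋ y → z ≈ 0#
    ⇒2*≈0 z≈ eq = R.trans z≈ (R.trans (double (≋⇒+≋0 eq)) (R.zeroʳ 2#))

    B₁≋ : ∀ x → (β - cube x) - cube (α - ω x) ≋ β + (cube x + cube (α + x))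
    B₁≋ x = R₂.trans (R₂.+-congˡ (R₂.-‿cong (cube-cong (α-ω≋ α x))))
      (solve₂ 3 (λ b y z → (b :- y) :- z := b :+ (y :+ z)) R₂.refl β (cube x) (cube (α + x)))

    B₂≋ : ∀ x → (β + cube x) + cube (α + ω x) ≋ β + (cube x + cube (α + x))
    B₂≋ x = R₂.trans (R₂.+-congˡ (cube-cong (α+ω≋ α x))) (R₂.+-assoc β (cube x) (cube (α + x)))

    U₁≈ : Indicates (U₁ α β) P₁
    U₁≈ x = (λ (w≋ , β≋) → δ-1 (⇒2*≈0 (A₁≈ x) w≋ , R₂.trans (B₁≋ x) (≋⇒+≋0 β≋)))
          , (λ n → δ-0 (λ (A≈0 , B≋0) → n (2*≈0 (A₁≈ x) A≈0 , ≋-+≋0 (R₂.trans (R₂.sym (B₁≋ x)) B≋0))))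

    U₂≈ : Indicates (U₂ α β) P₂
    U₂≈ x = (λ (w≋ , β≋) → δ-1 (⇒2*≈0 (A₂≈ x) w≋ , R₂.trans (B₂≋ x) (≋⇒+≋0 β≋)))
          , (λ n → δ-0 (λ (A≈0 , B≋0) → n (2*≈0 (A₂≈ x) A≈0 , ≋-+≋0 (R₂.trans (R₂.sym (B₂≋ x)) B≋0))))

    quad≋ : ∀ x → quad x ≋ sqrt x ² + sqrt α * sqrt x
    quad≋ x = R₂.+-congʳ (R₂.sym (sqrt² x))

    quad-injective : ∀ {x y} → quad x ≋ quad y → x ≋ y ⊎ x ≋ y + α
    quad-injective {x} {y} eq = Sum.map
      (λ e → R₂.trans (R₂.sym (sqrt² x)) (R₂.trans (R₂.*-cong (≋-+≋0 e) (≋-+≋0 e)) (sqrt² y)))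
      (λ e → R₂.trans (R₂.sym (sqrt² x)) (R₂.trans (R₂.*-cong (≋-+≋0 e) (≋-+≋0 e))
        (R₂.trans (solve₂ 2 (λ u v → (u :+ v) :* (u :+ v) := u :* u :+ v :* v) R₂.refl (sqrt y) (sqrt α))
          (R₂.+-cong (sqrt² y) (sqrt² α)))))
      (≋-domain {sqrt x + sqrt y} {sqrt x + (sqrt y + sqrt α)} (certificate₁ {b = 0#} 1#
        (R₂.trans (R₂.sym (quad≋ x)) (R₂.trans eq (quad≋ y))) (solve₂ 3 (λ a u v →
          (u :+ v) :* (u :+ (v :+ a)) :+ :0
          := :1 :* ((u :* u :+ a :* u) :+ (v :* v :+ a :* v))) R₂.refl (sqrt α) (sqrt x) (sqrt y))))

    quad-+α : ∀ x → quad (x + α) ≋ quad x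
    quad-+α x = R₂.trans (quad≋ (x + α)) (R₂.trans (R₂.+-cong (R₂.*-cong (sqrt-+ x α) (sqrt-+ x α))
        (R₂.*-congˡ (sqrt-+ x α)))
      (R₂.trans (solve₂ 2 (λ a u → (u :+ a) :* (u :+ a) :+ a :* (u :+ a) := u :* u :+ a :* u) R₂.refl (sqrt α) (sqrt x))
        (R₂.sym (quad≋ x))))

    CubeSum-+α : ∀ {x} → CubeSum x → CubeSum (x + α)
    CubeSum-+α {x} β≋ = R₂.trans β≋ (R₂.trans (R₂.+-comm (cube x) (cube (α + x))) (R₂.+-cong
      (cube-cong (R₂.+-comm α x)) (cube-cong (solve₂ 2 (λ α x → x := α :+ (x :+ α)) R₂.refl α x))))

    -- Both at once would make √x + √y a zero of u² + u√α + α. This form is anisotropic because Tr 1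
    -- = 1.
    exclusive : ∀ {x y} → ¬ α ≋ 0# → P₁ x → ¬ P₂ y
    exclusive {x} {y} α≢0 (w≋ , _) (w≋′ , _) = norm-form≢0 {sqrt x + sqrt y} {sqrt α}
      (λ eq → α≢0 (R₂.trans (R₂.sym (sqrt² α)) (R₂.trans (R₂.*-congʳ eq) (R₂.zeroˡ _))))
      (certificate₁ {b = 0#} 1#
        (R₂.trans (R₂.sym (quad≋ x)) (R₂.trans (R₂.sym w≋) (R₂.trans w≋′ (R₂.+-cong (R₂.sym (sqrt² α)) (quad≋ y)))))
        (solve₂ 3 (λ a u v → (u :+ v) :* (u :+ v) :+ (u :+ v) :* a :+ a :* a :+ :0
          := :1 :* ((u :* u :+ a :* u) :+ (a :* a :+ (v :* v :+ a :* v)))) R₂.refl (sqrt α) (sqrt x) (sqrt y)))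

    x≢x+α : ∀ {x} → ¬ α ≋ 0# → ¬ x ≋ x + α
    x≢x+α {x} α≢0 eq = α≢0 (certificate₁ {b = 0#} 1# eq (solve₂ 2 (λ α x → α :+ :0
      := :1 :* (x :+ (x :+ α))) R₂.refl α x))

    φ₄≈ : φ₄ (2F , α , β) ℂ.≈ Σ₂.∑ (U₁ α β) ℂ.+ Σ₂.∑ (U₂ α β)
    φ₄≈ = ℂ.trans (ℂ.+-cong (od²-2 α β) (ℂ.-‿cong (ℂ.*-congˡ
        (ℂ.*-congˡ (δ-off (2F , α , β) (λ on → contradiction (onL-s {_} {α} {β} on) λ ()))))))
      (solve 3 (λ q x y → (x ⊕ y) ⊖ con (+ 2) ⊗ (q ⊗ con (+ 0)) ⊜ x ⊕ y) ℂ.refl Q (Σ₂.∑ (U₁ α β)) (Σ₂.∑ (U₂ α β)))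

    -- Solutions come in pairs x and x + α, which exchange the two points. A pair occurs for at most
    -- one of the two signs, so the total is 0 or 2.
    unit : ¬ α ≋ 0# → 0-or-2 (φ₄ (2F , α , β))
    unit α≢0 = go (HasSize-any? residue-size P₁? P₁-resp) (HasSize-any? residue-size P₂? P₂-resp)
      where
      go : Dec (∃ P₁) → Dec (∃ P₂) → 0-or-2 (φ₄ (2F , α , β))
      go (no none₁) (no none₂) = inj₁ (ℂ.trans φ₄≈ (ℂ.trans (ℂ.+-cong (Σ₂-none P₁? P₁-resp U₁≈ none₁)
          (Σ₂-none P₂? P₂-resp U₂≈ none₂))
        (ℂ.trans (ℂ.+-identityʳ ℂ.0#) (ℂ.sym emb-0))))
      go (yes (x , p)) _ = inj₂ (ℂ.trans φ₄≈ (ℂ.trans (ℂ.+-cong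
        (Σ₂-pair P₁? P₁-resp U₁≈ p (R₂.trans (proj₁ p) (R₂.sym (quad-+α x)) , CubeSum-+α (proj₂ p)) (x≢x+α α≢0)
          (λ p′ → quad-injective (R₂.trans (R₂.sym (proj₁ p′)) (proj₁ p))))
        (Σ₂-none P₂? P₂-resp U₂≈ (λ (_ , p′) → exclusive α≢0 p p′))) (ℂ.+-identityʳ _)))
      go (no none₁) (yes (x , p)) = inj₂ (ℂ.trans φ₄≈ (ℂ.trans (ℂ.+-cong (Σ₂-none P₁? P₁-resp U₁≈ none₁)
        (Σ₂-pair P₂? P₂-resp U₂≈ p (R₂.trans (proj₁ p) (R₂.+-congˡ (R₂.sym (quad-+α x))) , CubeSum-+α (proj₂ p))
            (x≢x+α α≢0)
          (λ {y} p′ → quad-injective (α+-cancel (R₂.trans (R₂.sym (proj₁ p′)) (proj₁ p)))))) (ℂ.+-identityˡ _)))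
        where
        α+-cancel : ∀ {y z} → α + y ≋ α + z → y ≋ z
        α+-cancel {y} {z} eq = certificate₁ 1# eq (solve₂ 3 (λ α y z → y :+ z := :1 :* ((α :+ y) :+ (α :+ z))) R₂.refl
            α y z)

    -- Here x is unique, but the conditions for the two signs coincide, so each sign contributes the
    -- same 0 or 1.
    nonunit : α ≋ 0# → 0-or-2 (φ₄ (2F , α , β))
    nonunit α≋0 = go (HasSize-any? residue-size P₁? P₁-resp)
      where
      P₁⇒P₂ : ∀ {x} → P₁ x → P₂ x
      P₁⇒P₂ (w≋ , β≋) = R₂.trans w≋ (R₂.trans (R₂.sym (R₂.+-identityˡ _)) (R₂.+-congʳ (R₂.sym α≋0))) , β≋
      P₂⇒P₁ : ∀ {x} → P₂ x → P₁ x
      P₂⇒P₁ (w≋ , β≋) = R₂.trans w≋ (R₂.trans (R₂.+-congʳ α≋0) (R₂.+-identityˡ _)) , β≋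
      unique : ∀ {x y} → P₁ x → P₁ y → x ≋ y
      unique {x} {y} p p′ = [ id , (λ eq → R₂.trans eq (R₂.trans (R₂.+-congˡ α≋0) (R₂.+-identityʳ y))) ]′
        (quad-injective (R₂.trans (R₂.sym (proj₁ p)) (proj₁ p′)))
      go : Dec (∃ P₁) → 0-or-2 (φ₄ (2F , α , β))
      go (no none) = inj₁ (ℂ.trans φ₄≈ (ℂ.trans (ℂ.+-cong (Σ₂-none P₁? P₁-resp U₁≈ none)
        (Σ₂-none P₂? P₂-resp U₂≈ (λ (x , p) → none (x , P₂⇒P₁ p)))) (ℂ.trans (ℂ.+-identityʳ ℂ.0#) (ℂ.sym emb-0))))
      go (yes (x , p)) = inj₂ (ℂ.trans φ₄≈ (ℂ.trans (ℂ.+-cong (Σ₂-unique P₁? P₁-resp U₁≈ p (λ p′ → unique p′ p))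
        (Σ₂-unique P₂? P₂-resp U₂≈ (P₁⇒P₂ p) (λ p′ → unique (P₂⇒P₁ p′) p)))
            (solve 0 (con (+ 1) ⊕ con (+ 1) ⊜ con (+ 2)) ℂ.refl)))

  φ₄-2 : ∀ α β → 0-or-2 (φ₄ (2F , α , β))
  φ₄-2 α β = go (α ≋? 0#)
    where
    go : Dec (α ≋ 0#) → 0-or-2 (φ₄ (2F , α , β))
    go (yes α≋0) = SumOfPoints.nonunit α β α≋0
    go (no α≢0)  = SumOfPoints.unit α β α≢0

  -- The generators of the dual algebra and their values on its ten classes

  g₂ : M
  g₂ = 2F , 0# , 0#

  -- Twice the indicator of the points with even first coordinate: the character of `g₂` is the sign
  -- (-1)^s of that coordinate.
  even : M → 𝔾
  even h = ℂ.1# ℂ.+ χ g₂ h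

  gen : Fin 10 → M → 𝔾
  gen 0F = ψ 0F
  gen 1F = ψ 1F
  gen 2F = ψ 2F
  gen 3F = ψ 3F
  gen 4F = even
  gen 5F = φ₄
  gen 6F = od (ψ 0F)
  gen 7F = od (ψ 1F)
  gen 8F = od (ψ 2F)
  gen 9F = od (ψ 3F)

  -- A row for each class of the dual group, a column for each generator.
  gen-value : Fin 10 → Fin 10 → ℕ
  gen-value st i = lookup (lookup rows st) i
    where
    rows : Vec (Vec ℕ 10) 10
    rows = (1 ∷ 1 ∷ 0 ∷ 1 ∷ 2 ∷ 0 ∷ 0 ∷ 0 ∷ 0 ∷ 0 ∷ [])
         ∷ (0 ∷ 1 ∷ 0 ∷ 1 ∷ 2 ∷ 0 ∷ 0 ∷ 0 ∷ 0 ∷ 0 ∷ [])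
         ∷ (0 ∷ 0 ∷ 0 ∷ 1 ∷ 2 ∷ 0 ∷ 0 ∷ 0 ∷ 0 ∷ 0 ∷ [])
         ∷ (0 ∷ 0 ∷ 3 ∷ 1 ∷ 2 ∷ 0 ∷ 0 ∷ 0 ∷ 0 ∷ 0 ∷ [])
         ∷ (0 ∷ 0 ∷ 0 ∷ 0 ∷ 2 ∷ 0 ∷ 0 ∷ 0 ∷ 0 ∷ 0 ∷ [])
         ∷ (0 ∷ 0 ∷ 0 ∷ 0 ∷ 2 ∷ 2 ∷ 0 ∷ 0 ∷ 0 ∷ 0 ∷ [])
         ∷ (0 ∷ 0 ∷ 0 ∷ 0 ∷ 0 ∷ 0 ∷ 1 ∷ 1 ∷ 0 ∷ 1 ∷ [])
         ∷ (0 ∷ 0 ∷ 0 ∷ 0 ∷ 0 ∷ 0 ∷ 0 ∷ 1 ∷ 0 ∷ 1 ∷ [])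
         ∷ (0 ∷ 0 ∷ 0 ∷ 0 ∷ 0 ∷ 0 ∷ 0 ∷ 0 ∷ 0 ∷ 1 ∷ [])
         ∷ (0 ∷ 0 ∷ 0 ∷ 0 ∷ 0 ∷ 0 ∷ 0 ∷ 0 ∷ 3 ∷ 1 ∷ [])
         ∷ []

  abstract
    -- Each column of `gen-value` is constant on its support, and any two supports are nested or
    -- disjoint. Hence a product is 0 or a multiple, by at most 3, of the generator with the smaller
    -- support; the finite table lets this be decided.
    gen-product : ∀ i j → ∃ λ (c : Fin 4) → ∃ λ k → ∀ st →
      gen-value st i ℕ.* gen-value st j ≡ toℕ c ℕ.* gen-value st k
    gen-product = from-yes (Fin.all? λ i → Fin.all? λ j → Fin.any? λ (c : Fin 4) → Fin.any? λ k → Fin.all? λ st →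
      (gen-value st i ℕ.* gen-value st j) ℕ.≟ (toℕ c ℕ.* gen-value st k))

  even-value : ∀ s α β → even (s , α , β) ℂ.≈ ℂ.1# ℂ.+ e (s +₄ s)
  even-value s α β = ℂ.+-congˡ (e-cong (≡.trans (≡.cong₂ _+₄_ (2* s) (≡.cong₂ _+₄_
    (≡.trans (tr₄-cong (R.zeroˡ α)) tr₄-0) (≡.trans (tr-cong (R₂.zeroˡ β)) tr-0))) (ℤ₄.identityʳ (s +₄ s))))
    where
    2* : ∀ s → 2F *₄ s ≡ s +₄ s
    2* = from-yes (Fin.all? λ s → (2F *₄ s) Fin.≟ (s +₄ s))

  even-even : ∀ {s} α β → s +₄ s ≡ 0F → even (s , α , β) ℂ.≈ emb (+ 2)
  even-even {s} α β eq = ℂ.trans (even-value s α β) (ℂ.trans (ℂ.+-congˡ (ℂ.trans (e-cong eq) e-0))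
    (solve 0 (con (+ 1) ⊕ con (+ 1) ⊜ con (+ 2)) ℂ.refl))

  even-odd : ∀ {s} α β → s +₄ s ≡ 2F → even (s , α , β) ℂ.≈ emb (+ 0)
  even-odd {s} α β eq = ℂ.trans (even-value s α β) (ℂ.trans (ℂ.+-congˡ (ℂ.trans (e-cong eq) e-2))
    (ℂ.trans (ℂ.-‿inverseʳ ℂ.1#) (ℂ.sym emb-0)))

  private
    _≈0 : 𝔾 → Set
    x ≈0 = x ℂ.≈ emb (+ 0)

    →≈0 : ∀ {x} → x ℂ.≈ ℂ.0# → x ≈0
    →≈0 eq = ℂ.trans eq (ℂ.sym emb-0)

    ψ-off≈0 : ∀ i h → ¬ OnL h → ψ i h ≈0
    ψ-off≈0 i h off = →≈0 (ψ-off i h off)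

    even-off : ∀ {h} → (∀ i → ψ i h ≈0) → even h ℂ.≈ emb (+ 2) → 0-or-2 (φ₄ h) → (∀ i → od (ψ i) h ≈0) →
               ∃ λ st → ∀ i → gen i h ℂ.≈ emb (+ gen-value st i)
    even-off ψ≈ even≈ (inj₁ φ≈) od≈ = 4F , λ
      { 0F → ψ≈ 0F ; 1F → ψ≈ 1F ; 2F → ψ≈ 2F ; 3F → ψ≈ 3F ; 4F → even≈ ; 5F → φ≈
      ; 6F → od≈ 0F ; 7F → od≈ 1F ; 8F → od≈ 2F ; 9F → od≈ 3F }
    even-off ψ≈ even≈ (inj₂ φ≈) od≈ = 5F , λ
      { 0F → ψ≈ 0F ; 1F → ψ≈ 1F ; 2F → ψ≈ 2F ; 3F → ψ≈ 3F ; 4F → even≈ ; 5F → φ≈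
      ; 6F → od≈ 0F ; 7F → od≈ 1F ; 8F → od≈ 2F ; 9F → od≈ 3F }

    odd : ∀ {h} k → OnL k → (∀ i → ψ i h ≈0) → even h ≈0 → φ₄ h ≈0 → (∀ i → od (ψ i) h ℂ.≈ ψ i k) →
          ∃ λ st → ∀ i → gen i h ℂ.≈ emb (+ gen-value st i)
    odd {h} k k∈L ψ≈ even≈ φ≈ od≈ = go (ψ-on k k∈L)
      where
      go : (∃ λ st → ∀ i → ψ i k ℂ.≈ emb (+ ψ-value st i)) → ∃ λ st → ∀ i → gen i h ℂ.≈ emb (+ gen-value st i)
      go (0F , v) = 6F , λ
        { 0F → ψ≈ 0F ; 1F → ψ≈ 1F ; 2F → ψ≈ 2F ; 3F → ψ≈ 3F ; 4F → even≈ ; 5F → φ≈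
        ; 6F → ℂ.trans (od≈ 0F) (v 0F) ; 7F → ℂ.trans (od≈ 1F) (v 1F) ; 8F → ℂ.trans (od≈ 2F) (v 2F) ; 9F → ℂ.trans
            (od≈ 3F) (v 3F) }
      go (1F , v) = 7F , λ
        { 0F → ψ≈ 0F ; 1F → ψ≈ 1F ; 2F → ψ≈ 2F ; 3F → ψ≈ 3F ; 4F → even≈ ; 5F → φ≈
        ; 6F → ℂ.trans (od≈ 0F) (v 0F) ; 7F → ℂ.trans (od≈ 1F) (v 1F) ; 8F → ℂ.trans (od≈ 2F) (v 2F) ; 9F → ℂ.trans
            (od≈ 3F) (v 3F) }
      go (2F , v) = 8F , λ
        { 0F → ψ≈ 0F ; 1F → ψ≈ 1F ; 2F → ψ≈ 2F ; 3F → ψ≈ 3F ; 4F → even≈ ; 5F → φ≈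
        ; 6F → ℂ.trans (od≈ 0F) (v 0F) ; 7F → ℂ.trans (od≈ 1F) (v 1F) ; 8F → ℂ.trans (od≈ 2F) (v 2F) ; 9F → ℂ.trans
            (od≈ 3F) (v 3F) }
      go (3F , v) = 9F , λ
        { 0F → ψ≈ 0F ; 1F → ψ≈ 1F ; 2F → ψ≈ 2F ; 3F → ψ≈ 3F ; 4F → even≈ ; 5F → φ≈
        ; 6F → ℂ.trans (od≈ 0F) (v 0F) ; 7F → ℂ.trans (od≈ 1F) (v 1F) ; 8F → ℂ.trans (od≈ 2F) (v 2F) ; 9F → ℂ.trans
            (od≈ 3F) (v 3F) }

    onL-even : ∀ {h} → (∃ λ st → ∀ i → ψ i h ℂ.≈ emb (+ ψ-value st i)) → even h ℂ.≈ emb (+ 2) → φ₄ h ≈0 →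
        (∀ i → od (ψ i) h ≈0) →
               ∃ λ st → ∀ i → gen i h ℂ.≈ emb (+ gen-value st i)
    onL-even (0F , v) even≈ φ≈ od≈ = 0F , λ
      { 0F → v 0F ; 1F → v 1F ; 2F → v 2F ; 3F → v 3F ; 4F → even≈ ; 5F → φ≈
      ; 6F → od≈ 0F ; 7F → od≈ 1F ; 8F → od≈ 2F ; 9F → od≈ 3F }
    onL-even (1F , v) even≈ φ≈ od≈ = 1F , λ
      { 0F → v 0F ; 1F → v 1F ; 2F → v 2F ; 3F → v 3F ; 4F → even≈ ; 5F → φ≈
      ; 6F → od≈ 0F ; 7F → od≈ 1F ; 8F → od≈ 2F ; 9F → od≈ 3F }
    onL-even (2F , v) even≈ φ≈ od≈ = 2F , λ
      { 0F → v 0F ; 1F → v 1F ; 2F → v 2F ; 3F → v 3F ; 4F → even≈ ; 5F → φ≈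
      ; 6F → od≈ 0F ; 7F → od≈ 1F ; 8F → od≈ 2F ; 9F → od≈ 3F }
    onL-even (3F , v) even≈ φ≈ od≈ = 3F , λ
      { 0F → v 0F ; 1F → v 1F ; 2F → v 2F ; 3F → v 3F ; 4F → even≈ ; 5F → φ≈
      ; 6F → od≈ 0F ; 7F → od≈ 1F ; 8F → od≈ 2F ; 9F → od≈ 3F }

  gen-state : ∀ h → ∃ λ st → ∀ i → gen i h ℂ.≈ emb (+ gen-value st i)
  gen-state (0F , α , β) = go (α ≋? 0#)
    where
    go : Dec (α ≋ 0#) → ∃ λ st → ∀ i → gen i (0F , α , β) ℂ.≈ emb (+ gen-value st i)
    go (yes α≋0) = onL-even {0F , α , β} (ψ-on (0F , α , β) (onL {α} {β} α≋0)) (even-even {0F} α β refl) (φ₄-L β α≋0)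
      (λ i → →≈0 (od-0 (ψ i) (ψ-off i) α β))
    go (no α≢0) = even-off {0F , α , β} (λ i → ψ-off≈0 i (0F , α , β) (λ on → α≢0 (onL-α {0F} {α} {β} on)))
        (even-even {0F} α β refl) (φ₄-0 β α≢0)
      (λ i → →≈0 (od-0 (ψ i) (ψ-off i) α β))
  gen-state (2F , α , β) = even-off {2F , α , β} (λ i → ψ-off≈0 i (2F , α , β)
      (λ on → contradiction (onL-s {2F} {α} {β} on) λ ()))
    (even-even {2F} α β refl) (φ₄-2 α β) (λ i → →≈0 (od-2 (ψ i) (ψ-off i) α β))
  gen-state (1F , α , β) = odd {1F , α , β} ((1F , α , β) ⊝ point α)
    (onL {α - ω α} {β - α * (α * α)} (R₂.trans (α-ω≋ α α) (≋⇒+≋0 R₂.refl)))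
    (λ i → ψ-off≈0 i (1F , α , β) (λ on → contradiction (onL-s {1F} {α} {β} on) λ ())) (even-odd {1F} α β refl)
        (→≈0 (φ₄-odd-1 α β))
    (λ i → od-1 (ψ i) (λ {g} {h} → ψ-resp i {g} {h}) (ψ-off i) α β)
  gen-state (3F , α , β) = odd {3F , α , β} ((3F , α , β) ⊞ point α)
    (onL {α + ω α} {β + α * (α * α)} (R₂.trans (α+ω≋ α α) (≋⇒+≋0 R₂.refl)))
    (λ i → ψ-off≈0 i (3F , α , β) (λ on → contradiction (onL-s {3F} {α} {β} on) λ ())) (even-odd {3F} α β refl)
        (→≈0 (φ₄-odd-3 α β))
    (λ i → od-3 (ψ i) (λ {g} {h} → ψ-resp i {g} {h}) (ψ-off i) α β)

  gen-* : ∀ i j → ∃ λ (c : Fin 4) → ∃ λ k → ∀ h → gen i h ℂ.* gen j h ℂ.≈ emb (+ toℕ c) ℂ.* gen k h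
  gen-* i j = let c , k , eq = gen-product i j in c , k , λ h → let st , v = gen-state h in begin
    gen i h ℂ.* gen j h                                          ≈⟨ ℂ.*-cong (v i) (v j) ⟩
    emb (+ gen-value st i) ℂ.* emb (+ gen-value st j)            ≈⟨ emb-* _ _ ⟨
    emb (+ gen-value st i ℤ.* + gen-value st j)                  ≈⟨ emb-cong
        (≡.trans (≡.sym (ℤ.pos-* (gen-value st i) (gen-value st j)))
        (≡.trans (≡.cong +_ (eq st)) (ℤ.pos-* (toℕ c) (gen-value st k)))) ⟩
    emb (+ toℕ c ℤ.* + gen-value st k)                           ≈⟨ emb-* _ _ ⟩
    emb (+ toℕ c) ℂ.* emb (+ gen-value st k)                     ≈⟨ ℂ.*-congˡ (v k) ⟨
    emb (+ toℕ c) ℂ.* gen k h                                    ∎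

  gen-resp : ∀ i → 𝓕.Respectful (gen i)
  gen-resp 0F {g} {h} eq = ψ-resp 0F {g} {h} eq
  gen-resp 1F {g} {h} eq = ψ-resp 1F {g} {h} eq
  gen-resp 2F {g} {h} eq = ψ-resp 2F {g} {h} eq
  gen-resp 3F {g} {h} eq = ψ-resp 3F {g} {h} eq
  gen-resp 4F {g} {h} eq = ℂ.+-congˡ (𝓕.χ-congʳ g₂ {g} {h} eq)
  gen-resp 5F {g} {h} eq = φ₄-resp {g} {h} eq
  gen-resp 6F {g} {h} eq = od-resp {ψ 0F} (λ {g} {h} → ψ-resp 0F {g} {h}) {g} {h} eq
  gen-resp 7F {g} {h} eq = od-resp {ψ 1F} (λ {g} {h} → ψ-resp 1F {g} {h}) {g} {h} eq
  gen-resp 8F {g} {h} eq = od-resp {ψ 2F} (λ {g} {h} → ψ-resp 2F {g} {h}) {g} {h} eq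
  gen-resp 9F {g} {h} eq = od-resp {ψ 3F} (λ {g} {h} → ψ-resp 3F {g} {h}) {g} {h} eq

  -- Class functions, with values polynomial in s

  ρ : Vec ℤ 1
  ρ = + s ∷ []

  Poly : Set
  Poly = Polynomial 1

  infix 5 _at_
  _at_ : (Fin 10 → Poly) → Fin 10 → ℤ
  P at k = ⟦ P k ⟧ₚ ρ

  sₚ qₚ 1ₚ 0ₚ : Poly
  sₚ = varₚ 0F
  qₚ = conₚ (+ 2) *ₚ (sₚ *ₚ sₚ)
  1ₚ = conₚ (+ 1)
  0ₚ = conₚ (+ 0)

  e-kind e′-kind y-kind : Kind → Poly
  e-kind null        = 1ₚ
  e-kind line        = 1ₚ
  e-kind irreducible = 0ₚ
  e-kind reducible   = 0ₚ
  e′-kind null        = 1ₚ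
  e′-kind line        = 0ₚ
  e′-kind irreducible = 0ₚ
  e′-kind reducible   = 0ₚ
  y-kind null        = (qₚ -ₚ 1ₚ) *ₚ (conₚ (+ 2) *ₚ qₚ -ₚ 1ₚ)
  y-kind line        = 1ₚ -ₚ conₚ (+ 2) *ₚ qₚ
  y-kind irreducible = 1ₚ -ₚ conₚ (+ 2) *ₚ qₚ
  y-kind reducible   = qₚ +ₚ 1ₚ

  f-poly : Fin 10 → Poly
  f-poly 0F = qₚ
  f-poly 1F = conₚ (+ 2) *ₚ sₚ
  f-poly 2F = sₚ
  f-poly 3F = sₚ
  f-poly 4F = 0ₚ
  f-poly 5F = 0ₚ
  f-poly 6F = -ₚ sₚ
  f-poly 7F = -ₚ sₚ
  f-poly 8F = -ₚ (conₚ (+ 2) *ₚ sₚ)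
  f-poly 9F = -ₚ qₚ

  t-poly : Fin 10 → Poly
  t-poly 0F = 1ₚ
  t-poly 9F = 1ₚ
  t-poly _  = 0ₚ

  -- Row i is the transform of `gen i` up to the nonzero integer `factor i`. Dropping the factor
  -- does not change the span, and it leaves polynomials in s that can be compared for all m at
  -- once.
  table : Fin 10 → Fin 10 → Poly
  table 0F k = 1ₚ
  table 1F k = e-kind (kind k)
  table 2F k = y-kind (kind k)
  table 3F k = e′-kind (kind k)
  table 4F k = t-poly k
  table 5F k = conₚ (+ 4) *ₚ (f-poly k *ₚ f-poly k) -ₚ conₚ (+ 2) *ₚ qₚ
  table 6F k = f-poly k
  table 7F k = f-poly k *ₚ e-kind (kind k)
  table 8F k = f-poly k *ₚ y-kind (kind k)
  table 9F k = f-poly k *ₚ e′-kind (kind k)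

  factor : Fin 10 → ℤ
  factor 0F = + 1
  factor 1F = + length
  factor 2F = + 1
  factor 3F = + length ℤ.* + length
  factor 4F = + N
  factor 5F = + 1
  factor 6F = + 2
  factor 7F = + 2 ℤ.* + length
  factor 8F = + 2
  factor 9F = + 2 ℤ.* (+ length ℤ.* + length)

  f-poly≡F̂ : ∀ k → f-poly at k ≡ F̂ (+ s) k
  f-poly≡F̂ 0F = refl
  f-poly≡F̂ 1F = refl
  f-poly≡F̂ 2F = refl
  f-poly≡F̂ 3F = refl
  f-poly≡F̂ 4F = refl
  f-poly≡F̂ 5F = refl
  f-poly≡F̂ 6F = refl
  f-poly≡F̂ 7F = refl
  f-poly≡F̂ 8F = refl
  f-poly≡F̂ 9F = refl

  f-cong : ∀ {g h} → g ∼ h → f g ℂ.≈ f h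
  f-cong {g} {h} eq = Σ₂.∑-cong (λ x → e-cong (⟪⟫-congˡ {g} {h} (point x) eq))

  hasKind-resp : ∀ k {a a′ b b′} → a ≈ a′ → b ≋ b′ → HasKind k a b → HasKind k a′ b′
  hasKind-resp k {a} {a′} {b} {b′} a≈ b≋ = go k
    where
    a≋ : a ≋ a′
    a≋ = ≈⇒≋ a≈
    cubic-resp : ∀ {a a′ b b′ γ} → a ≋ a′ → b ≋ b′ → Cubic a b γ → Cubic a′ b′ γ
    cubic-resp {a} {a′} {b} {b′} {γ} a≋ b≋ = R₂.trans (R₂.sym
        (R₂.+-cong (R₂.+-congˡ {1#} (R₂.*-congʳ {γ ²} (R₂.*-cong a≋ a≋))) (R₂.*-congʳ {γ * γ ²} b≋)))
    go : ∀ k → HasKind k a b → HasKind k a′ b′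
    go null        (Level.lift (a≋0 , b≋0)) = Level.lift (R₂.trans (R₂.sym a≋) a≋0 , R₂.trans (R₂.sym b≋) b≋0)
    go line        (Level.lift (a≢0 , b≋0)) = Level.lift ((λ eq → a≢0 (R₂.trans a≋ eq)) , R₂.trans (R₂.sym b≋) b≋0)
    go irreducible (b≢0 , none) = (λ eq → b≢0 (R₂.trans b≋ eq)) , (λ (γ , cubic) → none
        (γ , cubic-resp (R₂.sym a≋) (R₂.sym b≋) cubic))
    go reducible   (b≢0 , γ , cubic) = (λ eq → b≢0 (R₂.trans b≋ eq)) , (γ , cubic-resp a≋ b≋ cubic)

  inClass-resp : ∀ {g h i} → g ∼ h → InClass g i → InClass h i
  inClass-resp {g} {h} {i} eq I = inClass (≡.trans (re-cong (f-cong {h} {g} (G.sym {g} {h} eq))) (InClass.re-f I))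
    (hasKind-resp (kind i) (proj₁ (proj₂ eq)) (proj₂ (proj₂ eq)) (InClass.hasKind I))
    (λ i≡ → G.trans {h} {g} {G.ε} (G.sym {g} {h} eq) (InClass.origin I i≡))
    (λ i≡ → G.trans {h} {g} {g₂} (G.sym {g} {h} eq) (InClass.antipode I i≡))

  class-cong : ∀ {g h} → g ∼ h → class g ≡ class h
  class-cong {g} {h} eq = inClass-unique {h} (inClass-resp {g} {h} eq (class-spec g)) (class-spec h)

  f-axis : ∀ u → f (u , 0# , 0#) ℂ.≈ e u ℂ.* Q
  f-axis u = ℂ.trans (f≈eE u 0# 0#) (ℂ.*-congˡ (ℂ.trans (E-null {0#} {0#} {0#} (R.sym (R.zeroʳ 2#)) R₂.refl)
    (ℂ.trans (ℂ.*-congʳ (⟦⟧-true (0# ≋? 0#) R₂.refl)) (ℂ.*-identityˡ Q))))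

  class-rank : ∀ g {r} → re (f g) ≡ value (+ s) r → rank (class g) ≡ r
  class-rank g eq = value-injective (≡.trans (≡.sym (InClass.re-f (class-spec g))) eq)

  class-ε : class G.ε ≡ 0F
  class-ε = rank-6 (class G.ε) (class-rank G.ε {6F} (≡.trans
      (re-cong (ℂ.trans (f-axis 0F) (ℂ.trans (ℂ.*-congʳ e-0) (ℂ.*-identityˡ Q)))) (≡.trans (re-emb (+ length)) q≡)))
    where
    rank-6 : ∀ i → rank i ≡ 6F → i ≡ 0F
    rank-6 = from-yes (Fin.all? λ i → (rank i Fin.≟ 6F) →-dec (i Fin.≟ 0F))

  class-g₂ : class g₂ ≡ 9F
  class-g₂ = rank-0 (class g₂) (class-rank g₂ {0F} (≡.trans (re-cong (ℂ.trans (f-axis 2F) (ℂ.trans (ℂ.*-congʳ e-2)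
      (solve 1 (λ q → ⊖ con (+ 1) ⊗ q ⊜ ⊖ q) ℂ.refl Q))))
      (≡.trans (re-neg Q) (≡.cong ℤ.-_ (≡.trans (re-emb (+ length)) q≡)))))
    where
    rank-0 : ∀ i → rank i ≡ 0F → i ≡ 9F
    rank-0 = from-yes (Fin.all? λ i → (rank i Fin.≟ 0F) →-dec (i Fin.≟ 9F))

  -- The Fourier transforms of the generators

  ⟦⟧-axes : ∀ g → ⟦ g ≟ G.ε ⟧ ℂ.+ ⟦ g ≟ g₂ ⟧ ℂ.≈ emb (t-poly at class g)
  ⟦⟧-axes g = go (class g) refl
    where
    not-ε : ∀ {i} → class g ≡ i → i ≢ 0F → ⟦ g ≟ G.ε ⟧ ℂ.≈ ℂ.0#
    not-ε eq n = ⟦⟧-false (g ≟ G.ε) (λ g∼ε → n (≡.trans (≡.sym eq) (≡.trans (class-cong {g} {G.ε} g∼ε) class-ε)))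
    not-g₂ : ∀ {i} → class g ≡ i → i ≢ 9F → ⟦ g ≟ g₂ ⟧ ℂ.≈ ℂ.0#
    not-g₂ eq n = ⟦⟧-false (g ≟ g₂) (λ g∼g₂ → n (≡.trans (≡.sym eq) (≡.trans (class-cong {g} {g₂} g∼g₂) class-g₂)))
    neither : ∀ {i} → class g ≡ i → i ≢ 0F → i ≢ 9F → ⟦ g ≟ G.ε ⟧ ℂ.+ ⟦ g ≟ g₂ ⟧ ℂ.≈ emb (+ 0)
    neither eq n n′ = ℂ.trans (ℂ.+-cong (not-ε eq n) (not-g₂ eq n′)) (ℂ.trans (ℂ.+-identityʳ ℂ.0#) (ℂ.sym emb-0))
    go : ∀ i → class g ≡ i → ⟦ g ≟ G.ε ⟧ ℂ.+ ⟦ g ≟ g₂ ⟧ ℂ.≈ emb (t-poly at i)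
    go 0F eq = ℂ.trans (ℂ.+-cong (⟦⟧-true (g ≟ G.ε) (InClass.origin (class-spec g) eq)) (not-g₂ eq λ ()))
      (ℂ.trans (ℂ.+-identityʳ ℂ.1#) (ℂ.sym emb-1))
    go 9F eq = ℂ.trans (ℂ.+-cong (not-ε eq λ ()) (⟦⟧-true (g ≟ g₂) (InClass.antipode (class-spec g) eq)))
      (ℂ.trans (ℂ.+-identityˡ ℂ.1#) (ℂ.sym emb-1))
    go 1F eq = neither eq (λ ()) (λ ())
    go 2F eq = neither eq (λ ()) (λ ())
    go 3F eq = neither eq (λ ()) (λ ())
    go 4F eq = neither eq (λ ()) (λ ())
    go 5F eq = neither eq (λ ()) (λ ())
    go 6F eq = neither eq (λ ()) (λ ())
    go 7F eq = neither eq (λ ()) (λ ())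
    go 8F eq = neither eq (λ ()) (λ ())

  hat-even : ∀ g → 𝓕.hat even g ℂ.≈ emb (+ N) ℂ.* emb (t-poly at class g)
  hat-even g = begin
    𝓕.hat even g
      ≈⟨ 𝓕.∑-cong (λ h → ℂ.trans (ℂ.distribʳ _ _ _) (ℂ.+-cong (ℂ.*-identityˡ _) (ℂ.sym (χ-∙ g₂ g h)))) ⟩
    𝓕.∑ (λ h → χ g h ℂ.+ χ (g₂ ⊞ g) h)
      ≈⟨ ℂ.trans (𝓕.∑-+ _ _) (ℂ.+-cong (𝓕.χ-sum g) (𝓕.χ-sum (g₂ ⊞ g))) ⟩
    ⟦ g 𝓕.≟ G.ε ⟧ ℂ.* emb (+ N) ℂ.+ ⟦ (g₂ ⊞ g) 𝓕.≟ G.ε ⟧ ℂ.* emb (+ N)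
      ≈⟨ ℂ.+-cong (ℂ.*-congʳ (⟦⟧-cong (g 𝓕.≟ G.ε) (g ≟ G.ε) (mk⇔ id id)))
           (ℂ.*-congʳ (⟦⟧-cong ((g₂ ⊞ g) 𝓕.≟ G.ε) (g ≟ g₂) (mk⇔ to from))) ⟩
    ⟦ g ≟ G.ε ⟧ ℂ.* emb (+ N) ℂ.+ ⟦ g ≟ g₂ ⟧ ℂ.* emb (+ N)
      ≈⟨ ℂ.trans (ℂ.sym (ℂ.distribʳ _ _ _)) (ℂ.trans (ℂ.*-comm _ _) (ℂ.*-congˡ (⟦⟧-axes g))) ⟩
    emb (+ N) ℂ.* emb (t-poly at class g) ∎
    where
    2+s : ∀ s → 2F +₄ s ≡ 0F → s ≡ 2F
    2+s = from-yes (Fin.all? λ s → ((2F +₄ s) Fin.≟ 0F) →-dec (s Fin.≟ 2F))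
    to : (g₂ ⊞ g) ∼ G.ε → g ∼ g₂
    to (s≡ , α≈ , β≋) = 2+s _ s≡ , R.trans (R.sym (R.+-identityˡ _)) α≈ , R₂.trans (R₂.sym (R₂.+-identityˡ _)) β≋
    from : g ∼ g₂ → (g₂ ⊞ g) ∼ G.ε
    from (refl , α≈ , β≋) = refl , R.trans (R.+-identityˡ _) α≈ , R₂.trans (R₂.+-identityˡ _) β≋

  hat-ψ₁ : ∀ u a b → 𝓕.hat (ψ 1F) (u , a , b) ℂ.≈ ⟦ b ≋? 0# ⟧ ℂ.* Q
  hat-ψ₁ u a b = ℂ.trans (hat-Σ₂ (λ y h → ⟦ h ≟ ℓ-point 0# y ⟧) (u , a , b)) (ℂ.trans
    (Σ₂.∑-cong (λ y → ℂ.trans (hat-⟦≟⟧ (ℓ-point 0# y) (u , a , b)) (ℂ.trans (χ-ℓ u a b 0# y)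
      (ℂ.trans (ℂ.*-congʳ (e-tr-0 (R₂.zeroʳ a))) (ℂ.trans (ℂ.*-identityˡ _) (e-cong (tr-cong (R₂.*-comm b y))))))))
    (Σ₂-tr b))

  hat-ψ₃ : ∀ u a b → 𝓕.hat (ψ 3F) (u , a , b) ℂ.≈ (⟦ a ≋? 0# ⟧ ℂ.* Q) ℂ.* (⟦ b ≋? 0# ⟧ ℂ.* Q)
  hat-ψ₃ u a b = ℂ.trans (hat-Σ₂ (λ x h → Σ₂.∑ (λ y → ⟦ h ≟ ℓ-point x y ⟧)) (u , a , b)) (ℂ.trans
    (Σ₂.∑-cong (λ x → ℂ.trans (hat-Σ₂ (λ y h → ⟦ h ≟ ℓ-point x y ⟧) (u , a , b)) (ℂ.trans
      (Σ₂.∑-cong (λ y → ℂ.trans (hat-⟦≟⟧ (ℓ-point x y) (u , a , b)) (ℂ.trans (χ-ℓ u a b x y)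
        (ℂ.*-cong (e-cong (tr-cong (R₂.*-comm a x))) (e-cong (tr-cong (R₂.*-comm b y)))))))
      (ℂ.trans (Σ₂.∑-*ˡ _ _) (ℂ.*-congˡ (Σ₂-tr b))))))
    (ℂ.trans (Σ₂.∑-*ʳ _ _) (ℂ.*-congʳ (Σ₂-tr a))))

  e-kind-spec : ∀ k {a b} → HasKind k a b → ⟦ b ≋? 0# ⟧ ℂ.≈ emb (⟦ e-kind k ⟧ₚ ρ)
  e-kind-spec null        {b = b} (Level.lift (_ , b≋0)) = ℂ.trans (⟦⟧-true (b ≋? 0#) b≋0) (ℂ.sym emb-1)
  e-kind-spec line        {b = b} (Level.lift (_ , b≋0)) = ℂ.trans (⟦⟧-true (b ≋? 0#) b≋0) (ℂ.sym emb-1)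
  e-kind-spec irreducible {b = b} (b≢0 , _)              = ℂ.trans (⟦⟧-false (b ≋? 0#) b≢0) (ℂ.sym emb-0)
  e-kind-spec reducible   {b = b} (b≢0 , _)              = ℂ.trans (⟦⟧-false (b ≋? 0#) b≢0) (ℂ.sym emb-0)

  e′-kind-spec : ∀ k {a b} → HasKind k a b → ⟦ a ≋? 0# ⟧ ℂ.* ⟦ b ≋? 0# ⟧ ℂ.≈ emb (⟦ e′-kind k ⟧ₚ ρ)
  e′-kind-spec null {a} {b} (Level.lift (a≋0 , b≋0)) =
    ℂ.trans (ℂ.*-cong (⟦⟧-true (a ≋? 0#) a≋0) (⟦⟧-true (b ≋? 0#) b≋0)) (ℂ.trans (ℂ.*-identityˡ _) (ℂ.sym emb-1))
  e′-kind-spec line {a} {b} (Level.lift (a≢0 , _)) =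
    ℂ.trans (ℂ.*-congʳ (⟦⟧-false (a ≋? 0#) a≢0)) (ℂ.trans (ℂ.zeroˡ _) (ℂ.sym emb-0))
  e′-kind-spec irreducible {a} {b} (b≢0 , _) =
    ℂ.trans (ℂ.*-congˡ (⟦⟧-false (b ≋? 0#) b≢0)) (ℂ.trans (ℂ.zeroʳ _) (ℂ.sym emb-0))
  e′-kind-spec reducible {a} {b} (b≢0 , _) =
    ℂ.trans (ℂ.*-congˡ (⟦⟧-false (b ≋? 0#) b≢0)) (ℂ.trans (ℂ.zeroʳ _) (ℂ.sym emb-0))

  q-poly : ⟦ qₚ ⟧ₚ ρ ≡ + length
  q-poly = ≡.sym q≡

  private
    emb-− : ∀ j k → emb (j ℤ.- k) ℂ.≈ emb j ℂ.- emb k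
    emb-− j k = ℂ.trans (emb-+ j (ℤ.- k)) (ℂ.+-congˡ (emb-neg k))

    Q≈ : emb (⟦ qₚ ⟧ₚ ρ) ℂ.≈ Q
    Q≈ = emb-cong q-poly

    2Q-1 : emb (⟦ conₚ (+ 2) *ₚ qₚ -ₚ 1ₚ ⟧ₚ ρ) ℂ.≈ emb (+ 2) ℂ.* Q ℂ.- ℂ.1#
    2Q-1 = ℂ.trans (emb-− (+ 2 ℤ.* ⟦ qₚ ⟧ₚ ρ) (+ 1)) (ℂ.+-cong (ℂ.trans (emb-* (+ 2) (⟦ qₚ ⟧ₚ ρ)) (ℂ.*-congˡ Q≈))
        (ℂ.-‿cong emb-1))

    1-2Q : emb (⟦ 1ₚ -ₚ conₚ (+ 2) *ₚ qₚ ⟧ₚ ρ) ℂ.≈ ℂ.1# ℂ.- emb (+ 2) ℂ.* Q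
    1-2Q = ℂ.trans (emb-− (+ 1) (+ 2 ℤ.* ⟦ qₚ ⟧ₚ ρ)) (ℂ.+-cong emb-1
        (ℂ.-‿cong (ℂ.trans (emb-* (+ 2) (⟦ qₚ ⟧ₚ ρ)) (ℂ.*-congˡ Q≈))))

  y-kind-spec : ∀ k → Ŷ-kind k ℂ.≈ emb (⟦ y-kind k ⟧ₚ ρ)
  y-kind-spec null = ℂ.sym (ℂ.trans (emb-* (⟦ qₚ -ₚ 1ₚ ⟧ₚ ρ) (⟦ conₚ (+ 2) *ₚ qₚ -ₚ 1ₚ ⟧ₚ ρ))
    (ℂ.*-cong (ℂ.trans (emb-− (⟦ qₚ ⟧ₚ ρ) (+ 1)) (ℂ.+-cong Q≈ (ℂ.-‿cong emb-1))) 2Q-1))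
  y-kind-spec line        = ℂ.sym 1-2Q
  y-kind-spec irreducible = ℂ.sym 1-2Q
  y-kind-spec reducible   = ℂ.sym (ℂ.trans (emb-+ (⟦ qₚ ⟧ₚ ρ) (+ 1)) (ℂ.+-cong Q≈ emb-1))

  hat-gen-ψ : ∀ i g → 𝓕.hat (ψ i) g ℂ.≈ emb (factor (Fin.inject≤ i (ℕ.m≤m+n 4 6))) ℂ.*
      emb (table (Fin.inject≤ i (ℕ.m≤m+n 4 6)) at class g)
  hat-gen-ψ 0F g@(u , a , b) = begin
    𝓕.hat (ψ 0F) g               ≈⟨ hat-⟦≟⟧ (ℓ-point 0# 0#) g ⟩
    χ g (ℓ-point 0# 0#)          ≈⟨ χ-ℓ u a b 0# 0# ⟩
    e (tr (a * 0#)) ℂ.* e (tr (b * 0#))  ≈⟨ ℂ.*-cong (e-tr-0 (R₂.zeroʳ a)) (e-tr-0 (R₂.zeroʳ b)) ⟩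
    ℂ.1# ℂ.* ℂ.1#                ≈⟨ ℂ.*-cong emb-1 emb-1 ⟨
    emb (+ 1) ℂ.* emb (+ 1)      ∎
  hat-gen-ψ 1F g@(u , a , b) = ℂ.trans (hat-ψ₁ u a b) (ℂ.trans (ℂ.*-comm _ _)
      (ℂ.*-congˡ (e-kind-spec (kind (class g)) (InClass.hasKind (class-spec g)))))
  hat-gen-ψ 2F g@(u , a , b) = ℂ.trans (hat-V-kind (kind (class g)) u a b (InClass.hasKind (class-spec g)))
    (ℂ.trans (y-kind-spec (kind (class g))) (ℂ.sym (ℂ.trans (ℂ.*-congʳ emb-1) (ℂ.*-identityˡ _))))
  hat-gen-ψ 3F g@(u , a , b) = ℂ.trans (hat-ψ₃ u a b) (ℂ.trans
    (solve 3 (λ x y q → (x ⊗ q) ⊗ (y ⊗ q) ⊜ (q ⊗ q) ⊗ (x ⊗ y))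
      ℂ.refl ⟦ a ≋? 0# ⟧ ⟦ b ≋? 0# ⟧ Q)
    (ℂ.*-cong (ℂ.sym (emb-* (+ length) (+ length))) (e′-kind-spec (kind (class g)) (InClass.hasKind (class-spec g)))))

  re-f-poly : ∀ g → re (f g) ≡ f-poly at class g
  re-f-poly g = ≡.trans (InClass.re-f (class-spec g)) (≡.sym (f-poly≡F̂ (class g)))

  hat-gen-od : ∀ i g → 𝓕.hat (od (ψ i)) g ℂ.≈
    emb (+ 2 ℤ.* factor (Fin.inject≤ i (ℕ.m≤m+n 4 6))) ℂ.* emb ((f-poly at class g) ℤ.*
        (table (Fin.inject≤ i (ℕ.m≤m+n 4 6)) at class g))
  hat-gen-od i g = begin
    𝓕.hat (od (ψ i)) g
      ≈⟨ hat-od (ψ i) (λ {g} {h} → ψ-resp i {g} {h}) g ⟩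
    emb (+ 2 ℤ.* re (f g)) ℂ.* 𝓕.hat (ψ i) g
      ≈⟨ ℂ.*-cong (ℂ.trans (emb-cong (≡.cong (+ 2 ℤ.*_) (re-f-poly g))) (emb-* (+ 2) F)) (hat-gen-ψ i g) ⟩
    (emb (+ 2) ℂ.* emb F) ℂ.* (emb r ℂ.* emb T)
      ≈⟨ solve 4 (λ w x y z → (w ⊗ x) ⊗ (y ⊗ z) ⊜ (w ⊗ y) ⊗ (x ⊗ z))
           ℂ.refl (emb (+ 2)) (emb F) (emb r) (emb T) ⟩
    (emb (+ 2) ℂ.* emb r) ℂ.* (emb F ℂ.* emb T)
      ≈⟨ ℂ.*-cong (emb-* (+ 2) r) (emb-* F T) ⟨
    emb (+ 2 ℤ.* r) ℂ.* emb (F ℤ.* T) ∎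
    where
    F = f-poly at class g
    r = factor (Fin.inject≤ i (ℕ.m≤m+n 4 6))
    T = table (Fin.inject≤ i (ℕ.m≤m+n 4 6)) at class g

  hat-φ₄ : ∀ g → 𝓕.hat φ₄ g ℂ.≈ emb (+ 1) ℂ.* emb (table 5F at class g)
  hat-φ₄ g = begin
    𝓕.hat φ₄ g
      ≈⟨ 𝓕.hat-cong (λ h → ℂ.+-congˡ (solve 2 (λ q d → ⊖ (con (+ 2) ⊗ (q ⊗ d))
           ⊜ (⊖ (con (+ 2) ⊗ q)) ⊗ d) ℂ.refl Q (ψ 0F h))) g ⟩
    𝓕.hat (λ h → od (od (ψ 0F)) h ℂ.+ (ℂ.- (emb (+ 2) ℂ.* Q)) ℂ.* ψ 0F h) g
      ≈⟨ ℂ.trans (𝓕.hat-+ (od (od (ψ 0F))) (λ h → (ℂ.- (emb (+ 2) ℂ.* Q)) ℂ.* ψ 0F h) g)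
           (ℂ.+-cong (hat-od (od (ψ 0F)) (λ {g} {h} → od-resp {ψ 0F} (λ {g} {h} → ψ-resp 0F {g} {h}) {g} {h}) g)
               (𝓕.hat-* _ (ψ 0F) g)) ⟩
    emb (+ 2 ℤ.* re (f g)) ℂ.* 𝓕.hat (od (ψ 0F)) g ℂ.+ (ℂ.- (emb (+ 2) ℂ.* Q)) ℂ.* 𝓕.hat (ψ 0F) g
      ≈⟨ ℂ.+-cong (ℂ.*-cong 2F≈ (ℂ.trans (hat-od (ψ 0F) (λ {g} {h} → ψ-resp 0F {g} {h}) g) (ℂ.*-cong 2F≈ δ^)))
          (ℂ.*-cong (ℂ.-‿cong (ℂ.*-congˡ (ℂ.sym Q≈))) δ^) ⟩
    (emb (+ 2) ℂ.* emb F) ℂ.* ((emb (+ 2) ℂ.* emb F) ℂ.* ℂ.1#) ℂ.+ (ℂ.- (emb (+ 2) ℂ.* emb q)) ℂ.* ℂ.1#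
      ≈⟨ solve 2 (λ x q → (con (+ 2) ⊗ x) ⊗ ((con (+ 2) ⊗ x) ⊗ con (+ 1))
             ⊕ (⊖ (con (+ 2) ⊗ q)) ⊗ con (+ 1)
           ⊜ con (+ 4) ⊗ (x ⊗ x) ⊖ con (+ 2) ⊗ q) ℂ.refl (emb F) (emb q) ⟩
    emb (+ 4) ℂ.* (emb F ℂ.* emb F) ℂ.- emb (+ 2) ℂ.* emb q
      ≈⟨ ℂ.trans (emb-− (+ 4 ℤ.* (F ℤ.* F)) (+ 2 ℤ.* q)) (ℂ.+-cong
          (ℂ.trans (emb-* (+ 4) (F ℤ.* F)) (ℂ.*-congˡ (emb-* F F))) (ℂ.-‿cong (emb-* (+ 2) q))) ⟨
    emb (+ 4 ℤ.* (F ℤ.* F) ℤ.- + 2 ℤ.* q)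
      ≈⟨ ℂ.trans (ℂ.*-congʳ emb-1) (ℂ.*-identityˡ _) ⟨
    emb (+ 1) ℂ.* emb (table 5F at class g) ∎
    where
    F = f-poly at class g
    q = ⟦ qₚ ⟧ₚ ρ
    2F≈ : emb (+ 2 ℤ.* re (f g)) ℂ.≈ emb (+ 2) ℂ.* emb F
    2F≈ = ℂ.trans (emb-cong (≡.cong (+ 2 ℤ.*_) (re-f-poly g))) (emb-* (+ 2) F)
    δ^ : 𝓕.hat (ψ 0F) g ℂ.≈ ℂ.1#
    δ^ = ℂ.trans (hat-gen-ψ 0F g) (ℂ.trans (ℂ.*-cong emb-1 emb-1) (ℂ.*-identityˡ _))

  hat-gen : ∀ i g → 𝓕.hat (gen i) g ℂ.≈ emb (factor i) ℂ.* emb (table i at class g)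
  hat-gen 0F g = hat-gen-ψ 0F g
  hat-gen 1F g = hat-gen-ψ 1F g
  hat-gen 2F g = hat-gen-ψ 2F g
  hat-gen 3F g = hat-gen-ψ 3F g
  hat-gen 4F g = hat-even g
  hat-gen 5F g = hat-φ₄ g
  hat-gen 6F g = ℂ.trans (hat-gen-od 0F g) (ℂ.*-congˡ (emb-cong (ℤ.*-identityʳ (f-poly at class g))))
  hat-gen 7F g = hat-gen-od 1F g
  hat-gen 8F g = hat-gen-od 2F g
  hat-gen 9F g = hat-gen-od 3F g

  -- The span of the transforms of the generators

  -- The rational span of the table, kept integral: `divide` cancels a polynomial whose value at s
  -- is nonzero. Its premise compares normal forms, so each step of the elimination below is checked
  -- by computation.
  data Spectral : (Fin 10 → Poly) → Set where
    generator : ∀ i → Spectral (table i)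
    plus      : ∀ {P P′} → Spectral P → Spectral P′ → Spectral (λ k → P k +ₚ P′ k)
    scale     : ∀ c {P} → Spectral P → Spectral (λ k → c *ₚ P k)
    divide    : ∀ c {P P′} → ⟦ c ⟧ₚ ρ ≢ + 0 → (∀ k → ⟦ c *ₚ P k ⟧↓ ρ ≡ ⟦ P′ k ⟧↓ ρ) → Spectral P′ → Spectral P

  convolve : (Fin 10 → Poly) → (Fin 10 → Poly) → M → 𝔾
  convolve P P′ z = 𝓕.∑ (λ w → emb (P at class w) ℂ.* emb (P′ at class (z ⊝ w)))

  ClassInvariant : (M → 𝔾) → Set c
  ClassInvariant X = ∀ z z′ → class z ≡ class z′ → X z ℂ.≈ X z′

  invariant-cancel : ∀ {X Y} k → k ≢ + 0 → (∀ z → emb k ℂ.* X z ℂ.≈ Y z) → ClassInvariant Y → ClassInvariant X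
  invariant-cancel k k≢0 eq inv z z′ cl = emb-*-cancel k k≢0 (ℂ.trans (eq z) (ℂ.trans (inv z z′ cl) (ℂ.sym (eq z′))))

  invariant-+ : ∀ {X Y Z} → (∀ z → Z z ℂ.≈ X z ℂ.+ Y z) → ClassInvariant X → ClassInvariant Y → ClassInvariant Z
  invariant-+ eq inv inv′ z z′ cl = ℂ.trans (eq z) (ℂ.trans (ℂ.+-cong (inv z z′ cl) (inv′ z z′ cl)) (ℂ.sym (eq z′)))

  invariant-* : ∀ {X Z} k → (∀ z → Z z ℂ.≈ emb k ℂ.* X z) → ClassInvariant X → ClassInvariant Z
  invariant-* k eq inv z z′ cl = ℂ.trans (eq z) (ℂ.trans (ℂ.*-congˡ (inv z z′ cl)) (ℂ.sym (eq z′)))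

  *≢0 : ∀ {j k} → j ≢ + 0 → k ≢ + 0 → j ℤ.* k ≢ + 0
  *≢0 {j} j≢0 k≢0 eq = [ j≢0 , k≢0 ]′ (ℤ.i*j≡0⇒i≡0∨j≡0 j eq)

  private
    +s≢0 : + s ≢ + 0
    +s≢0 eq = contradiction (≡.subst (2 ℕ.≤_) (ℤ.+-injective eq) 2≤s) λ ()

    length≢0 : + length ≢ + 0
    length≢0 ()

    N≢0 : + N ≢ + 0
    N≢0 eq = ℕ.<⇒≢ (ℕ.>-nonZero⁻¹ N ⦃ ℕ.m*n≢0 4 (4 ℕ.^ m ℕ.* length) ⦃ _ ⦄ ⦃ ℕ.m*n≢0 (4 ℕ.^ m) length ⦃ ℕ.m^n≢0 4 m ⦄
        ⦄ ⦄) (≡.sym (ℤ.+-injective eq))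

    factor≢0 : ∀ i → factor i ≢ + 0
    factor≢0 0F = λ ()
    factor≢0 1F = length≢0
    factor≢0 2F = λ ()
    factor≢0 3F = *≢0 length≢0 length≢0
    factor≢0 4F = N≢0
    factor≢0 5F = λ ()
    factor≢0 6F = λ ()
    factor≢0 7F = *≢0 {+ 2} (λ ()) length≢0
    factor≢0 8F = λ ()
    factor≢0 9F = *≢0 {+ 2} (λ ()) (*≢0 length≢0 length≢0)

  -- By `hat-convolution` this is, up to the factors, N times the transform of a product of
  -- generators. By `gen-*` the product is a multiple of one generator, whose transform depends on
  -- the class only.
  convolve-generators : ∀ i j → ClassInvariant (convolve (table i) (table j))
  convolve-generators i j = invariant-cancel (factor i ℤ.* factor j) (*≢0 (factor≢0 i) (factor≢0 j)) (λ z → begin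
      emb (factor i ℤ.* factor j) ℂ.* convolve (table i) (table j) z
        ≈⟨ 𝓕.∑-*ˡ (emb (factor i ℤ.* factor j)) _ ⟨
      𝓕.∑ (λ w → emb (factor i ℤ.* factor j) ℂ.* (emb (table i at class w) ℂ.* emb (table j at class (z ⊝ w))))
        ≈⟨ 𝓕.∑-cong (λ w → ℂ.trans (ℂ.*-congʳ (emb-* (factor i) (factor j))) (ℂ.trans
             (solve 4 (λ a b x y → (a ⊗ b) ⊗ (x ⊗ y) ⊜ (a ⊗ x) ⊗ (b ⊗ y))
               ℂ.refl (emb (factor i)) (emb (factor j)) (emb (table i at class w)) (emb (table j at class (z ⊝ w))))
             (ℂ.sym (ℂ.*-cong (hat-gen i w) (hat-gen j (z ⊝ w)))))) ⟩
      𝓕.∑ (λ w → 𝓕.hat (gen i) w ℂ.* 𝓕.hat (gen j) (z ⊝ w))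
        ≈⟨ 𝓕.hat-convolution (gen i) (gen j) (λ {g} {h} → gen-resp i {g} {h}) (λ {g} {h} → gen-resp j {g} {h}) z ⟩
      emb (+ N) ℂ.* 𝓕.hat (λ h → gen i h ℂ.* gen j h) z
        ≈⟨ ℂ.*-congˡ (ℂ.trans (𝓕.hat-cong product≈ z) (ℂ.trans (𝓕.hat-* (emb (+ toℕ d)) (gen k) z)
            (ℂ.*-congˡ (hat-gen k z)))) ⟩
      Y z ∎)
    (λ z z′ cl → ℂ.*-congˡ (ℂ.*-congˡ (ℂ.*-congˡ (emb-cong (≡.cong (λ r → table k at r) cl)))))
    where
    d = proj₁ (gen-* i j)
    k = proj₁ (proj₂ (gen-* i j))
    product≈ : ∀ h → gen i h ℂ.* gen j h ℂ.≈ emb (+ toℕ d) ℂ.* gen k h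
    product≈ = proj₂ (proj₂ (gen-* i j))
    Y : M → 𝔾
    Y z = emb (+ N) ℂ.* (emb (+ toℕ d) ℂ.* (emb (factor k) ℂ.* emb (table k at class z)))

  convolve-spectralʳ : ∀ i {P} → Spectral P → ClassInvariant (convolve (table i) P)
  convolve-spectralʳ i (generator j) = convolve-generators i j
  convolve-spectralʳ i (plus {P} {P′} S S′) = invariant-+
    (λ z → ℂ.trans (𝓕.∑-cong (λ w → ℂ.trans (ℂ.*-congˡ (emb-+ (P at class (z ⊝ w)) (P′ at class (z ⊝ w))))
        (ℂ.distribˡ _ _ _))) (𝓕.∑-+ _ _))
    (convolve-spectralʳ i S) (convolve-spectralʳ i S′)
  convolve-spectralʳ i (scale a {P} S) = invariant-* (⟦ a ⟧ₚ ρ)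
    (λ z → ℂ.trans (𝓕.∑-cong (λ w → ℂ.trans (ℂ.*-congˡ (emb-* (⟦ a ⟧ₚ ρ) (P at class (z ⊝ w))))
      (solve 3 (λ x a y → x ⊗ (a ⊗ y) ⊜ a ⊗ (x ⊗ y)) ℂ.refl
        (emb (table i at class w)) (emb (⟦ a ⟧ₚ ρ)) (emb (P at class (z ⊝ w)))))) (𝓕.∑-*ˡ _ _))
    (convolve-spectralʳ i S)
  convolve-spectralʳ i (divide a {P} {P′} a≢0 eq S) = invariant-cancel (⟦ a ⟧ₚ ρ) a≢0
    (λ z → ℂ.trans (ℂ.sym (𝓕.∑-*ˡ _ _)) (𝓕.∑-cong (λ w → ℂ.trans
      (solve 3 (λ x a y → a ⊗ (x ⊗ y) ⊜ x ⊗ (a ⊗ y)) ℂ.refl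
        (emb (table i at class w)) (emb (⟦ a ⟧ₚ ρ)) (emb (P at class (z ⊝ w))))
      (ℂ.*-congˡ (ℂ.trans (ℂ.sym (emb-* (⟦ a ⟧ₚ ρ) (P at class (z ⊝ w))))
          (emb-cong (prove ρ (a *ₚ P (class (z ⊝ w))) (P′ (class (z ⊝ w))) (eq (class (z ⊝ w))))))))))
    (convolve-spectralʳ i S)

  convolve-spectral : ∀ {P P′} → Spectral P → Spectral P′ → ClassInvariant (convolve P P′)
  convolve-spectral (generator i) S′ = convolve-spectralʳ i S′
  convolve-spectral {P′ = P′} (plus {P₁} {P₂} S₁ S₂) S′ = invariant-+
    (λ z → ℂ.trans (𝓕.∑-cong (λ w → ℂ.trans (ℂ.*-congʳ (emb-+ (P₁ at class w) (P₂ at class w))) (ℂ.distribʳ _ _ _)))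
        (𝓕.∑-+ _ _))
    (convolve-spectral S₁ S′) (convolve-spectral S₂ S′)
  convolve-spectral {P′ = P′} (scale a {P} S) S′ = invariant-* (⟦ a ⟧ₚ ρ)
    (λ z → ℂ.trans (𝓕.∑-cong (λ w → ℂ.trans (ℂ.*-congʳ (emb-* (⟦ a ⟧ₚ ρ) (P at class w))) (ℂ.*-assoc _ _ _)))
        (𝓕.∑-*ˡ _ _))
    (convolve-spectral S S′)
  convolve-spectral {P′ = P′} (divide a {P} {P″} a≢0 eq S) S′ = invariant-cancel (⟦ a ⟧ₚ ρ) a≢0
    (λ z → ℂ.trans (ℂ.sym (𝓕.∑-*ˡ _ _)) (𝓕.∑-cong (λ w → ℂ.trans (ℂ.sym (ℂ.*-assoc _ _ _))
      (ℂ.*-congʳ (ℂ.trans (ℂ.sym (emb-* (⟦ a ⟧ₚ ρ) (P at class w)))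
          (emb-cong (prove ρ (a *ₚ P (class w)) (P″ (class w)) (eq (class w)))))))))
    (convolve-spectral S S′)

  row : Vec Poly 10 → Fin 10 → Poly
  row = lookup

  -1ₚ : Poly
  -1ₚ = conₚ (ℤ.- + 1)

  indicator : Fin 10 → Fin 10 → Poly
  indicator i k = if does (i Fin.≟ k) then 1ₚ else 0ₚ

  private
    all₁₀ : ∀ {T : Fin 10 → Set} → T 0F → T 1F → T 2F → T 3F → T 4F → T 5F → T 6F → T 7F → T 8F → T 9F → ∀ k → T k
    all₁₀ t₀ t₁ t₂ t₃ t₄ t₅ t₆ t₇ t₈ t₉ = λ
      { 0F → t₀ ; 1F → t₁ ; 2F → t₂ ; 3F → t₃ ; 4F → t₄ ; 5F → t₅ ; 6F → t₆ ; 7F → t₇ ; 8F → t₈ ; 9F → t₉ }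

    minus : ∀ {P P′} → Spectral P → Spectral P′ → Spectral (λ k → P k +ₚ -1ₚ *ₚ P′ k)
    minus S S′ = plus S (scale -1ₚ S′)

    half : ∀ {P P′} → (∀ k → ⟦ conₚ (+ 2) *ₚ P k ⟧↓ ρ ≡ ⟦ P′ k ⟧↓ ρ) → Spectral P′ → Spectral P
    half = divide (conₚ (+ 2)) (λ ())

    qₚ≢0 : ⟦ qₚ ⟧ₚ ρ ≢ + 0
    qₚ≢0 = *≢0 {+ 2} (λ ()) (*≢0 +s≢0 +s≢0)

    e₋ : Spectral (λ k → table 1F k +ₚ -1ₚ *ₚ table 3F k)
    e₋ = minus (generator 1F) (generator 3F)

    outside : Spectral (λ k → table 0F k +ₚ -1ₚ *ₚ table 1F k)
    outside = minus (generator 0F) (generator 1F)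

    -- The function f restricted to the `null` kind is q, 0, -q on the classes 0, 4, 9.
    sign₀ : Spectral (row (1ₚ ∷ 0ₚ ∷ 0ₚ ∷ 0ₚ ∷ 0ₚ ∷ 0ₚ ∷ 0ₚ ∷ 0ₚ ∷ 0ₚ ∷ -1ₚ ∷ []))
    sign₀ = divide qₚ qₚ≢0 (all₁₀ refl refl refl refl refl refl refl refl refl refl) (generator 9F)

    -- The transform of `V` is subtracted from the function that agrees with it on `null`, `line`
    -- and `reducible` and is q + 1 on `irreducible`. The difference there is (q + 1) - (1 - 2q) =
    -- 3q.
    irreducibles : Spectral (row (0ₚ ∷ 0ₚ ∷ 0ₚ ∷ 1ₚ ∷ 0ₚ ∷ 0ₚ ∷ 1ₚ ∷ 0ₚ ∷ 0ₚ ∷ 0ₚ ∷ []))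
    irreducibles = divide (conₚ (+ 3) *ₚ qₚ) (*≢0 {+ 3} (λ ()) qₚ≢0)
        (all₁₀ refl refl refl refl refl refl refl refl refl refl)
      (minus (plus (scale (qₚ +ₚ 1ₚ) outside) (plus (scale (1ₚ -ₚ conₚ (+ 2) *ₚ qₚ) e₋)
        (scale ((qₚ -ₚ 1ₚ) *ₚ (conₚ (+ 2) *ₚ qₚ -ₚ 1ₚ)) (generator 3F)))) (generator 2F))

    reducibles : Spectral (row (0ₚ ∷ 1ₚ ∷ 0ₚ ∷ 0ₚ ∷ 0ₚ ∷ 1ₚ ∷ 0ₚ ∷ 0ₚ ∷ 1ₚ ∷ 0ₚ ∷ []))
    -- Division by 1 only replaces a linear combination by its evaluated row.
    reducibles = divide 1ₚ (λ ()) (all₁₀ refl refl refl refl refl refl refl refl refl refl) (minus outside irreducibles)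

    null₄ : Spectral (λ k → table 3F k +ₚ -1ₚ *ₚ table 4F k)
    null₄ = minus (generator 3F) (generator 4F)

    -- Since q = 2s², the function 4f² - 2q vanishes on the classes 2, 3, 6 and 7. The other
    -- summands cancel its values -2q on the classes 4 and 5 and 4q² - 2q on 0 and 9; 16s² remains
    -- on 1 and 8.
    extremes : Spectral (row (0ₚ ∷ 1ₚ ∷ 0ₚ ∷ 0ₚ ∷ 0ₚ ∷ 0ₚ ∷ 0ₚ ∷ 0ₚ ∷ 1ₚ ∷ 0ₚ ∷ []))
    extremes = divide (conₚ (+ 16) *ₚ (sₚ *ₚ sₚ)) (*≢0 {+ 16} (λ ()) (*≢0 +s≢0 +s≢0))
        (all₁₀ refl refl refl refl refl refl refl refl refl refl)
      (minus (plus (generator 5F) (plus (scale (conₚ (+ 2) *ₚ qₚ) reducibles) (scale (conₚ (+ 2) *ₚ qₚ) null₄)))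
        (scale (conₚ (+ 4) *ₚ (qₚ *ₚ qₚ) -ₚ conₚ (+ 2) *ₚ qₚ) (generator 4F)))

    sign₂₇ : Spectral (row (0ₚ ∷ 0ₚ ∷ 1ₚ ∷ 0ₚ ∷ 0ₚ ∷ 0ₚ ∷ 0ₚ ∷ -1ₚ ∷ 0ₚ ∷ 0ₚ ∷ []))
    sign₂₇ = divide sₚ +s≢0 (all₁₀ refl refl refl refl refl refl refl refl refl refl)
      (minus (generator 7F) (scale qₚ sign₀))

    f-outside : Spectral (λ k → table 6F k +ₚ -1ₚ *ₚ table 7F k)
    f-outside = minus (generator 6F) (generator 7F)

    -- The elimination of `irreducibles` multiplied by f: on the irreducible pairs it leaves 3q f =
    -- ±3qs. The values on `null` and `line` are cancelled by multiples of `sign₀` and `sign₂₇`.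
    sign₃₆ : Spectral (row (0ₚ ∷ 0ₚ ∷ 0ₚ ∷ 1ₚ ∷ 0ₚ ∷ 0ₚ ∷ -1ₚ ∷ 0ₚ ∷ 0ₚ ∷ 0ₚ ∷ []))
    sign₃₆ = divide (conₚ (+ 3) *ₚ (qₚ *ₚ sₚ)) (*≢0 {+ 3} (λ ()) (*≢0 qₚ≢0 +s≢0))
        (all₁₀ refl refl refl refl refl refl refl refl refl refl)
      (plus (minus (scale (qₚ +ₚ 1ₚ) f-outside) (generator 8F))
        (plus (scale ((qₚ -ₚ 1ₚ) *ₚ (conₚ (+ 2) *ₚ qₚ -ₚ 1ₚ) *ₚ qₚ) sign₀)
            (scale ((1ₚ -ₚ conₚ (+ 2) *ₚ qₚ) *ₚ sₚ) sign₂₇)))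

    sign₁₈ : Spectral (row (0ₚ ∷ 1ₚ ∷ 0ₚ ∷ 0ₚ ∷ 0ₚ ∷ 0ₚ ∷ 0ₚ ∷ 0ₚ ∷ -1ₚ ∷ 0ₚ ∷ []))
    sign₁₈ = divide (conₚ (+ 2) *ₚ sₚ) (*≢0 {+ 2} (λ ()) +s≢0) (all₁₀ refl refl refl refl refl refl refl refl refl refl)
      (minus f-outside (scale sₚ sign₃₆))

  indicator-spectral : ∀ i → Spectral (indicator i)
  indicator-spectral 0F = half (all₁₀ refl refl refl refl refl refl refl refl refl refl) (plus (generator 4F) sign₀)
  indicator-spectral 1F = half (all₁₀ refl refl refl refl refl refl refl refl refl refl) (plus extremes sign₁₈)
  indicator-spectral 2F = half (all₁₀ refl refl refl refl refl refl refl refl refl refl) (plus e₋ sign₂₇)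
  indicator-spectral 3F = half (all₁₀ refl refl refl refl refl refl refl refl refl refl) (plus irreducibles sign₃₆)
  indicator-spectral 4F = divide 1ₚ (λ ()) (all₁₀ refl refl refl refl refl refl refl refl refl refl) null₄
  indicator-spectral 5F = divide 1ₚ (λ ()) (all₁₀ refl refl refl refl refl refl refl refl refl refl)
      (minus reducibles extremes)
  indicator-spectral 6F = half (all₁₀ refl refl refl refl refl refl refl refl refl refl) (minus irreducibles sign₃₆)
  indicator-spectral 7F = half (all₁₀ refl refl refl refl refl refl refl refl refl refl) (minus e₋ sign₂₇)
  indicator-spectral 8F = half (all₁₀ refl refl refl refl refl refl refl refl refl refl) (minus extremes sign₁₈)
  indicator-spectral 9F = half (all₁₀ refl refl refl refl refl refl refl refl refl refl) (minus (generator 4F) sign₀)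

  indicator-at : ∀ i k → emb (indicator i at k) ℂ.≈ ⟦ k Fin.≟ i ⟧
  indicator-at i k = go (i Fin.≟ k) (k Fin.≟ i)
    where
    go : (d : Dec (i ≡ k)) (d′ : Dec (k ≡ i)) → emb (⟦ if does d then 1ₚ else 0ₚ ⟧ₚ ρ) ℂ.≈ ⟦ d′ ⟧
    go (yes _)  (yes _) = emb-1
    go (no _)   (no _)  = emb-0
    go (yes eq) (no n)  = contradiction (≡.sym eq) n
    go (no n)  (yes eq) = contradiction (≡.sym eq) n

  intersection-invariant : ∀ i j → ClassInvariant (λ z → 𝓕.∑ (λ w → ⟦ class w Fin.≟ i ⟧ ℂ.* ⟦ class (z ⊝ w) Fin.≟ j ⟧))
  intersection-invariant i j z z′ cl = ℂ.trans (ℂ.sym (eq z)) (ℂ.trans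
    (convolve-spectral (indicator-spectral i) (indicator-spectral j) z z′ cl) (eq z′))
    where
    eq : ∀ z → convolve (indicator i) (indicator j) z ℂ.≈ 𝓕.∑ (λ w → ⟦ class w Fin.≟ i ⟧ ℂ.* ⟦ class (z ⊝ w) Fin.≟ j ⟧)
    eq z = 𝓕.∑-cong (λ w → ℂ.*-cong (indicator-at i (class w)) (indicator-at j (class (z ⊝ w))))

  open RawSemiringDefs (Semiring.rawSemiring semiring) using (_^_)
  open GaloisRing R isGR4 β β-order using (Word; IsCodeword; DelsarteGoethals; Kerdock)

  -- Codewords

  word : M → Word
  word (u , a , b) k = u +₄ phase a b (τ k)

  word-cong : ∀ {g h} → g ∼ h → ∀ k → word g k ≡ word h k
  word-cong (u≡ , a≈ , b≋) k = ≡.cong₂ _+₄_ u≡ (phase-cong a≈ b≋ R₂.refl)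

  ⟪⟫-point : ∀ g k → ⟪ g , point (τ k) ⟫ ≡ word g k
  ⟪⟫-point (u , a , b) k = ≡.cong (_+₄ phase a b (τ k)) (u*1 u)

  word-∙ : ∀ g h k → word (g ⊞ h) k ≡ word g k +₄ word h k
  word-∙ g h k = ≡.trans (≡.sym (⟪⟫-point (g ⊞ h) k)) (≡.trans (⟪⟫-∙ g h (point (τ k)))
      (≡.cong₂ _+₄_ (⟪⟫-point g k) (⟪⟫-point h k)))

  word-ε : ∀ k → word G.ε k ≡ 0F
  word-ε k = ≡.trans (≡.sym (⟪⟫-point G.ε k)) (⟪⟫-ε (point (τ k)))

  word-⁻¹ : ∀ g k → word (g G.⁻¹) k ≡ -₄ word g k
  word-⁻¹ g k = ℤ₄P.inverseʳ-unique (word g k) (word (g G.⁻¹) k) (≡.trans (≡.sym (word-∙ g (g G.⁻¹) k))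
    (≡.trans (word-cong {g G.∙ g G.⁻¹} {G.ε} (G.inverseʳ g) k) (word-ε k)))
    where module ℤ₄P = AbelianGroupProperties ℤ₄

  word-⊝ : ∀ g h k → word (g ⊝ h) k ≡ word g k +₄ (-₄ word h k)
  word-⊝ g h k = ≡.trans (word-∙ g (h G.⁻¹) k) (≡.cong (word g k +₄_) (word-⁻¹ h k))

  ι-word : ∀ u a j k → ι (word (u , a , τ j) k) ≈ ι u + trace (a * τ k + 2# * τ j * τ k ^ 3)
  ι-word u a j k = R.trans (ι-+ u (phase a (τ j) (τ k))) (+-congˡ
      (R.trans (ι-+ (tr₄ (a * ω (τ k))) (tr (τ j * cube (τ k)))) (R.trans
    (+-cong (ι-tr₄ (a * ω (τ k))) (ι-tr₄ (2# * (τ j * cube (τ k)))))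
        (R.trans (R.sym (trace-+ (a * ω (τ k)) (2# * (τ j * cube (τ k)))))
      (trace-cong (+-cong (*-congˡ (ω-T (k , R.refl))) (R.trans (R.sym (R.*-assoc 2# (τ j) (cube (τ k))))
        (*-congˡ (*-congˡ (*-congˡ (R.sym (R.*-identityʳ (τ k)))))))))))))

  codeword⇒ : ∀ {u a j v} → IsCodeword u a j v → ∀ k → v k ≡ word (u , a , τ j) k
  codeword⇒ {u} {a} {j} cw k = ι-injective (R.trans (cw k) (R.sym (ι-word u a j k)))

  ⇒codeword : ∀ {u a j v} → (∀ k → v k ≡ word (u , a , τ j) k) → IsCodeword u a j v
  ⇒codeword {u} {a} {j} v≡ k = R.trans (R.reflexive (≡.cong ι (v≡ k))) (ι-word u a j k)

  parameters : ∀ v → DelsarteGoethals v → M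
  parameters _ (u , a , j , _) = u , a , τ j

  parameters-word : ∀ v (p : DelsarteGoethals v) → ∀ k → v k ≡ word (parameters v p) k
  parameters-word v (u , a , j , cw) = codeword⇒ {u} {a} {j} {v} cw

  residue-digit : ∀ g → g ∼ (proj₁ g , proj₁ (proj₂ g) , τ (d₀ (proj₂ (proj₂ g))))
  residue-digit (u , a , b) = refl , R.refl , R₂.sym (ω-≋ b)

  word∈DG : ∀ {v} g → (∀ k → v k ≡ word g k) → DelsarteGoethals v
  word∈DG {v} g@(u , a , b) v≡ = u , a , d₀ b , ⇒codeword {u} {a} {d₀ b} {v}
    (λ k → ≡.trans (v≡ k) (word-cong {g} {u , a , τ (d₀ b)} (residue-digit g) k))

  -- Lee weights, injectivity of the parametrisation and the Kerdock code

  private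
    module ℂΣ = SemiringSum ℂ.semiring

  lee-sum : ∀ {n} (v : Fin n → Fin 4) → + leeWeight v ℤ.+ re (ℂΣ.sum (λ k → e (v k))) ≡ + n
  lee-sum {zero}  v = ≡.trans (ℤ.+-identityˡ _) (≡.trans (re-cong (ℂ.sym emb-0)) (re-emb (+ 0)))
  lee-sum {suc n} v = ≡.trans (≡.cong₂ ℤ._+_ (ℤ.pos-+ (lee (v 0F)) (leeWeight (v ∘ Fin.suc)))
      (re-+ (e (v 0F)) (ℂΣ.sum (λ k → e (v (Fin.suc k))))))
    (≡.trans (solveₚ 4 (λ a b c d → (a +ₚ b) +ₚ (c +ₚ d) =ₚ (a +ₚ c) +ₚ (b +ₚ d)) refl
        (+ lee (v 0F)) (+ leeWeight (v ∘ Fin.suc)) (re (e (v 0F))) (re (ℂΣ.sum (λ k → e (v (Fin.suc k))))))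
      (≡.cong₂ ℤ._+_ (lee+re-e (v 0F)) (lee-sum (v ∘ Fin.suc))))

  leeWeight-word : ∀ {v} g → (∀ k → v k ≡ word g k) → + leeWeight v ℤ.+ re (f g) ≡ + length
  leeWeight-word {v} g v≡ = ≡.trans (≡.cong (λ r → + leeWeight v ℤ.+ r)
      (re-cong (ℂ.trans (Σ₂.∑≈sum (λ x → χ g (point x)))
    (ℂΣ.sum-cong-≋ (λ k → e-cong (≡.trans (⟪⟫-point g k) (≡.sym (v≡ k)))))))) (lee-sum v)

  class-by : ∀ g i → re (f g) ≡ F̂ (+ s) i → inKerdock (kind i) ≡ does (proj₂ (proj₂ g) ≋? 0#) → class g ≡ i
  class-by g i re≡ bit≡ = class-unique (class-rank g re≡)
    (≡.trans (hasKind⇒inKerdock (kind (class g)) (InClass.hasKind (class-spec g))) (≡.sym bit≡))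

  re-f≡q⇒ε : ∀ g → re (f g) ≡ + length → g ∼ G.ε
  re-f≡q⇒ε g re≡ = InClass.origin (class-spec g) (rank-6 (class g) (class-rank g {6F} (≡.trans re≡ q≡)))
    where
    rank-6 : ∀ i → rank i ≡ 6F → i ≡ 0F
    rank-6 = from-yes (Fin.all? λ i → (rank i Fin.≟ 6F) →-dec (i Fin.≟ 0F))

  ⊝∼ε⇒∼ : ∀ {g h} → (g ⊝ h) ∼ G.ε → g ∼ h
  ⊝∼ε⇒∼ {g} {h} = GP.x∙y⁻¹≈ε⇒x≈y g h

  ∼⇒⊝∼ε : ∀ {g h} → g ∼ h → (g ⊝ h) ∼ G.ε
  ∼⇒⊝∼ε {g} {h} = GP.x≈y⇒x∙y⁻¹≈ε

  leeWeight-0 : ∀ {n} {v : Fin n → Fin 4} → (∀ k → v k ≡ 0F) → leeWeight v ≡ 0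
  leeWeight-0 {zero}  eq = refl
  leeWeight-0 {suc n} eq = ≡.cong₂ ℕ._+_ (≡.cong lee (eq 0F)) (leeWeight-0 (eq ∘ Fin.suc))

  -- The difference has the zero word, so its weight is 0 and Re f = q there. By the classification
  -- only the neutral element has this value.
  word-injective : ∀ {g h} → (∀ k → word g k ≡ word h k) → g ∼ h
  word-injective {g} {h} eq = ⊝∼ε⇒∼ {g} {h} (re-f≡q⇒ε (g ⊝ h) (≡.trans (≡.sym (ℤ.+-identityˡ _)) (≡.trans
    (≡.cong (λ w → + w ℤ.+ re (f (g ⊝ h))) (≡.sym (leeWeight-0 {v = word (g ⊝ h)} zero-word)))
    (leeWeight-word (g ⊝ h) (λ _ → refl)))))
    where
    zero-word : ∀ k → word (g ⊝ h) k ≡ 0F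
    zero-word k = ≡.trans (word-⊝ g h k) (≡.trans (≡.cong (_+₄ (-₄ word h k)) (eq k)) (ℤ₄.inverseʳ (word h k)))

  kerdock⇒ : ∀ {v} g → (∀ k → v k ≡ word g k) → Kerdock v → proj₂ (proj₂ g) ≋ 0#
  kerdock⇒ {v} g v≡ (u , a , cw) = proj₂ (proj₂ (word-injective {g} {u , a , τ 0F}
      (λ k → ≡.trans (≡.sym (v≡ k)) (codeword⇒ {u} {a} {0F} {v} cw k))))

  ⇒kerdock : ∀ {v} g → (∀ k → v k ≡ word g k) → proj₂ (proj₂ g) ≋ 0# → Kerdock v
  ⇒kerdock {v} g@(u , a , b) v≡ b≋0 = u , a , ⇒codeword {u} {a} {0F} {v}
      (λ k → ≡.trans (v≡ k) (word-cong {g} {u , a , 0#} (refl , R.refl , b≋0) k))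

  -- Every class is inhabited

  f-2 : ∀ a b → re (f (2F , a , b)) ≡ ℤ.- re (f (0F , a , b))
  f-2 a b = ≡.trans (re-cong (ℂ.trans (f≈eE 2F a b) (ℂ.trans (ℂ.*-congʳ e-2) (ℂ.trans
      (solve 1 (λ x → ⊖ con (+ 1) ⊗ x ⊜ ⊖ x) ℂ.refl (E a b))
      (ℂ.-‿cong (ℂ.sym (ℂ.trans (f≈eE 0F a b) (ℂ.trans (ℂ.*-congʳ e-0) (ℂ.*-identityˡ _)))))))))
    (re-neg (f (0F , a , b)))

  -- Taking 2 instead of 0 for u negates f and leaves a and b unchanged, so two classes that differ
  -- in the sign of Re f are inhabited together.
  both-signs : ∀ {a b} i j → F̂ (+ s) j ≡ ℤ.- F̂ (+ s) i → F̂ (+ s) i ≡ ℤ.- F̂ (+ s) j →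
    inKerdock (kind i) ≡ does (b ≋? 0#) → inKerdock (kind j) ≡ does (b ≋? 0#) →
    re (f (0F , a , b)) ≡ F̂ (+ s) i ⊎ re (f (0F , a , b)) ≡ F̂ (+ s) j →
    (∃ λ g → class g ≡ i) × (∃ λ g → class g ≡ j)
  both-signs {a} {b} i j j≡-i i≡-j bitᵢ bitⱼ (inj₁ eq) =
    ((0F , a , b) , class-by (0F , a , b) i eq bitᵢ) , ((2F , a , b) , class-by (2F , a , b) j
        (≡.trans (f-2 a b) (≡.trans (≡.cong ℤ.-_ eq) (≡.sym j≡-i))) bitⱼ)
  both-signs {a} {b} i j j≡-i i≡-j bitᵢ bitⱼ (inj₂ eq) =
    ((2F , a , b) , class-by (2F , a , b) i (≡.trans (f-2 a b) (≡.trans (≡.cong ℤ.-_ eq) (≡.sym i≡-j)))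
        bitᵢ) , ((0F , a , b) , class-by (0F , a , b) j eq bitⱼ)

  classes-2-7 : (∃ λ g → class g ≡ 2F) × (∃ λ g → class g ≡ 7F)
  classes-2-7 = both-signs {1#} {0#} 2F 7F refl (≡.sym (ℤ.neg-involutive (+ s))) bit bit
      (re-±s 0F 1# 0# (kernel-line 1≋̸0 R₂.refl))
    where
    bit : true ≡ does (0# ≋? 0#)
    bit = ≡.sym (dec-true (0# ≋? 0#) R₂.refl)

  bit-1 : false ≡ does (1# ≋? 0#)
  bit-1 = ≡.sym (dec-false (1# ≋? 0#) 1≋̸0)

  -- γ ↦ a with a²γ² = 1 + γ³ maps 0 and 1 to 0, hence is not onto.
  irreducible-exists : ∃ λ a → ¬ ∃ (Cubic a 1#)
  irreducible-exists = τ missed , no-root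
    where
    h : Carrier → Carrier
    h γ = sqrt ((1# + cube γ) * (inv γ * inv γ))
    H : Fin length → Fin length
    H k = d₀ (h (τ k))
    sqrt-0 : ∀ {x} → x ≋ 0# → sqrt x ≋ 0#
    sqrt-0 {x} eq = [ id , id ]′ (≋-domain (R₂.trans (sqrt² x) eq))
    one : Fin length
    one = d₀ 1#
    h-zero : h (τ 0F) ≋ 0#
    h-zero = sqrt-0 (R₂.trans (R₂.*-congˡ (R₂.trans (R₂.*-congʳ (R₂.reflexive inv-0)) (R₂.zeroˡ _))) (R₂.zeroʳ _))
    h-one : h (τ one) ≋ 0#
    h-one = sqrt-0 (R₂.trans (R₂.*-congʳ (R₂.trans (R₂.+-congˡ (cube-cong (ω-≋ 1#)))
      (solve₂ 0 (:1 :+ :1 :* (:1 :* :1) := :0) R₂.refl))) (R₂.zeroˡ _))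
    0≢one : 0F ≢ one
    0≢one eq = 1≋̸0 (R₂.trans (R₂.sym (ω-≋ 1#)) (≈⇒≋ (R.reflexive (≡.cong τ (≡.sym eq)))))
    collision : ∃ λ y → ∀ z → H z ≢ y
    collision = non-injective⇒non-surjective H 0≢one (d₀-cong (R₂.trans h-zero (R₂.sym h-one)))
    missed : Fin length
    missed = proj₁ collision
    a : Carrier
    a = τ missed
    no-root : ¬ ∃ (Cubic a 1#)
    no-root (γ , cubic) = proj₂ collision k (≡.trans (d₀-cong (R₂.sym a≋)) (d₀-τ missed))
      where
      k : Fin length
      k = d₀ γ
      g : Carrier
      g = τ k
      g≋γ : g ≋ γ
      g≋γ = ω-≋ γ
      g≢0 : ¬ g ≋ 0#
      g≢0 eq = cubic≢0 cubic (R₂.trans (R₂.sym g≋γ) eq)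
      cubic-g : 1# + a ² * g ² + 1# * cube g ≋ 0#
      cubic-g = R₂.trans (R₂.+-cong (R₂.+-congˡ {1#} (R₂.*-congˡ {a ²} (R₂.*-cong g≋γ g≋γ)))
          (R₂.*-congˡ {1#} (cube-cong g≋γ))) cubic
      a≋ : a ≋ h g
      a≋ = square-injective (R₂.trans (certificate₂ (inv g * inv g) (a ² * (g * inv g + 1#)) cubic-g (inv-inverse g≢0)
          (solve₂ 3 (λ a g i → a :* a :+ (:1 :+ g :* (g :* g)) :* (i :* i)
            := (i :* i) :* (:1 :+ (a :* a) :* (g :* g) :+ :1 :* (g :* (g :* g)) :+ :0)
            :+ ((a :* a) :* (g :* i :+ :1)) :* (g :* i :+ :1)) R₂.refl a g (inv g)))
        (R₂.sym (sqrt² ((1# + cube g) * (inv g * inv g)))))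

  classes-3-6 : (∃ λ g → class g ≡ 3F) × (∃ λ g → class g ≡ 6F)
  classes-3-6 = let a , none = irreducible-exists in
    both-signs {a} {1#} 3F 6F refl (≡.sym (ℤ.neg-involutive (+ s))) bit-1 bit-1
        (re-±s 0F a 1# (kernel-irreducible 1≋̸0 none))

  E-even : ∀ α → E (2# * α) 1# ℂ.≈ Σ₂.∑ (λ x → e (tr (α * x)) ℂ.* e (tr (1# * cube x)))
  E-even α = Σ₂.∑-cong (λ x → ℂ.trans (e-+ _ _) (ℂ.*-congʳ (e-cong (≡.trans (tr₄-cong (R.*-assoc 2# α (ω x)))
      (tr-cong (R₂.*-congˡ (ω-≋ x)))))))

  conj-e-tr : ∀ x → conj (e (tr x)) ℂ.≈ e (tr x)
  conj-e-tr x = ℂ.trans (conj-e (tr x)) (e-cong (self-inverse (tr x) (tr-double x)))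
    where
    self-inverse : ∀ i → i +₄ i ≡ 0F → -₄ i ≡ i
    self-inverse = from-yes (Fin.all? λ i → ((i +₄ i) Fin.≟ 0F) →-dec ((-₄ i) Fin.≟ i))

  conj-E-even : ∀ α → conj (E (2# * α) 1#) ℂ.≈ E (2# * α) 1#
  conj-E-even α = ℂ.trans (conj-cong (E-even α)) (ℂ.trans (Σ₂.∑-conj _) (ℂ.trans
    (Σ₂.∑-cong (λ x → ℂ.trans (conj-* _ _) (ℂ.*-cong (conj-e-tr _) (conj-e-tr _)))) (ℂ.sym (E-even α))))

  ΣE-even : Σ₂.∑ (λ α → E (2# * α) 1#) ℂ.≈ Q
  ΣE-even = begin
    Σ₂.∑ (λ α → E (2# * α) 1#)
      ≈⟨ ℂ.trans (Σ₂.∑-cong E-even) (Σ₂.∑-swap _) ⟩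
    Σ₂.∑ (λ x → Σ₂.∑ (λ α → e (tr (α * x)) ℂ.* e (tr (1# * cube x))))
      ≈⟨ Σ₂.∑-cong (λ x → ℂ.trans (Σ₂.∑-*ʳ _ _) (ℂ.trans (ℂ.*-congʳ (Σ₂-tr x)) (ℂ.*-assoc _ _ _))) ⟩
    Σ₂.∑ (λ x → ⟦ x ≋? 0# ⟧ ℂ.* (Q ℂ.* e (tr (1# * cube x))))
      ≈⟨ Σ₂.∑-δ (λ x → Q ℂ.* e (tr (1# * cube x))) 0# (λ eq → ℂ.*-congˡ
          (e-cong (tr-cong (R₂.*-congˡ (cube-cong eq))))) ⟩
    Q ℂ.* e (tr (1# * cube 0#))
      ≈⟨ ℂ.trans (ℂ.*-congˡ (e-tr-0 (solve₂ 0 (:1 :* (:0 :* (:0 :* :0)) := :0) R₂.refl))) (ℂ.*-identityʳ Q) ⟩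
    Q ∎

  private
    Q≉0 : ¬ Q ℂ.≈ ℂ.0#
    Q≉0 eq with () ← emb-injective (ℂ.trans eq (ℂ.sym emb-0))

    re-E-resp : ∀ {α α′} → α ≋ α′ → re (E (2# * α) 1#) ≢ + 0 → re (E (2# * α′) 1#) ≢ + 0
    re-E-resp (halve eq) n z = n (≡.trans (re-cong (Σ₂.∑-cong (λ x → e-cong (phase-cong eq R₂.refl R₂.refl)))) z)

  -- For a in 2R the phases are 0 or 2, so these sums are real (`conj-E-even`). They add up to q by
  -- `ΣE-even`, hence not all of them vanish.
  nonzero-exists : ∃ λ α → re (E (2# * α) 1#) ≢ + 0
  nonzero-exists = go (HasSize-any? residue-size (λ α → ¬? (re (E (2# * α) 1#) ℤ.≟ + 0)) re-E-resp)
    where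
    go : Dec (∃ λ α → re (E (2# * α) 1#) ≢ + 0) → ∃ λ α → re (E (2# * α) 1#) ≢ + 0
    go (yes found) = found
    go (no none)   = contradiction (ℂ.trans (ℂ.sym ΣE-even) (Σ₂.∑-0 _ all-zero)) Q≉0
      where
      re-0 : ∀ α → re (E (2# * α) 1#) ≡ + 0
      re-0 α with re (E (2# * α) 1#) ℤ.≟ + 0
      ... | yes eq = eq
      ... | no neq = contradiction (α , neq) none
      all-zero : ∀ α → E (2# * α) 1# ℂ.≈ ℂ.0#
      all-zero α = x≈-x⇒x≈0 (x+x≈0⇒ (ℂ.trans (ℂ.+-congˡ (ℂ.sym (conj-E-even α))) (ℂ.trans (+-conj (E (2# * α) 1#))
        (ℂ.trans (emb-cong (≡.cong (+ 2 ℤ.*_) (re-0 α))) emb-0))))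
        where
        x+x≈0⇒ : ∀ {x} → x ℂ.+ x ℂ.≈ ℂ.0# → x ℂ.≈ ℂ.- x
        x+x≈0⇒ {x} eq = ℂ.trans (solve 1 (λ x → x ⊜ (x ⊕ x) ⊖ x) ℂ.refl x)
          (ℂ.trans (ℂ.+-congʳ eq) (ℂ.+-identityˡ _))

  -- For a in 2R and b = 1 the cubic reduces to 1 + γ³ and has a root. The pair is reducible, and a
  -- nonzero real part must be ±2s.
  classes-1-8 : (∃ λ g → class g ≡ 1F) × (∃ λ g → class g ≡ 8F)
  classes-1-8 = let α , nonzero = nonzero-exists in both-signs {2# * α} {1#} 1F 8F refl (≡.sym (ℤ.neg-involutive (+ 2 ℤ.* + s))) bit-1 bit-1
    (go α nonzero (class (0F , 2# * α , 1#)) (class-spec (0F , 2# * α , 1#)))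
    where
    go : ∀ α → re (E (2# * α) 1#) ≢ + 0 → ∀ i → InClass (0F , 2# * α , 1#) i →
         re (f (0F , 2# * α , 1#)) ≡ F̂ (+ s) 1F ⊎ re (f (0F , 2# * α , 1#)) ≡ F̂ (+ s) 8F
    go α nonzero = cases
      where
      g : M
      g = (0F , 2# * α , 1#)
      a≋0 : 2# * α ≋ 0#
      a≋0 = R₂.trans (≈⇒≋ (R.sym (R.+-identityˡ _))) (≋-+2 0# α)
      in-kerdock : ∀ {A : Set} → 1# ≋ 0# → A
      in-kerdock eq = contradiction eq 1≋̸0
      has-root : ∀ {A : Set} → ¬ ∃ (Cubic (2# * α) 1#) → A
      has-root none = contradiction (_ , Null.⇒cubic a≋0 1≋̸0 R₂.refl) none
      cases : ∀ i → InClass g i → re (f g) ≡ F̂ (+ s) 1F ⊎ re (f g) ≡ F̂ (+ s) 8F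
      cases 0F (inClass _ (Level.lift (_ , b≋0)) _ _) = in-kerdock b≋0
      cases 1F (inClass eq _ _ _) = inj₁ eq
      cases 2F (inClass _ (Level.lift (_ , b≋0)) _ _) = in-kerdock b≋0
      cases 3F (inClass _ (_ , none) _ _) = has-root none
      cases 4F (inClass _ (Level.lift (_ , b≋0)) _ _) = in-kerdock b≋0
      cases 5F (inClass eq _ _ _) = contradiction (≡.trans (re-cong
          (ℂ.sym (ℂ.trans (f≈eE 0F (2# * α) 1#) (ℂ.trans (ℂ.*-congʳ e-0) (ℂ.*-identityˡ _))))) eq) nonzero
      cases 6F (inClass _ (_ , none) _ _) = has-root none
      cases 7F (inClass _ (Level.lift (_ , b≋0)) _ _) = in-kerdock b≋0
      cases 8F (inClass eq _ _ _) = inj₂ eq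
      cases 9F (inClass _ (Level.lift (_ , b≋0)) _ _) = in-kerdock b≋0

  -- With u = 1 a real sum is multiplied by i, which makes the real part 0.
  class-5 : ∃ λ g → class g ≡ 5F
  class-5 = g , class-by g 5F re≡0 bit-1
    where
    g : M
    g = (1F , 2# * 0# , 1#)
    f≈ : f g ℂ.≈ 𝕚 ℂ.* E (2# * 0#) 1#
    f≈ = ℂ.trans (f≈eE 1F (2# * 0#) 1#) (ℂ.*-congʳ e-1)
    f+conj : f g ℂ.+ conj (f g) ℂ.≈ ℂ.0#
    f+conj = ℂ.trans (ℂ.+-cong f≈ (ℂ.trans (conj-cong f≈) (ℂ.trans (conj-* 𝕚 _) (ℂ.*-cong conj-𝕚 (conj-E-even 0#)))))
      (solve 2 (λ i x → i ⊗ x ⊕ (⊖ i) ⊗ x ⊜ con (+ 0)) ℂ.refl 𝕚 (E (2# * 0#) 1#))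
    re≡0 : re (f g) ≡ + 0
    re≡0 = [ (λ ()) , id ]′ (ℤ.i*j≡0⇒i≡0∨j≡0 (+ 2) (emb-injective
        (ℂ.trans (ℂ.sym (+-conj (f g))) (ℂ.trans f+conj (ℂ.sym emb-0)))))

  class-4 : ∃ λ g → class g ≡ 4F
  class-4 = (1F , 0# , 0#) , class-by (1F , 0# , 0#) 4F
    (≡.trans (re-cong (ℂ.trans (f-axis 1F) (ℂ.*-congʳ e-1))) (≡.trans (re-𝕚* Q) (≡.cong ℤ.-_ (im-emb (+ length)))))
    (≡.sym (dec-true (0# ≋? 0#) R₂.refl))

  class-surjective : ∀ i → ∃ λ g → class g ≡ i
  class-surjective 0F = G.ε , class-ε
  class-surjective 1F = proj₁ classes-1-8
  class-surjective 2F = proj₁ classes-2-7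
  class-surjective 3F = proj₁ classes-3-6
  class-surjective 4F = class-4
  class-surjective 5F = class-5
  class-surjective 6F = proj₂ classes-3-6
  class-surjective 7F = proj₂ classes-2-7
  class-surjective 8F = proj₂ classes-1-8
  class-surjective 9F = g₂ , class-g₂

  open GaloisRing R isGR4 β β-order using (q; S; S₀; S₁; S′₂₁; S′₂₂; S₃; S₄; S′₅₁; S′₅₂; S₆; S₇; _≡_−√_; _≡_+√_)
    renaming (_⊖_ to _⊖ʷ_)

  -- The relations in terms of classes


  q≡2s² : q ≡ 2 ℕ.* (s ℕ.* s)
  q≡2s² = ≡.trans q≡1+n length≡2s²

  square-root-unique : ∀ {j k} → j ℕ.* j ≡ k ℕ.* k → j ≡ k
  square-root-unique {j} {k} eq with ℕ.<-cmp j k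
  ... | tri< j<k _ _ = contradiction (ℕ.*-mono-< j<k j<k) (ℕ.<-irrefl eq)
  ... | tri≈ _ j≡k _ = j≡k
  ... | tri> _ _ k<j = contradiction (ℕ.*-mono-< k<j k<j) (ℕ.<-irrefl (≡.sym eq))

  [2s]²≡2q : 2 ℕ.* s ℕ.* (2 ℕ.* s) ≡ 2 ℕ.* q
  [2s]²≡2q = ≡.trans (solveₙ 1 (λ s → conₙ 2 *ₙ s *ₙ (conₙ 2 *ₙ s) =ₙ conₙ 2 *ₙ (conₙ 2 *ₙ (s *ₙ s))) refl s)
    (≡.cong (2 ℕ.*_) (≡.sym q≡2s²))

  s²≡q/2 : s ℕ.* s ≡ q / 2
  s²≡q/2 = ≡.sym (≡.trans (≡.cong (_/ 2) (≡.trans q≡2s² (ℕ.*-comm 2 (s ℕ.* s)))) (m*n/n≡m (s ℕ.* s) 2))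

  -√-intro : ∀ {w k l} t → t ℕ.* t ≡ l → w ℕ.+ t ≡ k → w ≡ k −√ l
  -√-intro t t²≡ eq = t , t²≡ , eq

  -√-elim : ∀ {w k l} t → t ℕ.* t ≡ l → w ≡ k −√ l → w ℕ.+ t ≡ k
  -√-elim {w} t t²≡ (t′ , t′²≡ , eq) = ≡.trans (≡.cong (w ℕ.+_)
      (square-root-unique {t} {t′} (≡.trans t²≡ (≡.sym t′²≡)))) eq

  +√-elim : ∀ {w k l} t → t ℕ.* t ≡ l → w ≡ k +√ l → w ≡ k ℕ.+ t
  +√-elim {w} {k} t t²≡ (t′ , t′²≡ , eq) = ≡.trans eq (≡.cong (k ℕ.+_)
      (square-root-unique {t′} {t} (≡.trans t′²≡ (≡.sym t²≡))))

  module Weight {w F} (w+F≡q : + w ℤ.+ F ≡ + q) where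
    F≡q-w : F ≡ + q ℤ.- + w
    F≡q-w = ≡.trans (solveₚ 2 (λ w F → F =ₚ (w +ₚ F) -ₚ w) refl (+ w) F) (≡.cong (λ x → x ℤ.- + w) w+F≡q)

    below : ∀ t → F ≡ + t → w ℕ.+ t ≡ q
    below t F≡ = ℤ.+-injective (≡.trans (ℤ.pos-+ w t) (≡.trans (≡.cong (λ x → + w ℤ.+ x) (≡.sym F≡)) w+F≡q))

    above : ∀ t → F ≡ ℤ.- + t → w ≡ q ℕ.+ t
    above t F≡ = ℤ.+-injective (≡.trans (solveₚ 2 (λ w t → w =ₚ (w +ₚ -ₚ t) +ₚ t) refl (+ w) (+ t))
      (≡.trans (≡.cong (ℤ._+ + t) (≡.trans (≡.cong (λ x → + w ℤ.+ x) (≡.sym F≡)) w+F≡q)) (≡.sym (ℤ.pos-+ q t))))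

    from-below : ∀ t → w ℕ.+ t ≡ q → F ≡ + t
    from-below t eq = ≡.trans F≡q-w (≡.trans (≡.cong (λ x → + x ℤ.- + w) (≡.sym eq))
        (≡.trans (≡.cong (ℤ._- + w) (ℤ.pos-+ w t))
      (solveₚ 2 (λ w t → (w +ₚ t) -ₚ w =ₚ t) refl (+ w) (+ t))))

    from-above : ∀ t → w ≡ q ℕ.+ t → F ≡ ℤ.- + t
    from-above t eq = ≡.trans F≡q-w (≡.trans (≡.cong (λ x → + q ℤ.- + x) eq)
        (≡.trans (≡.cong (λ x → + q ℤ.- x) (ℤ.pos-+ q t))
      (solveₚ 2 (λ q t → q -ₚ (q +ₚ t) =ₚ -ₚ t) refl (+ q) (+ t))))

  +2s² : + q ≡ + 2 ℤ.* (+ s ℤ.* + s)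
  +2s² = ≡.trans (≡.cong +_ q≡1+n) q≡

  does-true : ∀ {p} {P : Set p} (P? : Dec P) → true ≡ does P? → P
  does-true (yes x) _ = x

  does-false : ∀ {p} {P : Set p} (P? : Dec P) → false ≡ does P? → ¬ P
  does-false (no ¬x) _ = ¬x

  module Relation {x y : Word} (g : M) (x⊖y≡ : ∀ k → (x ⊖ʷ y) k ≡ word g k) where
    w : ℕ
    w = leeWeight (x ⊖ʷ y)

    b : Carrier
    b = proj₂ (proj₂ g)

    open Weight {w} {re (f g)} (≡.trans (leeWeight-word {x ⊖ʷ y} g x⊖y≡) (≡.cong +_ (≡.sym q≡1+n)))

    ∈K : b ≋ 0# → Kerdock (x ⊖ʷ y)
    ∈K = ⇒kerdock {x ⊖ʷ y} g x⊖y≡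

    ∈K⁻¹ : Kerdock (x ⊖ʷ y) → b ≋ 0#
    ∈K⁻¹ = kerdock⇒ {x ⊖ʷ y} g x⊖y≡

    class⇒S : ∀ i → re (f g) ≡ F̂ (+ s) i → inKerdock (kind i) ≡ does (b ≋? 0#) → S i x y
    class⇒S 0F F≡ bit = S₀ (ℕ.+-cancelʳ-≡ q w 0 (below q (≡.trans F≡ (≡.sym +2s²))))
    class⇒S 1F F≡ bit = S₁ (-√-intro (2 ℕ.* s) [2s]²≡2q (below (2 ℕ.* s) (≡.trans F≡ (≡.sym 2s≡))))
    class⇒S 2F F≡ bit = S′₂₁ (-√-intro s s²≡q/2 (below s F≡)) (∈K (does-true (b ≋? 0#) bit))
    class⇒S 3F F≡ bit = S′₂₂ (-√-intro s s²≡q/2 (below s F≡)) (does-false (b ≋? 0#) bit ∘ ∈K⁻¹)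
    class⇒S 4F F≡ bit = S₃ (≡.trans (≡.sym (ℕ.+-identityʳ w)) (below 0 F≡)) (∈K (does-true (b ≋? 0#) bit))
    class⇒S 5F F≡ bit = S₄ (≡.trans (≡.sym (ℕ.+-identityʳ w)) (below 0 F≡)) (does-false (b ≋? 0#) bit ∘ ∈K⁻¹)
    class⇒S 6F F≡ bit = S′₅₁ (s , s²≡q/2 , above s F≡) (does-false (b ≋? 0#) bit ∘ ∈K⁻¹)
    class⇒S 7F F≡ bit = S′₅₂ (s , s²≡q/2 , above s F≡) (∈K (does-true (b ≋? 0#) bit))
    class⇒S 8F F≡ bit = S₆ (2 ℕ.* s , [2s]²≡2q , above (2 ℕ.* s) (≡.trans F≡ (≡.cong ℤ.-_ (≡.sym 2s≡))))
    class⇒S 9F F≡ bit = S₇ (≡.trans (above q (≡.trans F≡ (≡.cong ℤ.-_ (≡.sym +2s²))))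
        (≡.cong (q ℕ.+_) (≡.sym (ℕ.+-identityʳ q))))

    class→S : ∀ {i} → class g ≡ i → S i x y
    class→S {i} refl = class⇒S (class g) (InClass.re-f (class-spec g))
        (hasKind⇒inKerdock (kind (class g)) (InClass.hasKind (class-spec g)))

    by-rank : ∀ i → (∀ j → rank j ≡ rank i → j ≡ i) → re (f g) ≡ F̂ (+ s) i → class g ≡ i
    by-rank i unique F≡ = unique (class g) (class-rank g {rank i} F≡)

    in-K : Kerdock (x ⊖ʷ y) → true ≡ does (b ≋? 0#)
    in-K k = ≡.sym (dec-true (b ≋? 0#) (∈K⁻¹ k))

    out-K : ¬ Kerdock (x ⊖ʷ y) → false ≡ does (b ≋? 0#)
    out-K ¬k = ≡.sym (dec-false (b ≋? 0#) (¬k ∘ ∈K))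

    S→class : ∀ {i} → S i x y → class g ≡ i
    S→class (S₀ w≡) = by-rank 0F (from-yes (Fin.all? λ j → (rank j Fin.≟ rank 0F) →-dec (j Fin.≟ 0F)))
      (≡.trans (from-below q (≡.cong (ℕ._+ q) w≡)) +2s²)
    S→class (S₁ w≡) = by-rank 1F (from-yes (Fin.all? λ j → (rank j Fin.≟ rank 1F) →-dec (j Fin.≟ 1F)))
      (≡.trans (from-below (2 ℕ.* s) (-√-elim (2 ℕ.* s) [2s]²≡2q w≡)) 2s≡)
    S→class (S′₂₁ w≡ k) = class-by g 2F (from-below s (-√-elim s s²≡q/2 w≡)) (in-K k)
    S→class (S′₂₂ w≡ k) = class-by g 3F (from-below s (-√-elim s s²≡q/2 w≡)) (out-K k)
    S→class (S₃ w≡ k) = class-by g 4F (from-below 0 (≡.trans (ℕ.+-identityʳ w) w≡)) (in-K k)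
    S→class (S₄ w≡ k) = class-by g 5F (from-below 0 (≡.trans (ℕ.+-identityʳ w) w≡)) (out-K k)
    S→class (S′₅₁ w≡ k) = class-by g 6F (from-above s (+√-elim s s²≡q/2 w≡)) (out-K k)
    S→class (S′₅₂ w≡ k) = class-by g 7F (from-above s (+√-elim s s²≡q/2 w≡)) (in-K k)
    S→class (S₆ w≡) = by-rank 8F (from-yes (Fin.all? λ j → (rank j Fin.≟ rank 8F) →-dec (j Fin.≟ 8F)))
      (≡.trans (from-above (2 ℕ.* s) (+√-elim (2 ℕ.* s) [2s]²≡2q w≡)) (≡.cong ℤ.-_ 2s≡))
    S→class (S₇ w≡) = by-rank 9F (from-yes (Fin.all? λ j → (rank j Fin.≟ rank 9F) →-dec (j Fin.≟ 9F)))
      (≡.trans (from-above q (≡.trans w≡ (≡.cong (q ℕ.+_) (ℕ.+-identityʳ q)))) (≡.cong ℤ.-_ +2s²))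

  -- The scheme

  module W = AbelianGroup (Words length)

  codewords : Setoid _ _
  codewords = Subsetoid W.setoid DelsarteGoethals

  module X = Setoid codewords

  param : X.Carrier → M
  param (v , p) = parameters v p

  param-word : ∀ x k → proj₁ x k ≡ word (param x) k
  param-word (v , p) = parameters-word v p

  -- Two membership proofs for the same word might carry different parameters; `word-injective`
  -- identifies them.
  param-cong : ∀ {x y} → x X.≈ y → param x ∼ param y
  param-cong {x} {y} eq = word-injective {param x} {param y}
      (λ k → ≡.trans (≡.sym (param-word x k)) (≡.trans (eq k) (param-word y k)))

  codeword : M → X.Carrier
  codeword g = word g , word∈DG {word g} g (λ _ → refl)

  codeword-cong : ∀ {g h} → g ∼ h → codeword g X.≈ codeword h
  codeword-cong {g} {h} eq k = word-cong {g} {h} eq k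

  codeword-param : ∀ x → codeword (param x) X.≈ x
  codeword-param x k = ≡.sym (param-word x k)

  param-codeword : ∀ g → param (codeword g) ∼ g
  param-codeword g = word-injective {param (codeword g)} {g} (λ k → ≡.sym (param-word (codeword g) k))

  difference : ∀ {x y} g h → (∀ k → x k ≡ word g k) → (∀ k → y k ≡ word h k) → ∀ k → (x ⊖ʷ y) k ≡ word (g ⊝ h) k
  difference g h x≡ y≡ k = ≡.trans (≡.cong₂ (λ i j → i +₄ (-₄ j)) (x≡ k) (y≡ k)) (≡.sym (word-⊝ g h k))

  module R-between (x y : X.Carrier) = Relation {proj₁ x} {proj₁ y} (param x ⊝ param y)
    (difference {proj₁ x} {proj₁ y} (param x) (param y) (param-word x) (param-word y))

  ⊝-cong : ∀ {g g′ h h′} → g ∼ g′ → h ∼ h′ → (g ⊝ h) ∼ (g′ ⊝ h′)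
  ⊝-cong {g} {g′} {h} {h′} eq eq′ = G.∙-cong {g} {g′} {h G.⁻¹} {h′ G.⁻¹} eq (G.⁻¹-cong {h} {h′} eq′)

  -- Inversion conjugates f and so preserves Re f, and -b is congruent to b.
  class-⁻¹ : ∀ g → class (g G.⁻¹) ≡ class g
  class-⁻¹ g@(u , a , b) = class-by (g G.⁻¹) (class g)
    (≡.trans (ℤ.*-cancelˡ-≡ (+ 2) _ _ (emb-injective (ℂ.trans (ℂ.sym (+-conj (f (g G.⁻¹))))
        (ℂ.trans sum≈ (+-conj (f g)))))) (InClass.re-f (class-spec g)))
    (≡.trans (hasKind⇒inKerdock (kind (class g)) (InClass.hasKind (class-spec g)))
        (does-⇔ (mk⇔ (R₂.trans -b≋b) (R₂.trans (R₂.sym -b≋b))) (b ≋? 0#) (- b ≋? 0#)))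
    where
    -b≋b : - b ≋ b
    -b≋b = solve₂ 1 (λ b → :- b := b) R₂.refl b
    χ-⁻¹ : ∀ k → χ (g G.⁻¹) k ℂ.≈ conj (χ g k)
    χ-⁻¹ k = ℂ.trans (e-cong (⟪⟫-sym (g G.⁻¹) k)) (ℂ.trans (χ-inverse k g) (conj-cong (e-cong (⟪⟫-sym k g))))
    f-⁻¹ : f (g G.⁻¹) ℂ.≈ conj (f g)
    f-⁻¹ = ℂ.trans (Σ₂.∑-cong (λ x → χ-⁻¹ (point x))) (ℂ.sym (Σ₂.∑-conj _))
    conj-conj : conj (f (g G.⁻¹)) ℂ.≈ f g
    conj-conj = ℂ.trans (Σ₂.∑-conj _) (Σ₂.∑-cong (λ x → ℂ.trans (conj-cong (e-cong (⟪⟫-sym (g G.⁻¹) (point x))))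
        (ℂ.trans
      (ℂ.sym (χ-inverse (point x) (g G.⁻¹))) (ℂ.trans (𝓕.χ-congʳ (point x) {(g G.⁻¹) G.⁻¹} {g} (GP.⁻¹-involutive g))
          (e-cong (⟪⟫-sym (point x) g))))))
    sum≈ : f (g G.⁻¹) ℂ.+ conj (f (g G.⁻¹)) ℂ.≈ f g ℂ.+ conj (f g)
    sum≈ = ℂ.trans (ℂ.+-cong f-⁻¹ conj-conj) (ℂ.+-comm _ _)

  Triangle : Fin 10 → Fin 10 → M → M → Set
  Triangle i j z w = class w ≡ i × class (z ⊝ w) ≡ j

  triangle? : ∀ i j z w → Dec (Triangle i j z w)
  triangle? i j z w = (class w Fin.≟ i) ×-dec (class (z ⊝ w) Fin.≟ j)

  triangle-resp : ∀ i j z {w w′} → w ∼ w′ → Triangle i j z w → Triangle i j z w′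
  triangle-resp i j z {w} {w′} eq (cl , cl′) = ≡.trans (≡.sym (class-cong {w} {w′} eq)) cl
    , ≡.trans (≡.sym (class-cong {z ⊝ w} {z ⊝ w′} (⊝-cong {z} {z} {w} {w′} (G.refl {z}) eq))) cl′

  triangles : Fin 10 → Fin 10 → M → ℕ
  triangles i j z = count (λ k → triangle? i j z (Inverse.from G-size k))

  triangles-sum : ∀ i j z → emb (+ triangles i j z) ℂ.≈ 𝓕.∑ (λ w → ⟦ class w Fin.≟ i ⟧ ℂ.* ⟦ class (z ⊝ w) Fin.≟ j ⟧)
  triangles-sum i j z = ℂ.trans (count-sum (λ k → triangle? i j z (Inverse.from G-size k)))
    (ℂ.trans (ℂ.sym (𝓕.∑≈sum (λ w → ⟦ triangle? i j z w ⟧)))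
        (𝓕.∑-cong (λ w → ⟦×⟧ (class w Fin.≟ i) (class (z ⊝ w) Fin.≟ j))))
    where
    ⟦×⟧ : ∀ {P Q : Set} (P? : Dec P) (Q? : Dec Q) → ⟦ P? ×-dec Q? ⟧ ℂ.≈ ⟦ P? ⟧ ℂ.* ⟦ Q? ⟧
    ⟦×⟧ (yes _) Q? = ℂ.sym (ℂ.*-identityˡ _)
    ⟦×⟧ (no _)  Q? = ℂ.sym (ℂ.zeroˡ _)

  triangles-invariant : ∀ i j z z′ → class z ≡ class z′ → triangles i j z ≡ triangles i j z′
  triangles-invariant i j z z′ cl = ℤ.+-injective (emb-injective
    (ℂ.trans (triangles-sum i j z) (ℂ.trans (intersection-invariant i j z z′ cl) (ℂ.sym (triangles-sum i j z′)))))

  -- A third vertex v corresponds to w = `param x ⊝ param v`; then z minus w is `param v ⊝ param y`,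
  -- where z is `param x ⊝ param y`. So the count depends on x and y through z only.
  triangles-size : ∀ i j x y → HasSize (Subsetoid codewords (λ z → S i (proj₁ x) (proj₁ z) × S j (proj₁ z) (proj₁ y)))
    (triangles i j (param x ⊝ param y))
  triangles-size i j x y = HasSize-subset {X = G.setoid} {Y = codewords} G-size (triangle? i j z)
      (λ {w} {w′} → triangle-resp i j z {w} {w′})
    {Q = λ v → S i (proj₁ x) (proj₁ v) × S j (proj₁ v) (proj₁ y)}
    to from
    (λ {w} {w′} eq → codeword-cong {param x ⊝ w} {param x ⊝ w′}
        (⊝-cong {param x} {param x} {w} {w′} (G.refl {param x}) eq))
    (λ {v} {v′} eq → ⊝-cong {param x} {param x} {param v} {param v′} (G.refl {param x}) (param-cong {v} {v′} eq))
    (λ v → X.trans {to (from v)} {codeword (param v)} {v} (codeword-cong {param x ⊝ from v} {param v}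
        (reflect (param x) (param v))) (codeword-param v))
    (λ w → G.trans {from (to w)} {param x ⊝ (param x ⊝ w)} {w}
      (⊝-cong {param x} {param x} {param (to w)} {param x ⊝ w} (G.refl {param x}) (param-codeword (param x ⊝ w)))
          (reflect (param x) w))
    (λ {w} (cl , cl′) →
        R-between.class→S x (to w) (≡.trans (class-cong {param x ⊝ param (to w)} {w} (from-to w)) cl)
      , R-between.class→S (to w) y (≡.trans (class-cong {param (to w) ⊝ param y} {z ⊝ w} (to-⊝ w)) cl′))
    (λ {v} (Sᵢ , Sⱼ) → R-between.S→class x v Sᵢ
      , ≡.trans (class-cong {z ⊝ from v} {param v ⊝ param y} (⊝-from v)) (R-between.S→class v y Sⱼ))
    where
    z : M
    z = param x ⊝ param y
    to : M → X.Carrier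
    to w = codeword (param x ⊝ w)
    from : X.Carrier → M
    from v = param x ⊝ param v
    reflect : ∀ g h → (g ⊝ (g ⊝ h)) ∼ h
    reflect (u , a , b) (u′ , a′ , b′) = reflect₄ u u′
      , solve₄ 2 (λ a a′ → a :+₄ :-₄ (a :+₄ :-₄ a′) :=₄ a′) R.refl a a′
      , solve₂ 2 (λ b b′ → b :+ :- (b :+ :- b′) := b′) R₂.refl b b′
      where
      reflect₄ : ∀ u u′ → u +₄ (-₄ (u +₄ (-₄ u′))) ≡ u′
      reflect₄ = from-yes (Fin.all? λ u → Fin.all? λ u′ → (u +₄ (-₄ (u +₄ (-₄ u′)))) Fin.≟ u′)
    from-to : ∀ w → (param x ⊝ param (to w)) ∼ w
    from-to w = G.trans {param x ⊝ param (to w)} {param x ⊝ (param x ⊝ w)} {w}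
      (⊝-cong {param x} {param x} {param (to w)} {param x ⊝ w} (G.refl {param x}) (param-codeword (param x ⊝ w)))
          (reflect (param x) w)
    swap : ∀ g h k → ((g ⊝ h) ⊝ k) ∼ ((g ⊝ k) ⊝ h)
    swap g h k = G.trans {(g ⊝ h) ⊝ k} {g ⊞ ((h G.⁻¹) ⊞ (k G.⁻¹))} {(g ⊝ k) ⊝ h} (G.assoc g (h G.⁻¹) (k G.⁻¹))
      (G.trans {g ⊞ ((h G.⁻¹) ⊞ (k G.⁻¹))} {g ⊞ ((k G.⁻¹) ⊞ (h G.⁻¹))} {(g ⊝ k) ⊝ h}
        (G.∙-congˡ {g} {(h G.⁻¹) ⊞ (k G.⁻¹)} {(k G.⁻¹) ⊞ (h G.⁻¹)} (G.comm (h G.⁻¹) (k G.⁻¹)))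
        (G.sym {(g ⊝ k) ⊝ h} {g ⊞ ((k G.⁻¹) ⊞ (h G.⁻¹))} (G.assoc g (k G.⁻¹) (h G.⁻¹))))
    to-⊝ : ∀ w → (param (to w) ⊝ param y) ∼ (z ⊝ w)
    to-⊝ w = G.trans {param (to w) ⊝ param y} {(param x ⊝ w) ⊝ param y} {z ⊝ w}
      (⊝-cong {param (to w)} {param x ⊝ w} {param y} {param y} (param-codeword (param x ⊝ w)) (G.refl {param y}))
          (swap (param x) w (param y))
    ⊝-from : ∀ v → (z ⊝ from v) ∼ (param v ⊝ param y)
    ⊝-from v = G.trans {z ⊝ from v} {(param x ⊝ from v) ⊝ param y} {param v ⊝ param y}
        (swap (param x) (param y) (from v))
      (⊝-cong {param x ⊝ from v} {param v} {param y} {param y} (reflect (param x) (param v)) (G.refl {param y}))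

  associationScheme : IsAssociationScheme codewords 9 (λ i x y → S i (proj₁ x) (proj₁ y))
  associationScheme = record
    { finite       = N , HasSize-transport {X = G.setoid} {Y = codewords} codeword param
        (λ {g} {h} → codeword-cong {g} {h}) (λ {x} {y} → param-cong {x} {y}) codeword-param param-codeword G-size
    ; respects     = λ i → (λ {x} {y} {y′} eq Sᵢ → R-between.class→S x y′ (≡.trans
          (class-cong {param x ⊝ param y′} {param x ⊝ param y} (⊝-cong {param x} {param x} {param y′} {param y}
              (G.refl {param x}) (G.sym {param y} {param y′} (param-cong {y} {y′} eq))))
          (R-between.S→class x y Sᵢ)))
        , (λ {y} {x} {x′} eq Sᵢ → R-between.class→S x′ y (≡.trans
          (class-cong {param x′ ⊝ param y} {param x ⊝ param y} (⊝-cong {param x′} {param x} {param y} {param y}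
              (G.sym {param x} {param x′} (param-cong {x} {x′} eq)) (G.refl {param y})))
          (R-between.S→class x y Sᵢ)))
    ; diagonal     = λ x y → mk⇔
        (λ S₀ → X.trans {x} {codeword (param x)} {y} (X.sym {codeword (param x)} {x} (codeword-param x))
            (X.trans {codeword (param x)} {codeword (param y)} {y}
          (codeword-cong {param x} {param y} (⊝∼ε⇒∼ {param x} {param y}
              (InClass.origin (class-spec (param x ⊝ param y)) (R-between.S→class x y S₀))))
          (codeword-param y)))
        (λ eq → R-between.class→S x y (≡.trans (class-cong {param x ⊝ param y} {G.ε}
            (∼⇒⊝∼ε {param x} {param y} (param-cong {x} {y} eq))) class-ε))
    ; covering     = λ x y → class (param x ⊝ param y) , R-between.class→S x y refl
    ; disjoint     = λ {i} {j} {x} {y} Sᵢ Sⱼ → ≡.trans (≡.sym (R-between.S→class x y Sᵢ)) (R-between.S→class x y Sⱼ)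
    ; inhabited    = λ i → let g , cl = class-surjective i in codeword g , codeword G.ε ,
        R-between.class→S (codeword g) (codeword G.ε) (≡.trans
            (class-cong {param (codeword g) ⊝ param (codeword G.ε)} {g} (minus-ε g)) cl)
    ; symmetric    = λ i {x} {y} Sᵢ → R-between.class→S y x (≡.trans
        (class-cong {param y ⊝ param x} {(param x ⊝ param y) G.⁻¹}
            (G.sym {(param x ⊝ param y) G.⁻¹} {param y ⊝ param x} (⊝-⁻¹ (param x) (param y))))
        (≡.trans (class-⁻¹ (param x ⊝ param y)) (R-between.S→class x y Sᵢ)))
    ; intersection = λ i j k → let z , cl = class-surjective k in triangles i j z , λ x y Sₖ →
        ≡.subst (HasSize _) (triangles-invariant i j (param x ⊝ param y) z
            (≡.trans (R-between.S→class x y Sₖ) (≡.sym cl))) (triangles-size i j x y)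
    }
    where
    minus-ε : ∀ g → (param (codeword g) ⊝ param (codeword G.ε)) ∼ g
    minus-ε g = G.trans {param (codeword g) ⊝ param (codeword G.ε)} {g ⊝ G.ε} {g}
      (⊝-cong {param (codeword g)} {g} {param (codeword G.ε)} {G.ε} (param-codeword g) (param-codeword G.ε))
      (G.trans {g ⊝ G.ε} {g ⊞ G.ε} {g} (G.∙-congˡ {g} {G.ε G.⁻¹} {G.ε} GP.ε⁻¹≈ε) (G.identityʳ g))
    ⊝-⁻¹ : ∀ g h → ((g ⊝ h) G.⁻¹) ∼ (h ⊝ g)
    ⊝-⁻¹ (u , a , b) (u′ , a′ , b′) = ⊝-⁻¹₄ u u′
      , solve₄ 2 (λ a a′ → :-₄ (a :+₄ :-₄ a′) :=₄ a′ :+₄ :-₄ a) R.refl a a′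
      , solve₂ 2 (λ b b′ → :- (b :+ :- b′) := b′ :+ :- b) R₂.refl b b′
      where
      ⊝-⁻¹₄ : ∀ u u′ → -₄ (u +₄ (-₄ u′)) ≡ u′ +₄ (-₄ u)
      ⊝-⁻¹₄ = from-yes (Fin.all? λ u → Fin.all? λ u′ → (-₄ (u +₄ (-₄ u′))) Fin.≟ (u′ +₄ (-₄ u)))

  ∙∈DG : ∀ {v w} (p : DelsarteGoethals v) (p′ : DelsarteGoethals w) → ∀ k → (v W.∙ w) k ≡ word
      (parameters v p ⊞ parameters w p′) k
  ∙∈DG {v} {w} p p′ k = ≡.trans (≡.cong₂ _+₄_ (parameters-word v p k) (parameters-word w p′ k))
      (≡.sym (word-∙ (parameters v p) (parameters w p′) k))

  translationScheme : IsTranslationScheme (Words length) DelsarteGoethals 9 S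
  translationScheme = record
    { C-respects  = λ {v} {w} eq p → word∈DG {w} (parameters v p) (λ k → ≡.trans (≡.sym (eq k)) (parameters-word v p k))
    ; ε∈C         = word∈DG {W.ε} G.ε (λ k → ≡.sym (word-ε k))
    ; ∙-closed    = λ {v} {w} p p′ → word∈DG {v W.∙ w} (parameters v p ⊞ parameters w p′) (∙∈DG {v} {w} p p′)
    ; ⁻¹-closed   = λ {v} p → word∈DG {v W.⁻¹} (parameters v p G.⁻¹)
        (λ k → ≡.trans (≡.cong -₄_ (parameters-word v p k)) (≡.sym (word-⁻¹ (parameters v p) k)))
    ; scheme      = associationScheme
    ; translation = λ i {x} {y} {z} p p′ p″ Sᵢ →
        Relation.class→S {x W.∙ z} {y W.∙ z} ((parameters x p ⊞ parameters z p″) ⊝ (parameters y p′ ⊞ parameters z p″))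
          (difference {x W.∙ z} {y W.∙ z} (parameters x p ⊞ parameters z p″) (parameters y p′ ⊞ parameters z p″)
              (∙∈DG {x} {z} p p″) (∙∈DG {y} {z} p′ p″))
          (≡.trans (class-cong {(parameters x p ⊞ parameters z p″) ⊝ (parameters y p′ ⊞ parameters z p″)}
              {parameters x p ⊝ parameters y p′}
              (cancel (parameters x p) (parameters y p′) (parameters z p″)))
            (R-between.S→class (x , p) (y , p′) Sᵢ))
    }
    where
    cancel : ∀ g h k → ((g ⊞ k) ⊝ (h ⊞ k)) ∼ (g ⊝ h)
    cancel (u , a , b) (u′ , a′ , b′) (u″ , a″ , b″) = cancel₄ u u′ u″
      , solve₄ 3 (λ a a′ a″ → (a :+₄ a″) :+₄ :-₄ (a′ :+₄ a″) :=₄ a :+₄ :-₄ a′) R.refl a a′ a″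
      , solve₂ 3 (λ b b′ b″ → (b :+ b″) :+ :- (b′ :+ b″) := b :+ :- b′) R₂.refl b b′ b″
      where
      cancel₄ : ∀ u u′ u″ → (u +₄ u″) +₄ (-₄ (u′ +₄ u″)) ≡ u +₄ (-₄ u′)
      cancel₄ = from-yes (Fin.all? λ u → Fin.all? λ u′ → Fin.all? λ u″ → ((u +₄ u″) +₄ (-₄ (u′ +₄ u″))) Fin.≟
          (u +₄ (-₄ u′)))

open import Data.Nat.Base using (_≤_; _^_; _∸_)

theorem3p2 : ∀ {c ℓ} (m : ℕ) → 3 ≤ m → ¬ (2 ∣ m) →
    (R : CommutativeRing c ℓ) (isGR4 : IsGR4 R m)
    (β : CommutativeRing.Carrier R) (β-order : HasOrder R β (2 ^ m ∸ 1)) →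
    let open GaloisRing R isGR4 β β-order in
    IsTranslationScheme (Words length) DelsarteGoethals 9 S
theorem3p2 = DelsarteGoethalsScheme.translationScheme
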